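{- Let $p>3$ be a prime and $t\in\mathbb{F}_p^\times$. (1) Suppose $p\equiv 1\pmod 3$ and let $g$ be a primitive root modulo $p$. If $t\neq 1$, then ${_3G_3}(t)=0$ if and only if $t=g^i$ for some integer $i$ with $\gcd(i,3)=1$. If $t=1$, then ${_3G_3}(1)=0$ if and only if $p\equiv 7\pmod{12}$. (2) Suppose $p\not\equiv 1\pmod 3$. Then ${_3G_3}(t)=0$ if and only if $t=1$ (equivalently, for $t\in\mathbb{F}_p$, ${_3G_3}(t)=0$ iff $t\in\{0,1\}$); in other words, if $t\neq 0,1$ then ${_3G_3}(t)\neq 0$.
   Context: $\Gamma_p$ is Morita's $p$-adic gamma function; $\omega$ is the Teichmüller character of $\mathbb{F}_p^\times$ ($\omega(a)\equiv a\pmod p$), $\overline{\omega}$ its inverse, and every multiplicative character (including the trivial one) takes value $0$ at $0$. $\langle x\rangle$ denotes the fractional part and $\lfloor x\rfloor$ the floor of $x\in\mathbb{Q}$. For $a_k,b_k\in\mathbb{Q}\cap\mathbb{Z}_p$ and $t\in\mathbb{F}_p$, $${_n\mathbb{G}_n}\left[\begin{array}{ccc}a_1,&\ldots,&a_n\\ b_1,&\ldots,&b_n\end{array}\Big| t\right]:=\frac{ -1}{p-1}\sum_{a=0}^{p-2}(-1)^{an}\,\overline{\omega}^a(t)\prod_{k=1}^n(-p)^{ -\lfloor\langle a_k\rangle-\frac{a}{p-1}\rfloor-\lfloor\langle -b_k\rangle+\frac{a}{p-1}\rfloor}\frac{\Gamma_p(\langle a_k-\frac{a}{p-1}\rangle)}{\Gamma_p(\langle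 a_k\rangle)}\frac{\Gamma_p(\langle -b_k+\frac{a}{p-1}\rangle)}{\Gamma_p(\langle -b_k\rangle)}.$$ Here ${_3G_3}(t):={_3\mathbb{G}_3}\left[\begin{array}{ccc}\frac{1}{6},&\frac{1}{2},&\frac{5}{6}\\ 0,&\frac13,&\frac{2}{3}\end{array}\Big| t\right]$. -}

module Defs where

open import Data.Nat as ℕ using (ℕ; zero; suc; _∸_; _^_; _%_)
open import Data.Nat.Divisibility using (_∣?_)
open import Data.Integer as ℤ using (ℤ; +_; -[1+_]; ∣_∣)
open import Data.Rational as ℚ using (ℚ; floor; 0ℚ; ↥_; ↧ₙ_)
open import Data.List using (List; map; upTo)
open import Data.Nat.ListAction using (sum)
open import Data.Vec using (Vec; foldr; zipWith)
open import Data.Bool using (if_then_else_)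
open import Relation.Nullary using (does)
open import Relation.Binary.PropositionalEquality using (_≡_; _≢_)
open import Data.Product using (_×_)

_mod_ : ℕ → ℕ → ℕ
x mod zero    = x
x mod (suc m) = x % suc m

negM : ℕ → ℕ → ℕ
negM m x = (m ∸ (x mod m)) mod m

zmod : ℕ → ℤ → ℕ
zmod m (+ n)      = n mod m
zmod m (-[1+ n ]) = negM m (suc n)

signM : ℕ → ℕ → ℕ → ℕ
signM m e x = if does (2 ∣? e) then x mod m else negM m x

modulus : ℕ → ℕ → ℕ
modulus p k = p ^ k

totient : ℕ → ℕ → ℕ
totient p zero    = 1
totient p (suc k) = p ^ k ℕ.* (p ∸ 1)

-- inverse mod p^k of a unit u of ℤ_p:  u^(φ(p^k) - 1)
invM : ℕ → ℕ → ℕ → ℕ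
invM p k u = (u ^ (totient p k ∸ 1)) mod modulus p k

-- residue mod p^k of a rational x ∈ ℚ ∩ ℤ_p (denominator prime to p)
qmod : ℕ → ℕ → ℚ → ℕ
qmod p k x = (zmod (modulus p k) (↥ x) ℕ.* invM p k (↧ₙ x)) mod modulus p k

-- Morita's p-adic gamma function.
-- On positive integers: Γ_p(n) = (-1)^n ∏_{0<j<n, p∤j} j  (and Γ_p(0) = 1);
-- extended to ℤ_p by continuity.  Since |Γ_p(x) - Γ_p(y)|_p ≤ |x - y|_p,
-- Γ_p(x) mod p^k = Γ_p(N) mod p^k for any N ∈ ℕ with N ≡ x (mod p^k).

unitProd : ℕ → ℕ → ℕ
unitProd p zero    = 1
unitProd p (suc n) = unitProd p n ℕ.* (if does (p ∣? n) then 1 else n)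

Γp : ℕ → ℕ → ℚ → ℕ
Γp p k x = signM (modulus p k) N (unitProd p N)
  where N = qmod p k x

fr : ℚ → ℚ
fr x = x ℚ.- (floor x ℚ./ 1)

_over_ : ℕ → ℕ → ℚ
a over zero    = 0ℚ
a over (suc d) = (+ a) ℚ./ suc d

-- Teichmüller character: ω(t) mod p^k = t^(p^(k-1)) mod p^k  (t ∈ ℕ, p ∤ t),
-- and ω̄(t) = ω(t)^(p-2) = ω(t)^(-1).  (All characters vanish at 0.)

ωbarPow : ℕ → ℕ → ℕ → ℕ → ℕ
ωbarPow p k t a =
  if does (p ∣? t) then 0
  else ((t ^ (p ^ (k ∸ 1))) ^ ((p ∸ 2) ℕ.* a)) mod modulus p k

-- The hypergeometric function  nGn[a; b | t].
-- Each summand is (-1)^{an} ω̄^a(t) ∏_k (-p)^{e_k(a)} R_k(a) with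
--   e_k(a) = -⌊⟨a_k⟩ - a/(p-1)⌋ - ⌊⟨-b_k⟩ + a/(p-1)⌋ ∈ {-1,0,1}
-- and R_k(a) the ratio of Γ_p values (a p-adic unit).  Since Σ_k e_k ≥ -n,
-- p^n · nGn ∈ ℤ_p; `scaledG n p k as bs t` is the residue of p^n · nGn(t)
-- modulo p^k.  nGn(t) = 0 in ℚ_p iff all these residues vanish.

module _ (p k : ℕ) where
  private
    m = modulus p k
    infixl 7 _*m_
    _*m_ : ℕ → ℕ → ℕ
    x *m y = (x ℕ.* y) mod m

  expo : ℕ → ℚ → ℚ → ℤ
  expo a ak bk =
    ℤ.- floor (fr ak ℚ.- (a over (p ∸ 1))) ℤ.- floor (fr (ℚ.- bk) ℚ.+ (a over (p ∸ 1)))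

  ratio : ℕ → ℚ → ℚ → ℕ
  ratio a ak bk =
    Γp p k (fr (ak ℚ.- (a over (p ∸ 1)))) *m invM p k (Γp p k (fr ak))
    *m (Γp p k (fr (ℚ.- bk ℚ.+ (a over (p ∸ 1)))) *m invM p k (Γp p k (fr (ℚ.- bk))))

  term : (n : ℕ) → Vec ℚ n → Vec ℚ n → ℕ → ℕ → ℕ
  term n as bs t a =
    signM m (a ℕ.* n)
      (ωbarPow p k t a *m signM m ∣ E ∣ ((p ^ ∣ (+ n) ℤ.+ E ∣) *m R))
    where
      E = foldr _ ℤ._+_ (+ 0) (zipWith (expo a) as bs)
      R = foldr _ _*m_ 1 (zipWith (ratio a) as bs)

  scaledG : (n : ℕ) → Vec ℚ n → Vec ℚ n → ℕ → ℕ
  scaledG n as bs t =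
    negM m (invM p k (p ∸ 1) *m (sum (map (term n as bs t) (upTo (p ∸ 1))) mod m))

GVanishes : (n : ℕ) → ℕ → Vec ℚ n → Vec ℚ n → ℕ → Set
GVanishes n p as bs t = ∀ k → scaledG p k n as bs t ≡ 0

open Data.Vec using ([]; _∷_)

as₃ : Vec ℚ 3
as₃ = (+ 1 ℚ./ 6) ∷ (+ 1 ℚ./ 2) ∷ (+ 5 ℚ./ 6) ∷ []

bs₃ : Vec ℚ 3
bs₃ = 0ℚ ∷ (+ 1 ℚ./ 3) ∷ (+ 2 ℚ./ 3) ∷ []

G3Vanishes : ℕ → ℕ → Set
G3Vanishes p t = GVanishes 3 p as₃ bs₃ t

PrimitiveRoot : ℕ → ℕ → Set
PrimitiveRoot p g =
  ((g ^ (p ∸ 1)) mod p ≡ 1) × (∀ j → 0 ℕ.< j → j ℕ.< p ∸ 1 → (g ^ j) mod p ≢ 1)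

{-# OPTIONS --safe #-}

-- By the Gauss multiplication formula for Γ_p the six gamma values in the a-th term collapse, up to a
-- constant unit, to Γ_p(c/(p-1)) Γ_p(c'/(p-1)) with c = 3a and c' = (p-1)/2 - 3a modulo p-1, so that
-- ₃G₃(t) is a sum of ₁G₁-type values over the cube roots of t.
--
-- Nonvanishing is read off modulo p: Γ_p(c/(p-1)) ≡ 1/c!, the terms with c > (p-1)/2 carry a factor p,
-- and the binomial theorem turns the sum into Σ (1-y)^((p-1)/2) over the cube roots y of 1/t, a sum of
-- signs.  Vanishing is exact: for a non-cube t it is 1 + ρ + ρ² = 0, for t = 1 and p ≡ 7 mod 12 the
-- involution c ↔ c' reverses the sign of every term.
--
-- For t = 1 and p ≡ 2 mod 3 one needs Σ_c (-1)^c (-p)^[c > (p-1)/2] Γ_p(c/(p-1)) Γ_p(c'/(p-1)) = 0.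
-- Let exp(X + X^p/p) = Σ c_n X^n.  As in Dwork's proof of the Gross–Koblitz formula, Γ_p(a/(p-1)) is
-- (1-p) Σ_j (-p)^j c_{a+j(p-1)}: its interpolation series Σ_n (m)_n (-p)^n c_{pn+a} at m = -a/(p-1) is
-- rearranged by means of n c_n = c_{n-1} + c_{n-p}.  The sum then consists of coefficients of
-- exp(X + X^p/p) exp(-X - X^p/p) = 1 in positive degree.
module Submission where

-- Dwork's splitting function exp(πY - πY^p), with π^(p-1) = -p, lives over a ramified extension of
-- ℚ_p. The substitution X = πY turns it into exp(X + X^p/p), whose coefficients are rational, and
-- in the sums that matter only the powers π^(j(p-1)) = (-p)^j survive. So all the work is done in ℚ
-- and with congruences modulo p^(k+1), one level k at a time, without p-adic numbers.
--
-- The obstacle is convergence: every series is cut off, and its tail has to be divisible by a high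
-- power of p although the c_n have denominators. The bound comes from Γ_p itself. The numbers
-- (-p)^j c_(pj+a) are the Newton coefficients of m ↦ Γ_p(-(pm+a)). The j-th difference of this
-- function at 0 is divisible by p^⌊j/2⌋, and dividing by j! costs at most j/4 powers of p because p
-- ≥ 5; about j/4 powers remain.
--
-- The definition gives access only to residues of p^3 · ₃G₃, so a statement about ₃G₃ modulo p has
-- to be read off modulo p^4.

-- Finite sums in a commutative ring, and their rearrangement by classes modulo 3

module FiniteSums where
  open import Algebra.Bundles using (CommutativeRing)
  open import Level using (0ℓ)
  open import Data.Nat as ℕ using (ℕ; zero; suc; _<_)
  import Data.Nat.Properties as ℕₚ
  open import Data.Nat.Tactic.RingSolver using (solve-∀)
  open import Relation.Binary.PropositionalEquality as ≡ using (_≡_)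

  module _ {A : Set} (_+_ : A → A → A) (0# : A) where
    -- It depends on addition and zero alone, not on the ring laws or the equality. Hence the sums
    -- in ℤ modulo different `M` are the same function as `sumℤ`, and a congruence can be applied
    -- inside an integer sum.
    sumOf : ℕ → (ℕ → A) → A
    sumOf zero    f = 0#
    sumOf (suc n) f = sumOf n f + f n

  module SumLaws (R : CommutativeRing 0ℓ 0ℓ) where
    open CommutativeRing R
    open import Relation.Binary.Reasoning.Setoid setoid
    open import Algebra.Properties.CommutativeSemigroup +-commutativeSemigroup using (interchange)
    open import Algebra.Properties.Ring ring using (-0#≈0#; -‿+-comm)

    sum : ℕ → (ℕ → Carrier) → Carrier
    sum = sumOf _+_ 0#

    sum-cong : ∀ n {f g} → (∀ i → i < n → f i ≈ g i) → sum n f ≈ sum n g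
    sum-cong zero    h = refl
    sum-cong (suc n) h = +-cong (sum-cong n (λ i i<n → h i (ℕₚ.m<n⇒m<1+n i<n))) (h n (ℕₚ.n<1+n n))

    sum-zero : ∀ n {f} → (∀ i → i < n → f i ≈ 0#) → sum n f ≈ 0#
    sum-zero zero    h = refl
    sum-zero (suc n) h = trans
      (+-cong (sum-zero n (λ i i<n → h i (ℕₚ.m<n⇒m<1+n i<n))) (h n (ℕₚ.n<1+n n))) (+-identityˡ 0#)

    sum-+ : ∀ n (f g : ℕ → Carrier) → sum n (λ i → f i + g i) ≈ sum n f + sum n g
    sum-+ zero    f g = sym (+-identityˡ 0#)
    sum-+ (suc n) f g = trans (+-congʳ (sum-+ n f g)) (interchange _ _ _ _)

    sum-neg : ∀ n (f : ℕ → Carrier) → sum n (λ i → - f i) ≈ - sum n f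
    sum-neg zero    f = sym -0#≈0#
    sum-neg (suc n) f = trans (+-congʳ (sum-neg n f)) (-‿+-comm _ _)

    sum-*ˡ : ∀ n x f → x * sum n f ≈ sum n (λ i → x * f i)
    sum-*ˡ zero    x f = zeroʳ x
    sum-*ˡ (suc n) x f = trans (distribˡ x _ _) (+-congʳ (sum-*ˡ n x f))

    sum-*ʳ : ∀ n x f → sum n f * x ≈ sum n (λ i → f i * x)
    sum-*ʳ n x f = trans (*-comm _ x) (trans (sum-*ˡ n x f) (sum-cong n (λ i _ → *-comm x (f i))))

    sum-split : ∀ m n f → sum (m ℕ.+ n) f ≈ sum m f + sum n (λ i → f (m ℕ.+ i))
    sum-split m zero    f rewrite ℕₚ.+-identityʳ m = sym (+-identityʳ _)
    sum-split m (suc n) f rewrite ℕₚ.+-suc m n = trans (+-congʳ (sum-split m n f)) (+-assoc _ _ _)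

    sum-first : ∀ n f → sum (suc n) f ≈ f 0 + sum n (λ i → f (suc i))
    sum-first n f = trans (sum-split 1 n f) (+-congʳ (+-identityˡ (f 0)))

    sum-swap : ∀ m n (f : ℕ → ℕ → Carrier) → sum m (λ i → sum n (f i)) ≈ sum n (λ j → sum m (λ i → f i j))
    sum-swap zero    n f = sym (sum-zero n (λ _ _ → refl))
    sum-swap (suc m) n f = trans (+-congʳ (sum-swap m n f)) (sym (sum-+ n _ _))

    sum-blocks : ∀ m n f → sum (m ℕ.* n) f ≈ sum m (λ j → sum n (λ i → f (j ℕ.* n ℕ.+ i)))
    sum-blocks zero    n f = refl
    sum-blocks (suc m) n f rewrite ℕₚ.+-comm n (m ℕ.* n) =
      trans (sum-split (m ℕ.* n) n f) (+-congʳ (sum-blocks m n f))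

    sum-telescope : ∀ n (f : ℕ → Carrier) → sum n (λ i → f (suc i) - f i) ≈ f n - f 0
    sum-telescope zero    f = sym (-‿inverseʳ (f 0))
    sum-telescope (suc n) f = begin
      sum n (λ i → f (suc i) - f i) + (f (suc n) - f n) ≈⟨ +-congʳ (sum-telescope n f) ⟩
      (f n - f 0) + (f (suc n) - f n)                   ≈⟨ +-comm _ _ ⟩
      (f (suc n) - f n) + (f n - f 0)                   ≈⟨ +-assoc _ _ _ ⟩
      f (suc n) + (- f n + (f n - f 0))                 ≈⟨ +-congˡ (+-assoc _ _ _) ⟨
      f (suc n) + ((- f n + f n) - f 0)                 ≈⟨ +-congˡ (+-congʳ (-‿inverseˡ (f n))) ⟩
      f (suc n) + (0# - f 0)                            ≈⟨ +-congˡ (+-identityˡ _) ⟩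
      f (suc n) - f 0                                   ∎

    -- The classes come in the order 0, 2, 1, which is the order in which multiplication by 3 modulo
    -- 3l + 1 meets them.
    sum-residues : ∀ l f → sum (l ℕ.* 3) f ≈
      sum l (λ j → f (j ℕ.* 3)) + sum l (λ j → f (2 ℕ.+ j ℕ.* 3)) + sum l (λ j → f (1 ℕ.+ j ℕ.* 3))
    sum-residues zero    f = sym (trans (+-identityʳ _) (+-identityʳ _))
    sum-residues (suc l) f = begin
      sum (l ℕ.* 3) f + f₀ + f₁ + f₂        ≈⟨ +-congʳ (+-congʳ (+-congʳ (sum-residues l f))) ⟩
      s₀ + s₂ + s₁ + f₀ + f₁ + f₂           ≈⟨ +-congʳ (+-assoc _ _ _) ⟩
      s₀ + s₂ + s₁ + (f₀ + f₁) + f₂         ≈⟨ +-assoc _ _ _ ⟩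
      s₀ + s₂ + s₁ + ((f₀ + f₁) + f₂)       ≈⟨ +-congˡ (+-assoc _ _ _) ⟩
      s₀ + s₂ + s₁ + (f₀ + (f₁ + f₂))       ≈⟨ +-congˡ (+-congˡ (+-comm _ _)) ⟩
      s₀ + s₂ + s₁ + (f₀ + (f₂ + f₁))       ≈⟨ +-congˡ (+-assoc _ _ _) ⟨
      s₀ + s₂ + s₁ + (f₀ + f₂ + f₁)         ≈⟨ interchange _ _ _ _ ⟩
      (s₀ + s₂) + (f₀ + f₂) + (s₁ + f₁)     ≈⟨ +-congʳ (interchange _ _ _ _) ⟩
      (s₀ + f₀) + (s₂ + f₂) + (s₁ + f₁)     ∎
      where
      f₀ = f (l ℕ.* 3)
      f₁ = f (1 ℕ.+ l ℕ.* 3)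
      f₂ = f (2 ℕ.+ l ℕ.* 3)
      s₀ = sum l (λ j → f (j ℕ.* 3))
      s₁ = sum l (λ j → f (1 ℕ.+ j ℕ.* 3))
      s₂ = sum l (λ j → f (2 ℕ.+ j ℕ.* 3))

    sum-thirds : ∀ l f → sum (l ℕ.* 3) f ≈
      sum l f + sum l (λ j → f (l ℕ.+ j)) + sum l (λ j → f (l ℕ.+ l ℕ.+ j))
    sum-thirds l f = begin
      sum (l ℕ.* 3) f                         ≡⟨ ≡.cong (λ n → sum n f) (e₀ l) ⟩
      sum ((l ℕ.+ l) ℕ.+ l) f                 ≈⟨ sum-split (l ℕ.+ l) l f ⟩
      sum (l ℕ.+ l) f + _                     ≈⟨ +-congʳ (sum-split l l f) ⟩
      _                                       ∎
      where
      e₀ : ∀ l → l ℕ.* 3 ≡ l ℕ.+ l ℕ.+ l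
      e₀ = solve-∀

    -- Multiplication by 3 permutes the residues modulo 3l + 1: the first l + 1 multiples stay below
    -- the modulus and fill class 0, the next l wrap around once and fill class 2, the last l wrap
    -- around twice and fill class 1.
    sum-triple-perm : ∀ l f → (∀ i → f (i ℕ.+ suc (l ℕ.* 3)) ≈ f i) →
      sum (suc (l ℕ.* 3)) (λ a → f (a ℕ.* 3)) ≈ sum (suc (l ℕ.* 3)) f
    sum-triple-perm l f per = begin
      sum (suc (l ℕ.* 3)) g                                             ≡⟨ ≡.cong (λ n → sum n g) (e₀ l) ⟩
      sum (suc l ℕ.+ l ℕ.+ l) g                                         ≈⟨ sum-split (suc l ℕ.+ l) l g ⟩
      sum (suc l ℕ.+ l) g + sum l (λ j → g (suc l ℕ.+ l ℕ.+ j))          ≈⟨ +-cong (sum-split (suc l) l g) (sum-cong l (λ j _ → third j)) ⟩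
      s₀ + f (l ℕ.* 3) + sum l (λ j → g (suc l ℕ.+ j)) + s₁             ≈⟨ +-congʳ (+-congˡ (sum-cong l (λ j _ → second j))) ⟩
      s₀ + f (l ℕ.* 3) + s₂ + s₁                                        ≈⟨ +-congʳ (+-assoc _ _ _) ⟩
      s₀ + (f (l ℕ.* 3) + s₂) + s₁                                      ≈⟨ +-congʳ (+-congˡ (+-comm _ _)) ⟩
      s₀ + (s₂ + f (l ℕ.* 3)) + s₁                                      ≈⟨ +-congʳ (+-assoc _ _ _) ⟨
      s₀ + s₂ + f (l ℕ.* 3) + s₁                                        ≈⟨ +-assoc _ _ _ ⟩
      s₀ + s₂ + (f (l ℕ.* 3) + s₁)                                      ≈⟨ +-congˡ (+-comm _ _) ⟩
      s₀ + s₂ + (s₁ + f (l ℕ.* 3))                                      ≈⟨ +-assoc _ _ _ ⟨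
      s₀ + s₂ + s₁ + f (l ℕ.* 3)                                        ≈⟨ +-congʳ (sum-residues l f) ⟨
      sum (suc (l ℕ.* 3)) f                                             ∎
      where
      g = λ a → f (a ℕ.* 3)
      s₀ = sum l (λ j → f (j ℕ.* 3))
      s₁ = sum l (λ j → f (1 ℕ.+ j ℕ.* 3))
      s₂ = sum l (λ j → f (2 ℕ.+ j ℕ.* 3))
      e₀ : ∀ l → suc (l ℕ.* 3) ≡ suc l ℕ.+ l ℕ.+ l
      e₀ = solve-∀
      e₁ : ∀ l j → (suc l ℕ.+ j) ℕ.* 3 ≡ (2 ℕ.+ j ℕ.* 3) ℕ.+ suc (l ℕ.* 3)
      e₁ = solve-∀
      e₂ : ∀ l j → (suc l ℕ.+ l ℕ.+ j) ℕ.* 3 ≡ (1 ℕ.+ j ℕ.* 3) ℕ.+ suc (l ℕ.* 3) ℕ.+ suc (l ℕ.* 3)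
      e₂ = solve-∀
      second : ∀ j → g (suc l ℕ.+ j) ≈ f (2 ℕ.+ j ℕ.* 3)
      second j = trans (reflexive (≡.cong f (e₁ l j))) (per _)
      third : ∀ j → g (suc l ℕ.+ l ℕ.+ j) ≈ f (1 ℕ.+ j ℕ.* 3)
      third j = trans (reflexive (≡.cong f (e₂ l j))) (trans (per _) (per _))

-- Congruences of integers, binomial identities, the theorems of Fermat and Wilson

module ModularArithmetic where
  open import Algebra.Bundles using (CommutativeRing)
  open import Algebra.Structures using (IsCommutativeRing)
  open import Level using (0ℓ)
  open import Data.Empty using (⊥-elim)
  open import Data.Nat as ℕ using (ℕ; zero; suc; _<_; _≤_; z≤n; s≤s; _!)
  import Data.Nat.Properties as ℕₚ
  open import Data.Nat.Divisibility as ℕ∣ using (divides) renaming (_∣_ to _∣ℕ_; _∤_ to _∤ℕ_)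
  open import Data.Nat.Primality using (Prime; euclidsLemma; prime⇒nonZero; prime⇒nonTrivial)
  open import Data.Nat.Combinatorics using (_C_; nCn≡1; nCk+nC[k+1]≡[n+1]C[k+1]; k>n⇒nCk≡0; nC1≡n)
  import Data.Nat.Tactic.RingSolver as ℕS
  open import Data.Integer as ℤ using (ℤ; +_; -[1+_]; _+_; _*_; -_; _-_; _^_; 0ℤ; 1ℤ; ∣_∣)
  import Data.Integer.Properties as ℤₚ
  open import Data.Integer.Tactic.RingSolver using (solve-∀)
  open import Data.Product using (_,_)
  open import Function using (_$_)
  open import Data.Sum using (inj₁; inj₂)
  open import Relation.Nullary using (¬_)
  open import Relation.Binary.PropositionalEquality as ≡ using (_≡_; refl; cong; cong₂; subst; module ≡-Reasoning)
  open FiniteSums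

  pos-^ : ∀ x n → + (x ℕ.^ n) ≡ (+ x) ^ n
  pos-^ x zero    = refl
  pos-^ x (suc n) = ≡.trans (ℤₚ.pos-* x (x ℕ.^ n)) (cong (+ x *_) (pos-^ x n))

  *-^-distrib : ∀ x y n → (x * y) ^ n ≡ x ^ n * y ^ n
  *-^-distrib x y zero    = refl
  *-^-distrib x y (suc n) = ≡.trans (cong (x * y *_) (*-^-distrib x y n)) (e x y (x ^ n) (y ^ n))
    where
    e : ∀ x y u v → x * y * (u * v) ≡ x * u * (y * v)
    e = solve-∀

  module Mod (M : ℤ) where
    infix 4 _≈_
    -- Congruence is a relation on ℤ itself, not a quotient: identities from the ring solver enter
    -- through `≡⇒≈`, and a change of modulus speaks of the same numbers.
    record _≈_ (x y : ℤ) : Set where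
      constructor mk
      field
        quot : ℤ
        eq   : x ≡ y + quot * M

    ≡⇒≈ : ∀ {x y} → x ≡ y → x ≈ y
    ≡⇒≈ {x} refl = mk 0ℤ (≡.sym (ℤₚ.+-identityʳ x))

    ≈-refl : ∀ {x} → x ≈ x
    ≈-refl = ≡⇒≈ refl

    ≈-sym : ∀ {x y} → x ≈ y → y ≈ x
    ≈-sym {x} {y} (mk q refl) = mk (- q) (e y q M)
      where
      e : ∀ y q M → y ≡ (y + q * M) + - q * M
      e = solve-∀

    ≈-trans : ∀ {x y z} → x ≈ y → y ≈ z → x ≈ z
    ≈-trans {z = z} (mk q refl) (mk r refl) = mk (q + r) (e z q r M)
      where
      e : ∀ z q r M → z + r * M + q * M ≡ z + (q + r) * M
      e = solve-∀

    +-cong : ∀ {x y u v} → x ≈ y → u ≈ v → x + u ≈ y + v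
    +-cong {y = y} {v = v} (mk q refl) (mk r refl) = mk (q + r) (e y v q r M)
      where
      e : ∀ y v q r M → (y + q * M) + (v + r * M) ≡ y + v + (q + r) * M
      e = solve-∀

    *-cong : ∀ {x y u v} → x ≈ y → u ≈ v → x * u ≈ y * v
    *-cong {y = y} {v = v} (mk q refl) (mk r refl) = mk (q * v + y * r + q * r * M) (e y v q r M)
      where
      e : ∀ y v q r M → (y + q * M) * (v + r * M) ≡ y * v + (q * v + y * r + q * r * M) * M
      e = solve-∀

    neg-cong : ∀ {x y} → x ≈ y → - x ≈ - y
    neg-cong {y = y} (mk q refl) = mk (- q) (e y q M)
      where
      e : ∀ y q M → - (y + q * M) ≡ - y + - q * M
      e = solve-∀

    isCommutativeRing : IsCommutativeRing _≈_ _+_ _*_ -_ 0ℤ 1ℤ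
    isCommutativeRing = record
      { isRing = record
        { +-isAbelianGroup = record
          { isGroup = record
            { isMonoid = record
              { isSemigroup = record
                { isMagma = record
                  { isEquivalence = record { refl = ≈-refl ; sym = ≈-sym ; trans = ≈-trans }
                  ; ∙-cong = +-cong }
                ; assoc = λ x y z → ≡⇒≈ (ℤₚ.+-assoc x y z) }
              ; identity = (λ x → ≡⇒≈ (ℤₚ.+-identityˡ x)) , (λ x → ≡⇒≈ (ℤₚ.+-identityʳ x)) }
            ; inverse = (λ x → ≡⇒≈ (ℤₚ.+-inverseˡ x)) , (λ x → ≡⇒≈ (ℤₚ.+-inverseʳ x))
            ; ⁻¹-cong = neg-cong }
          ; comm = λ x y → ≡⇒≈ (ℤₚ.+-comm x y) }
        ; *-cong = *-cong
        ; *-assoc = λ x y z → ≡⇒≈ (ℤₚ.*-assoc x y z)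
        ; *-identity = (λ x → ≡⇒≈ (ℤₚ.*-identityˡ x)) , (λ x → ≡⇒≈ (ℤₚ.*-identityʳ x))
        ; distrib = (λ x y z → ≡⇒≈ (ℤₚ.*-distribˡ-+ x y z)) , (λ x y z → ≡⇒≈ (ℤₚ.*-distribʳ-+ x y z)) }
      ; *-comm = λ x y → ≡⇒≈ (ℤₚ.*-comm x y) }

    commutativeRing : CommutativeRing 0ℓ 0ℓ
    commutativeRing = record { isCommutativeRing = isCommutativeRing }

    open CommutativeRing commutativeRing public using (setoid)
    module ≈-Reasoning where
      open import Relation.Binary.Reasoning.Setoid setoid public
    open SumLaws commutativeRing public

    *-congˡ : ∀ u {x y} → x ≈ y → u * x ≈ u * y
    *-congˡ u h = *-cong (≈-refl {u}) h

    *-congʳ : ∀ u {x y} → x ≈ y → x * u ≈ y * u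
    *-congʳ u h = *-cong h (≈-refl {u})

    +-congˡ : ∀ u {x y} → x ≈ y → u + x ≈ u + y
    +-congˡ u h = +-cong (≈-refl {u}) h

    +-congʳ : ∀ u {x y} → x ≈ y → x + u ≈ y + u
    +-congʳ u h = +-cong h (≈-refl {u})

    ^-cong : ∀ {x y} n → x ≈ y → x ^ n ≈ y ^ n
    ^-cong zero    h = ≈-refl
    ^-cong (suc n) h = *-cong h (^-cong n h)

    1^≈1 : ∀ {x} n → x ≈ 1ℤ → x ^ n ≈ 1ℤ
    1^≈1 n h = ≈-trans (^-cong n h) (≡⇒≈ (ℤₚ.^-zeroˡ n))

    multiple≈0 : ∀ q → q * M ≈ 0ℤ
    multiple≈0 q = mk q (≡.sym (ℤₚ.+-identityˡ (q * M)))

    ≈⇒∸≈0 : ∀ {x y} → x ≈ y → x - y ≈ 0ℤ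
    ≈⇒∸≈0 {x} {y} h = ≈-trans (+-congʳ (- y) h) (≡⇒≈ (ℤₚ.+-inverseʳ y))

    ∸≈0⇒≈ : ∀ {x y} → x - y ≈ 0ℤ → x ≈ y
    ∸≈0⇒≈ {x} {y} h = ≈-trans (≡⇒≈ (e x y)) (≈-trans (+-congʳ y h) (≡⇒≈ (ℤₚ.+-identityˡ y)))
      where
      e : ∀ x y → x ≡ (x - y) + y
      e = solve-∀

    record Unit (u : ℤ) : Set where
      constructor unit
      field
        inv    : ℤ
        u*inv≈1 : u * inv ≈ 1ℤ

    Unit-* : ∀ {x y} → Unit x → Unit y → Unit (x * y)
    Unit-* {x} {y} (unit u xu) (unit v yv) = unit (u * v) $ ≈-trans (≡⇒≈ (e x y u v)) (*-cong xu yv)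
      where
      e : ∀ x y u v → x * y * (u * v) ≡ x * u * (y * v)
      e = solve-∀

    Unit-^ : ∀ {x} n → Unit x → Unit (x ^ n)
    Unit-^ zero    u = unit 1ℤ (≈-refl {1ℤ})
    Unit-^ (suc n) u = Unit-* u (Unit-^ n u)

    Unit-inv : ∀ {x y} → x * y ≈ 1ℤ → Unit y
    Unit-inv {x} {y} h = unit x $ ≈-trans (≡⇒≈ (ℤₚ.*-comm y x)) h

    Unit-resp : ∀ {x y} → x ≈ y → Unit x → Unit y
    Unit-resp h (unit v xv) = unit v (≈-trans (*-congʳ v (≈-sym h)) xv)

    Unit-neg : ∀ {x} → Unit x → Unit (- x)
    Unit-neg {x} (unit v xv) = unit (- v) $ ≈-trans (≡⇒≈ (e x v)) xv
      where
      e : ∀ x v → - x * - v ≡ x * v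
      e = solve-∀

    *-cancelˡ : ∀ {u x y} → Unit u → u * x ≈ u * y → x ≈ y
    *-cancelˡ {u} {x} {y} (unit v uv) h = begin
      x           ≡⟨ ℤₚ.*-identityˡ x ⟨
      1ℤ * x      ≈⟨ *-congʳ x uv ⟨
      u * v * x   ≡⟨ e u v x ⟩
      v * (u * x) ≈⟨ *-congˡ v h ⟩
      v * (u * y) ≡⟨ e u v y ⟨
      u * v * y   ≈⟨ *-congʳ y uv ⟩
      1ℤ * y      ≡⟨ ℤₚ.*-identityˡ y ⟩
      y           ∎
      where
      open ≈-Reasoning
      e : ∀ u v x → u * v * x ≡ v * (u * x)
      e = solve-∀

  open Mod using () renaming (mk to mkM)

  ≈-weaken : ∀ {M N x y} → Mod._≈_ (N * M) x y → Mod._≈_ M x y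
  ≈-weaken {M} {N} {x} {y} (mkM q e) = mkM (q * N) (≡.trans e (cong (_+_ y) (≡.sym (ℤₚ.*-assoc q N M))))


  pascal : ∀ n k → suc n C suc k ≡ n C k ℕ.+ n C suc k
  pascal n k = ≡.sym (nCk+nC[k+1]≡[n+1]C[k+1] n k)

  C-absorb : ∀ n k → suc k ℕ.* (suc n C suc k) ≡ suc n ℕ.* (n C k)
  C-absorb zero    zero    = refl
  C-absorb zero    (suc k) = ≡.trans (cong (suc (suc k) ℕ.*_) (k>n⇒nCk≡0 {1} {suc (suc k)} (s≤s (s≤s z≤n)))) (ℕₚ.*-zeroʳ (suc (suc k)))
  C-absorb (suc n) zero    = ≡.trans (ℕₚ.*-identityˡ _) (≡.trans (nC1≡n (suc (suc n))) (≡.sym (ℕₚ.*-identityʳ _)))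
  C-absorb (suc n) (suc k) = begin
    suc (suc k) ℕ.* (suc (suc n) C suc (suc k))       ≡⟨ cong (suc (suc k) ℕ.*_) (pascal (suc n) (suc k)) ⟩
    suc (suc k) ℕ.* (a ℕ.+ b)                         ≡⟨ e₁ (suc k) a b ⟩
    suc k ℕ.* a ℕ.+ suc (suc k) ℕ.* b ℕ.+ a           ≡⟨ cong (ℕ._+ a) (cong₂ ℕ._+_ (C-absorb n k) (C-absorb n (suc k))) ⟩
    suc n ℕ.* (n C k) ℕ.+ suc n ℕ.* (n C suc k) ℕ.+ a ≡⟨ cong (ℕ._+ a) (ℕₚ.*-distribˡ-+ (suc n) (n C k) (n C suc k)) ⟨
    suc n ℕ.* (n C k ℕ.+ n C suc k) ℕ.+ a             ≡⟨ cong (λ x → suc n ℕ.* x ℕ.+ a) (pascal n k) ⟨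
    suc n ℕ.* a ℕ.+ a                                 ≡⟨ ℕₚ.+-comm _ a ⟩
    suc (suc n) ℕ.* a                                 ∎
    where
    open ≡-Reasoning
    a = suc n C suc k
    b = suc n C suc (suc k)
    e₁ : ∀ k a b → suc k ℕ.* (a ℕ.+ b) ≡ k ℕ.* a ℕ.+ suc k ℕ.* b ℕ.+ a
    e₁ = ℕS.solve-∀

  module ℤΣ = SumLaws ℤₚ.+-*-commutativeRing

  sumℤ : ℕ → (ℕ → ℤ) → ℤ
  sumℤ = ℤΣ.sum

  binomial-theorem : ∀ y n → (1ℤ + y) ^ n ≡ sumℤ (suc n) (λ i → + (n C i) * y ^ i)
  binomial-theorem y zero    = refl
  binomial-theorem y (suc n) = begin
    (1ℤ + y) * (1ℤ + y) ^ n                                   ≡⟨ cong ((1ℤ + y) *_) (binomial-theorem y n) ⟩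
    (1ℤ + y) * S                                              ≡⟨ e₁ y S ⟩
    S + y * S                                                 ≡⟨ cong₂ _+_ left (ℤΣ.sum-*ˡ (suc n) y t) ⟩
    (+ (n C 0) * 1ℤ + sumℤ (suc n) (λ i → t (suc i))) + sumℤ (suc n) (λ i → y * t i)
                                                              ≡⟨ ℤₚ.+-assoc (+ (n C 0) * 1ℤ) (sumℤ (suc n) (λ i → t (suc i))) (sumℤ (suc n) (λ i → y * t i)) ⟩
    + (n C 0) * 1ℤ + (sumℤ (suc n) (λ i → t (suc i)) + sumℤ (suc n) (λ i → y * t i))
                                                              ≡⟨ cong (_+_ (+ (n C 0) * 1ℤ)) (≡.sym (ℤΣ.sum-+ (suc n) (λ i → t (suc i)) (λ i → y * t i))) ⟩
    + (n C 0) * 1ℤ + sumℤ (suc n) (λ i → t (suc i) + y * t i) ≡⟨ cong (_+_ (+ (n C 0) * 1ℤ)) (ℤΣ.sum-cong (suc n) (λ i _ → step i)) ⟩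
    u 0 + sumℤ (suc n) (λ i → u (suc i))                      ≡⟨ ℤΣ.sum-first (suc n) u ⟨
    sumℤ (suc (suc n)) u                                      ∎
    where
    open ≡-Reasoning
    t u : ℕ → ℤ
    t i = + (n C i) * y ^ i
    u i = + (suc n C i) * y ^ i
    S = sumℤ (suc n) t
    e₁ : ∀ y s → (1ℤ + y) * s ≡ s + y * s
    e₁ = solve-∀
    left : S ≡ t 0 + sumℤ (suc n) (λ i → t (suc i))
    left = begin
      S                                              ≡⟨ ℤΣ.sum-first n t ⟩
      t 0 + sumℤ n (λ i → t (suc i))                 ≡⟨ cong (_+_ (t 0)) (ℤₚ.+-identityʳ (sumℤ n (λ i → t (suc i)))) ⟨
      t 0 + (sumℤ n (λ i → t (suc i)) + 0ℤ)
        ≡⟨ cong (λ z → t 0 + (sumℤ n (λ i → t (suc i)) + z)) (cong (λ c → + c * y ^ suc n) (k>n⇒nCk≡0 {n} {suc n} (ℕₚ.n<1+n n))) ⟨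
      t 0 + sumℤ (suc n) (λ i → t (suc i))           ∎
    e₂ : ∀ a b y z → a * (y * z) + y * (b * z) ≡ (b + a) * (y * z)
    e₂ = solve-∀
    step : ∀ i → t (suc i) + y * t i ≡ u (suc i)
    step i = ≡.trans (e₂ (+ (n C suc i)) (+ (n C i)) y (y ^ i))
      (cong (_* y ^ suc i) (≡.trans (≡.sym (ℤₚ.pos-+ (n C i) (n C suc i))) (cong +_ (≡.sym (pascal n i)))))

  ΣC≡C : ∀ n j → sumℤ n (λ i → + (i C j)) ≡ + (n C suc j)
  ΣC≡C zero    j = refl
  ΣC≡C (suc n) j = ≡.trans (cong (_+ + (n C j)) (ΣC≡C n j))
    (≡.trans (≡.sym (ℤₚ.pos-+ (n C suc j) (n C j)))
      (cong +_ (≡.trans (ℕₚ.+-comm (n C suc j) _) (≡.sym (pascal n j)))))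

  module PrimeModulus (p : ℕ) (pr : Prime p) where
    private instance
      p≢0 = prime⇒nonZero pr
      p-nt = prime⇒nonTrivial pr

    1<p : 1 < p
    1<p = ℕ.nonTrivial⇒n>1 p

    private
      p' = ℕ.pred p
      p≡ : p ≡ suc p'
      p≡ = ≡.sym (ℕₚ.suc-pred p)

    module 𝔽 = Mod (+ p)
    open 𝔽

    ≈0⇒∣ : ∀ {x} → x ≈ 0ℤ → p ∣ℕ ∣ x ∣
    ≈0⇒∣ {x} (mk q e) = divides ∣ q ∣ (≡.trans (cong ∣_∣ (≡.trans e (ℤₚ.+-identityˡ (q * + p)))) (ℤₚ.abs-* q (+ p)))

    ∣⇒≈0 : ∀ {x} → p ∣ℕ ∣ x ∣ → x ≈ 0ℤ
    ∣⇒≈0 {+ n}      (divides q e) = mk (+ q) (≡.trans (cong +_ e) (≡.trans (ℤₚ.pos-* q p) (≡.sym (ℤₚ.+-identityˡ (+ q * + p)))))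
    ∣⇒≈0 { -[1+ n ]} (divides q e) = mk (- (+ q)) (≡.trans (cong (λ z → - (+ z)) e)
      (≡.trans (cong -_ (ℤₚ.pos-* q p)) (≡.trans (ℤₚ.neg-distribˡ-* (+ q) (+ p)) (≡.sym (ℤₚ.+-identityˡ (- (+ q) * + p))))))

    zero-product : ∀ x y → x * y ≈ 0ℤ → ¬ x ≈ 0ℤ → y ≈ 0ℤ
    zero-product x y h x≉0 with euclidsLemma ∣ x ∣ ∣ y ∣ pr (subst (p ∣ℕ_) (ℤₚ.abs-* x y) (≈0⇒∣ h))
    ... | inj₁ d = ⊥-elim (x≉0 (∣⇒≈0 d))
    ... | inj₂ d = ∣⇒≈0 d

    ∤⇒≉0 : ∀ {u} → p ∤ℕ u → ¬ + u ≈ 0ℤ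
    ∤⇒≉0 p∤u h = p∤u (≈0⇒∣ h)

    0<u<p⇒∤ : ∀ {u} → 0 < u → u < p → p ∤ℕ u
    0<u<p⇒∤ {suc u} _ u<p d = ℕₚ.<⇒≱ u<p (ℕ∣.∣⇒≤ d)

    1≉0 : ¬ 1ℤ ≈ 0ℤ
    1≉0 h = 0<u<p⇒∤ {1} (s≤s z≤n) 1<p (≈0⇒∣ h)

    -- In (i+1) C(p, i+1) = p C(p-1, i) the factor i + 1 is prime to p.
    pCi≈0 : ∀ i → suc i < p → + (p C suc i) ≈ 0ℤ
    pCi≈0 i i<p = zero-product (+ suc i) _ (≈-trans (≡⇒≈ (≡.sym (ℤₚ.pos-* (suc i) (p C suc i))))
       (≈-trans (≡⇒≈ (cong +_ (h p p≡))) (∣⇒≈0 (divides (p' C i) (ℕₚ.*-comm p (p' C i))))))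
       (∤⇒≉0 (0<u<p⇒∤ (s≤s z≤n) i<p))
      where
      h : ∀ q → q ≡ suc p' → suc i ℕ.* (q C suc i) ≡ q ℕ.* (p' C i)
      h q refl = C-absorb p' i

    frobenius : ∀ y → (1ℤ + y) ^ p ≈ 1ℤ + y ^ p
    frobenius y = begin
      (1ℤ + y) ^ p                                       ≡⟨ binomial-theorem y p ⟩
      sumℤ p t + t p                                     ≡⟨ cong (λ n → sumℤ n t + t p) p≡ ⟩
      sumℤ (suc p') t + t p                              ≡⟨ cong (_+ t p) (ℤΣ.sum-first p' t) ⟩
      (t 0 + sumℤ p' (λ i → t (suc i))) + t p            ≈⟨ +-congʳ (t p) (+-congˡ (t 0) (sum-zero p' small)) ⟩
      (1ℤ + 0ℤ) + t p                                    ≡⟨ cong (λ c → 1ℤ + + c * y ^ p) (nCn≡1 p) ⟩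
      1ℤ + 1ℤ * y ^ p                                    ≡⟨ cong (_+_ 1ℤ) (ℤₚ.*-identityˡ (y ^ p)) ⟩
      1ℤ + y ^ p                                         ∎
      where
      open ≈-Reasoning
      t : ℕ → ℤ
      t i = + (p C i) * y ^ i
      small : ∀ i → i < p' → t (suc i) ≈ 0ℤ
      small i i<p' = ≈-trans (*-congʳ (y ^ suc i) (pCi≈0 i (subst (suc (suc i) ≤_) (≡.sym p≡) (s≤s i<p')))) (≡⇒≈ (ℤₚ.*-zeroˡ (y ^ suc i)))

    fermat : ∀ u → (+ u) ^ p ≈ + u
    fermat zero    = ≡⇒≈ (≡.trans (cong (0ℤ ^_) p≡) (ℤₚ.*-zeroˡ (0ℤ ^ p')))
    fermat (suc u) = ≈-trans (frobenius (+ u)) (+-cong (≈-refl {1ℤ}) (fermat u))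

    fermat-unit : ∀ {u} → p ∤ℕ u → (+ u) ^ p' ≈ 1ℤ
    fermat-unit {u} p∤u = ∸≈0⇒≈ (zero-product (+ u) _
      (≈-trans (≡⇒≈ (e (+ u) ((+ u) ^ p'))) (≈⇒∸≈0 (≈-trans (≡⇒≈ (cong ((+ u) ^_) (≡.sym p≡))) (fermat u)))) (∤⇒≉0 p∤u))
      where
      e : ∀ u v → u * (v - 1ℤ) ≡ u * v - u
      e = solve-∀

    private
      -- The identity i C(i,j) = (j+1) C(i,j+1) + j C(i,j) trades a power of i for a larger j, until
      -- the hockey-stick identity leaves a binomial coefficient of p. For n + j < p - 1 all of
      -- these are divisible by p; for n + j = p - 1 a single path survives, with coefficient
      -- (p-1)!/j!.
      A : ℕ → ℕ → ℤ
      A n j = sumℤ p (λ i → (+ i) ^ n * + (i C j))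

      i*C : ∀ i j → + i * + (i C j) ≡ + suc j * + (i C suc j) + + j * + (i C j)
      i*C i j = ≡.trans (≡.sym (ℤₚ.pos-* i (i C j))) (≡.trans (cong +_ (h i))
         (≡.trans (ℤₚ.pos-+ (suc j ℕ.* (i C suc j)) (j ℕ.* (i C j))) (cong₂ _+_ (ℤₚ.pos-* (suc j) _) (ℤₚ.pos-* j _))))
        where
        e : ∀ j x y → suc j ℕ.* y ℕ.+ j ℕ.* x ℕ.+ x ≡ suc j ℕ.* (x ℕ.+ y)
        e = ℕS.solve-∀
        h : ∀ i → i ℕ.* (i C j) ≡ suc j ℕ.* (i C suc j) ℕ.+ j ℕ.* (i C j)
        h i = ℕₚ.+-cancelʳ-≡ (i C j) _ _ (begin
          i ℕ.* (i C j) ℕ.+ (i C j)                          ≡⟨ ℕₚ.+-comm _ (i C j) ⟩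
          suc i ℕ.* (i C j)                                  ≡⟨ C-absorb i j ⟨
          suc j ℕ.* (suc i C suc j)                          ≡⟨ cong (suc j ℕ.*_) (pascal i j) ⟩
          suc j ℕ.* (i C j ℕ.+ i C suc j)                    ≡⟨ e j (i C j) (i C suc j) ⟨
          suc j ℕ.* (i C suc j) ℕ.+ j ℕ.* (i C j) ℕ.+ i C j  ∎)
          where open ≡-Reasoning

      A-suc : ∀ n j → A (suc n) j ≡ + suc j * A n (suc j) + + j * A n j
      A-suc n j = begin
        A (suc n) j ≡⟨ ℤΣ.sum-cong p (λ i _ → step i) ⟩
        sumℤ p (λ i → + suc j * ((+ i) ^ n * + (i C suc j)) + + j * ((+ i) ^ n * + (i C j))) ≡⟨ ℤΣ.sum-+ p (λ i → + suc j * ((+ i) ^ n * + (i C suc j))) (λ i → + j * ((+ i) ^ n * + (i C j))) ⟩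
        sumℤ p (λ i → + suc j * ((+ i) ^ n * + (i C suc j))) + sumℤ p (λ i → + j * ((+ i) ^ n * + (i C j)))
          ≡⟨ cong₂ _+_ (≡.sym (ℤΣ.sum-*ˡ p (+ suc j) (λ i → (+ i) ^ n * + (i C suc j)))) (≡.sym (ℤΣ.sum-*ˡ p (+ j) (λ i → (+ i) ^ n * + (i C j)))) ⟩
        + suc j * A n (suc j) + + j * A n j ∎
        where
        open ≡-Reasoning
        e₁ : ∀ i w c → i * w * c ≡ w * (i * c)
        e₁ = solve-∀
        e₂ : ∀ w a x b y → w * (a * x + b * y) ≡ a * (w * x) + b * (w * y)
        e₂ = solve-∀
        step : ∀ i → (+ i) ^ suc n * + (i C j) ≡ + suc j * ((+ i) ^ n * + (i C suc j)) + + j * ((+ i) ^ n * + (i C j))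
        step i = ≡.trans (e₁ (+ i) ((+ i) ^ n) (+ (i C j))) (≡.trans (cong ((+ i) ^ n *_) (i*C i j))
           (e₂ ((+ i) ^ n) (+ suc j) (+ (i C suc j)) (+ j) (+ (i C j))))

      A-zero : ∀ j → A 0 j ≡ + (p C suc j)
      A-zero j = ≡.trans (ℤΣ.sum-cong p (λ i _ → ℤₚ.*-identityˡ (+ (i C j)))) (ΣC≡C p j)

      A-low : ∀ n j → n ℕ.+ j < p' → A n j ≈ 0ℤ
      A-low zero    j h = ≈-trans (≡⇒≈ (A-zero j)) (pCi≈0 j (subst (suc (suc j) ≤_) (≡.sym p≡) (s≤s h)))
      A-low (suc n) j h = ≈-trans (≡⇒≈ (A-suc n j))
        (≈-trans (+-cong (*-congˡ (+ suc j) (A-low n (suc j) (subst (_< p') (≡.sym (ℕₚ.+-suc n j)) h))) (*-congˡ (+ j) (A-low n j (ℕₚ.<-trans (ℕₚ.n<1+n _) h))))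
          (≡⇒≈ (cong₂ _+_ (ℤₚ.*-zeroʳ (+ suc j)) (ℤₚ.*-zeroʳ (+ j)))))

      A-top : ∀ n j → n ℕ.+ j ≡ p' → + (j !) * A n j ≈ + (p' !)
      A-top zero    j refl = ≡⇒≈ (≡.trans (cong (+ (j !) *_) (≡.trans (A-zero j) (≡.trans (cong (λ q → + (q C suc j)) p≡) (cong +_ (nCn≡1 (suc j))))))
                                (ℤₚ.*-identityʳ (+ (j !))))
      A-top (suc n) j h = begin
        + (j !) * A (suc n) j                                        ≡⟨ cong (+ (j !) *_) (A-suc n j) ⟩
        + (j !) * (+ suc j * A n (suc j) + + j * A n j)              ≡⟨ e (+ (j !)) (+ suc j) (A n (suc j)) (+ j) (A n j) ⟩
        (+ suc j * + (j !)) * A n (suc j) + + (j !) * + j * A n j    ≡⟨ cong (λ z → z * A n (suc j) + + (j !) * + j * A n j) (≡.sym (ℤₚ.pos-* (suc j) (j !))) ⟩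
        + (suc j !) * A n (suc j) + + (j !) * + j * A n j
          ≈⟨ +-cong (A-top n (suc j) (≡.trans (ℕₚ.+-suc n j) h)) (*-congˡ (+ (j !) * + j) (A-low n j (subst (n ℕ.+ j <_) h (ℕₚ.n<1+n _)))) ⟩
        + (p' !) + + (j !) * + j * 0ℤ                                ≡⟨ cong (_+_ (+ (p' !))) (ℤₚ.*-zeroʳ (+ (j !) * + j)) ⟩
        + (p' !) + 0ℤ                                                ≡⟨ ℤₚ.+-identityʳ (+ (p' !)) ⟩
        + (p' !)                                                     ∎
        where
        open ≈-Reasoning
        e : ∀ f s a j b → f * (s * a + j * b) ≡ (s * f) * a + f * j * b
        e = solve-∀

      sum-const : ∀ n x → sumℤ n (λ _ → x) ≡ + n * x
      sum-const zero    x = refl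
      sum-const (suc n) x = ≡.trans (cong (_+ x) (sum-const n x)) (≡.trans (e (+ n) x) (cong (_* x) (≡.sym (ℤₚ.pos-+ 1 n))))
        where
        e : ∀ n x → n * x + x ≡ (1ℤ + n) * x
        e = solve-∀

    -- Both sides are the sum of i^(p-1) over a period: expand i^(p-1) in binomial coefficients,
    -- of which only the last has a nonzero sum.
    wilson : + (p' !) ≈ - 1ℤ
    wilson = begin
      + (p' !)                            ≈⟨ A-top p' 0 (ℕₚ.+-identityʳ p') ⟨
      1ℤ * A p' 0                         ≡⟨ ℤₚ.*-identityˡ (A p' 0) ⟩
      A p' 0                              ≡⟨ ℤΣ.sum-cong p (λ i _ → ℤₚ.*-identityʳ ((+ i) ^ p')) ⟩
      sumℤ p f                            ≡⟨ cong (λ n → sumℤ n f) p≡ ⟩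
      sumℤ (suc p') f                     ≡⟨ ℤΣ.sum-first p' f ⟩
      f 0 + sumℤ p' (λ i → f (suc i))     ≈⟨ +-cong f0 (sum-cong p' (λ i h → fermat-unit (0<u<p⇒∤ (s≤s z≤n) (subst (suc (suc i) ≤_) (≡.sym p≡) (s≤s h))))) ⟩
      0ℤ + sumℤ p' (λ _ → 1ℤ)             ≡⟨ ≡.trans (ℤₚ.+-identityˡ (sumℤ p' (λ _ → 1ℤ))) (≡.trans (sum-const p' 1ℤ) (ℤₚ.*-identityʳ (+ p'))) ⟩
      + p'                                ≈⟨ mk 1ℤ (≡.trans (e (+ p')) (cong (λ z → - 1ℤ + 1ℤ * z) (≡.trans (≡.sym (ℤₚ.pos-+ 1 p')) (cong +_ (≡.sym p≡))))) ⟩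
      - 1ℤ                                ∎
      where
      open ≈-Reasoning
      f : ℕ → ℤ
      f i = (+ i) ^ p'
      e : ∀ x → x ≡ - 1ℤ + 1ℤ * (1ℤ + x)
      e = solve-∀
      f0 : f 0 ≈ 0ℤ
      f0 = ≈-trans (≡⇒≈ (cong (0ℤ ^_) (≡.sym (ℕₚ.suc-pred p' ⦃ ℕ.>-nonZero (ℕ.s≤s⁻¹ (subst (1 <_) p≡ 1<p)) ⦄))))
             (≡⇒≈ (ℤₚ.*-zeroˡ (0ℤ ^ ℕ.pred p')))

-- Morita's Γ_p modulo powers of p: periodicity, reflection, and the argument c/(p-1)

module MoritaGamma where
  open import Data.Bool using (if_then_else_)
  open import Data.Empty using (⊥-elim)
  open import Data.Nat as ℕ using (ℕ; zero; suc; _<_; z≤n; s≤s; _!; _∸_)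
  import Data.Nat.Properties as ℕₚ
  open import Data.Nat.Divisibility as ℕ∣ using (divides; _∣?_; _∣_; _∤_)
  open import Data.Nat.Primality using (Prime; euclidsLemma; prime⇒nonZero)
  import Data.Nat.Tactic.RingSolver as ℕS
  open import Data.Integer as ℤ using (ℤ; +_; -[1+_]; _+_; _*_; -_; _-_; _^_; 0ℤ; 1ℤ; -1ℤ; ∣_∣)
  import Data.Integer.Properties as ℤₚ
  open import Data.Integer.Tactic.RingSolver using (solve-∀)
  open import Data.Product using (_,_; ∃; proj₁; proj₂)
  open import Data.Sum using ([_,_]′)
  open import Relation.Nullary using (¬_; yes; no; does)
  open import Relation.Binary.PropositionalEquality as ≡ using (_≡_; refl; cong; cong₂; subst; sym; trans; module ≡-Reasoning)
  open FiniteSums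
  open ModularArithmetic

  one-plus-^ : ∀ d n → ∃ λ w → (1ℤ + d) ^ n ≡ 1ℤ + + n * d + d * d * w
  one-plus-^ d zero    = 0ℤ , e d
    where
    e : ∀ d → 1ℤ ≡ 1ℤ + 0ℤ * d + d * d * 0ℤ
    e = solve-∀
  one-plus-^ d (suc n) with one-plus-^ d n
  ... | w , h = + n + w + d * w , trans (cong ((1ℤ + d) *_) h) (e d (+ n) w)
    where
    e : ∀ d n w → (1ℤ + d) * (1ℤ + n * d + d * d * w) ≡ 1ℤ + (1ℤ + n) * d + d * d * (n + w + d * w)
    e = solve-∀

  -1^2n : ∀ n → -1ℤ ^ (n ℕ.+ n) ≡ 1ℤ
  -1^2n n = trans (ℤₚ.^-distribˡ-+-* -1ℤ n n) (trans (sym (*-^-distrib -1ℤ -1ℤ n)) (ℤₚ.^-zeroˡ n))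

  x+x-injective : ∀ x y → x + x ≡ y + y → x ≡ y
  x+x-injective x y h = ℤₚ.*-cancelˡ-≡ (+ 2) x y (trans (e x) (trans h (sym (e y))))
    where
    e : ∀ x → + 2 * x ≡ x + x
    e = solve-∀

  ∣m+n∣n⇒∣m : ∀ {d} m {n} → d ∣ m ℕ.+ n → d ∣ n → d ∣ m
  ∣m+n∣n⇒∣m {d} m {n} h = ℕ∣.∣m+n∣m⇒∣n (subst (d ∣_) (ℕₚ.+-comm m n) h)

  module GammaP (p : ℕ) (pr : Prime p) (b : ℕ) (p≡1+2b : p ≡ suc (b ℕ.+ b)) where

    open PrimeModulus p pr public

    private instance
      p≢0 = prime⇒nonZero pr

    module ℤ/ (k : ℕ) = Mod (+ (p ℕ.^ k))

    +p^suc : ∀ k → + (p ℕ.^ suc k) ≡ + p * + (p ℕ.^ k)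
    +p^suc k = ℤₚ.pos-* p (p ℕ.^ k)

    private
      n : ℕ
      n = p ∸ 1
      p≡1+n : p ≡ suc n
      p≡1+n = sym (ℕₚ.suc-pred p)

    to-p : ∀ k {x y} → ℤ/._≈_ (suc k) x y → 𝔽._≈_ x y
    to-p k {x} {y} h = ≈-weaken {+ p} {+ (p ℕ.^ k)} (subst (λ M → Mod._≈_ M x y) (trans (+p^suc k) (ℤₚ.*-comm (+ p) (+ (p ℕ.^ k)))) h)

    from-p : ∀ {x y} → 𝔽._≈_ x y → ℤ/._≈_ 1 x y
    from-p {x} {y} = subst (λ M → Mod._≈_ M x y) (cong +_ (sym (ℕₚ.*-identityʳ p)))

    module _ (k : ℕ) where
      private
        M = + (p ℕ.^ suc k)
      open ℤ/ (suc (suc k))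
      p*M≈0 : ∀ x → + p * x * M ≈ 0ℤ
      p*M≈0 x = mk x (trans (e (+ p) x M) (cong (λ z → 0ℤ + x * z) (sym (+p^suc (suc k)))))
        where
        e : ∀ p x M → p * x * M ≡ 0ℤ + x * (p * M)
        e = solve-∀
      M*M≈0 : ∀ x → M * M * x ≈ 0ℤ
      M*M≈0 x = ≈-trans (≡⇒≈ (trans (cong (λ z → z * M * x) (+p^suc k)) (e (+ p) (+ (p ℕ.^ k)) M x))) (p*M≈0 (+ (p ℕ.^ k) * x))
        where
        e : ∀ p q M x → p * q * M * x ≡ p * (q * x) * M
        e = solve-∀

    -- In (1 + qM)^p the linear term has the extra factor p, and all further terms contain M², a
    -- multiple of pM.
    lift-1 : ∀ k {x} → ℤ/._≈_ (suc k) x 1ℤ → ℤ/._≈_ (suc (suc k)) (x ^ p) 1ℤ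
    lift-1 k {x} (Mod.mk q refl) with one-plus-^ (q * + (p ℕ.^ suc k)) p
    ... | w , h = begin
      (1ℤ + q * M) ^ p                                 ≡⟨ h ⟩
      1ℤ + + p * (q * M) + q * M * (q * M) * w         ≡⟨ e (+ p) q M w ⟩
      1ℤ + + p * q * M + M * M * (q * q * w)           ≈⟨ +-cong (+-congˡ 1ℤ (p*M≈0 k q)) (M*M≈0 k (q * q * w)) ⟩
      1ℤ + 0ℤ + 0ℤ                                     ≡⟨⟩
      1ℤ                                               ∎
      where
      open ℤ/ (suc (suc k))
      open ≈-Reasoning
      M = + (p ℕ.^ suc k)
      e : ∀ p q M w → 1ℤ + p * (q * M) + q * M * (q * M) * w ≡ 1ℤ + p * q * M + M * M * (q * q * w)
      e = solve-∀

    euler : ∀ k {u} → p ∤ u → ℤ/._≈_ (suc k) ((+ u) ^ (p ℕ.^ k ℕ.* n)) 1ℤ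
    euler zero    {u} p∤u = subst (λ e → ℤ/._≈_ 1 ((+ u) ^ e) 1ℤ) (sym (ℕₚ.+-identityʳ n)) (from-p (fermat-unit p∤u))
    euler (suc k) {u} p∤u = subst (λ x → ℤ/._≈_ (suc (suc k)) x 1ℤ) e (lift-1 k (euler k p∤u))
      where
      e : ((+ u) ^ (p ℕ.^ k ℕ.* n)) ^ p ≡ (+ u) ^ (p ℕ.^ suc k ℕ.* n)
      e = trans (ℤₚ.^-*-assoc (+ u) (p ℕ.^ k ℕ.* n) p) (cong ((+ u) ^_) (h (p ℕ.^ k) n p))
        where
        h : ∀ a n p → a ℕ.* n ℕ.* p ≡ p ℕ.* a ℕ.* n
        h = ℕS.solve-∀

    private
      n>0 : 0 < n
      n>0 = ℕ.s≤s⁻¹ (subst (1 <_) p≡1+n 1<p)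
      tot>0 : ∀ k → 0 < p ℕ.^ k ℕ.* n
      tot>0 k = ℕₚ.*-mono-≤ (ℕₚ.m^n>0 p k) n>0

    euler-inv : ∀ k {u} → p ∤ u → ℤ/._≈_ (suc k) (+ u * (+ u) ^ (p ℕ.^ k ℕ.* n ∸ 1)) 1ℤ
    euler-inv k {u} p∤u = subst (λ e → ℤ/._≈_ (suc k) ((+ u) ^ e) 1ℤ) (sym (ℕₚ.suc-pred (p ℕ.^ k ℕ.* n) ⦃ ℕ.>-nonZero (tot>0 k) ⦄)) (euler k p∤u)

    ℕ-unit : ∀ k {u} → p ∤ u → ℤ/.Unit (suc k) (+ u)
    ℕ-unit k {u} p∤u = Mod.unit ((+ u) ^ (p ℕ.^ k ℕ.* n ∸ 1)) (euler-inv k p∤u)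

    unit-to-p : ∀ k {u} → ℤ/.Unit (suc k) u → 𝔽.Unit u
    unit-to-p k (Mod.unit v uv) = Mod.unit v (to-p k uv)

    unit⇒≉0 : ∀ {u} → 𝔽.Unit u → ¬ 𝔽._≈_ u 0ℤ
    unit⇒≉0 {u} (Mod.unit v uv) h = 1≉0 (𝔽.≈-trans (𝔽.≈-sym uv) (𝔽.≈-trans (𝔽.*-congʳ v h) (𝔽.≡⇒≈ (ℤₚ.*-zeroˡ v))))

    -- `σ N` is the quotient Γ_p(N+1)/Γ_p(N), and `s N` is the same quotient at the argument -N,
    -- that is Γ_p(1-N)/Γ_p(-N).
    σ s : ℕ → ℤ
    σ N = if does (p ∣? N) then -1ℤ else - (+ N)
    s N = if does (p ∣? N) then -1ℤ else + N

    σ-∣ : ∀ {N} → p ∣ N → σ N ≡ -1ℤ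
    σ-∣ {N} d with p ∣? N
    ... | yes _ = refl
    ... | no nd = ⊥-elim (nd d)

    σ-∤ : ∀ {N} → p ∤ N → σ N ≡ - (+ N)
    σ-∤ {N} nd with p ∣? N
    ... | yes d = ⊥-elim (nd d)
    ... | no _  = refl

    s-∣ : ∀ {N} → p ∣ N → s N ≡ -1ℤ
    s-∣ {N} d with p ∣? N
    ... | yes _ = refl
    ... | no nd = ⊥-elim (nd d)

    s-∤ : ∀ {N} → p ∤ N → s N ≡ + N
    s-∤ {N} nd with p ∣? N
    ... | yes d = ⊥-elim (nd d)
    ... | no _  = refl

    σ-unit : ∀ k N → ℤ/.Unit (suc k) (σ N)
    σ-unit k N with p ∣? N
    ... | yes _ = Mod.unit -1ℤ (ℤ/.≈-refl (suc k) {1ℤ})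
    ... | no nd = ℤ/.Unit-neg (suc k) (ℕ-unit k nd)

    -- The quotient Γ_p(N+L)/Γ_p(N).
    blk : ℕ → ℕ → ℤ
    blk N zero    = 1ℤ
    blk N (suc L) = blk N L * σ (N ℕ.+ L)

    -- Γ_p at the natural number N
    gam : ℕ → ℤ
    gam = blk 0

    blk-+ : ∀ N L L' → blk N (L ℕ.+ L') ≡ blk N L * blk (N ℕ.+ L) L'
    blk-+ N L zero     = trans (cong (blk N) (ℕₚ.+-identityʳ L)) (sym (ℤₚ.*-identityʳ (blk N L)))
    blk-+ N L (suc L') = begin
      blk N (L ℕ.+ suc L')                               ≡⟨ cong (blk N) (ℕₚ.+-suc L L') ⟩
      blk N (L ℕ.+ L') * σ (N ℕ.+ (L ℕ.+ L'))            ≡⟨ cong₂ (λ x y → x * σ y) (blk-+ N L L') (sym (ℕₚ.+-assoc N L L')) ⟩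
      blk N L * blk (N ℕ.+ L) L' * σ (N ℕ.+ L ℕ.+ L')    ≡⟨ ℤₚ.*-assoc (blk N L) (blk (N ℕ.+ L) L') (σ (N ℕ.+ L ℕ.+ L')) ⟩
      blk N L * (blk (N ℕ.+ L) L' * σ (N ℕ.+ L ℕ.+ L'))  ∎
      where open ≡-Reasoning

    blk-front : ∀ N L → blk N (suc L) ≡ σ N * blk (suc N) L
    blk-front N L = trans (blk-+ N 1 L) (cong₂ (λ x y → x * blk y L) (trans (ℤₚ.*-identityˡ (σ (N ℕ.+ 0))) (cong σ (ℕₚ.+-identityʳ N))) (ℕₚ.+-comm N 1))

    σ+p : ∀ N → 𝔽._≈_ (σ (N ℕ.+ p)) (σ N)
    σ+p N with p ∣? N
    ... | yes d = 𝔽.≡⇒≈ (σ-∣ (ℕ∣.∣m∣n⇒∣m+n d ℕ∣.∣-refl))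
    ... | no nd = 𝔽.≈-trans (𝔽.≡⇒≈ (σ-∤ (λ d → nd (∣m+n∣n⇒∣m N d ℕ∣.∣-refl))))
                   (Mod.mk -1ℤ (trans (cong -_ (ℤₚ.pos-+ N p)) (e (+ N) (+ p))))
      where
      e : ∀ N p → - (N + p) ≡ - N + -1ℤ * p
      e = solve-∀

    gam-factorial : ∀ L → L < p → gam (suc L) ≡ - (-1ℤ ^ L * + (L !))
    gam-factorial zero    h = cong (1ℤ *_) (σ-∣ (p ℕ∣.∣0))
    gam-factorial (suc L) h = trans (cong₂ _*_ (gam-factorial L (ℕₚ.<-trans (ℕₚ.n<1+n L) h)) (σ-∤ (0<u<p⇒∤ (s≤s z≤n) h)))
      (trans (e (-1ℤ ^ L) (+ (L !)) (+ suc L)) (cong (λ z → - (-1ℤ * -1ℤ ^ L * z)) (sym (ℤₚ.pos-* (suc L) (L !)))))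
      where
      e : ∀ x f l → - (x * f) * - l ≡ - (-1ℤ * x * (l * f))
      e = solve-∀

    -- Wilson's theorem gives `N` = 0, the sign being right because p is odd; sliding the window by
    -- one drops a factor and adds a congruent one.
    blk-p : ∀ N → 𝔽._≈_ (blk N p) 1ℤ
    blk-p zero    = begin
      gam p                          ≡⟨ cong gam p≡1+n ⟩
      gam (suc n)                    ≡⟨ gam-factorial n (subst (n <_) (sym p≡1+n) (ℕₚ.n<1+n n)) ⟩
      - (-1ℤ ^ n * + (n !))          ≡⟨ cong (λ m → - (-1ℤ ^ m * + (n !))) (cong ℕ.pred p≡1+2b) ⟩
      - (-1ℤ ^ (b ℕ.+ b) * + (n !))  ≡⟨ cong (λ z → - (z * + (n !))) (-1^2n b) ⟩
      - (1ℤ * + (n !))               ≈⟨ neg-cong (*-congˡ 1ℤ wilson) ⟩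
      1ℤ                             ∎
      where
      open 𝔽
      open ≈-Reasoning
    blk-p (suc N) = *-cancelˡ (unit-to-p 0 (σ-unit 0 N)) (begin
      σ N * blk (suc N) p     ≡⟨ blk-front N p ⟨
      blk N p * σ (N ℕ.+ p)   ≈⟨ *-cong (blk-p N) (σ+p N) ⟩
      1ℤ * σ N                ≡⟨ ℤₚ.*-comm 1ℤ (σ N) ⟩
      σ N * 1ℤ                ∎)
      where
      open 𝔽
      open ≈-Reasoning

    private
      T : ℕ → ℤ
      T zero    = 0ℤ
      T (suc r) = T r + + r

      T-closed : ∀ m → T (suc m) + T (suc m) ≡ + m * + suc m
      T-closed zero    = refl
      T-closed (suc m) = trans (e₁ (T (suc m)) (+ suc m)) (trans (cong (_+ (+ suc m + + suc m)) (T-closed m)) (e₂ (+ m)))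
        where
        e₁ : ∀ t m → (t + m) + (t + m) ≡ (t + t) + (m + m)
        e₁ = solve-∀
        e₂ : ∀ m → m * (1ℤ + m) + ((1ℤ + m) + (1ℤ + m)) ≡ (1ℤ + m) * (1ℤ + (1ℤ + m))
        e₂ = solve-∀

      T-p : T p ≡ + p * + b
      T-p = trans (cong T p≡1+2b) (x+x-injective _ (+ p * + b) (trans (T-closed (b ℕ.+ b))
              (trans (cong₂ _*_ (ℤₚ.pos-+ b b) (cong +_ (sym p≡1+2b))) (e (+ b) (+ p)))))
        where
        e : ∀ b p → (b + b) * p ≡ p * b + p * b
        e = solve-∀

      module Step (k : ℕ) (ih : ∀ N → ℤ/._≈_ (suc k) (blk N (p ℕ.^ suc k)) 1ℤ) (N : ℕ) where
        open ℤ/ (suc (suc k))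
        m = p ℕ.^ suc k
        M = + m

        σ-shift : ∀ N → ∃ λ d → ∀ i → σ (N ℕ.+ i ℕ.* m) ≡ σ N + + i * M * d
        σ-shift N with p ∣? N
        ... | yes p∣N = 0ℤ , λ i → trans (σ-∣ (ℕ∣.∣m∣n⇒∣m+n p∣N (ℕ∣.∣n⇒∣m*n i (ℕ∣.m∣m*n (p ℕ.^ k))))) (sym (trans (cong (_+_ -1ℤ) (ℤₚ.*-zeroʳ (+ i * M))) refl))
        ... | no p∤N = -1ℤ , λ i → trans (σ-∤ (λ d → p∤N (∣m+n∣n⇒∣m N d (ℕ∣.∣n⇒∣m*n i (ℕ∣.m∣m*n (p ℕ.^ k))))))
                (trans (cong -_ (trans (ℤₚ.pos-+ N (i ℕ.* m)) (cong (_+_ (+ N)) (ℤₚ.pos-* i m)))) (e (+ N) (+ i) M))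
          where
          e : ∀ N i M → - (N + i * M) ≡ - N + i * M * -1ℤ
          e = solve-∀

        -- Modulo p^(k+2), which divides M², the window depends linearly on the number i of steps of
        -- length M. The slope `d` plays the role of a derivative and is therefore chosen before i.
        blk-shift : ∀ L → ∃ λ d → ∀ i → blk (N ℕ.+ i ℕ.* m) L ≈ blk N L + + i * M * d
        blk-shift zero = 0ℤ , λ i → ≡⇒≈ (sym (trans (cong (_+_ 1ℤ) (ℤₚ.*-zeroʳ (+ i * M))) refl))
        blk-shift (suc L) with blk-shift L | σ-shift (N ℕ.+ L)
        ... | d , hd | t , ht = d * y + x * t , λ i → begin
          blk (N ℕ.+ i ℕ.* m) L * σ (N ℕ.+ i ℕ.* m ℕ.+ L)      ≡⟨ cong (λ z → blk (N ℕ.+ i ℕ.* m) L * σ z) (e₀ N (i ℕ.* m) L) ⟩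
          blk (N ℕ.+ i ℕ.* m) L * σ (N ℕ.+ L ℕ.+ i ℕ.* m)      ≈⟨ *-cong (hd i) (≡⇒≈ (ht i)) ⟩
          (x + + i * M * d) * (y + + i * M * t)                ≡⟨ e₁ x y (+ i) M d t ⟩
          x * y + + i * M * (d * y + x * t) + M * M * (+ i * + i * d * t) ≈⟨ +-congˡ (x * y + + i * M * (d * y + x * t)) (M*M≈0 k (+ i * + i * d * t)) ⟩
          x * y + + i * M * (d * y + x * t) + 0ℤ               ≡⟨ ℤₚ.+-identityʳ (x * y + + i * M * (d * y + x * t)) ⟩
          x * y + + i * M * (d * y + x * t)                    ∎
          where
          open ≈-Reasoning
          x = blk N L
          y = σ (N ℕ.+ L)
          e₀ : ∀ N i L → N ℕ.+ i ℕ.+ L ≡ N ℕ.+ L ℕ.+ i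
          e₀ = ℕS.solve-∀
          e₁ : ∀ x y i M d t → (x + i * M * d) * (y + i * M * t) ≡ x * y + i * M * (d * y + x * t) + M * M * (i * i * d * t)
          e₁ = solve-∀

        q d : ℤ
        q = Mod._≈_.quot (ih N)
        d = proj₁ (blk-shift m)

        block : ∀ i → blk (N ℕ.+ i ℕ.* m) m ≈ 1ℤ + q * M + + i * M * d
        block i = ≈-trans (proj₂ (blk-shift m) i) (+-congʳ (+ i * M * d) (≡⇒≈ (Mod._≈_.eq (ih N))))

        blocks : ∀ r → blk N (r ℕ.* m) ≈ 1ℤ + (+ r * q + T r * d) * M
        blocks zero    = ≡⇒≈ (e q d M)
          where
          e : ∀ q d M → 1ℤ ≡ 1ℤ + (0ℤ * q + 0ℤ * d) * M
          e = solve-∀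
        blocks (suc r) = begin
          blk N (suc r ℕ.* m)                                          ≡⟨ cong (blk N) (ℕₚ.+-comm m (r ℕ.* m)) ⟩
          blk N (r ℕ.* m ℕ.+ m)                                        ≡⟨ blk-+ N (r ℕ.* m) m ⟩
          blk N (r ℕ.* m) * blk (N ℕ.+ r ℕ.* m) m                      ≈⟨ *-cong (blocks r) (block r) ⟩
          (1ℤ + (+ r * q + T r * d) * M) * (1ℤ + q * M + + r * M * d)  ≡⟨ e (+ r) q (T r) d M ⟩
          z + M * M * w                                                ≈⟨ +-congˡ z (M*M≈0 k w) ⟩
          z + 0ℤ                                                       ≡⟨ ℤₚ.+-identityʳ z ⟩
          z                                                            ∎
          where
          open ≈-Reasoning
          z = 1ℤ + (+ suc r * q + T (suc r) * d) * M
          w = (+ r * q + T r * d) * (q + + r * d)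
          e : ∀ r q t d M → (1ℤ + (r * q + t * d) * M) * (1ℤ + q * M + r * M * d) ≡
                1ℤ + ((1ℤ + r) * q + (t + r) * d) * M + M * M * ((r * q + t * d) * (q + r * d))
          e = solve-∀

        result : blk N (p ℕ.^ suc (suc k)) ≈ 1ℤ
        result = begin
          blk N (p ℕ.* m)                          ≈⟨ blocks p ⟩
          1ℤ + (+ p * q + T p * d) * M             ≡⟨ cong (λ t → 1ℤ + (+ p * q + t * d) * M) T-p ⟩
          1ℤ + (+ p * q + + p * + b * d) * M       ≡⟨ e (+ p) q (+ b) d M ⟩
          1ℤ + + p * (q + + b * d) * M             ≈⟨ +-congˡ 1ℤ (p*M≈0 k (q + + b * d)) ⟩
          1ℤ                                       ∎
          where
          open ≈-Reasoning
          e : ∀ p q b d M → 1ℤ + (p * q + p * b * d) * M ≡ 1ℤ + p * (q + b * d) * M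
          e = solve-∀

    -- A window of length p^(k+2) consists of p windows of length M = p^(k+1). Modulo p^(k+2) the
    -- i-th of them is 1 + qM + iMd, so the product is 1 + (pq + (0 + 1 + ⋯ + (p-1)) d) M, and the
    -- inner sum is p(p-1)/2, a multiple of p since p is odd.
    blk-p^ : ∀ k N → ℤ/._≈_ (suc k) (blk N (p ℕ.^ suc k)) 1ℤ
    blk-p^ zero    N = subst (λ m → ℤ/._≈_ 1 (blk N m) 1ℤ) (sym (ℕₚ.*-identityʳ p)) (from-p (blk-p N))
    blk-p^ (suc k) N = Step.result k (blk-p^ k) N

    -- refl-prod i · Γ_p(-i) = 1
    refl-prod : ℕ → ℤ
    refl-prod zero    = 1ℤ
    refl-prod (suc i) = refl-prod i * s (suc i)

    module Level (k : ℕ) where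
      open ℤ/ (suc k) public

      -- `Q` is a natural number representing -1, so `i * Q` serves as the argument -i of `gam`.
      P Q : ℕ
      P = p ℕ.^ suc k
      Q = P ∸ 1

      private instance
        P≢0 : ℕ.NonZero P
        P≢0 = ℕ.>-nonZero (ℕₚ.m^n>0 p (suc k))

      P≡1+Q : P ≡ suc Q
      P≡1+Q = sym (ℕₚ.suc-pred P)

      gam-period : ∀ N q → gam (N ℕ.+ q ℕ.* P) ≈ gam N
      gam-period N zero    = ≡⇒≈ (cong gam (ℕₚ.+-identityʳ N))
      gam-period N (suc q) = begin
        gam (N ℕ.+ (P ℕ.+ q ℕ.* P))                      ≡⟨ cong gam (e N P (q ℕ.* P)) ⟩
        gam (N ℕ.+ q ℕ.* P ℕ.+ P)                        ≡⟨ blk-+ 0 (N ℕ.+ q ℕ.* P) P ⟩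
        gam (N ℕ.+ q ℕ.* P) * blk (N ℕ.+ q ℕ.* P) P      ≈⟨ *-cong (gam-period N q) (blk-p^ k (N ℕ.+ q ℕ.* P)) ⟩
        gam N * 1ℤ                                       ≡⟨ ℤₚ.*-identityʳ (gam N) ⟩
        gam N                                            ∎
        where
        open ≈-Reasoning
        e : ∀ N P q → N ℕ.+ (P ℕ.+ q) ≡ N ℕ.+ q ℕ.+ P
        e = ℕS.solve-∀

      -- Continuity of Γ_p: any natural number congruent to x modulo p^(k+1) may stand for x ∈ ℤ_p.
      gam-cong : ∀ {N N'} → + N ≈ + N' → gam N ≈ gam N'
      gam-cong {N} {N'} (Mod.mk (+ q) e) = subst (λ x → gam x ≈ gam N') (sym N≡) (gam-period N' q)
        where
        N≡ : N ≡ N' ℕ.+ q ℕ.* P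
        N≡ = ℤₚ.+-injective (trans e (trans (cong (_+_ (+ N')) (sym (ℤₚ.pos-* q P))) (sym (ℤₚ.pos-+ N' (q ℕ.* P)))))
      gam-cong {N} {N'} (Mod.mk -[1+ q ] e) = ≈-sym (subst (λ x → gam x ≈ gam N) (sym N'≡) (gam-period N (suc q)))
        where
        e' : ∀ n' q P → n' ≡ n' + - q * P + q * P
        e' = solve-∀
        N'≡ : N' ≡ N ℕ.+ suc q ℕ.* P
        N'≡ = ℤₚ.+-injective (trans (e' (+ N') (+ suc q) (+ P)) (trans (cong (_+ (+ suc q * + P)) (sym e))
                (trans (cong (_+_ (+ N)) (sym (ℤₚ.pos-* (suc q) P))) (sym (ℤₚ.pos-+ N (suc q ℕ.* P))))))

      gam-unit : ∀ N → Unit (gam N)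
      gam-unit zero    = Mod.unit 1ℤ (≈-refl {1ℤ})
      gam-unit (suc N) = Unit-* (gam-unit N) (σ-unit k N)

      Q≈-1 : + Q ≈ -1ℤ
      Q≈-1 = mk 1ℤ (trans (e (+ Q)) (cong (λ z → -1ℤ + 1ℤ * z) (trans (sym (ℤₚ.pos-+ 1 Q)) (cong +_ (sym P≡1+Q)))))
        where
        e : ∀ x → x ≡ -1ℤ + 1ℤ * (1ℤ + x)
        e = solve-∀

      i*Q≈-i : ∀ i → + (i ℕ.* Q) ≈ - (+ i)
      i*Q≈-i i = ≈-trans (≡⇒≈ (ℤₚ.pos-* i Q)) (≈-trans (*-congˡ (+ i) Q≈-1) (≡⇒≈ (e (+ i))))
        where
        e : ∀ i → i * -1ℤ ≡ - i
        e = solve-∀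

      p∤Q : p ∤ Q
      p∤Q d = 1≉0 (𝔽.≈-trans (𝔽.neg-cong (𝔽.≈-sym (to-p k Q≈-1))) (𝔽.neg-cong (∣⇒≈0 {+ Q} d)))

      reflection : ∀ i → gam (i ℕ.* Q) * refl-prod i ≈ 1ℤ
      reflection zero    = ≈-refl {1ℤ}
      reflection (suc i) = begin
        gam (suc i ℕ.* Q) * (refl-prod i * s (suc i))        ≡⟨ e₁ (gam (suc i ℕ.* Q)) (refl-prod i) (s (suc i)) ⟩
        gam (suc i ℕ.* Q) * s (suc i) * refl-prod i          ≈⟨ *-congʳ (refl-prod i) (*-congˡ (gam (suc i ℕ.* Q)) (≈-sym step)) ⟩
        gam (suc (suc i ℕ.* Q)) * refl-prod i                ≈⟨ *-congʳ (refl-prod i) (gam-cong {suc (suc i ℕ.* Q)} {i ℕ.* Q} wrap) ⟩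
        gam (i ℕ.* Q) * refl-prod i                          ≈⟨ reflection i ⟩
        1ℤ                                                   ∎
        where
        open ≈-Reasoning
        e₁ : ∀ x y z → x * (y * z) ≡ x * z * y
        e₁ = solve-∀
        wrap : + suc (suc i ℕ.* Q) ≈ + (i ℕ.* Q)
        wrap = mk 1ℤ (trans (cong +_ (trans (cong (ℕ._+ i ℕ.* Q) (sym P≡1+Q)) (ℕₚ.+-comm P (i ℕ.* Q)))) (trans (ℤₚ.pos-+ (i ℕ.* Q) P) (cong (_+_ (+ (i ℕ.* Q))) (sym (ℤₚ.*-identityˡ (+ P))))))
        step : σ (suc i ℕ.* Q) ≈ s (suc i)
        step with p ∣? suc i
        ... | yes d = ≡⇒≈ (σ-∣ (ℕ∣.∣m⇒∣m*n Q d))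
        ... | no nd = ≈-trans (≡⇒≈ (σ-∤ λ d → [ nd , p∤Q ]′ (euclidsLemma (suc i) Q pr d))) (≈-trans (neg-cong (i*Q≈-i (suc i))) (≡⇒≈ (ℤₚ.neg-involutive (+ suc i))))

    -- The repunit 1 + p + ⋯ + p^(k-1) = (p^k - 1)/(p - 1), a representative of -1/(p-1) modulo p^k.
    rep : ℕ → ℕ
    rep zero    = 0
    rep (suc k) = 1 ℕ.+ rep k ℕ.* p

    rep*n : ∀ k → suc (rep k ℕ.* n) ≡ p ℕ.^ k
    rep*n zero    = refl
    rep*n (suc k) = trans (e (rep k) n p) (trans (cong (λ q → suc n ℕ.+ rep k ℕ.* n ℕ.* q) p≡1+n)
         (trans (e' (rep k) n) (cong₂ ℕ._*_ (sym p≡1+n) (rep*n k))))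
      where
      e : ∀ r n p → suc ((1 ℕ.+ r ℕ.* p) ℕ.* n) ≡ suc n ℕ.+ r ℕ.* n ℕ.* p
      e = ℕS.solve-∀
      e' : ∀ r n → suc n ℕ.+ r ℕ.* n ℕ.* suc n ≡ suc n ℕ.* suc (r ℕ.* n)
      e' = ℕS.solve-∀

    units≤ : ℕ → ℕ
    units≤ zero    = 0
    units≤ (suc i) = if does (p ∣? suc i) then units≤ i else suc (units≤ i)

    private
      units-∣ : ∀ i → p ∣ suc i → units≤ (suc i) ≡ units≤ i
      units-∣ i d with p ∣? suc i
      ... | yes _ = refl
      ... | no nd = ⊥-elim (nd d)
      units-∤ : ∀ i → p ∤ suc i → units≤ (suc i) ≡ suc (units≤ i)
      units-∤ i nd with p ∣? suc i
      ... | yes d = ⊥-elim (nd d)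
      ... | no _ = refl

    units-split : ∀ m r → r < p → units≤ (m ℕ.* p ℕ.+ r) ≡ m ℕ.* n ℕ.+ r
    units-split zero    zero h = refl
    units-split (suc m) zero h = begin
      units≤ (suc m ℕ.* p ℕ.+ 0)      ≡⟨ cong units≤ e₁ ⟩
      units≤ (suc (m ℕ.* p ℕ.+ n))    ≡⟨ units-∣ _ (subst (p ∣_) e₁ (divides (suc m) (ℕₚ.+-identityʳ _))) ⟩
      units≤ (m ℕ.* p ℕ.+ n)          ≡⟨ units-split m n (subst (n <_) (sym p≡1+n) (ℕₚ.n<1+n n)) ⟩
      m ℕ.* n ℕ.+ n                   ≡⟨ e₂ m n ⟩
      suc m ℕ.* n ℕ.+ 0               ∎
      where
      open ≡-Reasoning
      e₂ : ∀ m n → m ℕ.* n ℕ.+ n ≡ suc m ℕ.* n ℕ.+ 0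
      e₂ = ℕS.solve-∀
      e₀ : ∀ m p n → suc n ℕ.+ m ℕ.* p ℕ.+ 0 ≡ suc (m ℕ.* p ℕ.+ n)
      e₀ = ℕS.solve-∀
      e₁ : suc m ℕ.* p ℕ.+ 0 ≡ suc (m ℕ.* p ℕ.+ n)
      e₁ = trans (cong (λ q → q ℕ.+ m ℕ.* p ℕ.+ 0) p≡1+n) (e₀ m p n)
    units-split m (suc r) h = trans (cong units≤ (ℕₚ.+-suc (m ℕ.* p) r))
      (trans (units-∤ _ (λ d → 0<u<p⇒∤ (s≤s z≤n) h (ℕ∣.∣m+n∣m⇒∣n (subst (p ∣_) (sym (ℕₚ.+-suc (m ℕ.* p) r)) d) (ℕ∣.n∣m*n m))))
        (trans (cong suc (units-split m r (ℕₚ.<-trans (ℕₚ.n<1+n r) h))) (sym (ℕₚ.+-suc (m ℕ.* n) r))))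

    -- Since c · rep(k+1) = (c · rep k) p + c, there are c · rep k · (p-1) + c = c p^k integers
    -- prime to p up to it. With this count as exponent, powers of 3 become powers of ω(3) =
    -- 3^(p^k).
    units-rep : ∀ k c → c < p → units≤ (c ℕ.* rep (suc k)) ≡ p ℕ.^ k ℕ.* c
    units-rep k c h = trans (cong units≤ (e₁ c (rep k) p)) (trans (units-split (c ℕ.* rep k) c h)
       (trans (e₂ c (rep k) n) (cong (ℕ._* c) (rep*n k))))
      where
      e₁ : ∀ c r p → c ℕ.* (1 ℕ.+ r ℕ.* p) ≡ c ℕ.* r ℕ.* p ℕ.+ c
      e₁ = ℕS.solve-∀
      e₂ : ∀ c r n → c ℕ.* r ℕ.* n ℕ.+ c ≡ suc (r ℕ.* n) ℕ.* c
      e₂ = ℕS.solve-∀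

-- The Gauss multiplication formula for Γ_p with three factors

module GaussMultiplication where
  open import Data.Nat as ℕ using (ℕ; zero; suc; _<_; z≤n; s≤s; _∸_)
  import Data.Nat.Properties as ℕₚ
  open import Data.Nat.Divisibility as ℕ∣ using (_∣?_; _∣_; _∤_)
  open import Data.Nat.Primality using (Prime; euclidsLemma)
  open import Data.Integer as ℤ using (ℤ; +_; _+_; _*_; -_; _-_; _^_; 0ℤ; 1ℤ; -1ℤ; ∣_∣)
  import Data.Integer.Properties as ℤₚ
  open import Data.Integer.Tactic.RingSolver using (solve-∀)
  open import Data.Product using (_,_)
  open import Data.Sum using ([_,_]′)
  open import Relation.Nullary using (yes; no)
  open import Relation.Binary.PropositionalEquality as ≡ using (_≡_; cong; sym; trans; module ≡-Reasoning)
  open ModularArithmetic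
  open MoritaGamma

  module Multiplication (p : ℕ) (pr : Prime p) (b : ℕ) (p≡1+2b : p ≡ suc (b ℕ.+ b)) (3<p : 3 < p) (k : ℕ) where
    open GammaP p pr b p≡1+2b
    open Level k

    private
      p∤3 : p ∤ 3
      p∤3 = 0<u<p⇒∤ (s≤s z≤n) 3<p

    θ : ℕ
    θ = 3 ℕ.^ (p ℕ.^ k ℕ.* (p ∸ 1) ∸ 1)

    3θ≈1 : + 3 * + θ ≈ 1ℤ
    3θ≈1 = ≈-trans (≡⇒≈ (cong (+ 3 *_) (pos-^ 3 (p ℕ.^ k ℕ.* (p ∸ 1) ∸ 1)))) (euler-inv k p∤3)

    -- X i j represents (j - i)/3
    X : ℕ → ℕ → ℕ
    X i j = θ ℕ.* (j ℕ.+ i ℕ.* Q)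

    X≈ : ∀ i j → + X i j ≈ + θ * (+ j - + i)
    X≈ i j = ≈-trans (≡⇒≈ (trans (ℤₚ.pos-* θ (j ℕ.+ i ℕ.* Q)) (cong (+ θ *_) (ℤₚ.pos-+ j (i ℕ.* Q)))))
       (*-congˡ (+ θ) (+-congˡ (+ j) (i*Q≈-i i)))

    -- The product Γ_p(x/3) Γ_p((x+1)/3) Γ_p((x+2)/3) at x = -i.
    Mul : ℕ → ℤ
    Mul i = gam (X i 0) * gam (X i 1) * gam (X i 2)

    private
      p∤θ : p ∤ θ
      p∤θ d = 1≉0 (𝔽.≈-trans (𝔽.≈-sym (to-p k 3θ≈1)) (𝔽.≈-trans (𝔽.*-congˡ (+ 3) (∣⇒≈0 {+ θ} d)) (𝔽.≡⇒≈ (ℤₚ.*-zeroʳ (+ 3)))))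

      X-suc : ∀ i j → gam (X (suc i) (suc j)) ≈ gam (X i j)
      X-suc i j = gam-cong {X (suc i) (suc j)} {X i j} (≈-trans (X≈ (suc i) (suc j)) (≈-trans (≡⇒≈ (e (+ θ) (+ j) (+ i))) (≈-sym (X≈ i j))))
        where
        e : ∀ θ j i → θ * ((1ℤ + j) - (1ℤ + i)) ≡ θ * (j - i)
        e = solve-∀

      X-wrap : ∀ i → gam (X i 2) ≈ gam (suc (X (suc i) 0))
      X-wrap i = gam-cong {X i 2} {suc (X (suc i) 0)} (begin
        + X i 2                              ≈⟨ X≈ i 2 ⟩
        + θ * (+ 2 - + i)                    ≡⟨ e (+ θ) (+ i) ⟩
        + 3 * + θ + + θ * (0ℤ - (1ℤ + + i))  ≈⟨ +-cong 3θ≈1 (≈-sym (X≈ (suc i) 0)) ⟩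
        1ℤ + + X (suc i) 0                   ∎)
        where
        open ≈-Reasoning
        e : ∀ θ i → θ * (+ 2 - i) ≡ + 3 * θ + θ * (0ℤ - (1ℤ + i))
        e = solve-∀

      Mul-step : ∀ i → Mul i ≈ Mul (suc i) * σ (X (suc i) 0)
      Mul-step i = begin
        gam (X i 0) * gam (X i 1) * gam (X i 2)            ≈⟨ *-cong (*-cong (≈-sym (X-suc i 0)) (≈-sym (X-suc i 1))) (X-wrap i) ⟩
        u * v * (w * σ (X (suc i) 0))                      ≡⟨ e u v w (σ (X (suc i) 0)) ⟩
        w * u * v * σ (X (suc i) 0)                        ∎
        where
        open ≈-Reasoning
        u = gam (X (suc i) 1)
        v = gam (X (suc i) 2)
        w = gam (X (suc i) 0)
        e : ∀ u v w s → u * v * (w * s) ≡ w * u * v * s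
        e = solve-∀

      p∣X : ∀ i → p ∣ i → p ∣ X i 0
      p∣X i d = ℕ∣.∣n⇒∣m*n θ (ℕ∣.∣m⇒∣m*n Q d)

      p∤X : ∀ i → p ∤ i → p ∤ X i 0
      p∤X i nd d = [ p∤θ , (λ d' → [ nd , p∤Q ]′ (euclidsLemma i Q pr d')) ]′ (euclidsLemma θ (i ℕ.* Q) pr d)

    -- Passing from x = -i to x = -(i+1) permutes the three arguments except that one of them drops
    -- by 1, which costs a single factor `σ`. If p does not divide i + 1, this factor is (i+1)/3
    -- where `refl-prod` collects i + 1, so a 3 is left over; otherwise both are -1. The constant
    -- `Mul 0` is never evaluated, being a unit is enough.
    multiplication : ∀ i → Mul i * refl-prod i ≈ Mul 0 * (+ 3) ^ units≤ i
    multiplication zero    = ≈-refl {Mul 0 * 1ℤ}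
    multiplication (suc i) with p ∣? suc i
    ... | yes d = begin
      Mul (suc i) * (refl-prod i * -1ℤ)              ≡⟨ e (Mul (suc i)) (refl-prod i) -1ℤ ⟩
      Mul (suc i) * -1ℤ * refl-prod i                ≡⟨ cong (λ z → Mul (suc i) * z * refl-prod i) (σ-∣ (p∣X (suc i) d)) ⟨
      Mul (suc i) * σ (X (suc i) 0) * refl-prod i    ≈⟨ *-congʳ (refl-prod i) (Mul-step i) ⟨
      Mul i * refl-prod i                            ≈⟨ multiplication i ⟩
      Mul 0 * (+ 3) ^ units≤ i                       ∎
      where
      open ≈-Reasoning
      e : ∀ x y z → x * (y * z) ≡ x * z * y
      e = solve-∀
    ... | no nd = begin
      Mul (suc i) * (refl-prod i * + suc i)                ≡⟨ e₁ (Mul (suc i)) (refl-prod i) (+ suc i) ⟩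
      1ℤ * (Mul (suc i) * + suc i * refl-prod i)           ≈⟨ *-congʳ (Mul (suc i) * + suc i * refl-prod i) (≈-sym 3θ≈1) ⟩
      + 3 * + θ * (Mul (suc i) * + suc i * refl-prod i)    ≡⟨ e₂ (+ 3) (+ θ) (Mul (suc i)) (+ suc i) (refl-prod i) ⟩
      + 3 * (Mul (suc i) * - (+ θ * (0ℤ - + suc i)) * refl-prod i)
        ≈⟨ *-congˡ (+ 3) (*-congʳ (refl-prod i) (*-congˡ (Mul (suc i)) (neg-cong (X≈ (suc i) 0)))) ⟨
      + 3 * (Mul (suc i) * - (+ X (suc i) 0) * refl-prod i) ≡⟨ cong (λ z → + 3 * (Mul (suc i) * z * refl-prod i)) (σ-∤ (p∤X (suc i) nd)) ⟨
      + 3 * (Mul (suc i) * σ (X (suc i) 0) * refl-prod i)  ≈⟨ *-congˡ (+ 3) (*-congʳ (refl-prod i) (Mul-step i)) ⟨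
      + 3 * (Mul i * refl-prod i)                          ≈⟨ *-congˡ (+ 3) (multiplication i) ⟩
      + 3 * (Mul 0 * (+ 3) ^ units≤ i)                     ≡⟨ e₃ (+ 3) (Mul 0) ((+ 3) ^ units≤ i) ⟩
      Mul 0 * (+ 3 * (+ 3) ^ units≤ i)                     ∎
      where
      open ≈-Reasoning
      e₁ : ∀ x y z → x * (y * z) ≡ 1ℤ * (x * z * y)
      e₁ = solve-∀
      e₂ : ∀ h t m s r → h * t * (m * s * r) ≡ h * (m * - (t * (0ℤ - s)) * r)
      e₂ = solve-∀
      e₃ : ∀ x y z → x * (y * z) ≡ y * (x * z)
      e₃ = solve-∀

    -- Γ₁ c = Γ_p(c/(p-1))
    Γ₁ : ℕ → ℤ
    Γ₁ c = gam (c ℕ.* rep (suc k) ℕ.* Q)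

    Γ₁-refl : ∀ c → Γ₁ c * refl-prod (c ℕ.* rep (suc k)) ≈ 1ℤ
    Γ₁-refl c = reflection (c ℕ.* rep (suc k))

    -- The Teichmüller representative ω(3) modulo p^(k+1).
    ω₃ : ℤ
    ω₃ = (+ 3) ^ (p ℕ.^ k)

    multiplication₁ : ∀ c → c < p → Mul (c ℕ.* rep (suc k)) ≈ Mul 0 * ω₃ ^ c * Γ₁ c
    multiplication₁ c h = begin
      Mul i                                    ≡⟨ ℤₚ.*-identityʳ (Mul i) ⟨
      Mul i * 1ℤ                               ≈⟨ *-congˡ (Mul i) (Γ₁-refl c) ⟨
      Mul i * (Γ₁ c * refl-prod i)             ≡⟨ e (Mul i) (Γ₁ c) (refl-prod i) ⟩
      Mul i * refl-prod i * Γ₁ c               ≈⟨ *-congʳ (Γ₁ c) (multiplication i) ⟩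
      Mul 0 * (+ 3) ^ units≤ i * Γ₁ c          ≡⟨ cong (λ z → Mul 0 * z * Γ₁ c) (trans (cong ((+ 3) ^_) (units-rep k c h)) (sym (ℤₚ.^-*-assoc (+ 3) (p ℕ.^ k) c))) ⟩
      Mul 0 * ω₃ ^ c * Γ₁ c                    ∎
      where
      open ≈-Reasoning
      i = c ℕ.* rep (suc k)
      e : ∀ x y z → x * (y * z) ≡ x * z * y
      e = solve-∀

    ω₃^n≈1 : ω₃ ^ (p ∸ 1) ≈ 1ℤ
    ω₃^n≈1 = ≈-trans (≡⇒≈ (ℤₚ.^-*-assoc (+ 3) (p ℕ.^ k) (p ∸ 1))) (euler k p∤3)

    ω₃-unit : Unit ω₃
    ω₃-unit = Unit-^ (p ℕ.^ k) (ℕ-unit k p∤3)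

    Mul-unit : ∀ i → Unit (Mul i)
    Mul-unit i = Unit-* (Unit-* (gam-unit (X i 0)) (gam-unit (X i 1))) (gam-unit (X i 2))

    -- c * rep * (p-1) = c (p^(k+1) - 1), so X (c * rep) j represents (c + j(p-1)) / (3(p-1)).
    X-spec : ∀ c j → + X (c ℕ.* rep (suc k)) j * (+ 3 * + (p ∸ 1)) ≈ + (c ℕ.+ j ℕ.* (p ∸ 1))
    X-spec c j = begin
      + X i j * (+ 3 * + n)                ≈⟨ *-congʳ (+ 3 * + n) (X≈ i j) ⟩
      + θ * (+ j - + i) * (+ 3 * + n)      ≡⟨ e₁ (+ θ) (+ j) (+ i) (+ n) ⟩
      + 3 * + θ * (+ j * + n - + i * + n)  ≈⟨ *-cong 3θ≈1 (+-congˡ (+ j * + n) (neg-cong in≈)) ⟩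
      1ℤ * (+ j * + n - - (+ c))           ≡⟨ e₂ (+ j * + n) (+ c) ⟩
      + c + + j * + n                      ≡⟨ trans (cong (_+_ (+ c)) (sym (ℤₚ.pos-* j n))) (sym (ℤₚ.pos-+ c (j ℕ.* n))) ⟩
      + (c ℕ.+ j ℕ.* n)                    ∎
      where
      open ≈-Reasoning
      n = p ∸ 1
      i = c ℕ.* rep (suc k)
      e₁ : ∀ θ j i n → θ * (j - i) * (+ 3 * n) ≡ + 3 * θ * (j * n - i * n)
      e₁ = solve-∀
      e₂ : ∀ x c → 1ℤ * (x - - c) ≡ c + x
      e₂ = solve-∀
      in≈ : + i * + n ≈ - (+ c)
      in≈ = ≈-trans (≡⇒≈ (trans (sym (ℤₚ.pos-* i n)) (cong +_ (trans (ℕₚ.*-assoc c (rep (suc k)) n) (cong (λ z → c ℕ.* (z ∸ 1)) (rep*n (suc k))))))) (i*Q≈-i c)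

-- An axiomatic ℚ and divisibility by powers of p in the localisation at p

module RationalValuation where
  open import Algebra.Bundles using (CommutativeRing)
  open import Algebra.Structures using (IsCommutativeRing)
  import Algebra.Solver.Ring as RingSolver
  import Algebra.Solver.Ring.AlmostCommutativeRing as ACR
  open import Level using (0ℓ)
  open import Data.Nat as ℕ using (ℕ; zero; suc; _<_; _≤_; z≤n; s≤s; _∸_)
  import Data.Nat.Properties as ℕₚ
  open import Data.Nat.Divisibility using (_∤_)
  open import Data.Nat.Primality using (Prime; euclidsLemma; prime⇒nonZero)
  open import Data.Integer as ℤ using (ℤ; +_; 0ℤ; 1ℤ; -1ℤ)
  import Data.Integer.Properties as ℤₚ
  open import Data.Maybe using (Maybe; just; nothing)
  open import Data.Product using (_,_)
  open import Data.Sum using ([_,_]′)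
  open import Relation.Nullary using (yes; no)
  open import Relation.Binary.PropositionalEquality as ≡ using (_≡_; refl; cong; cong₂; subst; sym; trans; module ≡-Reasoning)
  open FiniteSums
  open ModularArithmetic
  open MoritaGamma

  -- What the series argument uses of ℚ. With the field as a parameter the coefficients stay formal
  -- and no fraction is ever normalised. The inverse is indexed so that `inv n` belongs to n + 1.
  record RationalField : Set₁ where
    infixl 7 _*_
    infixl 6 _+_
    infix  8 -_
    field
      A                 : Set
      _+_ _*_           : A → A → A
      -_                : A → A
      ι                 : ℤ → A
      isCommutativeRing : IsCommutativeRing _≡_ _+_ _*_ -_ (ι 0ℤ) (ι 1ℤ)
      ι-+               : ∀ x y → ι (x ℤ.+ y) ≡ ι x + ι y
      ι-*               : ∀ x y → ι (x ℤ.* y) ≡ ι x * ι y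
      ι-neg             : ∀ x → ι (ℤ.- x) ≡ - ι x
      ι-injective       : ∀ {x y} → ι x ≡ ι y → x ≡ y
      inv               : ℕ → A
      inv-law           : ∀ n → ι (+ suc n) * inv n ≡ ι 1ℤ

  module FieldLaws (F : RationalField) where
    open RationalField F public using (A; _+_; _*_; -_; ι; ι-+; ι-*; ι-neg; ι-injective; inv; inv-law)

    ring : CommutativeRing 0ℓ 0ℓ
    ring = record { isCommutativeRing = RationalField.isCommutativeRing F }
    open CommutativeRing ring public
      using (+-assoc; +-comm; +-identityˡ; +-identityʳ; *-assoc; *-comm; *-identityˡ; *-identityʳ; zeroˡ; zeroʳ; distribˡ; distribʳ; -‿inverseʳ; _-_)
    open SumLaws ring public

    private
      morphism : ℤ.+-*-rawRing ACR.-Raw-AlmostCommutative⟶ ACR.fromCommutativeRing ring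
      morphism = record { ⟦_⟧ = ι ; +-homo = ι-+ ; *-homo = ι-* ; -‿homo = ι-neg ; 0-homo = refl ; 1-homo = refl }
      _≟ι_ : ∀ x y → Maybe (ι x ≡ ι y)
      x ≟ι y with x ℤₚ.≟ y
      ... | yes refl = just refl
      ... | no _     = nothing
    open RingSolver ℤ.+-*-rawRing (ACR.fromCommutativeRing ring) morphism _≟ι_ public
      using (solve; _:=_; _:+_; _:*_; :-_; _:-_; con)

    0# 1# : A
    0# = ι 0ℤ
    1# = ι 1ℤ

    ι-ℕ* : ∀ m n → ι (+ (m ℕ.* n)) ≡ ι (+ m) * ι (+ n)
    ι-ℕ* m n = trans (cong ι (ℤₚ.pos-* m n)) (ι-* (+ m) (+ n))

    ι-ℕ+ : ∀ m n → ι (+ (m ℕ.+ n)) ≡ ι (+ m) + ι (+ n)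
    ι-ℕ+ m n = trans (cong ι (ℤₚ.pos-+ m n)) (ι-+ (+ m) (+ n))

    cancel-suc : ∀ n {x y} → ι (+ suc n) * x ≡ ι (+ suc n) * y → x ≡ y
    cancel-suc n {x} {y} h = begin
      x                              ≡⟨ *-identityˡ x ⟨
      1# * x                         ≡⟨ cong (_* x) (inv-law n) ⟨
      ι (+ suc n) * inv n * x        ≡⟨ solve 3 (λ a b c → a :* b :* c := b :* (a :* c)) refl (ι (+ suc n)) (inv n) x ⟩
      inv n * (ι (+ suc n) * x)      ≡⟨ cong (inv n *_) h ⟩
      inv n * (ι (+ suc n) * y)      ≡⟨ solve 3 (λ a b c → a :* b :* c := b :* (a :* c)) refl (ι (+ suc n)) (inv n) y ⟨
      ι (+ suc n) * inv n * y        ≡⟨ cong (_* y) (inv-law n) ⟩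
      1# * y                         ≡⟨ *-identityˡ y ⟩
      y                              ∎
      where open ≡-Reasoning

    cancel-pos : ∀ n .⦃ _ : ℕ.NonZero n ⦄ {x y} → ι (+ n) * x ≡ ι (+ n) * y → x ≡ y
    cancel-pos (suc n) = cancel-suc n

  module PAdic (F : RationalField) (p : ℕ) (pr : Prime p) (b : ℕ) (p≡1+2b : p ≡ suc (b ℕ.+ b)) where
    open FieldLaws F
    open GammaP p pr b p≡1+2b using (1<p; ℕ-unit; 0<u<p⇒∤; module ℤ/)

    private instance
      p≢0 = prime⇒nonZero pr

    p^ : ℕ → A
    p^ k = ι (+ (p ℕ.^ k))

    p^-+ : ∀ j k → p^ (j ℕ.+ k) ≡ p^ j * p^ k
    p^-+ j k = trans (cong (λ z → ι (+ z)) (ℕₚ.^-distribˡ-+-* p j k)) (ι-ℕ* (p ℕ.^ j) (p ℕ.^ k))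

    p^-suc : ∀ k → p^ (suc k) ≡ ι (+ p) * p^ k
    p^-suc k = ι-ℕ* p (p ℕ.^ k)

    -- O k x : x lies in p^k ℤ_(p)
    record O (k : ℕ) (x : A) : Set where
      constructor mkO
      field
        den  : ℕ
        p∤d  : p ∤ den
        num  : ℤ
        eq   : ι (+ den) * x ≡ p^ k * ι num

    p∤1 : p ∤ 1
    p∤1 = 0<u<p⇒∤ (s≤s z≤n) 1<p

    p∤* : ∀ {d e} → p ∤ d → p ∤ e → p ∤ d ℕ.* e
    p∤* {d} {e} nd ne h = [ nd , ne ]′ (euclidsLemma d e pr h)

    O-ι : ∀ z → O 0 (ι z)
    O-ι z = mkO 1 p∤1 z refl

    O-0 : ∀ k → O k 0#
    O-0 k = mkO 1 p∤1 0ℤ (trans (zeroʳ 1#) (sym (zeroʳ (p^ k))))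

    O-+ : ∀ {k x y} → O k x → O k y → O k (x + y)
    O-+ {k} {x} {y} (mkO d nd z e) (mkO d' nd' z' e') = mkO (d ℕ.* d') (p∤* nd nd') (+ d' ℤ.* z ℤ.+ + d ℤ.* z') (begin
      ι (+ (d ℕ.* d')) * (x + y)                    ≡⟨ cong (_* (x + y)) (ι-ℕ* d d') ⟩
      D * D' * (x + y)                              ≡⟨ solve 4 (λ D D' x y → D :* D' :* (x :+ y) := D' :* (D :* x) :+ D :* (D' :* y)) refl D D' x y ⟩
      D' * (D * x) + D * (D' * y)                   ≡⟨ cong₂ (λ u v → D' * u + D * v) e e' ⟩
      D' * (P * Z) + D * (P * Z')                   ≡⟨ solve 5 (λ D D' P Z Z' → D' :* (P :* Z) :+ D :* (P :* Z') := P :* (D' :* Z :+ D :* Z')) refl D D' P Z Z' ⟩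
      P * (D' * Z + D * Z')                         ≡⟨ cong (P *_) (trans (ι-+ (+ d' ℤ.* z) (+ d ℤ.* z')) (cong₂ _+_ (ι-* (+ d') z) (ι-* (+ d) z'))) ⟨
      P * ι (+ d' ℤ.* z ℤ.+ + d ℤ.* z')             ∎)
      where
      open ≡-Reasoning
      D = ι (+ d)
      D' = ι (+ d')
      Z = ι z
      Z' = ι z'
      P = p^ k

    O-* : ∀ {j k x y} → O j x → O k y → O (j ℕ.+ k) (x * y)
    O-* {j} {k} {x} {y} (mkO d nd z e) (mkO d' nd' z' e') = mkO (d ℕ.* d') (p∤* nd nd') (z ℤ.* z') (begin
      ι (+ (d ℕ.* d')) * (x * y)       ≡⟨ cong (_* (x * y)) (ι-ℕ* d d') ⟩
      D * D' * (x * y)                 ≡⟨ solve 4 (λ D D' x y → D :* D' :* (x :* y) := D :* x :* (D' :* y)) refl D D' x y ⟩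
      (D * x) * (D' * y)               ≡⟨ cong₂ _*_ e e' ⟩
      (p^ j * Z) * (p^ k * Z')         ≡⟨ solve 4 (λ D D' x y → D :* x :* (D' :* y) := D :* D' :* (x :* y)) refl (p^ j) (p^ k) Z Z' ⟩
      (p^ j * p^ k) * (Z * Z')         ≡⟨ cong₂ _*_ (p^-+ j k) (ι-* z z') ⟨
      p^ (j ℕ.+ k) * ι (z ℤ.* z')      ∎)
      where
      open ≡-Reasoning
      D = ι (+ d)
      D' = ι (+ d')
      Z = ι z
      Z' = ι z'

    O-ι* : ∀ {k x} z → O k x → O k (ι z * x)
    O-ι* z h = O-* (O-ι z) h

    O-neg : ∀ {k x} → O k x → O k (- x)
    O-neg {k} {x} h = subst (O k) (trans (cong (_* x) (ι-neg 1ℤ)) (solve 1 (λ x → (:- con 1ℤ) :* x := :- x) refl x)) (O-ι* -1ℤ h)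

    O-- : ∀ {k x y} → O k x → O k y → O k (x - y)
    O-- h h' = O-+ h (O-neg h')

    O-p^ : ∀ j → O j (p^ j)
    O-p^ j = mkO 1 p∤1 1ℤ (*-comm 1# (p^ j))

    O-weaken : ∀ {j k x} → j ≤ k → O k x → O j x
    O-weaken {j} {k} {x} j≤k (mkO d nd z e) = mkO d nd (+ (p ℕ.^ (k ∸ j)) ℤ.* z) (trans e (begin
      p^ k * ι z                        ≡⟨ cong (λ l → p^ l * ι z) (ℕₚ.m+[n∸m]≡n j≤k) ⟨
      p^ (j ℕ.+ (k ∸ j)) * ι z          ≡⟨ cong (_* ι z) (p^-+ j (k ∸ j)) ⟩
      p^ j * p^ (k ∸ j) * ι z           ≡⟨ *-assoc (p^ j) (p^ (k ∸ j)) (ι z) ⟩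
      p^ j * (p^ (k ∸ j) * ι z)         ≡⟨ cong (p^ j *_) (ι-* (+ (p ℕ.^ (k ∸ j))) z) ⟨
      p^ j * ι (+ (p ℕ.^ (k ∸ j)) ℤ.* z) ∎))
      where open ≡-Reasoning

    O-unp : ∀ j {k x} → O (j ℕ.+ k) (p^ j * x) → O k x
    O-unp j {k} {x} (mkO d nd z e) = mkO d nd z (cancel-pos (p ℕ.^ j) ⦃ ℕ.>-nonZero (ℕₚ.m^n>0 p j) ⦄ (begin
      p^ j * (ι (+ d) * x)   ≡⟨ solve 3 (λ a b c → a :* (b :* c) := b :* (a :* c)) refl (p^ j) (ι (+ d)) x ⟩
      ι (+ d) * (p^ j * x)   ≡⟨ e ⟩
      p^ (j ℕ.+ k) * ι z     ≡⟨ cong (_* ι z) (p^-+ j k) ⟩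
      p^ j * p^ k * ι z      ≡⟨ *-assoc (p^ j) (p^ k) (ι z) ⟩
      p^ j * (p^ k * ι z)    ∎))
      where open ≡-Reasoning

    O-unp₁ : ∀ {k x} → O (suc k) (ι (+ p) * x) → O k x
    O-unp₁ {k} {x} h = O-unp 1 (subst (λ q → O (suc k) (ι (+ q) * x)) (sym (ℕₚ.*-identityʳ p)) h)

    O-unit : ∀ u {k x} → p ∤ u → O k (ι (+ u) * x) → O k x
    O-unit u {k} {x} nu (mkO d nd z e) = mkO (d ℕ.* u) (p∤* nd nu) z (trans (cong (_* x) (ι-ℕ* d u)) (trans (*-assoc (ι (+ d)) (ι (+ u)) x) e))

    O-sum : ∀ {k} n {f} → (∀ i → i < n → O k (f i)) → O k (sum n f)
    O-sum {k} zero    h = O-0 k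
    O-sum     (suc n) h = O-+ (O-sum n (λ i i<n → h i (ℕₚ.m<n⇒m<1+n i<n))) (h n (ℕₚ.n<1+n n))

    -- The way back from ℚ to congruences: the denominator is a unit modulo p^k and can be
    -- cancelled.
    O⇒≈0 : ∀ k {z} → O k (ι z) → ℤ/._≈_ k z 0ℤ
    O⇒≈0 zero    {z} h = Mod.mk z (trans (sym (ℤₚ.*-identityʳ z)) (sym (ℤₚ.+-identityˡ (z ℤ.* 1ℤ))))
    O⇒≈0 (suc k) {z} (mkO d nd w e) = *-cancelˡ (ℕ-unit k nd) (≈-trans
      (mk w (trans (ι-injective (trans (ι-* (+ d) z) (trans e (trans (*-comm (p^ (suc k)) (ι w)) (sym (ι-* w (+ (p ℕ.^ suc k)))))))) (sym (ℤₚ.+-identityˡ (w ℤ.* + (p ℕ.^ suc k))))))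
      (≡⇒≈ (sym (ℤₚ.*-zeroʳ (+ d)))))
      where open ℤ/ (suc k)

    ≈0⇒O : ∀ k {z} → ℤ/._≈_ k z 0ℤ → O k (ι z)
    ≈0⇒O k {z} (Mod.mk q e) = mkO 1 p∤1 q (trans (*-identityˡ (ι z)) (trans (cong ι (trans e (trans (ℤₚ.+-identityˡ (q ℤ.* + (p ℕ.^ k))) (ℤₚ.*-comm q (+ (p ℕ.^ k)))))) (ι-* (+ (p ℕ.^ k)) q)))

-- Power series by their coefficients: exp(X + X^p/p) and its sections modulo p

module ExponentialSeries where
  open import Data.Bool using (if_then_else_; true; false; T)
  open import Data.Empty using (⊥-elim)
  open import Data.Nat as ℕ using (ℕ; zero; suc; _<_; _≤_; z≤n; s≤s; _!; _∸_)
  import Data.Nat.Properties as ℕₚ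
  open import Data.Nat.Divisibility as ℕ∣ using (divides; _∣_; _∤_)
  open import Data.Nat.Primality using (Prime; prime⇒nonZero)
  import Data.Nat.Tactic.RingSolver as ℕS
  open import Data.Integer as ℤ using (+_; 0ℤ; 1ℤ; -1ℤ; ∣_∣)
  open import Data.Sum using (inj₁; inj₂)
  open import Relation.Binary.PropositionalEquality as ≡ using (_≡_; refl; cong; cong₂; subst; sym; trans; module ≡-Reasoning)
  open FiniteSums
  open MoritaGamma
  open RationalValuation

  module Convolution (F : RationalField) where
    open FieldLaws F

    -- A sequence stands for its generating series, and this is multiplication by X.
    shift : (ℕ → A) → ℕ → A
    shift f zero    = 0#
    shift f (suc i) = f i

    shiftBy : ℕ → (ℕ → A) → ℕ → A
    shiftBy zero    f = f
    shiftBy (suc r) f = shift (shiftBy r f)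

    shiftBy-+ : ∀ r f i → shiftBy r f (r ℕ.+ i) ≡ f i
    shiftBy-+ zero    f i = refl
    shiftBy-+ (suc r) f i = shiftBy-+ r f i

    shiftBy-< : ∀ r f {i} → i < r → shiftBy r f i ≡ 0#
    shiftBy-< (suc r) f {zero}  _       = refl
    shiftBy-< (suc r) f {suc i} (s≤s h) = shiftBy-< r f h

    shiftBy-≤ : ∀ r {f g} N → (∀ i → i ≤ N → f i ≡ g i) → shiftBy r f N ≡ shiftBy r g N
    shiftBy-≤ zero    N       h = h N ℕₚ.≤-refl
    shiftBy-≤ (suc r) zero    h = refl
    shiftBy-≤ (suc r) (suc N) h = shiftBy-≤ r N (λ i i≤N → h i (ℕₚ.m≤n⇒m≤1+n i≤N))

    conv : (ℕ → A) → (ℕ → A) → ℕ → A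
    conv f g N = sum (suc N) (λ i → f i * g (N ∸ i))

    conv-congˡ : ∀ {f f'} g → (∀ i → f i ≡ f' i) → ∀ N → conv f g N ≡ conv f' g N
    conv-congˡ g h N = sum-cong (suc N) (λ i _ → cong (_* g (N ∸ i)) (h i))

    conv-congʳ : ∀ f {g g'} → (∀ i → g i ≡ g' i) → ∀ N → conv f g N ≡ conv f g' N
    conv-congʳ f h N = sum-cong (suc N) (λ i _ → cong (f i *_) (h (N ∸ i)))

    conv-+ˡ : ∀ f f' g N → conv (λ i → f i + f' i) g N ≡ conv f g N + conv f' g N
    conv-+ˡ f f' g N = trans (sum-cong (suc N) (λ i _ → distribʳ (g (N ∸ i)) (f i) (f' i))) (sum-+ (suc N) _ _)

    conv-+ʳ : ∀ f g g' N → conv f (λ i → g i + g' i) N ≡ conv f g N + conv f g' N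
    conv-+ʳ f g g' N = trans (sum-cong (suc N) (λ i _ → distribˡ (f i) (g (N ∸ i)) (g' (N ∸ i)))) (sum-+ (suc N) _ _)

    conv-negˡ : ∀ f g N → conv (λ i → - f i) g N ≡ - conv f g N
    conv-negˡ f g N = trans (sum-cong (suc N) (λ i _ → solve 2 (λ x y → (:- x) :* y := :- (x :* y)) refl (f i) (g (N ∸ i)))) (sum-neg (suc N) _)

    conv-negʳ : ∀ f g N → conv f (λ i → - g i) N ≡ - conv f g N
    conv-negʳ f g N = trans (sum-cong (suc N) (λ i _ → solve 2 (λ x y → x :* (:- y) := :- (x :* y)) refl (f i) (g (N ∸ i)))) (sum-neg (suc N) _)

    private
      suc∸ : ∀ {M i} → i ≤ M → suc M ∸ i ≡ suc (M ∸ i)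
      suc∸ i≤M = ℕₚ.+-∸-assoc 1 i≤M

    conv-shiftˡ : ∀ f g M → conv (shift f) g (suc M) ≡ conv f g M
    conv-shiftˡ f g M = trans (sum-first (suc M) (λ i → shift f i * g (suc M ∸ i)))
      (trans (cong (_+ conv f g M) (zeroˡ (g (suc M)))) (+-identityˡ (conv f g M)))

    conv-shiftʳ : ∀ f g M → conv f (shift g) (suc M) ≡ conv f g M
    conv-shiftʳ f g M = trans (cong₂ _+_
        (sum-cong (suc M) (λ i i<1+M → cong (λ z → f i * shift g z) (suc∸ (ℕ.s≤s⁻¹ i<1+M))))
        (trans (cong (λ z → f (suc M) * shift g z) (ℕₚ.n∸n≡0 M)) (zeroʳ (f (suc M)))))
      (+-identityʳ (conv f g M))

    conv-shift : ∀ f g N → conv (shift f) g N ≡ conv f (shift g) N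
    conv-shift f g zero    = cong (_+_ 0#) (trans (zeroˡ (g 0)) (sym (zeroʳ (f 0))))
    conv-shift f g (suc M) = trans (conv-shiftˡ f g M) (sym (conv-shiftʳ f g M))

    conv-shiftBy : ∀ r f g N → conv (shiftBy r f) g N ≡ conv f (shiftBy r g) N
    conv-shiftBy zero    f g N = refl
    conv-shiftBy (suc r) f g N = trans (conv-shift (shiftBy r f) g N) (trans (conv-shiftBy r f (shift g) N)
      (conv-congʳ f (λ i → comm r i) N))
      where
      comm : ∀ r i → shiftBy r (shift g) i ≡ shift (shiftBy r g) i
      comm zero    i       = refl
      comm (suc r) zero    = refl
      comm (suc r) (suc i) = trans (comm r i) refl

    -- The product rule for the operator qX d/dX + r, with r charged to the first factor. It is
    -- applied with q = 1 to series in X and with q = p to series in X^p.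
    leibniz : ∀ (q r : ℕ) f g N → ι (+ (q ℕ.* N ℕ.+ r)) * conv f g N ≡
      conv (λ i → ι (+ (q ℕ.* i ℕ.+ r)) * f i) g N + conv f (λ i → ι (+ (q ℕ.* i)) * g i) N
    leibniz q r f g N = trans (sum-*ˡ (suc N) _ _) (trans (sum-cong (suc N) step) (sum-+ (suc N) _ _))
      where
      step : ∀ i → i < suc N → ι (+ (q ℕ.* N ℕ.+ r)) * (f i * g (N ∸ i)) ≡
        ι (+ (q ℕ.* i ℕ.+ r)) * f i * g (N ∸ i) + f i * (ι (+ (q ℕ.* (N ∸ i))) * g (N ∸ i))
      step i i<1+N = begin
        ι (+ (q ℕ.* N ℕ.+ r)) * (x * y)                             ≡⟨ cong (λ z → ι (+ z) * (x * y)) e ⟩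
        ι (+ ((q ℕ.* i ℕ.+ r) ℕ.+ q ℕ.* (N ∸ i))) * (x * y)         ≡⟨ cong (_* (x * y)) (ι-ℕ+ (q ℕ.* i ℕ.+ r) (q ℕ.* (N ∸ i))) ⟩
        (u + v) * (x * y)                                           ≡⟨ solve 4 (λ u v x y → (u :+ v) :* (x :* y) := u :* x :* y :+ x :* (v :* y)) refl u v x y ⟩
        u * x * y + x * (v * y)                                     ∎
        where
        open ≡-Reasoning
        x = f i
        y = g (N ∸ i)
        u = ι (+ (q ℕ.* i ℕ.+ r))
        v = ι (+ (q ℕ.* (N ∸ i)))
        e₀ : ∀ q i d r → q ℕ.* (i ℕ.+ d) ℕ.+ r ≡ (q ℕ.* i ℕ.+ r) ℕ.+ q ℕ.* d
        e₀ = ℕS.solve-∀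
        e : q ℕ.* N ℕ.+ r ≡ (q ℕ.* i ℕ.+ r) ℕ.+ q ℕ.* (N ∸ i)
        e = trans (cong (λ z → q ℕ.* z ℕ.+ r) (sym (ℕₚ.m+[n∸m]≡n (ℕ.s≤s⁻¹ i<1+N)))) (e₀ q i (N ∸ i) r)

  module Series (F : RationalField) (p : ℕ) (pr : Prime p) (b : ℕ) (p≡1+2b : p ≡ suc (b ℕ.+ b)) where
    open FieldLaws F
    open Convolution F
    open PAdic F p pr b p≡1+2b
    open GammaP p pr b p≡1+2b using (1<p; 0<u<p⇒∤; refl-prod; s-∣; s-∤)

    private instance
      p≢0 = prime⇒nonZero pr

    private
      n : ℕ
      n = p ∸ 1
      p≡1+n : p ≡ suc n
      p≡1+n = sym (ℕₚ.suc-pred p)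

    pA : A
    pA = ι (+ p)

    sgn : ℕ → A
    sgn zero    = 1#
    sgn (suc i) = - sgn i

    sgn-+ : ∀ i j → sgn (i ℕ.+ j) ≡ sgn i * sgn j
    sgn-+ zero    j = sym (*-identityˡ (sgn j))
    sgn-+ (suc i) j = trans (cong -_ (sgn-+ i j)) (solve 2 (λ x y → :- (x :* y) := (:- x) :* y) refl (sgn i) (sgn j))

    sgn-2 : ∀ i → sgn (i ℕ.+ i) ≡ 1#
    sgn-2 zero    = refl
    sgn-2 (suc i) = trans (cong (λ z → - sgn z) (ℕₚ.+-suc i i)) (trans (solve 1 (λ x → :- (:- x) := x) refl (sgn (i ℕ.+ i))) (sgn-2 i))

    sgn-ι : ∀ i → sgn i ≡ ι (-1ℤ ℤ.^ i)
    sgn-ι zero    = refl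
    sgn-ι (suc i) = trans (cong -_ (sgn-ι i)) (sym (trans (ι-* -1ℤ (-1ℤ ℤ.^ i)) (trans (cong (_* ι (-1ℤ ℤ.^ i)) (ι-neg 1ℤ))
       (solve 1 (λ x → (:- con 1ℤ) :* x := :- x) refl (ι (-1ℤ ℤ.^ i))))))

    sgn-p : sgn p ≡ - 1#
    sgn-p = trans (cong sgn p≡1+2b) (cong -_ (sgn-2 b))

    mp : ℕ → A
    mp zero    = 1#
    mp (suc j) = - pA * mp j

    mp-sgn : ∀ j → mp j ≡ sgn j * p^ j
    mp-sgn zero    = sym (*-identityˡ 1#)
    mp-sgn (suc j) = trans (cong (- pA *_) (mp-sgn j)) (trans (solve 3 (λ a b c → (:- a) :* (b :* c) := (:- b) :* (a :* c)) refl pA (sgn j) (p^ j))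
       (cong (- sgn j *_) (sym (p^-suc j))))

    mp-+ : ∀ i j → mp (i ℕ.+ j) ≡ mp i * mp j
    mp-+ zero    j = sym (*-identityˡ (mp j))
    mp-+ (suc i) j = trans (cong (- pA *_) (mp-+ i j)) (sym (*-assoc (- pA) (mp i) (mp j)))

    -- A table: `cs N` is final at the indices up to `N`, and each step appends one coefficient. The
    -- recurrence reaches back to the index n - p, which is not a structural predecessor.
    cs : ℕ → ℕ → A
    cs zero    i = 1#
    cs (suc N) i = if i ℕ.≤ᵇ N then cs N i else inv N * (cs N N + shiftBy p (cs N) (suc N))

    -- The coefficients of exp(X + X^p/p).
    c : ℕ → A
    c N = cs N N

    private
      ≤ᵇ-true : ∀ {i N} → i ≤ N → (i ℕ.≤ᵇ N) ≡ true
      ≤ᵇ-true {i} {N} h with i ℕ.≤ᵇ N | ℕₚ.≤⇒≤ᵇ h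
      ... | true | _ = refl

      cs-stable : ∀ N i → i ≤ N → cs N i ≡ c i
      cs-stable zero    zero h = refl
      cs-stable (suc N) i    h with ℕₚ.m≤n⇒m<n∨m≡n h
      ... | inj₂ refl = refl
      ... | inj₁ (s≤s i≤N) = trans (cong (λ d → if d then cs N i else _) (≤ᵇ-true i≤N)) (cs-stable N i i≤N)

    c-rec : ∀ N → ι (+ N) * c N ≡ shift c N + shiftBy p c N
    c-rec zero = trans (zeroˡ (c 0)) (sym (trans (cong (_+_ 0#) (shiftBy-< p c (ℕₚ.<-trans (s≤s z≤n) 1<p))) (+-identityˡ 0#)))
    c-rec (suc N) with suc N ℕ.≤ᵇ N in eq
    ... | true = ⊥-elim (ℕₚ.1+n≰n (ℕₚ.≤ᵇ⇒≤ (suc N) N (subst T (sym eq) _)))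
    ... | false = begin
      ι (+ suc N) * (inv N * y)       ≡⟨ *-assoc (ι (+ suc N)) (inv N) y ⟨
      ι (+ suc N) * inv N * y         ≡⟨ cong (_* y) (inv-law N) ⟩
      1# * y                          ≡⟨ *-identityˡ y ⟩
      c N + shiftBy p (cs N) (suc N)  ≡⟨ cong (_+_ (c N)) (local p p≡1+n) ⟩
      c N + shiftBy p c (suc N)       ∎
      where
      open ≡-Reasoning
      y = cs N N + shiftBy p (cs N) (suc N)
      -- Once p is written as a successor, the shift reads only indices up to `N`, where the table
      -- `cs N` is final.
      local : ∀ q → q ≡ suc n → shiftBy q (cs N) (suc N) ≡ shiftBy q c (suc N)
      local _ refl = shiftBy-≤ n N (cs-stable N)

    -- The coefficients of exp(-X - X^p/p), obtained by X ↦ -X because p is odd.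
    c-alt : ℕ → A
    c-alt i = sgn i * c i

    private
      shiftBy-alt : ∀ r f i → shiftBy r (λ j → sgn j * f j) i ≡ sgn r * (sgn i * shiftBy r f i)
      shiftBy-alt zero    f i       = sym (*-identityˡ _)
      shiftBy-alt (suc r) f zero    = sym (trans (cong (sgn (suc r) *_) (zeroʳ 1#)) (zeroʳ (sgn (suc r))))
      shiftBy-alt (suc r) f (suc i) = trans (shiftBy-alt r f i)
        (solve 3 (λ x y z → x :* (y :* z) := (:- x) :* ((:- y) :* z)) refl (sgn r) (sgn i) (shiftBy r f i))

      c-alt-rec : ∀ N → ι (+ N) * c-alt N ≡ - shift c-alt N + - shiftBy p c-alt N
      c-alt-rec N = begin
        ι (+ N) * (sgn N * c N)                             ≡⟨ solve 3 (λ a b c → a :* (b :* c) := b :* (a :* c)) refl (ι (+ N)) (sgn N) (c N) ⟩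
        sgn N * (ι (+ N) * c N)                             ≡⟨ cong (sgn N *_) (c-rec N) ⟩
        sgn N * (shift c N + shiftBy p c N)                 ≡⟨ solve 3 (λ s x y → s :* (x :+ y) := :- ((:- con 1ℤ) :* (s :* x)) :+ :- ((:- con 1ℤ) :* (s :* y))) refl (sgn N) (shift c N) (shiftBy p c N) ⟩
        - (- 1# * (sgn N * shift c N)) + - (- 1# * (sgn N * shiftBy p c N))
          ≡⟨ cong₂ (λ x y → - x + - y) (sym (shiftBy-alt 1 c N)) (trans (cong (_* (sgn N * shiftBy p c N)) (sym sgn-p)) (sym (shiftBy-alt p c N))) ⟩
        - shift c-alt N + - shiftBy p c-alt N ∎
        where open ≡-Reasoning

    -- exp(X + X^p/p) exp(-X - X^p/p) = 1
    conv-c-alt : ∀ N → conv c-alt c (suc N) ≡ 0#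
    conv-c-alt N = cancel-suc N (trans (begin
      ι (+ M) * conv c-alt c M                                  ≡⟨ cong (λ z → ι (+ z) * conv c-alt c M) (e M) ⟨
      ι (+ (1 ℕ.* M ℕ.+ 0)) * conv c-alt c M                    ≡⟨ leibniz 1 0 c-alt c M ⟩
      conv (λ i → ι (+ (1 ℕ.* i ℕ.+ 0)) * c-alt i) c M + conv c-alt (λ i → ι (+ (1 ℕ.* i)) * c i) M
        ≡⟨ cong₂ _+_ (conv-congˡ c (λ i → trans (cong (λ z → ι (+ z) * c-alt i) (e i)) (c-alt-rec i)) M)
                     (conv-congʳ c-alt (λ i → trans (cong (λ z → ι (+ z) * c i) (ℕₚ.*-identityˡ i)) (c-rec i)) M) ⟩
      conv (λ i → - shift c-alt i + - shiftBy p c-alt i) c M + conv c-alt (λ i → shift c i + shiftBy p c i) M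
        ≡⟨ cong₂ _+_ (trans (conv-+ˡ (λ i → - shift c-alt i) (λ i → - shiftBy p c-alt i) c M) (cong₂ _+_ (conv-negˡ (shift c-alt) c M) (conv-negˡ (shiftBy p c-alt) c M)))
                     (conv-+ʳ c-alt (shift c) (shiftBy p c) M) ⟩
      (- conv (shift c-alt) c M + - conv (shiftBy p c-alt) c M) + (conv c-alt (shift c) M + conv c-alt (shiftBy p c) M)
        ≡⟨ cong₂ (λ x y → (- x + - y) + (conv c-alt (shift c) M + conv c-alt (shiftBy p c) M)) (conv-shift c-alt c M) (conv-shiftBy p c-alt c M) ⟩
      (- conv c-alt (shift c) M + - conv c-alt (shiftBy p c) M) + (conv c-alt (shift c) M + conv c-alt (shiftBy p c) M)
        ≡⟨ solve 2 (λ x y → (:- x :+ :- y) :+ (x :+ y) := con 0ℤ) refl (conv c-alt (shift c) M) (conv c-alt (shiftBy p c) M) ⟩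
      0# ∎) (sym (zeroʳ (ι (+ M)))))
      where
      open ≡-Reasoning
      M = suc N
      e : ∀ i → 1 ℕ.* i ℕ.+ 0 ≡ i
      e = ℕS.solve-∀

    -- The coefficients of exp(-X/p).
    ε : ℕ → A
    ε zero    = 1#
    ε (suc i) = - (inv n * inv i * ε i)

    ε-rec : ∀ i → ι (+ (p ℕ.* suc i)) * ε (suc i) ≡ - ε i
    ε-rec i = begin
      ι (+ (p ℕ.* suc i)) * - (inv n * inv i * ε i)        ≡⟨ cong (_* - (inv n * inv i * ε i)) (ι-ℕ* p (suc i)) ⟩
      pA * ι (+ suc i) * - (inv n * inv i * ε i)
        ≡⟨ solve 5 (λ p s a b e → p :* s :* (:- (a :* b :* e)) := :- ((p :* a) :* (s :* b) :* e)) refl pA (ι (+ suc i)) (inv n) (inv i) (ε i) ⟩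
      - (pA * inv n * (ι (+ suc i) * inv i) * ε i)         ≡⟨ cong₂ (λ x y → - (x * y * ε i)) (trans (cong (λ q → ι (+ q) * inv n) p≡1+n) (inv-law n)) (inv-law i) ⟩
      - (1# * 1# * ε i)                                    ≡⟨ solve 1 (λ e → :- (con 1ℤ :* con 1ℤ :* e) := :- e) refl (ε i) ⟩
      - ε i                                                ∎
      where open ≡-Reasoning

    -- The part of the series in degrees congruent to r modulo p, as a series in X^p.
    x : ℕ → ℕ → A
    x r i = c (p ℕ.* i ℕ.+ r)

    private
      e₁ : ∀ p i r → p ℕ.* suc i ℕ.+ r ≡ p ℕ.+ (p ℕ.* i ℕ.+ r)
      e₁ = ℕS.solve-∀

      Dε : ∀ i → ι (+ (p ℕ.* i)) * ε i ≡ - shift ε i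
      Dε zero    = trans (cong (λ z → ι (+ z) * 1#) (ℕₚ.*-zeroʳ p)) (solve 0 (con 0ℤ :* con 1ℤ := :- con 0ℤ) refl)
      Dε (suc i) = ε-rec i

      shift-x : ∀ r → r < p → ∀ i → shiftBy p c (p ℕ.* i ℕ.+ r) ≡ shift (x r) i
      shift-x r h zero    = trans (cong (shiftBy p c) (cong (ℕ._+ r) (ℕₚ.*-zeroʳ p))) (shiftBy-< p c h)
      shift-x r h (suc i) = trans (cong (shiftBy p c) (e₁ p i r)) (shiftBy-+ p c (p ℕ.* i ℕ.+ r))

      x-rec : ∀ r → suc r < p → ∀ i → ι (+ (p ℕ.* i ℕ.+ suc r)) * x (suc r) i ≡ x r i + shift (x (suc r)) i
      x-rec r h i = trans (c-rec (p ℕ.* i ℕ.+ suc r)) (cong₂ _+_ (cong (shift c) (ℕₚ.+-suc (p ℕ.* i) r)) (shift-x (suc r) h i))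

      x-rec₀ : ∀ i → ι (+ (p ℕ.* i ℕ.+ 0)) * x 0 i ≡ shift (x n) i + shift (x 0) i
      x-rec₀ i = trans (c-rec (p ℕ.* i ℕ.+ 0)) (cong₂ _+_ (l i) (shift-x 0 (ℕₚ.<-trans (s≤s z≤n) 1<p) i))
        where
        l : ∀ i → shift c (p ℕ.* i ℕ.+ 0) ≡ shift (x n) i
        l zero    = cong (shift c) (trans (ℕₚ.+-identityʳ (p ℕ.* 0)) (ℕₚ.*-zeroʳ p))
        l (suc i) = cong (shift c) (trans (e₁ p i 0) (trans (cong (ℕ._+ (p ℕ.* i ℕ.+ 0)) p≡1+n) (e₂ n (p ℕ.* i))))
          where
          e₂ : ∀ n y → suc n ℕ.+ (y ℕ.+ 0) ≡ suc (y ℕ.+ n)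
          e₂ = ℕS.solve-∀

      -- The term `shift (x r)` of the recurrence comes from the factor exp(X^p/p); multiplying by
      -- `ε`, that is by exp(-X^p/p), removes it.
      Dx : ∀ r f → (∀ i → ι (+ (p ℕ.* i ℕ.+ r)) * x r i ≡ f i + shift (x r) i) → ∀ m → ι (+ (p ℕ.* m ℕ.+ r)) * conv (x r) ε m ≡ conv f ε m
      Dx r f h m = begin
        ι (+ (p ℕ.* m ℕ.+ r)) * conv (x r) ε m                                       ≡⟨ leibniz p r (x r) ε m ⟩
        conv (λ i → ι (+ (p ℕ.* i ℕ.+ r)) * x r i) ε m + conv (x r) (λ i → ι (+ (p ℕ.* i)) * ε i) m
          ≡⟨ cong₂ _+_ (trans (conv-congˡ ε h m) (conv-+ˡ f (shift (x r)) ε m)) (trans (conv-congʳ (x r) Dε m) (conv-negʳ (x r) (shift ε) m)) ⟩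
        conv f ε m + conv (shift (x r)) ε m + - conv (x r) (shift ε) m               ≡⟨ cong (λ z → conv f ε m + z + - conv (x r) (shift ε) m) (conv-shift (x r) ε m) ⟩
        conv f ε m + conv (x r) (shift ε) m + - conv (x r) (shift ε) m               ≡⟨ solve 2 (λ x y → x :+ y :+ :- y := x) refl (conv f ε m) (conv (x r) (shift ε) m) ⟩
        conv f ε m                                                                   ∎
        where open ≡-Reasoning

    fac : ℕ → A
    fac N = ι (+ (N !))

    fac-suc : ∀ N → fac (suc N) ≡ ι (+ suc N) * fac N
    fac-suc N = ι-ℕ* (suc N) (N !)

    -- exp(X + X^p/p) exp(-X^p/p) = exp X
    conv-x-ε : ∀ m r → r < p → fac (p ℕ.* m ℕ.+ r) * conv (x r) ε m ≡ 1#
    conv-x-ε zero zero h = trans (cong₂ (λ z w → fac z * (0# + c w * 1#)) e e)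
         (solve 0 (con 1ℤ :* (con 0ℤ :+ con 1ℤ :* con 1ℤ) := con 1ℤ) refl)
      where
      e : p ℕ.* 0 ℕ.+ 0 ≡ 0
      e = trans (ℕₚ.+-identityʳ (p ℕ.* 0)) (ℕₚ.*-zeroʳ p)
    conv-x-ε (suc m) zero h = begin
      fac (p ℕ.* suc m ℕ.+ 0) * d₀                       ≡⟨ cong (λ z → fac z * d₀) eN ⟩
      fac (suc N) * d₀                                   ≡⟨ cong (_* d₀) (fac-suc N) ⟩
      ι (+ suc N) * fac N * d₀                           ≡⟨ solve 3 (λ a b c → a :* b :* c := b :* (a :* c)) refl (ι (+ suc N)) (fac N) d₀ ⟩
      fac N * (ι (+ suc N) * d₀)                         ≡⟨ cong (λ z → fac N * (ι (+ z) * d₀)) eN ⟨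
      fac N * (ι (+ (p ℕ.* suc m ℕ.+ 0)) * d₀)           ≡⟨ cong (fac N *_) (trans (Dx 0 (shift (x n)) x-rec₀ (suc m)) (conv-shiftˡ (x n) ε m)) ⟩
      fac N * conv (x n) ε m                             ≡⟨ conv-x-ε m n (subst (n <_) (sym p≡1+n) (ℕₚ.n<1+n n)) ⟩
      1#                                                 ∎
      where
      open ≡-Reasoning
      N = p ℕ.* m ℕ.+ n
      d₀ = conv (x 0) ε (suc m)
      e₂ : ∀ n y → suc n ℕ.+ (y ℕ.+ 0) ≡ suc (y ℕ.+ n)
      e₂ = ℕS.solve-∀
      eN : p ℕ.* suc m ℕ.+ 0 ≡ suc N
      eN = trans (e₁ p m 0) (trans (cong (ℕ._+ (p ℕ.* m ℕ.+ 0)) p≡1+n) (e₂ n (p ℕ.* m)))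
    conv-x-ε m (suc r) h = begin
      fac (p ℕ.* m ℕ.+ suc r) * d                        ≡⟨ cong (λ z → fac z * d) eN ⟩
      fac (suc N) * d                                    ≡⟨ cong (_* d) (fac-suc N) ⟩
      ι (+ suc N) * fac N * d                            ≡⟨ solve 3 (λ a b c → a :* b :* c := b :* (a :* c)) refl (ι (+ suc N)) (fac N) d ⟩
      fac N * (ι (+ suc N) * d)                          ≡⟨ cong (λ z → fac N * (ι (+ z) * d)) eN ⟨
      fac N * (ι (+ (p ℕ.* m ℕ.+ suc r)) * d)            ≡⟨ cong (fac N *_) (Dx (suc r) (x r) (x-rec r h) m) ⟩
      fac N * conv (x r) ε m                             ≡⟨ conv-x-ε m r (ℕₚ.<-trans (ℕₚ.n<1+n r) h) ⟩
      1#                                                 ∎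
      where
      open ≡-Reasoning
      N = p ℕ.* m ℕ.+ r
      d = conv (x (suc r)) ε m
      eN : p ℕ.* m ℕ.+ suc r ≡ suc N
      eN = ℕₚ.+-suc (p ℕ.* m) r

    -- The multiples p, 2p, ..., mp contribute p^m m! to the factorial. `refl-prod` contains a
    -- factor -1 in place of each of them, which turns p^m into (-p)^m.
    fac-refl : ∀ m r → r < p → fac (p ℕ.* m ℕ.+ r) ≡ ι (refl-prod (p ℕ.* m ℕ.+ r)) * (mp m * fac m)
    fac-refl zero zero h = trans (cong fac e) (trans (solve 0 (con 1ℤ := con 1ℤ :* (con 1ℤ :* con 1ℤ)) refl) (cong (λ z → ι (refl-prod z) * (1# * 1#)) (sym e)))
      where
      e : p ℕ.* 0 ℕ.+ 0 ≡ 0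
      e = trans (ℕₚ.+-identityʳ (p ℕ.* 0)) (ℕₚ.*-zeroʳ p)
    fac-refl (suc m) zero h = begin
      fac (p ℕ.* suc m ℕ.+ 0)                             ≡⟨ cong fac eN ⟩
      fac (suc N)                                         ≡⟨ fac-suc N ⟩
      ι (+ suc N) * fac N                                 ≡⟨ cong₂ _*_ (trans (cong (λ z → ι (+ z)) (trans (sym eN) (ℕₚ.+-identityʳ (p ℕ.* suc m)))) (ι-ℕ* p (suc m)))
                                                               (fac-refl m n (subst (n <_) (sym p≡1+n) (ℕₚ.n<1+n n))) ⟩
      pA * ι (+ suc m) * (ι (refl-prod N) * (mp m * fac m))
        ≡⟨ solve 5 (λ p s r q f → p :* s :* (r :* (q :* f)) := r :* (:- con 1ℤ) :* ((:- p) :* q :* (s :* f))) refl pA (ι (+ suc m)) (ι (refl-prod N)) (mp m) (fac m) ⟩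
      ι (refl-prod N) * - 1# * (mp (suc m) * (ι (+ suc m) * fac m))  ≡⟨ cong₂ (λ z w → ι (refl-prod N) * z * (mp (suc m) * w)) (ι-neg 1ℤ) (fac-suc m) ⟨
      ι (refl-prod N) * ι -1ℤ * (mp (suc m) * fac (suc m))  ≡⟨ cong (_* (mp (suc m) * fac (suc m))) (trans (sym (ι-* (refl-prod N) -1ℤ))
                                                               (cong (λ z → ι (refl-prod N ℤ.* z)) (sym (s-∣ (divides (suc m) (trans (sym eN) (trans (ℕₚ.+-identityʳ (p ℕ.* suc m)) (ℕₚ.*-comm p (suc m))))))))) ⟩
      ι (refl-prod (suc N)) * (mp (suc m) * fac (suc m))  ≡⟨ cong (λ z → ι (refl-prod z) * (mp (suc m) * fac (suc m))) eN ⟨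
      ι (refl-prod (p ℕ.* suc m ℕ.+ 0)) * (mp (suc m) * fac (suc m)) ∎
      where
      open ≡-Reasoning
      N = p ℕ.* m ℕ.+ n
      e₂ : ∀ n y → suc n ℕ.+ (y ℕ.+ 0) ≡ suc (y ℕ.+ n)
      e₂ = ℕS.solve-∀
      eN : p ℕ.* suc m ℕ.+ 0 ≡ suc N
      eN = trans (e₁ p m 0) (trans (cong (ℕ._+ (p ℕ.* m ℕ.+ 0)) p≡1+n) (e₂ n (p ℕ.* m)))
    fac-refl m (suc r) h = begin
      fac (p ℕ.* m ℕ.+ suc r)                             ≡⟨ cong fac eN ⟩
      fac (suc N)                                         ≡⟨ fac-suc N ⟩
      ι (+ suc N) * fac N                                 ≡⟨ cong (ι (+ suc N) *_) (fac-refl m r (ℕₚ.<-trans (ℕₚ.n<1+n r) h)) ⟩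
      ι (+ suc N) * (ι (refl-prod N) * (mp m * fac m))    ≡⟨ solve 3 (λ a b c → a :* (b :* c) := b :* a :* c) refl (ι (+ suc N)) (ι (refl-prod N)) (mp m * fac m) ⟩
      ι (refl-prod N) * ι (+ suc N) * (mp m * fac m)      ≡⟨ cong (_* (mp m * fac m)) (trans (sym (ι-* (refl-prod N) (+ suc N)))
                                                               (cong (λ z → ι (refl-prod N ℤ.* z)) (sym (s-∤ p∤)))) ⟩
      ι (refl-prod (suc N)) * (mp m * fac m)              ≡⟨ cong (λ z → ι (refl-prod z) * (mp m * fac m)) eN ⟨
      ι (refl-prod (p ℕ.* m ℕ.+ suc r)) * (mp m * fac m)  ∎
      where
      open ≡-Reasoning
      N = p ℕ.* m ℕ.+ r
      eN : p ℕ.* m ℕ.+ suc r ≡ suc N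
      eN = ℕₚ.+-suc (p ℕ.* m) r
      p∤ : p ∤ suc N
      p∤ d = 0<u<p⇒∤ (s≤s z≤n) h (ℕ∣.∣m+n∣m⇒∣n (subst (p ∣_) (sym eN) d) (ℕ∣.m∣m*n m))

-- Higher differences of Γ_p along arithmetic progressions with step p

module CoefficientBounds where
  open import Data.Bool using (T)
  open import Data.Nat as ℕ using (ℕ; zero; suc; _<_; _≤_; z≤n; s≤s; _!; _∸_)
  import Data.Nat.Properties as ℕₚ
  open import Data.Nat.Divisibility as ℕ∣ using (_∣?_; _∣_; _∤_)
  open import Data.Nat.Primality using (Prime; prime⇒nonZero)
  import Data.Nat.Tactic.RingSolver as ℕS
  open import Data.Integer as ℤ using (ℤ; +_; -[1+_]; 0ℤ; 1ℤ; -1ℤ; ∣_∣)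
  import Data.Integer.Properties as ℤₚ
  open import Data.Product using (_,_; ∃)
  open import Data.Sum using (_⊎_; inj₁; inj₂)
  open import Relation.Nullary using (yes; no)
  open import Relation.Binary.PropositionalEquality as ≡ using (_≡_; refl; cong; cong₂; subst; subst₂; sym; trans; module ≡-Reasoning)
  open import Data.Nat.DivMod using (_/_; _%_; m≡m%n+[m/n]*n; m%n<n; m/n*n≤m)
  open import Data.Nat.Induction using (<-rec)
  open import Data.Integer.Tactic.RingSolver using (solve-∀)
  open FiniteSums
  open ModularArithmetic
  open MoritaGamma
  open RationalValuation
  open ExponentialSeries

  -- The product (m-n)(m-n-1)⋯(m-n-u+1); the offset `n` makes it possible to split off a factor at
  -- either end.
  falling : ℕ → ℕ → ℕ → ℤ
  falling m n zero    = 1ℤ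
  falling m n (suc u) = falling m n u ℤ.* (+ m ℤ.- + (n ℕ.+ u))

  falling-front : ∀ m n u → falling m n (suc u) ≡ (+ m ℤ.- + n) ℤ.* falling m (suc n) u
  falling-front m n zero    = trans (cong (λ z → 1ℤ ℤ.* (+ m ℤ.- + z)) (ℕₚ.+-identityʳ n)) (ℤₚ.*-comm 1ℤ (+ m ℤ.- + n))
  falling-front m n (suc u) = trans (cong₂ (λ x y → x ℤ.* (+ m ℤ.- + y)) (falling-front m n u) (ℕₚ.+-suc n u)) (ℤₚ.*-assoc (+ m ℤ.- + n) (falling m (suc n) u) (+ m ℤ.- + suc (n ℕ.+ u)))

  falling-suc : ∀ m n u → falling (suc m) (suc n) u ≡ falling m n u
  falling-suc m n zero    = refl
  falling-suc m n (suc u) = cong₂ ℤ._*_ (falling-suc m n u) (e (+ m) (+ (n ℕ.+ u)))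
    where
    e : ∀ m y → (1ℤ ℤ.+ m) ℤ.- (1ℤ ℤ.+ y) ≡ m ℤ.- y
    e = solve-∀

  falling-suc-front : ∀ m i → falling (suc m) 0 (suc i) ≡ + suc m ℤ.* falling m 0 i
  falling-suc-front m i = trans (falling-front (suc m) 0 i) (cong₂ ℤ._*_ (ℤₚ.+-identityʳ (+ suc m)) (falling-suc m 0 i))

  falling-vanish : ∀ m i → m < i → falling m 0 i ≡ 0ℤ
  falling-vanish m (suc i) (s≤s m≤i) with ℕₚ.m≤n⇒m<n∨m≡n m≤i
  ... | inj₁ m<i  = trans (cong (ℤ._* (+ m ℤ.- + i)) (falling-vanish m i m<i)) (ℤₚ.*-zeroˡ (+ m ℤ.- + i))
  ... | inj₂ refl = trans (cong (falling m 0 m ℤ.*_) (ℤₚ.+-inverseʳ (+ m))) (ℤₚ.*-zeroʳ (falling m 0 m))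

  falling-! : ∀ i j → + ((i ℕ.+ j) !) ≡ falling (i ℕ.+ j) 0 i ℤ.* + (j !)
  falling-! zero    j = sym (ℤₚ.*-identityˡ (+ (j !)))
  falling-! (suc i) j = trans (ℤₚ.pos-* (suc (i ℕ.+ j)) ((i ℕ.+ j) !)) (trans (cong (+ suc (i ℕ.+ j) ℤ.*_) (falling-! i j))
    (trans (sym (ℤₚ.*-assoc (+ suc (i ℕ.+ j)) (falling (i ℕ.+ j) 0 i) (+ (j !)))) (cong (ℤ._* + (j !)) (sym (falling-suc-front (i ℕ.+ j) i)))))

  -- Integer polynomial functions of m in which p has weight 2 and m has weight -1.
  module Weight (p : ℕ) (pr : Prime p) (b : ℕ) (p≡1+2b : p ≡ suc (b ℕ.+ b)) where
    open GammaP p pr b p≡1+2b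
    open import Data.Integer using (_+_; _*_; -_; _-_)

    data W : ℕ → (ℕ → ℤ) → Set where
      W-const : ∀ z → W 0 (λ _ → z)
      W-p     : ∀ {w f} → W w f → W (2 ℕ.+ w) (λ m → + p * f m)
      W-pm    : ∀ {w f} → W w f → W (1 ℕ.+ w) (λ m → + p * + m * f m)
      W-+     : ∀ {w f g} → W w f → W w g → W w (λ m → f m + g m)
      W-*     : ∀ {w f} z → W w f → W w (λ m → z * f m)
      W-weak  : ∀ {w f} → W (suc w) f → W w f
      W-ext   : ∀ {w f g} → (∀ m → f m ≡ g m) → W w f → W w g

    W-0 : ∀ w → W w (λ _ → 0ℤ)
    W-0 zero    = W-const 0ℤ
    W-0 (suc w) = W-ext (λ m → ℤₚ.*-zeroʳ (+ p * + m)) (W-pm (W-0 w))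

    -- At m = 0 only powers of p are left to account for the weight, and each p carries weight 2.
    W-at-0 : ∀ {w f} → W w f → ∀ j → j ℕ.+ j ≤ w → ℤ/._≈_ j (f 0) 0ℤ
    W-at-0 {f = f} _ zero _ = Mod.mk (f 0) (trans (sym (ℤₚ.*-identityʳ (f 0))) (sym (ℤₚ.+-identityˡ (f 0 * 1ℤ))))
    W-at-0 (W-p {w} {f} h) (suc j) le with W-at-0 h j (ℕ.s≤s⁻¹ (ℕ.s≤s⁻¹ (subst (_≤ 2 ℕ.+ w) (cong suc (ℕₚ.+-suc j j)) le)))
    ... | Mod.mk q e = Mod.mk q (trans (cong (+ p *_) e) (trans (e' (+ p) q (+ (p ℕ.^ j))) (cong (λ z → 0ℤ + q * z) (sym (+p^suc j)))))
      where
      e' : ∀ p q x → p * (0ℤ + q * x) ≡ 0ℤ + q * (p * x)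
      e' = solve-∀
    W-at-0 (W-pm {f = f} h) (suc j) le = ℤ/.≡⇒≈ (suc j) (trans (cong (_* f 0) (ℤₚ.*-zeroʳ (+ p))) (ℤₚ.*-zeroˡ (f 0)))
    W-at-0 (W-+ h h') j@(suc _) le = ℤ/.+-cong j (W-at-0 h j le) (W-at-0 h' j le)
    W-at-0 (W-* z h) j@(suc _) le = ℤ/.≈-trans j (ℤ/.*-congˡ j z (W-at-0 h j le)) (ℤ/.≡⇒≈ j (ℤₚ.*-zeroʳ z))
    W-at-0 (W-weak h) j@(suc _) le = W-at-0 h j (ℕₚ.m≤n⇒m≤1+n le)
    W-at-0 (W-ext e h) j@(suc _) le = ℤ/.≈-trans j (ℤ/.≡⇒≈ j (sym (e 0))) (W-at-0 h j le)

    -- A difference lowers the degree in m, and m has weight -1. Constants have difference 0, which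
    -- lies in every weight.
    W-Δ : ∀ {w f} → W w f → W (suc w) (λ m → f (suc m) - f m)
    W-Δ (W-const z) = W-ext (λ m → sym (ℤₚ.+-inverseʳ z)) (W-0 1)
    W-Δ (W-p {f = f} h) = W-ext (λ m → e (+ p) (f (suc m)) (f m)) (W-p (W-Δ h))
      where
      e : ∀ p x y → p * (x - y) ≡ p * x - p * y
      e = solve-∀
    W-Δ (W-pm {f = f} h) = W-ext (λ m → e (+ p) (+ m) (f (suc m)) (f m)) (W-+ (W-+ (W-pm (W-Δ h)) (W-weak (W-p (W-Δ h)))) (W-p h))
      where
      e : ∀ p m x y → (p * m * (x - y) + p * (x - y)) + p * y ≡ p * (1ℤ + m) * x - p * m * y
      e = solve-∀
    W-Δ (W-+ {f = f} {g} h h') = W-ext (λ m → e (f (suc m)) (f m) (g (suc m)) (g m)) (W-+ (W-Δ h) (W-Δ h'))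
      where
      e : ∀ x y u v → (x - y) + (u - v) ≡ (x + u) - (y + v)
      e = solve-∀
    W-Δ (W-* {f = f} z h) = W-ext (λ m → e z (f (suc m)) (f m)) (W-* z (W-Δ h))
      where
      e : ∀ p x y → p * (x - y) ≡ p * x - p * y
      e = solve-∀
    W-Δ (W-weak h) = W-weak (W-Δ h)
    W-Δ (W-ext e h) = W-ext (λ m → cong₂ _-_ (e (suc m)) (e m)) (W-Δ h)

    sprod : ℕ → ℕ → ℤ
    sprod N zero    = 1ℤ
    sprod N (suc L) = sprod N L * s (suc (N ℕ.+ L))

    refl-prod-+ : ∀ N L → refl-prod (N ℕ.+ L) ≡ refl-prod N * sprod N L
    refl-prod-+ N zero    = trans (cong refl-prod (ℕₚ.+-identityʳ N)) (sym (ℤₚ.*-identityʳ (refl-prod N)))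
    refl-prod-+ N (suc L) = trans (cong refl-prod (ℕₚ.+-suc N L)) (trans (cong (_* s (suc (N ℕ.+ L))) (refl-prod-+ N L)) (ℤₚ.*-assoc (refl-prod N) (sprod N L) (s (suc (N ℕ.+ L)))))

    private
      s-shift : ∀ N → (∃ λ z → ∀ m → s (N ℕ.+ p ℕ.* m) ≡ + p * + m + z) ⊎ (∀ m → s (N ℕ.+ p ℕ.* m) ≡ -1ℤ)
      s-shift N with p ∣? N
      ... | yes d = inj₂ λ m → s-∣ (ℕ∣.∣m∣n⇒∣m+n d (ℕ∣.m∣m*n m))
      ... | no nd = inj₁ (+ N , λ m → trans (s-∤ (λ d → nd (∣m+n∣n⇒∣m N d (ℕ∣.m∣m*n m))))
              (trans (ℤₚ.pos-+ N (p ℕ.* m)) (trans (cong (_+_ (+ N)) (ℤₚ.pos-* p m)) (ℤₚ.+-comm (+ N) (+ p * + m)))))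

      s₀ : ∀ N → s (N ℕ.+ p ℕ.* 0) ≡ s N
      s₀ N = cong s (trans (cong (N ℕ.+_) (ℕₚ.*-zeroʳ p)) (ℕₚ.+-identityʳ N))

      index : ∀ N x L → suc (N ℕ.+ x ℕ.+ L) ≡ suc (N ℕ.+ L) ℕ.+ x
      index = ℕS.solve-∀

    W-sprod : ∀ N L {w f} → W w f → W w (λ m → sprod (N ℕ.+ p ℕ.* m) L * f m)
    W-sprod N zero    {f = f} h = W-ext (λ m → sym (ℤₚ.*-identityˡ (f m))) h
    W-sprod N (suc L) {f = f} h with s-shift (suc (N ℕ.+ L)) | W-sprod N L h
    ... | inj₁ (z , hz) | ih = W-ext (λ m → trans (e (+ p) (+ m) z (sprod (N ℕ.+ p ℕ.* m) L) (f m))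
        (cong (λ x → sprod (N ℕ.+ p ℕ.* m) L * x * f m) (trans (sym (hz m)) (cong s (sym (index N (p ℕ.* m) L)))))) (W-+ (W-weak (W-pm ih)) (W-* z ih))
      where
      e : ∀ p m z x y → p * m * (x * y) + z * (x * y) ≡ x * (p * m + z) * y
      e = solve-∀
    ... | inj₂ hz | ih = W-ext (λ m → trans (e (sprod (N ℕ.+ p ℕ.* m) L) (f m))
        (cong (λ x → sprod (N ℕ.+ p ℕ.* m) L * x * f m) (trans (sym (hz m)) (cong s (sym (index N (p ℕ.* m) L)))))) (W-* -1ℤ ih)
      where
      e : ∀ x y → -1ℤ * (x * y) ≡ x * -1ℤ * y
      e = solve-∀

    -- Each factor of the product is either constant in m or of the form pm + z, so the change from
    -- m = 0 is a multiple of pm, of weight 1.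
    W-sprod-Δ : ∀ N L {w f} → W w f → W (suc w) (λ m → sprod (N ℕ.+ p ℕ.* m) L * f m - sprod N L * f m)
    W-sprod-Δ N zero    {w} {f} h = W-ext (λ m → sym (ℤₚ.+-inverseʳ (1ℤ * f m))) (W-0 (suc w))
    W-sprod-Δ N (suc L) {f = f} h with s-shift (suc (N ℕ.+ L)) | W-sprod N L h | W-sprod-Δ N L h
    ... | inj₁ (z , hz) | S | ih = W-ext (λ m → trans (e (+ p) (+ m) z (sprod (N ℕ.+ p ℕ.* m) L) (f m) (sprod N L))
        (cong₂ (λ x y → sprod (N ℕ.+ p ℕ.* m) L * x * f m - sprod N L * y * f m) (trans (sym (hz m)) (cong s (sym (index N (p ℕ.* m) L)))) z≡))
        (W-+ (W-pm S) (W-* z ih))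
      where
      e : ∀ p m z x y u → p * m * (x * y) + z * (x * y - u * y) ≡ x * (p * m + z) * y - u * z * y
      e = solve-∀
      z≡ : z ≡ s (suc (N ℕ.+ L))
      z≡ = trans (trans (sym (ℤₚ.+-identityˡ z)) (cong (_+ z) (sym (ℤₚ.*-zeroʳ (+ p))))) (trans (sym (hz 0)) (s₀ (suc (N ℕ.+ L))))
    ... | inj₂ hz | S | ih = W-ext (λ m → trans (e (sprod (N ℕ.+ p ℕ.* m) L) (f m) (sprod N L))
        (cong₂ (λ x y → sprod (N ℕ.+ p ℕ.* m) L * x * f m - sprod N L * y * f m) (trans (sym (hz m)) (cong s (sym (index N (p ℕ.* m) L)))) (trans (sym (hz 0)) (s₀ (suc (N ℕ.+ L))))))
        (W-* -1ℤ ih)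
      where
      e : ∀ x y u → -1ℤ * (x * y - u * y) ≡ x * -1ℤ * y - u * -1ℤ * y
      e = solve-∀

    -- A shifted Wilson theorem: by the reflection formula the product compares Γ_p(-N) with
    -- Γ_p(-N-p), which agree modulo p.
    sprod-p≈1 : ∀ N → 𝔽._≈_ (sprod N p) 1ℤ
    sprod-p≈1 N = *-cancelˡ (Unit-* (unit-to-p 0 (gam-unit (N ℕ.* Q))) (Unit-inv {gam (N ℕ.* Q)} {refl-prod N} (to-p 0 (reflection N)))) (begin
      gam (N ℕ.* Q) * refl-prod N * sprod N p         ≡⟨ ℤₚ.*-assoc (gam (N ℕ.* Q)) (refl-prod N) (sprod N p) ⟩
      gam (N ℕ.* Q) * (refl-prod N * sprod N p)       ≡⟨ cong (gam (N ℕ.* Q) *_) (refl-prod-+ N p) ⟨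
      gam (N ℕ.* Q) * refl-prod (N ℕ.+ p)             ≈⟨ *-congʳ (refl-prod (N ℕ.+ p)) (to-p 0 (L.gam-cong {N ℕ.* Q} {(N ℕ.+ p) ℕ.* Q} per)) ⟩
      gam ((N ℕ.+ p) ℕ.* Q) * refl-prod (N ℕ.+ p)     ≈⟨ to-p 0 (reflection (N ℕ.+ p)) ⟩
      1ℤ                                              ≈⟨ to-p 0 (reflection N) ⟨
      gam (N ℕ.* Q) * refl-prod N                     ≡⟨ ℤₚ.*-identityʳ (gam (N ℕ.* Q) * refl-prod N) ⟨
      gam (N ℕ.* Q) * refl-prod N * 1ℤ                ∎)
      where
      module L = Level 0
      open L using (Q; gam-unit; reflection)
      open 𝔽
      open ≈-Reasoning
      per : L._≈_ (+ (N ℕ.* Q)) (+ ((N ℕ.+ p) ℕ.* Q))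
      per = L.≈-trans (L.i*Q≈-i N) (L.≈-trans (L.neg-cong (from-p (mk -1ℤ (trans (e' (+ N) (+ p)) (cong (_+ -1ℤ * + p) (sym (ℤₚ.pos-+ N p))))))) (L.≈-sym (L.i*Q≈-i (N ℕ.+ p))))
        where
        e' : ∀ N p → N ≡ (N + p) + -1ℤ * p
        e' = solve-∀

    -- Δⁿ Q_r(m) = newtonCoeff r n m · Q_r(m + n) for Q_r(m) = 1/refl-prod (pm + r)
    newtonCoeff : ℕ → ℕ → ℕ → ℤ
    newtonCoeff r zero    m = 1ℤ
    newtonCoeff r (suc j) m = newtonCoeff r j (suc m) - newtonCoeff r j m * sprod (p ℕ.* (m ℕ.+ j) ℕ.+ r) p

    -- With f the j-th coefficient, the next one is Δf - f · (S - 1), where S is the `sprod` of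
    -- length p. The difference gains a weight. In S - 1 the variation of S with m gains one as
    -- well, and the value of S at m = 0 minus 1 is a multiple of p. By `W-at-0` the j-th difference
    -- is then divisible by p^⌊j/2⌋ at m = 0.
    W-newton : ∀ r j → W j (newtonCoeff r j)
    W-newton r zero    = W-const 1ℤ
    W-newton r (suc j) with sprod-p≈1 (p ℕ.* j ℕ.+ r)
    ... | Mod.mk q e = W-ext eq (W-+ (W-Δ h) (W-* -1ℤ (W-+ (W-sprod-Δ N p h) (W-weak (W-p (W-* q h))))))
      where
      N = p ℕ.* j ℕ.+ r
      h = W-newton r j
      f = newtonCoeff r j
      e₁ : ∀ a b S T q p → (a - b) + -1ℤ * ((S * b - T * b) + p * (q * b)) ≡ a - b * (S - T + (1ℤ + q * p))
      e₁ = solve-∀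
      e₂ : ∀ S T → S - T + T ≡ S
      e₂ = solve-∀
      e₃ : ∀ p m j r → (p ℕ.* j ℕ.+ r) ℕ.+ p ℕ.* m ≡ p ℕ.* (m ℕ.+ j) ℕ.+ r
      e₃ = ℕS.solve-∀
      eq : ∀ m → _ ≡ newtonCoeff r (suc j) m
      eq m = trans (e₁ (f (suc m)) (f m) (sprod (N ℕ.+ p ℕ.* m) p) (sprod N p) q (+ p))
        (cong (λ z → f (suc m) - f m * z) (trans (cong (_+_ (sprod (N ℕ.+ p ℕ.* m) p - sprod N p)) (sym e))
           (trans (e₂ (sprod (N ℕ.+ p ℕ.* m) p) (sprod N p)) (cong (λ z → sprod z p) (e₃ p m j r)))))

  -- The Newton series of m ↦ Γ_p(-(pm+r)) and the size of the coefficients of exp(X + X^p/p)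

  module Estimates (F : RationalField) (p : ℕ) (pr : Prime p) (b : ℕ) (p≡1+2b : p ≡ suc (b ℕ.+ b)) (4<p : 4 < p) where
    open FieldLaws F
    open Convolution F
    open PAdic F p pr b p≡1+2b
    open Series F p pr b p≡1+2b
    open GammaP p pr b p≡1+2b using (refl-prod; s)
    open Weight p pr b p≡1+2b

    private instance
      p≢0 = prime⇒nonZero pr

    ε-closed : ∀ j → mp j * fac j * ε j ≡ 1#
    ε-closed zero    = solve 0 (con 1ℤ :* con 1ℤ :* con 1ℤ := con 1ℤ) refl
    ε-closed (suc j) = begin
      - pA * mp j * fac (suc j) * ε (suc j)                ≡⟨ cong (λ z → - pA * mp j * z * ε (suc j)) (fac-suc j) ⟩
      - pA * mp j * (ι (+ suc j) * fac j) * ε (suc j)      ≡⟨ solve 5 (λ p m s f e → (:- p) :* m :* (s :* f) :* e := :- (m :* f :* (p :* s :* e))) refl pA (mp j) (ι (+ suc j)) (fac j) (ε (suc j)) ⟩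
      - (mp j * fac j * (pA * ι (+ suc j) * ε (suc j)))    ≡⟨ cong (λ z → - (mp j * fac j * (z * ε (suc j)))) (ι-ℕ* p (suc j)) ⟨
      - (mp j * fac j * (ι (+ (p ℕ.* suc j)) * ε (suc j))) ≡⟨ cong (λ z → - (mp j * fac j * z)) (ε-rec j) ⟩
      - (mp j * fac j * - ε j)                             ≡⟨ solve 2 (λ x y → :- (x :* (:- y)) := x :* y) refl (mp j * fac j) (ε j) ⟩
      mp j * fac j * ε j                                   ≡⟨ ε-closed j ⟩
      1#                                                   ∎
      where open ≡-Reasoning

    d : ℕ → ℕ → A
    d r i = mp i * x r i

    newton : (ℕ → A) → ℕ → A
    newton f m = sum (suc m) (λ i → ι (falling m 0 i) * f i)

    -- The exact rational value of Γ_p(-(pm+r)), namely 1/`refl-prod (p m + r)` by `Q-refl`.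
    Q : ℕ → ℕ → A
    Q r m = mp m * fac m * conv (x r) ε m

    Q-refl : ∀ r m → r < p → ι (refl-prod (p ℕ.* m ℕ.+ r)) * Q r m ≡ 1#
    Q-refl r m h = trans (solve 4 (λ a m f c → a :* (m :* f :* c) := a :* (m :* f) :* c) refl (ι (refl-prod (p ℕ.* m ℕ.+ r))) (mp m) (fac m) (conv (x r) ε m))
      (trans (cong (_* conv (x r) ε m) (sym (fac-refl m r h))) (conv-x-ε m r h))

    -- In the i-th summand of the convolution, ε_(m-i) cancels (-p)^(m-i) (m-i)!; what remains of
    -- (-p)^m m! is (-p)^i times the falling factorial.
    Q-newton : ∀ r m → Q r m ≡ newton (d r) m
    Q-newton r m = trans (sum-*ˡ (suc m) (mp m * fac m) _) (sum-cong (suc m) (λ i i<1+m → term i (m ∸ i) (ℕₚ.m+[n∸m]≡n (ℕ.s≤s⁻¹ i<1+m))))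
      where
      open ≡-Reasoning
      term : ∀ i j → i ℕ.+ j ≡ m → mp m * fac m * (x r i * ε j) ≡ ι (falling m 0 i) * d r i
      term i j refl = begin
        mp (i ℕ.+ j) * fac (i ℕ.+ j) * (x r i * ε j)    ≡⟨ cong₂ (λ u v → u * v * (x r i * ε j)) (mp-+ i j) (trans (cong ι (falling-! i j)) (ι-* (falling (i ℕ.+ j) 0 i) (+ (j !)))) ⟩
        mp i * mp j * (φ * fac j) * (x r i * ε j)       ≡⟨ solve 6 (λ a b c d e f → a :* b :* (c :* d) :* (e :* f) := c :* (a :* e) :* (b :* d :* f)) refl (mp i) (mp j) φ (fac j) (x r i) (ε j) ⟩
        φ * (mp i * x r i) * (mp j * fac j * ε j)       ≡⟨ cong (φ * (mp i * x r i) *_) (ε-closed j) ⟩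
        φ * (mp i * x r i) * 1#                         ≡⟨ *-identityʳ (φ * (mp i * x r i)) ⟩
        φ * (mp i * x r i)                              ∎
        where φ = ι (falling (i ℕ.+ j) 0 i)

    -- The effect of Δ on the coefficients of a series in falling factorials, as Δ (m)_(i+1) = (i+1)
    -- (m)_i.
    deriv : (ℕ → A) → ℕ → A
    deriv f i = ι (+ suc i) * f (suc i)

    derivs : ℕ → (ℕ → A) → ℕ → A
    derivs zero    f = f
    derivs (suc j) f = deriv (derivs j f)

    derivs-fac : ∀ j f i → derivs j f i * fac i ≡ fac (i ℕ.+ j) * f (i ℕ.+ j)
    derivs-fac zero    f i = trans (*-comm (f i) (fac i)) (cong (λ z → fac z * f z) (sym (ℕₚ.+-identityʳ i)))
    derivs-fac (suc j) f i = begin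
      ι (+ suc i) * derivs j f (suc i) * fac i     ≡⟨ solve 3 (λ a b c → a :* b :* c := b :* (a :* c)) refl (ι (+ suc i)) (derivs j f (suc i)) (fac i) ⟩
      derivs j f (suc i) * (ι (+ suc i) * fac i)   ≡⟨ cong (derivs j f (suc i) *_) (fac-suc i) ⟨
      derivs j f (suc i) * fac (suc i)             ≡⟨ derivs-fac j f (suc i) ⟩
      fac (suc i ℕ.+ j) * f (suc i ℕ.+ j)          ≡⟨ cong (λ z → fac z * f z) (ℕₚ.+-suc i j) ⟨
      fac (i ℕ.+ suc j) * f (i ℕ.+ suc j)          ∎
      where open ≡-Reasoning

    newton-Δ : ∀ f m → newton f (suc m) - newton f m ≡ newton (deriv f) m
    newton-Δ f m = begin
      newton f (suc m) - newton f m
        ≡⟨ cong₂ _-_ (sum-first (suc m) _) (trans (sym extend) (sum-first (suc m) _)) ⟩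
      (1# * f 0 + sum (suc m) u) - (1# * f 0 + sum (suc m) v)   ≡⟨ solve 3 (λ a b c → (a :+ b) :- (a :+ c) := b :+ (:- c)) refl (1# * f 0) (sum (suc m) u) (sum (suc m) v) ⟩
      sum (suc m) u + - sum (suc m) v                           ≡⟨ cong (_+_ (sum (suc m) u)) (sum-neg (suc m) v) ⟨
      sum (suc m) u + sum (suc m) (λ i → - v i)                 ≡⟨ sum-+ (suc m) u _ ⟨
      sum (suc m) (λ i → u i + - v i)                           ≡⟨ sum-cong (suc m) (λ i _ → term i) ⟩
      newton (deriv f) m                                        ∎
      where
      open ≡-Reasoning
      u v : ℕ → A
      u i = ι (falling (suc m) 0 (suc i)) * f (suc i)
      v i = ι (falling m 0 (suc i)) * f (suc i)
      -- The added term is (m)_(m+1) = 0; it gives both sums the same length.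
      extend : sum (suc (suc m)) (λ i → ι (falling m 0 i) * f i) ≡ newton f m
      extend = trans (cong (_+_ (newton f m)) (trans (cong (λ z → ι z * f (suc m)) (falling-vanish m (suc m) (ℕₚ.n<1+n m))) (zeroˡ (f (suc m))))) (+-identityʳ (newton f m))
      e : ∀ m i φ → (1ℤ ℤ.+ m) ℤ.* φ ≡ φ ℤ.* (m ℤ.- i) ℤ.+ (1ℤ ℤ.+ i) ℤ.* φ
      e = solve-∀
      term : ∀ i → u i + - v i ≡ ι (falling m 0 i) * deriv f i
      term i = begin
        ι (falling (suc m) 0 (suc i)) * f (suc i) + - v i
          ≡⟨ cong (λ z → ι z * f (suc i) + - v i) (trans (falling-suc-front m i) (e (+ m) (+ i) φ)) ⟩
        ι (φ ℤ.* (+ m ℤ.- + i) ℤ.+ + suc i ℤ.* φ) * f (suc i) + - v i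
          ≡⟨ cong (λ z → z * f (suc i) + - v i) (trans (ι-+ (falling m 0 (suc i)) (+ suc i ℤ.* φ)) (cong (_+_ (ι (falling m 0 (suc i)))) (ι-* (+ suc i) φ))) ⟩
        (ι (falling m 0 (suc i)) + ι (+ suc i) * ι φ) * f (suc i) + - v i
          ≡⟨ solve 4 (λ a b c d → (a :+ b :* c) :* d :+ (:- (a :* d)) := c :* (b :* d)) refl (ι (falling m 0 (suc i))) (ι (+ suc i)) (ι φ) (f (suc i)) ⟩
        ι φ * (ι (+ suc i) * f (suc i)) ∎
        where φ = falling m 0 i

    Q-step : ∀ r m → r < p → Q r m ≡ ι (sprod (p ℕ.* m ℕ.+ r) p) * Q r (suc m)
    Q-step r m h = begin
      Q r m                                             ≡⟨ *-identityʳ (Q r m) ⟨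
      Q r m * 1#                                        ≡⟨ cong (Q r m *_) (Q-refl r (suc m) h) ⟨
      Q r m * (ι (refl-prod (p ℕ.* suc m ℕ.+ r)) * q')  ≡⟨ cong (λ z → Q r m * (ι z * q')) (trans (cong refl-prod (e p m r)) (refl-prod-+ N p)) ⟩
      Q r m * (ι (refl-prod N ℤ.* sprod N p) * q')      ≡⟨ cong (λ z → Q r m * (z * q')) (ι-* (refl-prod N) (sprod N p)) ⟩
      Q r m * (ι (refl-prod N) * ι (sprod N p) * q')    ≡⟨ solve 4 (λ a b c d → a :* (b :* c :* d) := b :* a :* (c :* d)) refl (Q r m) (ι (refl-prod N)) (ι (sprod N p)) q' ⟩
      ι (refl-prod N) * Q r m * (ι (sprod N p) * q')    ≡⟨ cong (_* (ι (sprod N p) * q')) (Q-refl r m h) ⟩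
      1# * (ι (sprod N p) * q')                         ≡⟨ *-identityˡ (ι (sprod N p) * q') ⟩
      ι (sprod N p) * q'                                ∎
      where
      open ≡-Reasoning
      N = p ℕ.* m ℕ.+ r
      q' = Q r (suc m)
      e : ∀ p m r → p ℕ.* suc m ℕ.+ r ≡ p ℕ.* m ℕ.+ r ℕ.+ p
      e = ℕS.solve-∀

    newton-derivs : ∀ r → r < p → ∀ j m → newton (derivs j (d r)) m ≡ ι (newtonCoeff r j m) * Q r (m ℕ.+ j)
    newton-derivs r h zero    m = trans (sym (Q-newton r m)) (trans (cong (Q r) (sym (ℕₚ.+-identityʳ m))) (sym (*-identityˡ (Q r (m ℕ.+ 0)))))
    newton-derivs r h (suc j) m = begin
      newton (deriv (derivs j (d r))) m                                          ≡⟨ newton-Δ (derivs j (d r)) m ⟨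
      newton (derivs j (d r)) (suc m) - newton (derivs j (d r)) m                ≡⟨ cong₂ _-_ (newton-derivs r h j (suc m)) (newton-derivs r h j m) ⟩
      ι a * q' - ι a' * Q r (m ℕ.+ j)                                            ≡⟨ cong (λ z → ι a * q' - ι a' * z) (Q-step r (m ℕ.+ j) h) ⟩
      ι a * q' - ι a' * (ι S * q')                                               ≡⟨ solve 4 (λ a b s q → a :* q :- b :* (s :* q) := (a :+ (:- (b :* s))) :* q) refl (ι a) (ι a') (ι S) q' ⟩
      (ι a + - (ι a' * ι S)) * q'                                                ≡⟨ cong (_* q') (trans (ι-+ a (ℤ.- (a' ℤ.* S))) (cong (_+_ (ι a)) (trans (ι-neg (a' ℤ.* S)) (cong -_ (ι-* a' S))))) ⟨
      ι (a ℤ.- a' ℤ.* S) * q'                                                    ≡⟨ cong (λ z → ι (a ℤ.- a' ℤ.* S) * Q r z) (ℕₚ.+-suc m j) ⟨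
      ι (a ℤ.- a' ℤ.* S) * Q r (m ℕ.+ suc j)                                     ∎
      where
      open ≡-Reasoning
      a = newtonCoeff r j (suc m)
      a' = newtonCoeff r j m
      S = sprod (p ℕ.* (m ℕ.+ j) ℕ.+ r) p
      q' = Q r (suc m ℕ.+ j)

    O-unitℤ : ∀ z {k y} → p ∤ ∣ z ∣ → O k (ι z * y) → O k y
    O-unitℤ (+ u)      {k} {y} nu h = O-unit u nu h
    O-unitℤ -[1+ u ]   {k} {y} nu h = O-unit (suc u) nu (subst (O k) (trans (cong (λ z → - (z * y)) (ι-neg (+ suc u))) (solve 2 (λ a y → :- ((:- a) :* y) := a :* y) refl (ι (+ suc u)) y)) (O-neg h))

    p∤refl-prod : ∀ i → p ∤ ∣ refl-prod i ∣
    p∤refl-prod zero    = p∤1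
    p∤refl-prod (suc i) h = p∤* (p∤refl-prod i) p∤s (subst (p ∣_) (ℤₚ.abs-* (refl-prod i) (s (suc i))) h)
      where
      p∤s : p ∤ ∣ s (suc i) ∣
      p∤s h with p ∣? suc i
      ... | yes _ = p∤1 h
      ... | no nd = nd h

    Q-O : ∀ r m → r < p → O 0 (Q r m)
    Q-O r m h = O-unitℤ (refl-prod (p ℕ.* m ℕ.+ r)) (p∤refl-prod (p ℕ.* m ℕ.+ r)) (subst (O 0) (sym (Q-refl r m h)) (O-ι 1ℤ))

    -- The left side j! d_j is the j-th difference of `Q r` at 0, hence `newtonCoeff r j 0` times
    -- the p-integral number `Q r j`.
    O-fac-d : ∀ r → r < p → ∀ j i → i ℕ.+ i ≤ j → O i (fac j * d r j)
    O-fac-d r h j i le = subst (O i) (begin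
      ι (newtonCoeff r j 0) * Q r j       ≡⟨ newton-derivs r h j 0 ⟨
      0# + 1# * derivs j (d r) 0          ≡⟨ solve 1 (λ a → con 0ℤ :+ con 1ℤ :* a := a :* con 1ℤ) refl (derivs j (d r) 0) ⟩
      derivs j (d r) 0 * fac 0            ≡⟨ derivs-fac j (d r) 0 ⟩
      fac j * d r j                       ∎)
      (subst (λ z → O z (ι (newtonCoeff r j 0) * Q r j)) (ℕₚ.+-identityʳ i) (O-* (≈0⇒O i (W-at-0 (W-newton r j) i le)) (Q-O r j h)))
      where open ≡-Reasoning

    -- v_p(N!) ≤ N/(p-1) ≤ N/4
    legendre : ∀ N e j y → N ≤ 4 ℕ.* j → O e (fac N * y) → O e (p^ j * y)
    legendre = <-rec _ step
      where
      step : ∀ N → (∀ {M} → M < N → ∀ e j y → M ≤ 4 ℕ.* j → O e (fac M * y) → O e (p^ j * y)) →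
        ∀ e j y → N ≤ 4 ℕ.* j → O e (fac N * y) → O e (p^ j * y)
      step zero    ih e j y le h = O-ι* (+ (p ℕ.^ j)) (subst (O e) (*-identityˡ y) h)
      step N@(suc _) ih e j y le h =
        -- N! is a p-adic unit times p^q q! with q = ⌊N/p⌋. From 5q ≤ N ≤ 4j it follows that q ≤
        -- 4(j-q), so the induction hypothesis applies to q! with the budget j - q.
        subst (O e) eq (ih q<N e (j ∸ q) (p^ q * y) q≤ (subst (O e) (*-assoc (fac q) (p^ q) y) (unsgn (O-unitℤ (refl-prod N') (p∤refl-prod N') (subst (O e) eq₁ h)))))
        where
        q = N / p
        r = N % p
        N' = p ℕ.* q ℕ.+ r
        N≡ : N ≡ N'
        N≡ = trans (m≡m%n+[m/n]*n N p) (trans (ℕₚ.+-comm r (q ℕ.* p)) (cong (ℕ._+ r) (ℕₚ.*-comm q p)))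
        5q≤N : 5 ℕ.* q ≤ N
        5q≤N = ℕₚ.≤-trans (ℕₚ.*-monoˡ-≤ q 4<p) (subst (_≤ N) (ℕₚ.*-comm q p) (m/n*n≤m N p))
        5q≤4j : 5 ℕ.* q ≤ 4 ℕ.* j
        5q≤4j = ℕₚ.≤-trans 5q≤N le
        e5 : ∀ q → 5 ℕ.* q ≡ 4 ℕ.* q ℕ.+ q
        e5 = ℕS.solve-∀
        q≤j : q ≤ j
        q≤j = ℕₚ.*-cancelˡ-≤ 4 (ℕₚ.≤-trans (subst (4 ℕ.* q ≤_) (sym (e5 q)) (ℕₚ.m≤m+n (4 ℕ.* q) q)) 5q≤4j)
        q≤ : q ≤ 4 ℕ.* (j ∸ q)
        q≤ = ℕₚ.+-cancelˡ-≤ (4 ℕ.* q) q (4 ℕ.* (j ∸ q)) (subst₂ _≤_ (e5 q) (trans (cong (4 ℕ.*_) (sym (ℕₚ.m+[n∸m]≡n q≤j))) (ℕₚ.*-distribˡ-+ 4 q (j ∸ q))) 5q≤4j)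
        q<N : q < N
        q<N = h' q 5q≤N
          where
          e₅ : ∀ q' → suc (suc q' ℕ.+ 3 ℕ.* suc q') ℕ.+ q' ≡ 5 ℕ.* suc q'
          e₅ = ℕS.solve-∀
          h' : ∀ q → 5 ℕ.* q ≤ N → q < N
          h' zero     _   = s≤s z≤n
          h' (suc q') 5q≤ = ℕₚ.≤-trans (s≤s (ℕₚ.m≤m+n (suc q') (3 ℕ.* suc q'))) (ℕₚ.≤-trans (subst (suc (suc q' ℕ.+ 3 ℕ.* suc q') ≤_) (e₅ q') (ℕₚ.m≤m+n _ q')) 5q≤)
        eq₁ : fac N * y ≡ ι (refl-prod N') * (sgn q * (fac q * p^ q * y))
        eq₁ = trans (cong (λ z → fac z * y) N≡) (trans (cong (_* y) (trans (fac-refl q r (m%n<n N p)) (cong (λ z → ι (refl-prod N') * (z * fac q)) (mp-sgn q))))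
           (solve 5 (λ a b c d y → a :* (b :* c :* d) :* y := a :* (b :* (d :* c :* y))) refl (ι (refl-prod N')) (sgn q) (p^ q) (fac q) y))
        unsgn : ∀ {y} → O e (sgn q * y) → O e y
        unsgn {y} h = subst (O e) (trans (cong (_* (sgn q * y)) (sym (sgn-ι q))) (trans (sym (*-assoc (sgn q) (sgn q) y)) (trans (cong (_* y) (trans (sym (sgn-+ q q)) (sgn-2 q))) (*-identityˡ y)))) (O-ι* (-1ℤ ℤ.^ q) h)
        eq : p^ (j ∸ q) * (p^ q * y) ≡ p^ j * y
        eq = trans (sym (*-assoc (p^ (j ∸ q)) (p^ q) y)) (cong (_* y) (trans (sym (p^-+ (j ∸ q) q)) (cong p^ (ℕₚ.m∸n+n≡m q≤j))))

    -- The analogue of Dwork's bound on the coefficients of his splitting function.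
    c-bound : ∀ q j N → q ℕ.* 4 ≤ j → N < p ℕ.* suc j → O q (pA * (p^ j * c N))
    c-bound q j N 4q≤j N< = O-weaken q≤ (subst (O ((j ∸ n₁) ℕ.+ q₁)) eq (O-* (O-p^ (j ∸ n₁)) (O-ι* (-1ℤ ℤ.^ n₁) step₁)))
      where
      n₁ = N / p
      r = N % p
      q₁ = n₁ / 4
      N≡ : p ℕ.* n₁ ℕ.+ r ≡ N
      N≡ = sym (trans (m≡m%n+[m/n]*n N p) (trans (ℕₚ.+-comm r (n₁ ℕ.* p)) (cong (ℕ._+ r) (ℕₚ.*-comm n₁ p))))
      n₁≤j : n₁ ≤ j
      n₁≤j = ℕ.s≤s⁻¹ (ℕₚ.*-cancelˡ-< p n₁ (suc j) (ℕₚ.≤-<-trans (subst (_≤ N) (ℕₚ.*-comm n₁ p) (m/n*n≤m N p)) N<))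
      n₁< : n₁ < 4 ℕ.+ q₁ ℕ.* 4
      n₁< = subst (_< 4 ℕ.+ q₁ ℕ.* 4) (sym (m≡m%n+[m/n]*n n₁ 4)) (ℕₚ.+-monoˡ-< (q₁ ℕ.* 4) (m%n<n n₁ 4))
      2q₁≤ : (q₁ ℕ.+ q₁) ℕ.+ (q₁ ℕ.+ q₁) ≤ n₁
      2q₁≤ = subst (_≤ n₁) (e q₁) (m/n*n≤m n₁ 4)
        where
        e : ∀ q → q ℕ.* 4 ≡ (q ℕ.+ q) ℕ.+ (q ℕ.+ q)
        e = ℕS.solve-∀
      -- n₁! d is divisible by p^(2q₁), and n₁ ≤ 4(q₁+1) allows n₁! at most q₁ + 1 factors p. This
      -- leaves p^(q₁-1), which explains the factor p in the bound.
      step₁ : O q₁ (pA * d r n₁)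
      step₁ = O-unp q₁ (subst (O (q₁ ℕ.+ q₁)) (trans (cong (_* d r n₁) (p^-suc q₁)) (solve 3 (λ a b c → a :* b :* c := b :* (a :* c)) refl pA (p^ q₁) (d r n₁)))
         (legendre n₁ (q₁ ℕ.+ q₁) (suc q₁) (d r n₁) (ℕₚ.≤-trans (ℕₚ.<⇒≤ n₁<) (ℕₚ.≤-reflexive (e q₁))) (O-fac-d r (m%n<n N p) n₁ (q₁ ℕ.+ q₁) 2q₁≤)))
        where
        e : ∀ q → 4 ℕ.+ q ℕ.* 4 ≡ 4 ℕ.* suc q
        e = ℕS.solve-∀
      q≤ : q ≤ (j ∸ n₁) ℕ.+ q₁
      q≤ = ℕ.s≤s⁻¹ (ℕₚ.*-cancelʳ-< 4 q (suc ((j ∸ n₁) ℕ.+ q₁)) (ℕₚ.≤-<-trans 4q≤j (subst (_< suc ((j ∸ n₁) ℕ.+ q₁) ℕ.* 4) (ℕₚ.m∸n+n≡m n₁≤j)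
             (ℕₚ.<-≤-trans (ℕₚ.+-monoʳ-< (j ∸ n₁) n₁<) (ℕₚ.≤-trans (ℕₚ.+-monoˡ-≤ (4 ℕ.+ q₁ ℕ.* 4) (ℕₚ.m≤m*n (j ∸ n₁) 4)) (ℕₚ.≤-reflexive (e (j ∸ n₁) q₁)))))))
        where
        e : ∀ x y → x ℕ.* 4 ℕ.+ (4 ℕ.+ y ℕ.* 4) ≡ suc (x ℕ.+ y) ℕ.* 4
        e = ℕS.solve-∀
      open ≡-Reasoning
      eq : p^ (j ∸ n₁) * (ι (-1ℤ ℤ.^ n₁) * (pA * d r n₁)) ≡ pA * (p^ j * c N)
      eq = begin
        p^ (j ∸ n₁) * (ι (-1ℤ ℤ.^ n₁) * (pA * (mp n₁ * c (p ℕ.* n₁ ℕ.+ r))))   ≡⟨ cong₂ (λ u v → p^ (j ∸ n₁) * (u * (pA * (v * c (p ℕ.* n₁ ℕ.+ r))))) (sym (sgn-ι n₁)) (mp-sgn n₁) ⟩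
        p^ (j ∸ n₁) * (sgn n₁ * (pA * (sgn n₁ * p^ n₁ * c (p ℕ.* n₁ ℕ.+ r))))   ≡⟨ cong (λ z → p^ (j ∸ n₁) * (sgn n₁ * (pA * (sgn n₁ * p^ n₁ * c z)))) N≡ ⟩
        p^ (j ∸ n₁) * (sgn n₁ * (pA * (sgn n₁ * p^ n₁ * c N)))
          ≡⟨ solve 5 (λ a s p b c → a :* (s :* (p :* (s :* b :* c))) := (s :* s) :* (p :* (a :* b :* c))) refl (p^ (j ∸ n₁)) (sgn n₁) pA (p^ n₁) (c N) ⟩
        sgn n₁ * sgn n₁ * (pA * (p^ (j ∸ n₁) * p^ n₁ * c N))     ≡⟨ cong₂ (λ u v → u * (pA * (v * c N))) (trans (sym (sgn-+ n₁ n₁)) (sgn-2 n₁)) (trans (sym (p^-+ (j ∸ n₁) n₁)) (cong p^ (ℕₚ.m∸n+n≡m n₁≤j))) ⟩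
        1# * (pA * (p^ j * c N))                                 ≡⟨ *-identityˡ (pA * (p^ j * c N)) ⟩
        pA * (p^ j * c N)                                        ∎

-- Γ_p(a/(p-1)) as a sum over the coefficients c_(a+j(p-1)), and the quadratic relation

module DworkCongruence where
  open import Data.Nat as ℕ using (ℕ; zero; suc; _<_; _≤_; z≤n; s≤s; _∸_)
  import Data.Nat.Properties as ℕₚ
  open import Data.Nat.Primality using (Prime; prime⇒nonZero)
  import Data.Nat.Tactic.RingSolver as ℕS
  open import Data.Integer as ℤ using (+_; 0ℤ; 1ℤ; -1ℤ)
  import Data.Integer.Properties as ℤₚ
  open import Relation.Binary.PropositionalEquality as ≡ using (_≡_; refl; cong; cong₂; subst; sym; trans; module ≡-Reasoning)
  open import Data.Nat.DivMod using (_/_; m≡m%n+[m/n]*n; m%n<n; m/n*n≤m)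
  open import Data.Integer.Tactic.RingSolver using (solve-∀)
  open FiniteSums
  open ModularArithmetic
  open MoritaGamma
  open RationalValuation
  open GaussMultiplication
  open ExponentialSeries
  open CoefficientBounds

  module DworkSum (F : RationalField) (p : ℕ) (pr : Prime p) (b' : ℕ) (p≡1+2b : p ≡ suc (suc b' ℕ.+ suc b')) (4<p : 4 < p) where
    private
      b : ℕ
      b = suc b'
    open FieldLaws F
    open Convolution F
    open PAdic F p pr b p≡1+2b
    open Series F p pr b p≡1+2b
    open Estimates F p pr b p≡1+2b 4<p

    private instance
      p≢0 = prime⇒nonZero pr

    private
      n : ℕ
      n = p ∸ 1
      p≡1+n : p ≡ suc n
      p≡1+n = sym (ℕₚ.suc-pred p)
      n≡2b : n ≡ b ℕ.+ b
      n≡2b = cong ℕ.pred p≡1+2b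

      suc∸ : ∀ {M i} → i ≤ M → suc M ∸ i ≡ suc (M ∸ i)
      suc∸ i≤M = ℕₚ.+-∸-assoc 1 i≤M

      O-sgn* : ∀ {k y} j → O k y → O k (sgn j * y)
      O-sgn* {k} {y} j h = subst (λ z → O k (z * y)) (sym (sgn-ι j)) (O-ι* (-1ℤ ℤ.^ j) h)

      O-negp* : ∀ {k y} → O k y → O k (- pA * y)
      O-negp* {k} {y} h = subst (λ z → O k (z * y)) (ι-neg (+ p)) (O-ι* (ℤ.- (+ p)) h)

    -- t a j are the terms of the Gauss sum (up to normalisation) attached to a, and g a R its partial sums.
    t : ℕ → ℕ → A
    t a j = mp j * c (n ℕ.* j ℕ.+ a)

    g : ℕ → ℕ → A
    g a R = sum R (t a)

    private
      t-index : ∀ a j → a < p → n ℕ.* j ℕ.+ a < p ℕ.* suc j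
      t-index a j a<p = subst (n ℕ.* j ℕ.+ a <_) (sym (trans (ℕₚ.*-suc p j) (ℕₚ.+-comm p (p ℕ.* j))))
        (ℕₚ.+-mono-≤-< (ℕₚ.*-monoˡ-≤ j (ℕₚ.m∸n≤m p 1)) a<p)

    mp-bound : ∀ q j N → q ℕ.* 4 ≤ j → N < p ℕ.* suc j → O q (pA * (mp j * c N))
    mp-bound q j N le lt = subst (O q) (trans (solve 4 (λ s p m c → s :* (p :* (m :* c)) := p :* (s :* m :* c)) refl (sgn j) pA (p^ j) (c N))
      (cong (λ z → pA * (z * c N)) (sym (mp-sgn j)))) (O-sgn* j (c-bound q j N le lt))

    mp-small : ∀ e j N → suc e ℕ.* 4 ≤ j → N < p ℕ.* suc j → O e (mp j * c N)
    mp-small e j N le lt = O-unp₁ (mp-bound (suc e) j N le lt)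

    -- A double family, essentially (-p)^(i+u) c_(ni+pu+a) times a falling factorial of length u,
    -- joins the terms `t a i` (at u = 0) to the terms of the Newton series of `Q a m` (at i = 0).
    -- The hypothesis says m ≡ -a/(p-1) modulo p^(e+1), and for such m the recurrence of c trades a
    -- step in u for a step in i with an error that contains p^(e+1).
    module Telescope (e : ℕ) (a : ℕ) (a<p : a < p) (m : ℕ) (nm+a : n ℕ.* m ℕ.+ a ≡ a ℕ.* p ℕ.^ suc e) where

      cc : ℕ → ℕ → A
      cc i u = c (n ℕ.* i ℕ.+ p ℕ.* u ℕ.+ a)

      cc-rec : ∀ i v → ι (+ (n ℕ.* i ℕ.+ p ℕ.* suc v ℕ.+ a)) * cc i (suc v) ≡ cc (suc i) v + cc i v
      cc-rec i v = trans (c-rec N) (cong₂ _+_ (cong (shift c) (trans (e₁ n i p v a) (trans (cong (λ q → q ℕ.+ (n ℕ.* i ℕ.+ p ℕ.* v ℕ.+ a)) p≡1+n) (e₂ n i p v a))))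
          (trans (cong (shiftBy p c) (e₁ n i p v a)) (shiftBy-+ p c (n ℕ.* i ℕ.+ p ℕ.* v ℕ.+ a))))
        where
        N = n ℕ.* i ℕ.+ p ℕ.* suc v ℕ.+ a
        e₁ : ∀ n i p v a → n ℕ.* i ℕ.+ p ℕ.* suc v ℕ.+ a ≡ p ℕ.+ (n ℕ.* i ℕ.+ p ℕ.* v ℕ.+ a)
        e₁ = ℕS.solve-∀
        e₂ : ∀ n i p v a → suc n ℕ.+ (n ℕ.* i ℕ.+ p ℕ.* v ℕ.+ a) ≡ suc (n ℕ.* suc i ℕ.+ p ℕ.* v ℕ.+ a)
        e₂ = ℕS.solve-∀

      α β err : ℕ → ℕ → A
      α i u = mp (i ℕ.+ u) * (ι (falling m (suc i) u) * cc i u)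
      β i u = mp (i ℕ.+ u) * (ι (falling m i u) * cc i u)
      err i v = mp (i ℕ.+ suc v) * (ι (falling m (suc i) v) * (ι (+ (a ℕ.* p ℕ.^ suc e)) * cc i (suc v)))

      -- c-rec, with n i + p(v+1) + a = (m-i) - p(m-(i+1+v)) + (n m + a).
      exchange : ∀ i v → (β (suc i) v - β i (suc v)) + pA * (α i (suc v) - α i v) ≡ err i v
      exchange i v = begin
        (β (suc i) v - β i (suc v)) + pA * (α i (suc v) - α i v)
          ≡⟨ cong₂ (λ x y → (x - y) + pA * (α i (suc v) - α i v)) (cong (λ z → mp z * (Φ * C₁)) (sym (ℕₚ.+-suc i v)))
               (cong (λ z → M * (z * C)) (trans (cong ι (falling-front m i v)) (ι-* (+ m ℤ.- + i) φ))) ⟩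
        (M * (Φ * C₁) - M * (D₁ * Φ * C)) + pA * (α i (suc v) - mp (i ℕ.+ v) * (Φ * C₀))
          ≡⟨ cong (λ z → (M * (Φ * C₁) - M * (D₁ * Φ * C)) + pA * (M * (z * C) - mp (i ℕ.+ v) * (Φ * C₀))) (ι-* φ (+ m ℤ.- + (suc i ℕ.+ v))) ⟩
        (M * (Φ * C₁) - M * (D₁ * Φ * C)) + pA * (M * (Φ * D₂ * C) - mp (i ℕ.+ v) * (Φ * C₀))
          ≡⟨ solve 8 (λ M Φ C₁ D C p D₂ y → (M :* (Φ :* C₁) :- M :* (D :* Φ :* C)) :+ p :* (M :* (Φ :* D₂ :* C) :- y)
                 := M :* (Φ :* C₁) :- M :* (D :* Φ :* C) :+ p :* M :* (Φ :* D₂ :* C) :+ (:- (p :* y))) refl M Φ C₁ D₁ C pA D₂ (mp (i ℕ.+ v) * (Φ * C₀)) ⟩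
        M * (Φ * C₁) - M * (D₁ * Φ * C) + pA * M * (Φ * D₂ * C) + - (pA * (mp (i ℕ.+ v) * (Φ * C₀)))
          ≡⟨ cong (λ z → M * (Φ * C₁) - M * (D₁ * Φ * C) + pA * M * (Φ * D₂ * C) + z)
               (trans (solve 3 (λ p m y → :- (p :* (m :* y)) := (:- p) :* m :* y) refl pA (mp (i ℕ.+ v)) (Φ * C₀)) (cong (λ z → mp z * (Φ * C₀)) (sym (ℕₚ.+-suc i v)))) ⟩
        M * (Φ * C₁) - M * (D₁ * Φ * C) + pA * M * (Φ * D₂ * C) + M * (Φ * C₀)
          ≡⟨ solve 8 (λ M Φ C₁ D C p D₂ C₀ → M :* (Φ :* C₁) :- M :* (D :* Φ :* C) :+ p :* M :* (Φ :* D₂ :* C) :+ M :* (Φ :* C₀)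
                 := M :* (Φ :* ((C₁ :+ C₀) :+ (p :* D₂ :+ (:- D)) :* C))) refl M Φ C₁ D₁ C pA D₂ C₀ ⟩
        M * (Φ * ((C₁ + C₀) + (pA * D₂ + - D₁) * C))      ≡⟨ cong (λ z → M * (Φ * (z + (pA * D₂ + - D₁) * C))) (cc-rec i v) ⟨
        M * (Φ * (ι (+ N) * C + (pA * D₂ + - D₁) * C))    ≡⟨ cong (λ z → M * (Φ * z)) (distribʳ C (ι (+ N)) (pA * D₂ + - D₁)) ⟨
        M * (Φ * ((ι (+ N) + (pA * D₂ + - D₁)) * C))      ≡⟨ cong (λ z → M * (Φ * (z * C))) integer ⟩
        err i v                                           ∎
        where
        open ≡-Reasoning
        M = mp (i ℕ.+ suc v)
        φ = falling m (suc i) v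
        Φ = ι φ
        C₁ = cc (suc i) v
        C₀ = cc i v
        C = cc i (suc v)
        D₁ = ι (+ m ℤ.- + i)
        D₂ = ι (+ m ℤ.- + (suc i ℕ.+ v))
        N = n ℕ.* i ℕ.+ p ℕ.* suc v ℕ.+ a
        N≡ : + N ≡ + n ℤ.* + i ℤ.+ + p ℤ.* + suc v ℤ.+ + a
        N≡ = trans (ℤₚ.pos-+ (n ℕ.* i ℕ.+ p ℕ.* suc v) a) (cong (ℤ._+ + a) (trans (ℤₚ.pos-+ (n ℕ.* i) (p ℕ.* suc v)) (cong₂ ℤ._+_ (ℤₚ.pos-* n i) (ℤₚ.pos-* p (suc v)))))
        p≡ : + p ≡ 1ℤ ℤ.+ + n
        p≡ = trans (cong +_ p≡1+n) (ℤₚ.pos-+ 1 n)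
        ident : ∀ n i v a m → (n ℤ.* i ℤ.+ (1ℤ ℤ.+ n) ℤ.* (1ℤ ℤ.+ v) ℤ.+ a) ℤ.+ ((1ℤ ℤ.+ n) ℤ.* (m ℤ.- ((1ℤ ℤ.+ i) ℤ.+ v)) ℤ.+ ℤ.- (m ℤ.- i)) ≡ n ℤ.* m ℤ.+ a
        ident = solve-∀
        integer : ι (+ N) + (pA * D₂ + - D₁) ≡ ι (+ (a ℕ.* p ℕ.^ suc e))
        integer = begin
          ι (+ N) + (pA * D₂ + - D₁)                                       ≡⟨ cong (λ z → ι (+ N) + (z + - D₁)) (ι-* (+ p) (+ m ℤ.- + (suc i ℕ.+ v))) ⟨
          ι (+ N) + (ι (+ p ℤ.* (+ m ℤ.- + (suc i ℕ.+ v))) + - D₁)         ≡⟨ cong (λ z → ι (+ N) + (ι (+ p ℤ.* (+ m ℤ.- + (suc i ℕ.+ v))) + z)) (ι-neg (+ m ℤ.- + i)) ⟨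
          ι (+ N) + (ι (+ p ℤ.* (+ m ℤ.- + (suc i ℕ.+ v))) + ι (ℤ.- (+ m ℤ.- + i)))  ≡⟨ cong (_+_ (ι (+ N))) (ι-+ (+ p ℤ.* (+ m ℤ.- + (suc i ℕ.+ v))) (ℤ.- (+ m ℤ.- + i))) ⟨
          ι (+ N) + ι (+ p ℤ.* (+ m ℤ.- + (suc i ℕ.+ v)) ℤ.+ ℤ.- (+ m ℤ.- + i))      ≡⟨ ι-+ (+ N) (+ p ℤ.* (+ m ℤ.- + (suc i ℕ.+ v)) ℤ.+ ℤ.- (+ m ℤ.- + i)) ⟨
          ι (+ N ℤ.+ (+ p ℤ.* (+ m ℤ.- + (suc i ℕ.+ v)) ℤ.+ ℤ.- (+ m ℤ.- + i)))      ≡⟨ cong ι (trans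
             (cong₂ (λ x q → x ℤ.+ (q ℤ.* (+ m ℤ.- + (suc i ℕ.+ v)) ℤ.+ ℤ.- (+ m ℤ.- + i))) (trans N≡ (cong (λ q → + n ℤ.* + i ℤ.+ q ℤ.* + suc v ℤ.+ + a) p≡)) p≡)
             (trans (cong (λ y → (+ n ℤ.* + i ℤ.+ (1ℤ ℤ.+ + n) ℤ.* + suc v ℤ.+ + a) ℤ.+ ((1ℤ ℤ.+ + n) ℤ.* (+ m ℤ.- y) ℤ.+ ℤ.- (+ m ℤ.- + i))) (ℤₚ.pos-+ (suc i) v))
               (trans (ident (+ n) (+ i) (+ v) (+ a) (+ m)) (trans (cong (ℤ._+ + a) (sym (ℤₚ.pos-* n m))) (trans (sym (ℤₚ.pos-+ (n ℕ.* m) a)) (cong +_ nm+a)))))) ⟩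
          ι (+ (a ℕ.* p ℕ.^ suc e)) ∎

      private
        cc-index : ∀ i u → n ℕ.* i ℕ.+ p ℕ.* u ℕ.+ a < p ℕ.* suc (i ℕ.+ u)
        cc-index i u = subst (n ℕ.* i ℕ.+ p ℕ.* u ℕ.+ a <_) (e₁ p i u)
          (ℕₚ.+-mono-≤-< (ℕₚ.+-monoˡ-≤ (p ℕ.* u) (ℕₚ.*-monoˡ-≤ i (ℕₚ.m∸n≤m p 1))) a<p)
          where
          e₁ : ∀ p i u → p ℕ.* i ℕ.+ p ℕ.* u ℕ.+ p ≡ p ℕ.* suc (i ℕ.+ u)
          e₁ = ℕS.solve-∀

      err-small : ∀ i v → O e (err i v)
      err-small i v = subst (O e) eq (O-ι* (falling m (suc i) v) (O-ι* (+ a) (subst (λ z → O z (p^ e * (pA * (M * C)))) (ℕₚ.+-identityʳ e)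
         (O-* (O-p^ e) (mp-bound 0 (i ℕ.+ suc v) _ z≤n (cc-index i (suc v)))))))
        where
        M = mp (i ℕ.+ suc v)
        C = cc i (suc v)
        eq : ι (falling m (suc i) v) * (ι (+ a) * (p^ e * (pA * (M * C)))) ≡ err i v
        eq = trans (solve 6 (λ f a e p m c → f :* (a :* (e :* (p :* (m :* c)))) := m :* (f :* (a :* (p :* e) :* c))) refl (ι (falling m (suc i) v)) (ι (+ a)) (p^ e) pA M C)
          (cong (λ z → M * (ι (falling m (suc i) v) * (z * C))) (trans (cong (ι (+ a) *_) (sym (p^-suc e))) (sym (ι-ℕ* a (p ℕ.^ suc e)))))

      -- What the sum of `err i v` over the triangle i + v < R telescopes to: the `β` differences
      -- along antidiagonals, the `α` differences along rows.
      X : ℕ → A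
      X R = sum R (λ i → β (suc i) 0 - β 0 (suc i)) + pA * sum R (λ i → α i (R ∸ i) - α i 0)

      X-suc : ∀ R → X (suc R) ≡ X R + sum (suc R) (λ i → err i (R ∸ i))
      X-suc R = sym (begin
        X R + sum (suc R) (λ i → err i (R ∸ i))                         ≡⟨ cong (_+_ (X R)) (trans (sum-cong (suc R) step) (sum-+ (suc R) _ _)) ⟩
        X R + (sum (suc R) (λ i → β' (suc i) - β' i) + sum (suc R) (λ i → pA * (x' i - y i)))
          ≡⟨ cong₂ (λ u v → X R + (u + v)) (sum-telescope (suc R) β') (sym (sum-*ˡ (suc R) pA _)) ⟩
        S + pA * sum R (λ i → y i - z i) + (β' (suc R) - β' 0 + pA * sum (suc R) (λ i → x' i - y i))
          ≡⟨ cong (λ w → S + pA * w + (β' (suc R) - β' 0 + pA * sum (suc R) (λ i → x' i - y i))) (sym extend) ⟩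
        S + pA * sum (suc R) (λ i → y i - z i) + (β' (suc R) - β' 0 + pA * sum (suc R) (λ i → x' i - y i))
          ≡⟨ solve 5 (λ S p u v w → S :+ p :* u :+ (v :+ p :* w) := (S :+ v) :+ p :* (u :+ w)) refl S pA (sum (suc R) (λ i → y i - z i)) (β' (suc R) - β' 0) (sum (suc R) (λ i → x' i - y i)) ⟩
        (S + (β' (suc R) - β' 0)) + pA * (sum (suc R) (λ i → y i - z i) + sum (suc R) (λ i → x' i - y i))
          ≡⟨ cong₂ (λ u v → (S + (u - β' 0)) + pA * v) (cong (β (suc R)) (ℕₚ.n∸n≡0 R))
               (trans (sym (sum-+ (suc R) _ _)) (sum-cong (suc R) (λ i _ → solve 3 (λ x y z → (y :- z) :+ (x :- y) := x :- z) refl (x' i) (y i) (z i)))) ⟩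
        X (suc R) ∎)
        where
        open ≡-Reasoning
        S = sum R (λ i → β (suc i) 0 - β 0 (suc i))
        β' x' y z : ℕ → A
        β' i = β i (suc R ∸ i)
        x' i = α i (suc R ∸ i)
        y i = α i (R ∸ i)
        z i = α i 0
        extend : sum (suc R) (λ i → y i - z i) ≡ sum R (λ i → y i - z i)
        extend = trans (cong (_+_ (sum R (λ i → y i - z i))) (trans (cong (λ w → α R w - z R) (ℕₚ.n∸n≡0 R)) (-‿inverseʳ (z R)))) (+-identityʳ _)
        step : ∀ i → i < suc R → err i (R ∸ i) ≡ (β' (suc i) - β' i) + pA * (x' i - y i)
        step i i<1+R = trans (sym (exchange i (R ∸ i))) (cong (λ w → (β' (suc i) - β i w) + pA * (α i w - y i)) (sym (suc∸ (ℕ.s≤s⁻¹ i<1+R))))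

      X-small : ∀ R → O e (X R)
      X-small zero    = subst (O e) (sym (solve 1 (λ p → con 0ℤ :+ p :* con 0ℤ := con 0ℤ) refl pA)) (O-0 e)
      X-small (suc R) = subst (O e) (sym (X-suc R)) (O-+ (X-small R) (O-sum (suc R) (λ i _ → err-small i (R ∸ i))))

      γ : ℕ → A
      γ i = ι (falling m 0 i) * d a i

      module Bound (R : ℕ) (4e≤R : suc e ℕ.* 4 ≤ R) where
        private
          G₁ = sum (suc R) γ
          α₀≡t : ∀ i → α i 0 ≡ t a i
          α₀≡t i = trans (cong₂ (λ u v → mp u * (1# * c v)) (ℕₚ.+-identityʳ i) (cong (ℕ._+ a) (trans (cong (n ℕ.* i ℕ.+_) (ℕₚ.*-zeroʳ p)) (ℕₚ.+-identityʳ _))))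
            (cong (mp i *_) (*-identityˡ (c (n ℕ.* i ℕ.+ a))))
          β₀≡t : ∀ i → β i 0 ≡ t a i
          β₀≡t i = α₀≡t i
          β≡γ : ∀ i → β 0 i ≡ γ i
          β≡γ i = trans (cong (λ z → mp i * (ι (falling m 0 i) * c z)) (cong (λ z → z ℕ.+ p ℕ.* i ℕ.+ a) (ℕₚ.*-zeroʳ n)))
            (solve 3 (λ a b c → a :* (b :* c) := b :* (a :* c)) refl (mp i) (ι (falling m 0 i)) (x a i))
          γ₀≡t₀ : γ 0 ≡ t a 0
          γ₀≡t₀ = trans (sym (β≡γ 0)) (β₀≡t 0)
          α-sum = sum R (λ i → α i (R ∸ i))

          X≡ : X R ≡ (g a R + t a R - G₁) + pA * (α-sum - g a R)
          X≡ = cong₂ (λ u v → u + pA * v)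
            (begin
              sum R (λ i → β (suc i) 0 - β 0 (suc i))                            ≡⟨ sum-cong R (λ i _ → cong₂ _-_ (β₀≡t (suc i)) (β≡γ (suc i))) ⟩
              sum R (λ i → t a (suc i) - γ (suc i))                              ≡⟨ sum-+ R _ _ ⟩
              sum R (λ i → t a (suc i)) + sum R (λ i → - γ (suc i))              ≡⟨ cong (_+_ (sum R (λ i → t a (suc i)))) (sum-neg R _) ⟩
              sum R (λ i → t a (suc i)) - sum R (λ i → γ (suc i))                ≡⟨ solve 3 (λ z u v → u :- v := (z :+ u) :- (z :+ v)) refl (t a 0) _ _ ⟩
              (t a 0 + sum R (λ i → t a (suc i))) - (t a 0 + sum R (λ i → γ (suc i)))
                ≡⟨ cong₂ _-_ (sym (sum-first R (t a))) (trans (cong (_+ sum R (λ i → γ (suc i))) (sym γ₀≡t₀)) (sym (sum-first R γ))) ⟩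
              g a R + t a R - G₁ ∎)
            (trans (sum-+ R _ _) (cong (_+_ α-sum) (trans (sum-neg R _) (cong -_ (sum-cong R (λ i _ → α₀≡t i))))))
            where open ≡-Reasoning

          tR-small : O e (t a R)
          tR-small = mp-small e R _ 4e≤R (t-index a R a<p)

          α-small : ∀ i → i < R → O e (pA * α i (R ∸ i))
          α-small i i<R = subst (O e) (solve 4 (λ f p m c → f :* (p :* (m :* c)) := p :* (m :* (f :* c))) refl (ι (falling m (suc i) u)) pA (mp (i ℕ.+ u)) (cc i u))
            (O-ι* (falling m (suc i) u) (mp-bound e (i ℕ.+ u) _ (subst (e ℕ.* 4 ≤_) (sym (ℕₚ.m+[n∸m]≡n (ℕₚ.<⇒≤ i<R))) (ℕₚ.≤-trans (ℕₚ.m≤n+m (e ℕ.* 4) 4) 4e≤R)) (cc-index i u)))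
            where u = R ∸ i

          γ-small : ∀ i → R ≤ i → O e (γ i)
          γ-small i R≤i = O-ι* (falling m 0 i) (mp-small e i _ (ℕₚ.≤-trans 4e≤R R≤i)
            (subst (p ℕ.* i ℕ.+ a <_) (trans (ℕₚ.+-comm (p ℕ.* i) p) (sym (ℕₚ.*-suc p i))) (ℕₚ.+-monoʳ-< (p ℕ.* i) a<p)))

          Q≡ : Q a m ≡ G₁ + sum m (λ i → γ (suc R ℕ.+ i))
          Q≡ = begin
            Q a m                                                    ≡⟨ Q-newton a m ⟩
            sum (suc m) γ                                            ≡⟨ +-identityʳ _ ⟨
            -- The falling factorials vanish beyond m, so the sum is padded to length m + 1 + R and
            -- cut again at R + 1; no comparison of m with R is required.
            sum (suc m) γ + 0#                                       ≡⟨ cong (_+_ (sum (suc m) γ)) (sum-zero R (λ i _ → vanish i)) ⟨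
            sum (suc m) γ + sum R (λ i → γ (suc m ℕ.+ i))            ≡⟨ sum-split (suc m) R γ ⟨
            sum (suc m ℕ.+ R) γ                                      ≡⟨ cong (λ z → sum (suc z) γ) (ℕₚ.+-comm m R) ⟩
            sum (suc R ℕ.+ m) γ                                      ≡⟨ sum-split (suc R) m γ ⟩
            G₁ + sum m (λ i → γ (suc R ℕ.+ i))                       ∎
            where
            open ≡-Reasoning
            vanish : ∀ i → γ (suc m ℕ.+ i) ≡ 0#
            vanish i = trans (cong (λ z → ι z * d a (suc m ℕ.+ i)) (falling-vanish m (suc m ℕ.+ i) (s≤s (ℕₚ.m≤m+n m i)))) (zeroˡ _)

        -- In `X R` the `β` part is g + t_R - G₁, and the `α` part is -p g up to entries with i + u
        -- = R. All of `X R`, t_R and those entries (times p) are small, so G₁ agrees with (1-p) g,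
        -- and `Q a m` with G₁ up to the tail of its Newton series.
        bound : O e (Q a m - (1# - pA) * g a R)
        bound = subst (O e) eq (O-+ (O-+ (O-- tR-small (X-small R)) (subst (O e) (sym (sum-*ˡ R pA _)) (O-sum R α-small))) (O-sum m (λ i _ → γ-small (suc R ℕ.+ i) (ℕₚ.m≤n⇒m≤1+n (ℕₚ.m≤m+n R i)))))
          where
          open ≡-Reasoning
          T = sum m (λ i → γ (suc R ℕ.+ i))
          eq : (t a R - X R) + pA * α-sum + T ≡ Q a m - (1# - pA) * g a R
          eq = begin
            (t a R - X R) + pA * α-sum + T   ≡⟨ cong (λ z → (t a R - z) + pA * α-sum + T) X≡ ⟩
            (t a R - ((g a R + t a R - G₁) + pA * (α-sum - g a R))) + pA * α-sum + T
              ≡⟨ solve 6 (λ t g G p α T → (t :- ((g :+ t :- G) :+ p :* (α :- g))) :+ p :* α :+ T := (G :+ T) :- (con 1ℤ :- p) :* g) refl (t a R) (g a R) G₁ pA α-sum T ⟩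
            (G₁ + T) - (1# - pA) * g a R     ≡⟨ cong (_- (1# - pA) * g a R) Q≡ ⟨
            Q a m - (1# - pA) * g a R        ∎

    -- The sum over j + j' < S arranged by antidiagonals, the form in which coefficients of a
    -- product of series appear.
    tri : ℕ → (ℕ → ℕ → A) → A
    tri S f = sum S (λ J → sum (suc J) (λ j → f j (J ∸ j)))

    tri-rows : ∀ S f → tri S f ≡ sum S (λ j → sum (S ∸ j) (f j))
    tri-rows zero    f = refl
    tri-rows (suc S) f = begin
      tri S f + sum (suc S) (λ j → f j (S ∸ j))                                  ≡⟨ cong (_+ sum (suc S) (λ j → f j (S ∸ j))) (tri-rows S f) ⟩
      sum S (λ j → sum (S ∸ j) (f j)) + sum (suc S) (λ j → f j (S ∸ j))          ≡⟨ cong (_+ sum (suc S) (λ j → f j (S ∸ j))) (sym extend) ⟩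
      sum (suc S) (λ j → sum (S ∸ j) (f j)) + sum (suc S) (λ j → f j (S ∸ j))    ≡⟨ sum-+ (suc S) _ _ ⟨
      sum (suc S) (λ j → sum (S ∸ j) (f j) + f j (S ∸ j))                        ≡⟨ sum-cong (suc S) (λ j j<1+S → cong (λ z → sum z (f j)) (sym (suc∸ (ℕ.s≤s⁻¹ j<1+S)))) ⟩
      sum (suc S) (λ j → sum (suc S ∸ j) (f j))                                  ∎
      where
      open ≡-Reasoning
      extend : sum (suc S) (λ j → sum (S ∸ j) (f j)) ≡ sum S (λ j → sum (S ∸ j) (f j))
      extend = trans (cong (λ z → sum S (λ j → sum (S ∸ j) (f j)) + sum z (f S)) (ℕₚ.n∸n≡0 S)) (+-identityʳ _)

    -- The relation between coefficients lives on triangles, whereas a square sum factors into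
    -- partial sums. The margin `E` fits triangles of different sizes into a common square.
    square-tri : ∀ e S E f → (∀ j j' → S ≤ j ℕ.+ j' → O e (f j j')) →
      O e (sum (S ℕ.+ E) (λ j → sum (S ℕ.+ E) (f j)) - tri S f)
    square-tri e S E f small = subst (O e) eq (O-+ (O-sum S (λ j j<S → O-sum (j ℕ.+ E) (λ i _ → small j _ (le j i j<S))))
        (O-sum E (λ i _ → O-sum (S ℕ.+ E) (λ j' _ → small (S ℕ.+ i) j' (ℕₚ.≤-trans (ℕₚ.m≤m+n S i) (ℕₚ.m≤m+n (S ℕ.+ i) j'))))))
      where
      open ≡-Reasoning
      le : ∀ j i → j < S → S ≤ j ℕ.+ (S ∸ j ℕ.+ i)
      le j i j<S = subst (S ≤_) (trans (cong (ℕ._+ i) (sym (ℕₚ.m+[n∸m]≡n (ℕₚ.<⇒≤ j<S)))) (ℕₚ.+-assoc j (S ∸ j) i)) (ℕₚ.m≤m+n S i)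
      tail : ℕ → A
      tail j = sum (j ℕ.+ E) (λ i → f j (S ∸ j ℕ.+ i))
      rest = sum E (λ i → sum (S ℕ.+ E) (f (S ℕ.+ i)))
      row : ∀ j → j < S → sum (S ℕ.+ E) (f j) ≡ sum (S ∸ j) (f j) + tail j
      row j j<S = trans (cong (λ z → sum z (f j)) (trans (cong (ℕ._+ E) (sym (ℕₚ.m∸n+n≡m (ℕₚ.<⇒≤ j<S)))) (ℕₚ.+-assoc (S ∸ j) j E))) (sum-split (S ∸ j) (j ℕ.+ E) (f j))
      eq : sum S tail + rest ≡ sum (S ℕ.+ E) (λ j → sum (S ℕ.+ E) (f j)) - tri S f
      eq = begin
        sum S tail + rest                                                             ≡⟨ solve 3 (λ a b c → b :+ c := (a :+ b :+ c) :- a) refl (tri S f) (sum S tail) rest ⟩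
        (tri S f + sum S tail + rest) - tri S f                                       ≡⟨ cong (λ z → (z + sum S tail + rest) - tri S f) (tri-rows S f) ⟩
        (sum S (λ j → sum (S ∸ j) (f j)) + sum S tail + rest) - tri S f               ≡⟨ cong (λ z → (z + rest) - tri S f) (sum-+ S _ _) ⟨
        (sum S (λ j → sum (S ∸ j) (f j) + tail j) + rest) - tri S f                   ≡⟨ cong (λ z → (z + rest) - tri S f) (sum-cong S row) ⟨
        (sum S (λ j → sum (S ℕ.+ E) (f j)) + rest) - tri S f                          ≡⟨ cong (_- tri S f) (sum-split S E (λ j → sum (S ℕ.+ E) (f j))) ⟨
        sum (S ℕ.+ E) (λ j → sum (S ℕ.+ E) (f j)) - tri S f                           ∎

    module GaussSum (e : ℕ) where
      -- For j + j' ≥ 4(e+4) the quotients ⌊j/4⌋ and ⌊j'/4⌋ add up to at least e + 2, and the bound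
      -- on each `t` loses one power of p, which leaves e. `R` is one more than `S` because the
      -- terms with the factor -p first occur in degree b + n, the others in degree b.
      S R : ℕ
      S = (e ℕ.+ 4) ℕ.* 4
      R = S ℕ.+ 1

      private
        tt-small : ∀ a a' j j' → a < p → a' < p → S ≤ j ℕ.+ j' → O e (t a j * t a' j')
        tt-small a a' j j' a<p a'<p S≤ = O-unp₁ (O-unp₁ (O-weaken le (subst (O (q ℕ.+ q')) (solve 3 (λ p x y → p :* x :* (p :* y) := p :* (p :* (x :* y))) refl pA (t a j) (t a' j'))
            (O-* (mp-bound q j _ (m/n*n≤m j 4) (t-index a j a<p)) (mp-bound q' j' _ (m/n*n≤m j' 4) (t-index a' j' a'<p))))))
          where
          q = j / 4
          q' = j' / 4
          j< : ∀ j → j < 4 ℕ.+ (j / 4) ℕ.* 4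
          j< j = subst (_< 4 ℕ.+ (j / 4) ℕ.* 4) (sym (m≡m%n+[m/n]*n j 4)) (ℕₚ.+-monoˡ-< ((j / 4) ℕ.* 4) (m%n<n j 4))
          e₁ : ∀ q q' → (4 ℕ.+ q ℕ.* 4) ℕ.+ (4 ℕ.+ q' ℕ.* 4) ≡ ((q ℕ.+ q') ℕ.+ 2) ℕ.* 4
          e₁ = ℕS.solve-∀
          e₂ : ∀ e → e ℕ.+ 4 ≡ suc (suc e) ℕ.+ 2
          e₂ = ℕS.solve-∀
          le : suc (suc e) ≤ q ℕ.+ q'
          le = ℕₚ.+-cancelʳ-≤ 2 (suc (suc e)) (q ℕ.+ q') (subst (_≤ (q ℕ.+ q') ℕ.+ 2) (e₂ e) (ℕₚ.*-cancelʳ-≤ (e ℕ.+ 4) ((q ℕ.+ q') ℕ.+ 2) 4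
                 (ℕₚ.≤-trans S≤ (subst (j ℕ.+ j' ≤_) (e₁ q q') (ℕₚ.+-mono-≤ (ℕₚ.<⇒≤ (j< j)) (ℕₚ.<⇒≤ (j< j')))))))

        n≡ : n ≡ suc b ℕ.+ b'
        n≡ = trans n≡2b (ℕₚ.+-suc b b')
        n<p : n < p
        n<p = subst (n <_) (sym p≡1+n) (ℕₚ.n<1+n n)
        b<p : b < p
        b<p = ℕₚ.≤-<-trans (subst (b ≤_) (sym n≡2b) (ℕₚ.m≤m+n b b)) n<p
        ≤b⇒<p : ∀ {i} → i ≤ b → i < p
        ≤b⇒<p h = ℕₚ.≤-<-trans h b<p
        second<p : ∀ {i} → i < b' → suc b ℕ.+ i < p
        second<p {i} h = ℕₚ.<-trans (subst (suc b ℕ.+ i <_) (sym n≡) (ℕₚ.+-monoʳ-< (suc b) h)) n<p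
        n∸<p : ∀ i → n ∸ i < p
        n∸<p i = ℕₚ.≤-<-trans (ℕₚ.m∸n≤m n i) n<p

        -- The contributions of c = i ≤ b and of c = b + 1 + i < n; the partner of the latter is c'
        -- = b + n - c = n - (i+1).
        f₁ f₂ : ℕ → ℕ → A
        f₁ j j' = sum (suc b) (λ i → sgn i * (t i j * t (b ∸ i) j'))
        f₂ j j' = sum b' (λ i → sgn (suc b ℕ.+ i) * (- pA * (t (suc b ℕ.+ i) j * t (n ∸ suc i) j')))

        f₁-small : ∀ j j' → R ≤ j ℕ.+ j' → O e (f₁ j j')
        f₁-small j j' h = O-sum (suc b) (λ i i≤b → O-sgn* i (tt-small i (b ∸ i) j j' (≤b⇒<p (ℕ.s≤s⁻¹ i≤b)) (≤b⇒<p (ℕₚ.m∸n≤m b i)) (ℕₚ.≤-trans (ℕₚ.m≤m+n S 1) h)))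

        f₂-small : ∀ j j' → S ≤ j ℕ.+ j' → O e (f₂ j j')
        f₂-small j j' h = O-sum b' (λ i i<b' → O-sgn* (suc b ℕ.+ i) (O-negp* (tt-small (suc b ℕ.+ i) (n ∸ suc i) j j' (second<p i<b') (n∸<p (suc i)) h)))

        sgn-even : ∀ j i → sgn (j ℕ.* n ℕ.+ i) ≡ sgn i
        sgn-even j i = trans (sgn-+ (j ℕ.* n) i) (trans (cong (_* sgn i) (trans (cong (λ z → sgn z) (trans (cong (j ℕ.*_) n≡2b) (ℕₚ.*-distribˡ-+ j b b))) (sgn-2 (j ℕ.* b)))) (*-identityˡ (sgn i)))

        -- The summands of the coefficient of X^(b+nJ) in exp(-X - X^p/p) exp(X + X^p/p).
        h : ℕ → ℕ → A
        h J I = c-alt I * c (b ℕ.+ n ℕ.* J ∸ I)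

        mp-split : ∀ j j' x y s → mp (j ℕ.+ j') * (s * x * y) ≡ s * (mp j * x * (mp j' * y))
        mp-split j j' x y s = trans (cong (_* (s * x * y)) (mp-+ j j')) (solve 5 (λ a b s x y → a :* b :* (s :* x :* y) := s :* (a :* x :* (b :* y))) refl (mp j) (mp j') s x y)

        h₁ : ∀ J j i → j ≤ J → i ≤ b → mp J * h J (j ℕ.* n ℕ.+ i) ≡ sgn i * (t i j * t (b ∸ i) (J ∸ j))
        h₁ J j i j≤J i≤b = trans (cong₂ (λ u v → u * (v * c (b ℕ.+ n ℕ.* J ∸ (j ℕ.* n ℕ.+ i)))) (cong mp (sym (ℕₚ.m+[n∸m]≡n j≤J))) (cong₂ _*_ (sgn-even j i) (cong (λ z → c (z ℕ.+ i)) (ℕₚ.*-comm j n))))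
          (trans (cong (λ z → mp (j ℕ.+ (J ∸ j)) * (sgn i * c (n ℕ.* j ℕ.+ i) * c z)) idx) (mp-split j (J ∸ j) _ _ (sgn i)))
          where
          e₁ : ∀ B i n j d → (i ℕ.+ B) ℕ.+ n ℕ.* (j ℕ.+ d) ≡ (j ℕ.* n ℕ.+ i) ℕ.+ (n ℕ.* d ℕ.+ B)
          e₁ = ℕS.solve-∀
          idx : b ℕ.+ n ℕ.* J ∸ (j ℕ.* n ℕ.+ i) ≡ n ℕ.* (J ∸ j) ℕ.+ (b ∸ i)
          idx = trans (cong (ℕ._∸ (j ℕ.* n ℕ.+ i)) (trans (cong₂ (λ u v → u ℕ.+ n ℕ.* v) (sym (ℕₚ.m+[n∸m]≡n i≤b)) (sym (ℕₚ.m+[n∸m]≡n j≤J))) (e₁ (b ∸ i) i n j (J ∸ j))))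
                  (ℕₚ.m+n∸m≡n (j ℕ.* n ℕ.+ i) _)

        -- For an index jn + c with c > b the complementary index needs a borrow: b + n(J+1) - (jn +
        -- c) = n(J-j) + (b + n - c). The borrow lowers J + 1 to J, and (-p)^(J+1) = -p (-p)^J
        -- supplies the factor -p.
        h₂ : ∀ J j i → j ≤ J → i < b' → mp (suc J) * h (suc J) (j ℕ.* n ℕ.+ (suc b ℕ.+ i)) ≡ sgn (suc b ℕ.+ i) * (- pA * (t (suc b ℕ.+ i) j * t (n ∸ suc i) (J ∸ j)))
        h₂ J j i j≤J i<b' = trans (cong₂ (λ u v → - pA * u * (v * c (b ℕ.+ n ℕ.* suc J ∸ (j ℕ.* n ℕ.+ (suc b ℕ.+ i))))) (cong mp (sym (ℕₚ.m+[n∸m]≡n j≤J))) (cong₂ _*_ (sgn-even j (suc b ℕ.+ i)) (cong (λ z → c (z ℕ.+ (suc b ℕ.+ i))) (ℕₚ.*-comm j n))))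
          (trans (cong (λ z → - pA * mp (j ℕ.+ (J ∸ j)) * (sgn (suc b ℕ.+ i) * c (n ℕ.* j ℕ.+ (suc b ℕ.+ i)) * c z)) idx)
            (trans (*-assoc (- pA) (mp (j ℕ.+ (J ∸ j))) _) (trans (cong (- pA *_) (mp-split j (J ∸ j) _ _ (sgn (suc b ℕ.+ i)))) (solve 3 (λ p s y → (:- p) :* (s :* y) := s :* ((:- p) :* y)) refl pA (sgn (suc b ℕ.+ i)) _))))
          where
          suci≤n : suc i ≤ n
          suci≤n = ℕₚ.≤-trans i<b' (subst (b' ≤_) (sym n≡) (ℕₚ.m≤n+m b' (suc b)))
          e₁ : ∀ b i n j d r → b ℕ.+ ((suc i ℕ.+ r) ℕ.+ n ℕ.* (j ℕ.+ d)) ≡ (j ℕ.* n ℕ.+ (suc b ℕ.+ i)) ℕ.+ (n ℕ.* d ℕ.+ r)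
          e₁ = ℕS.solve-∀
          idx : b ℕ.+ n ℕ.* suc J ∸ (j ℕ.* n ℕ.+ (suc b ℕ.+ i)) ≡ n ℕ.* (J ∸ j) ℕ.+ (n ∸ suc i)
          idx = trans (cong (ℕ._∸ (j ℕ.* n ℕ.+ (suc b ℕ.+ i))) (trans (cong (b ℕ.+_) (trans (ℕₚ.*-suc n J) (cong₂ (λ u v → u ℕ.+ n ℕ.* v) (sym (ℕₚ.m+[n∸m]≡n suci≤n)) (sym (ℕₚ.m+[n∸m]≡n j≤J))))) (e₁ b i n j (J ∸ j) (n ∸ suc i))))
                  (ℕₚ.m+n∸m≡n (j ℕ.* n ℕ.+ (suc b ℕ.+ i)) _)

        upper lower : ℕ → A
        upper J = sum (suc J) (λ j → sum (suc b) (λ i → mp J * h J (j ℕ.* n ℕ.+ i)))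
        lower J = sum J (λ j → sum b' (λ i → mp J * h J (j ℕ.* n ℕ.+ (suc b ℕ.+ i))))

        -- The indices 0, ..., b + nJ form J full blocks of length n = (b+1) + b' and a last block
        -- of length b + 1. The degree b + nJ is positive because b is, so the whole coefficient
        -- vanishes.
        conv-split : ∀ J → upper J + lower J ≡ 0#
        conv-split J = begin
          (sum J B₁ + B₁ J) + sum J B₂                 ≡⟨ solve 3 (λ a b c → (a :+ b) :+ c := (a :+ c) :+ b) refl (sum J B₁) (B₁ J) (sum J B₂) ⟩
          (sum J B₁ + sum J B₂) + B₁ J                 ≡⟨ cong (_+ B₁ J) (sum-+ J B₁ B₂) ⟨
          sum J (λ j → B₁ j + B₂ j) + B₁ J             ≡⟨ cong (_+ B₁ J) (sum-cong J (λ j _ → sum-split (suc b) b' (λ i → hh (j ℕ.* n ℕ.+ i)))) ⟨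
          sum J (λ j → sum (suc b ℕ.+ b') (λ i → hh (j ℕ.* n ℕ.+ i))) + B₁ J   ≡⟨ cong (λ z → sum J (λ j → sum z (λ i → hh (j ℕ.* n ℕ.+ i))) + B₁ J) (sym n≡) ⟩
          sum J (λ j → sum n (λ i → hh (j ℕ.* n ℕ.+ i))) + B₁ J                ≡⟨ cong (_+ B₁ J) (sum-blocks J n hh) ⟨
          sum (J ℕ.* n) hh + B₁ J                      ≡⟨ sum-split (J ℕ.* n) (suc b) hh ⟨
          sum (J ℕ.* n ℕ.+ suc b) hh                   ≡⟨ cong (λ z → sum z hh) (e₁ J n b) ⟩
          sum (suc (b ℕ.+ n ℕ.* J)) hh                 ≡⟨ sum-*ˡ (suc (b ℕ.+ n ℕ.* J)) (mp J) (h J) ⟨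
          mp J * conv c-alt c (b ℕ.+ n ℕ.* J)          ≡⟨ cong (mp J *_) (conv-c-alt (b' ℕ.+ n ℕ.* J)) ⟩
          mp J * 0#                                    ≡⟨ zeroʳ (mp J) ⟩
          0#                                           ∎
          where
          open ≡-Reasoning
          hh : ℕ → A
          hh I = mp J * h J I
          B₁ B₂ : ℕ → A
          B₁ j = sum (suc b) (λ i → hh (j ℕ.* n ℕ.+ i))
          B₂ j = sum b' (λ i → hh (j ℕ.* n ℕ.+ (suc b ℕ.+ i)))
          e₁ : ∀ J n b → J ℕ.* n ℕ.+ suc b ≡ suc (b ℕ.+ n ℕ.* J)
          e₁ = ℕS.solve-∀

        tri-zero : tri R f₁ + tri S f₂ ≡ 0#
        tri-zero = begin
          tri R f₁ + tri S f₂                               ≡⟨ cong₂ _+_ up low ⟩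
          sum R upper + sum R lower                         ≡⟨ sum-+ R upper lower ⟨
          sum R (λ J → upper J + lower J)                   ≡⟨ sum-zero R (λ J _ → conv-split J) ⟩
          0#                                                ∎
          where
          open ≡-Reasoning
          up : tri R f₁ ≡ sum R upper
          up = sum-cong R (λ J _ → sum-cong (suc J) (λ j j<1+J → sum-cong (suc b) (λ i i≤b → sym (h₁ J j i (ℕ.s≤s⁻¹ j<1+J) (ℕ.s≤s⁻¹ i≤b)))))
          low : tri S f₂ ≡ sum R lower
          low = sym (trans (cong (λ z → sum z lower) (ℕₚ.+-comm S 1)) (trans (sum-first S lower) (trans (+-identityˡ _)
             (sum-cong S (λ J _ → sum-cong (suc J) (λ j j<1+J → sum-cong b' (λ i i<b' → h₂ J j i (ℕ.s≤s⁻¹ j<1+J) i<b')))))))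

        square-sum : ∀ M (s : ℕ → A) (a a' : ℕ → ℕ) →
          sum R (λ j → sum R (λ j' → sum M (λ i → s i * (t (a i) j * t (a' i) j')))) ≡ sum M (λ i → s i * (g (a i) R * g (a' i) R))
        square-sum M s a a' = begin
          sum R (λ j → sum R (λ j' → sum M (λ i → s i * (t (a i) j * t (a' i) j'))))   ≡⟨ sum-cong R (λ j _ → sum-swap R M _) ⟩
          sum R (λ j → sum M (λ i → sum R (λ j' → s i * (t (a i) j * t (a' i) j'))))   ≡⟨ sum-swap R M _ ⟩
          sum M (λ i → sum R (λ j → sum R (λ j' → s i * (t (a i) j * t (a' i) j'))))   ≡⟨ sum-cong M (λ i _ → each i) ⟩
          sum M (λ i → s i * (g (a i) R * g (a' i) R))                                 ∎
          where
          open ≡-Reasoning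
          each : ∀ i → sum R (λ j → sum R (λ j' → s i * (t (a i) j * t (a' i) j'))) ≡ s i * (g (a i) R * g (a' i) R)
          each i = trans (sum-cong R (λ j _ → trans (sym (sum-*ˡ R (s i) _)) (cong (s i *_) (sym (sum-*ˡ R (t (a i) j) (t (a' i)))))))
            (trans (sym (sum-*ˡ R (s i) _)) (cong (s i *_) (sym (sum-*ʳ R (g (a' i) R) (t (a i))))))

      -- The sum Σ_c (-1)^c (-p)^[c > b] G_c G_(c') for arbitrary values `G`, so that the partial
      -- sums can be exchanged for values of Γ_p.
      total : (ℕ → A) → A
      total G = sum (suc b) (λ i → sgn i * (G i * G (b ∸ i))) + sum b' (λ i → sgn (suc b ℕ.+ i) * (- pA * (G (suc b ℕ.+ i) * G (n ∸ suc i))))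

      gauss-total : O e (total (λ a → g a R))
      gauss-total = subst (O e) eq (O-+ (subst (λ z → O e (sum z (λ j → sum z (f₁ j)) - tri R f₁)) (ℕₚ.+-identityʳ R) (square-tri e R 0 f₁ f₁-small)) (square-tri e S 1 f₂ f₂-small))
        where
        open ≡-Reasoning
        sq₁ = sum R (λ j → sum R (f₁ j))
        sq₂ = sum R (λ j → sum R (f₂ j))
        reassoc : ∀ j j' → f₂ j j' ≡ sum b' (λ i → (sgn (suc b ℕ.+ i) * - pA) * (t (suc b ℕ.+ i) j * t (n ∸ suc i) j'))
        reassoc j j' = sum-cong b' (λ i _ → sym (*-assoc (sgn (suc b ℕ.+ i)) (- pA) _))
        eq : (sq₁ - tri R f₁) + (sq₂ - tri S f₂) ≡ total (λ a → g a R)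
        eq = begin
          (sq₁ - tri R f₁) + (sq₂ - tri S f₂)      ≡⟨ solve 4 (λ a b c d → (a :- b) :+ (c :- d) := (a :+ c) :- (b :+ d)) refl sq₁ (tri R f₁) sq₂ (tri S f₂) ⟩
          (sq₁ + sq₂) - (tri R f₁ + tri S f₂)      ≡⟨ cong (λ z → (sq₁ + sq₂) - z) tri-zero ⟩
          (sq₁ + sq₂) - 0#                         ≡⟨ solve 1 (λ a → a :- con 0ℤ := a) refl (sq₁ + sq₂) ⟩
          sq₁ + sq₂                                ≡⟨ cong₂ _+_ (square-sum (suc b) sgn (λ i → i) (λ i → b ∸ i))
                                                        (trans (sum-cong R (λ j _ → sum-cong R (λ j' _ → reassoc j j'))) (trans (square-sum b' (λ i → sgn (suc b ℕ.+ i) * - pA) (λ i → suc b ℕ.+ i) (λ i → n ∸ suc i))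
                                                          (sum-cong b' (λ i _ → *-assoc (sgn (suc b ℕ.+ i)) (- pA) _)))) ⟩
          total (λ a → g a R)                      ∎

      -- total only involves products G i * G j, so replacing G by G' changes it by multiples of G - G'.
      total-cong : ∀ {G G'} → (∀ i → i < p → O e (G i - G' i)) → (∀ i → i < p → O 0 (G i)) → O e (total G') → O e (total G)
      total-cong {G} {G'} diff int h' = subst (O e) (solve 2 (λ a b → (a :- b) :+ b := a) refl (total G) (total G')) (O-+ d-total h')
        where
        int' : ∀ i → i < p → O 0 (G' i)
        int' i i<p = subst (O 0) (solve 2 (λ a b → a :- (a :- b) := b) refl (G i) (G' i)) (O-- (int i i<p) (O-weaken z≤n (diff i i<p)))
        prod : ∀ i j → i < p → j < p → O e (G i * G j - G' i * G' j)
        prod i j i<p j<p = subst (O e) (solve 4 (λ a b c d → a :* (b :- d) :+ d :* (a :- c) := a :* b :- c :* d) refl (G i) (G j) (G' i) (G' j))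
          (O-+ (O-* (int i i<p) (diff j j<p)) (O-* (int' j j<p) (diff i i<p)))
        d-sum : ∀ M (s : ℕ → A) (a a' : ℕ → ℕ) → (∀ i → i < M → O e (s i * (G (a i) * G (a' i) - G' (a i) * G' (a' i)))) →
          O e (sum M (λ i → s i * (G (a i) * G (a' i))) - sum M (λ i → s i * (G' (a i) * G' (a' i))))
        d-sum M s a a' h = subst (O e) (trans (sum-cong M (λ i _ → solve 3 (λ s x y → s :* (x :- y) := s :* x :+ (:- (s :* y))) refl (s i) _ _)) (trans (sum-+ M _ _) (cong (_+_ _) (sum-neg M _)))) (O-sum M h)
        re : ∀ (H : ℕ → A) → sum b' (λ i → sgn (suc b ℕ.+ i) * (- pA * (H (suc b ℕ.+ i) * H (n ∸ suc i)))) ≡ sum b' (λ i → (sgn (suc b ℕ.+ i) * - pA) * (H (suc b ℕ.+ i) * H (n ∸ suc i)))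
        re H = sum-cong b' (λ i _ → sym (*-assoc (sgn (suc b ℕ.+ i)) (- pA) _))
        first : (ℕ → A) → A
        first H = sum (suc b) (λ i → sgn i * (H i * H (b ∸ i)))
        second : (ℕ → A) → A
        second H = sum b' (λ i → sgn (suc b ℕ.+ i) * (- pA * (H (suc b ℕ.+ i) * H (n ∸ suc i))))
        d-first : O e (first G - first G')
        d-first = d-sum (suc b) sgn (λ i → i) (λ i → b ∸ i) (λ i i≤b → O-sgn* i (prod i (b ∸ i) (≤b⇒<p (ℕ.s≤s⁻¹ i≤b)) (≤b⇒<p (ℕₚ.m∸n≤m b i))))
        d-second : O e (second G - second G')
        d-second = subst (O e) (cong₂ _-_ (sym (re G)) (sym (re G')))
          (d-sum b' (λ i → sgn (suc b ℕ.+ i) * - pA) (λ i → suc b ℕ.+ i) (λ i → n ∸ suc i)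
            (λ i i<b' → subst (O e) (sym (*-assoc (sgn (suc b ℕ.+ i)) (- pA) _)) (O-sgn* (suc b ℕ.+ i) (O-negp* (prod (suc b ℕ.+ i) (n ∸ suc i) (second<p i<b') (n∸<p (suc i)))))))
        d-total : O e (total G - total G')
        d-total = subst (O e) (solve 4 (λ a b c d → (a :- b) :+ (c :- d) := (a :+ c) :- (b :+ d)) refl (first G) (first G') (second G) (second G')) (O-+ d-first d-second)

  module DworkVanishing (F : RationalField) (p : ℕ) (pr : Prime p) (b' : ℕ) (p≡1+2b : p ≡ suc (suc b' ℕ.+ suc b')) (4<p : 4 < p) (k : ℕ) where
    private
      b : ℕ
      b = suc b'
      n : ℕ
      n = p ∸ 1
      3<p : 3 < p
      3<p = ℕₚ.<-trans (ℕₚ.n<1+n 3) 4<p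
    open FieldLaws F
    open PAdic F p pr b p≡1+2b
    open Series F p pr b p≡1+2b using (pA; sgn; sgn-ι)
    open Estimates F p pr b p≡1+2b 4<p using (Q; Q-refl; Q-O)
    open DworkSum F p pr b' p≡1+2b 4<p
    open GaussSum (suc k)
    open GammaP p pr b p≡1+2b using (refl-prod; rep; rep*n; module Level)
    open Multiplication p pr b p≡1+2b 3<p k using (Γ₁)
    private module L = Level k

    private
      -- One level above the modulus p^(k+1): an error modulo p^(k+1) in the telescoping sum
      -- requires n m + a to be a multiple of p^(k+2).
      K = suc (suc k)

      4e≤R : suc (suc k) ℕ.* 4 ≤ R
      4e≤R = ℕₚ.≤-trans (ℕₚ.*-monoˡ-≤ 4 (subst (suc (suc k) ≤_) (e k) (ℕₚ.m≤m+n (suc (suc k)) 3))) (ℕₚ.m≤m+n S 1)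
        where
        e : ∀ k → suc (suc k) ℕ.+ 3 ≡ suc k ℕ.+ 4
        e = ℕS.solve-∀

      nm+a : ∀ a → n ℕ.* (a ℕ.* rep K) ℕ.+ a ≡ a ℕ.* p ℕ.^ K
      nm+a a = trans (e n a (rep K)) (cong (a ℕ.*_) (rep*n K))
        where
        e : ∀ n a r → n ℕ.* (a ℕ.* r) ℕ.+ a ≡ a ℕ.* suc (r ℕ.* n)
        e = ℕS.solve-∀

      Qa : ℕ → A
      Qa a = Q a (a ℕ.* rep K)

      rep-step : ∀ j → L._≈_ (+ rep (suc k)) (+ rep (j ℕ.+ suc k))
      rep-step zero    = L.≈-refl {+ rep (suc k)}
      rep-step (suc j) = L.≈-trans (rep-step j) (step (j ℕ.+ suc k) (ℕₚ.m≤n+m (suc k) j))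
        where
        rep-diff : ∀ i → rep (suc i) ≡ rep i ℕ.+ p ℕ.^ i
        rep-diff zero    = refl
        rep-diff (suc i) = trans (cong (λ z → 1 ℕ.+ z ℕ.* p) (rep-diff i)) (e (rep i) (p ℕ.^ i) p)
          where
          e : ∀ r x p → 1 ℕ.+ (r ℕ.+ x) ℕ.* p ≡ (1 ℕ.+ r ℕ.* p) ℕ.+ p ℕ.* x
          e = ℕS.solve-∀
        step : ∀ i → suc k ≤ i → L._≈_ (+ rep i) (+ rep (suc i))
        step i le = L.mk (ℤ.- (+ (p ℕ.^ (i ∸ suc k)))) (trans (e (+ rep i) (+ (p ℕ.^ (i ∸ suc k))) (+ (p ℕ.^ suc k)))
            (cong (ℤ._+ ℤ.- (+ (p ℕ.^ (i ∸ suc k))) ℤ.* + (p ℕ.^ suc k)) (sym (trans (cong +_ (rep-diff i)) (trans (ℤₚ.pos-+ (rep i) (p ℕ.^ i)) (cong (λ z → + rep i ℤ.+ z) (trans (cong +_ (trans (cong (p ℕ.^_) (sym (ℕₚ.m∸n+n≡m le))) (ℕₚ.^-distribˡ-+-* p (i ∸ suc k) (suc k)))) (ℤₚ.pos-* (p ℕ.^ (i ∸ suc k)) (p ℕ.^ suc k)))))))))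
          where
          e : ∀ r x y → r ≡ (r ℤ.+ x ℤ.* y) ℤ.+ ℤ.- x ℤ.* y
          e = solve-∀

      index : ∀ a → p ℕ.* (a ℕ.* rep K) ℕ.+ a ≡ a ℕ.* rep (suc K)
      index a = e p a (rep K)
        where
        e : ∀ p a r → p ℕ.* (a ℕ.* r) ℕ.+ a ≡ a ℕ.* (1 ℕ.+ r ℕ.* p)
        e = ℕS.solve-∀

      Γ₁*refl : ∀ a → L._≈_ (Γ₁ a ℤ.* refl-prod (a ℕ.* rep (suc K))) 1ℤ
      Γ₁*refl a = L.≈-trans (L.*-congʳ (refl-prod (a ℕ.* rep (suc K))) (L.gam-cong {a ℕ.* rep (suc k) ℕ.* L.Q} {a ℕ.* rep (suc K) ℕ.* L.Q} cong-index)) (L.reflection (a ℕ.* rep (suc K)))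
        where
        cong-index : L._≈_ (+ (a ℕ.* rep (suc k) ℕ.* L.Q)) (+ (a ℕ.* rep (suc K) ℕ.* L.Q))
        cong-index = L.≈-trans (L.≡⇒≈ (e (rep (suc k)))) (L.≈-trans (L.*-congʳ (+ L.Q) (L.*-congˡ (+ a) (rep-step 2))) (L.≡⇒≈ (sym (e (rep (suc K))))))
          where
          e : ∀ r → + (a ℕ.* r ℕ.* L.Q) ≡ + a ℤ.* + r ℤ.* + L.Q
          e r = trans (ℤₚ.pos-* (a ℕ.* r) L.Q) (cong (ℤ._* + L.Q) (ℤₚ.pos-* a r))

      -- Here p (a · rep K) + a = a · rep(K+1), and rep(K+1) ≡ rep(k+1) modulo p^(k+1); so `Γ₁ a`
      -- and `Qa a` are inverse to the same `refl-prod`.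
      Γ₁≈Q : ∀ a → a < p → O (suc k) (ι (Γ₁ a) - Qa a)
      Γ₁≈Q a a<p = subst (O (suc k)) eq (subst (λ z → O z (ι (Γ₁ a ℤ.* r ℤ.- 1ℤ) * Qa a)) (ℕₚ.+-identityʳ (suc k)) (O-* (≈0⇒O (suc k) (L.≈⇒∸≈0 (Γ₁*refl a))) (Q-O a (a ℕ.* rep K) a<p)))
        where
        open ≡-Reasoning
        r = refl-prod (a ℕ.* rep (suc K))
        eq : ι (Γ₁ a ℤ.* r ℤ.- 1ℤ) * Qa a ≡ ι (Γ₁ a) - Qa a
        eq = begin
          ι (Γ₁ a ℤ.* r ℤ.- 1ℤ) * Qa a               ≡⟨ cong (_* Qa a) (trans (ι-+ (Γ₁ a ℤ.* r) -1ℤ) (cong₂ _+_ (ι-* (Γ₁ a) r) (ι-neg 1ℤ))) ⟩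
          (ι (Γ₁ a) * ι r + - 1#) * Qa a             ≡⟨ solve 3 (λ g r q → (g :* r :+ (:- con 1ℤ)) :* q := g :* (r :* q) :- q) refl (ι (Γ₁ a)) (ι r) (Qa a) ⟩
          ι (Γ₁ a) * (ι r * Qa a) - Qa a             ≡⟨ cong (λ z → ι (Γ₁ a) * z - Qa a) (trans (cong (λ z → ι (refl-prod z) * Qa a) (sym (index a))) (Q-refl a (a ℕ.* rep K) a<p)) ⟩
          ι (Γ₁ a) * 1# - Qa a                       ≡⟨ cong (_- Qa a) (*-identityʳ (ι (Γ₁ a))) ⟩
          ι (Γ₁ a) - Qa a                            ∎

      diff : ∀ a → a < p → O (suc k) (ι (Γ₁ a) - (1# - pA) * g a R)
      diff a a<p = subst (O (suc k)) (solve 3 (λ x y z → (x :- y) :+ (y :- z) := x :- z) refl (ι (Γ₁ a)) (Qa a) ((1# - pA) * g a R))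
        (O-+ (Γ₁≈Q a a<p) (Telescope.Bound.bound (suc k) a a<p (a ℕ.* rep K) (nm+a a) R 4e≤R))

      total-scale : ∀ u G → total (λ a → u * G a) ≡ u * u * total G
      total-scale u G = trans (cong₂ _+_ (trans (sum-cong (suc b) (λ i _ → solve 4 (λ s u x y → s :* (u :* x :* (u :* y)) := u :* u :* (s :* (x :* y))) refl (sgn i) u (G i) (G (b ∸ i)))) (sym (sum-*ˡ (suc b) (u * u) _)))
           (trans (sum-cong b' (λ i _ → solve 5 (λ s q u x y → s :* (q :* (u :* x :* (u :* y))) := u :* u :* (s :* (q :* (x :* y)))) refl (sgn (suc b ℕ.+ i)) (- pA) u (G (suc b ℕ.+ i)) (G (n ∸ suc i)))) (sym (sum-*ˡ b' (u * u) _))))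
         (sym (distribˡ (u * u) _ _))

      O-total : O (suc k) (total (λ a → ι (Γ₁ a)))
      O-total = total-cong {λ a → ι (Γ₁ a)} {λ a → (1# - pA) * g a R} diff (λ i _ → O-ι (Γ₁ i))
        (subst (O (suc k)) (sym (total-scale (1# - pA) (λ a → g a R))) (O-* (O-* O-u O-u) gauss-total))
        where
        O-u : O 0 (1# - pA)
        O-u = O-- (O-ι 1ℤ) (O-ι (+ p))

      ι-sum : ∀ M f → ι (sumℤ M f) ≡ sum M (λ i → ι (f i))
      ι-sum zero    f = refl
      ι-sum (suc M) f = trans (ι-+ (sumℤ M f) (f M)) (cong (_+ ι (f M)) (ι-sum M f))

    vanishing : L._≈_
      (sumℤ (suc b) (λ i → -1ℤ ℤ.^ i ℤ.* (Γ₁ i ℤ.* Γ₁ (b ∸ i))) ℤ.+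
       sumℤ b' (λ i → -1ℤ ℤ.^ (suc b ℕ.+ i) ℤ.* (ℤ.- (+ p) ℤ.* (Γ₁ (suc b ℕ.+ i) ℤ.* Γ₁ (n ∸ suc i))))) 0ℤ
    vanishing = O⇒≈0 (suc k) (subst (O (suc k)) (sym (trans (ι-+ S₁ S₂) (cong₂ _+_
        (trans (ι-sum (suc b) _) (sum-cong (suc b) (λ i _ → trans (ι-* (-1ℤ ℤ.^ i) _) (cong₂ _*_ (sym (sgn-ι i)) (ι-* (Γ₁ i) (Γ₁ (b ∸ i)))))))
        (trans (ι-sum b' _) (sum-cong b' (λ i _ → trans (ι-* (-1ℤ ℤ.^ (suc b ℕ.+ i)) _) (cong₂ _*_ (sym (sgn-ι (suc b ℕ.+ i))) (trans (ι-* (ℤ.- (+ p)) _) (cong₂ _*_ (ι-neg (+ p)) (ι-* (Γ₁ (suc b ℕ.+ i)) (Γ₁ (n ∸ suc i)))))))))))) O-total)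
      where
      S₁ = sumℤ (suc b) (λ i → -1ℤ ℤ.^ i ℤ.* (Γ₁ i ℤ.* Γ₁ (b ∸ i)))
      S₂ = sumℤ b' (λ i → -1ℤ ℤ.^ (suc b ℕ.+ i) ℤ.* (ℤ.- (+ p) ℤ.* (Γ₁ (suc b ℕ.+ i) ℤ.* Γ₁ (n ∸ suc i))))

-- The rational field, and floors and fractional parts over a fixed denominator

module Fractions where
  open import Defs
  open import Data.Empty using (⊥-elim)
  open import Data.Nat as ℕ using (ℕ; zero; suc; _<_; _≤_)
  import Data.Nat.Properties as ℕₚ
  import Data.Nat.Coprimality as Coprimality
  open import Data.Nat.Divisibility using (divides; _∣_)
  open import Data.Integer as ℤ using (ℤ; +_; -[1+_]; _+_; _*_; -_; _-_; 1ℤ; ∣_∣)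
  import Data.Integer.Properties as ℤₚ
  import Data.Integer.DivMod as ℤ÷
  open import Data.Integer.Tactic.RingSolver using (solve-∀)
  open import Data.Rational as ℚ using (ℚ; mkℚ; floor; toℚᵘ)
  import Data.Rational.Properties as ℚₚ
  open import Data.Rational.Unnormalised using (mkℚᵘ; *≡*) renaming (_≃_ to _≃ᵘ_)
  import Data.Rational.Unnormalised.Properties as ℚᵘₚ
  open import Data.Product using (_,_; ∃; _×_; proj₁; proj₂)
  open import Relation.Binary.PropositionalEquality as ≡ using (_≡_; refl; cong; subst; sym; trans; module ≡-Reasoning)
  open FiniteSums
  open RationalValuation

  private
    ιℚ : ℤ → ℚ
    ιℚ z = z ℚ./ 1

    toᵘ-ι : ∀ z → toℚᵘ (ιℚ z) ≃ᵘ mkℚᵘ z 0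
    toᵘ-ι z = ℚₚ.toℚᵘ-fromℚᵘ (mkℚᵘ z 0)

    via : ∀ {x y u} → toℚᵘ x ≃ᵘ u → toℚᵘ y ≃ᵘ u → x ≡ y
    via h h' = ℚₚ.toℚᵘ-injective (ℚᵘₚ.≃-trans h (ℚᵘₚ.≃-sym h'))

  ℚ-field : RationalField
  ℚ-field = record
    { A = ℚ
    ; _+_ = ℚ._+_
    ; _*_ = ℚ._*_
    ; -_ = ℚ.-_
    ; ι = ιℚ
    ; isCommutativeRing = ℚₚ.+-*-isCommutativeRing
    ; ι-+ = λ x y → via (toᵘ-ι (x + y)) (ℚᵘₚ.≃-trans (ℚₚ.toℚᵘ-homo-+ (ιℚ x) (ιℚ y)) (ℚᵘₚ.≃-trans (ℚᵘₚ.+-cong (toᵘ-ι x) (toᵘ-ι y)) (*≡* (e₁ x y))))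
    ; ι-* = λ x y → via (toᵘ-ι (x * y)) (ℚᵘₚ.≃-trans (ℚₚ.toℚᵘ-homo-* (ιℚ x) (ιℚ y)) (ℚᵘₚ.≃-trans (ℚᵘₚ.*-cong (toᵘ-ι x) (toᵘ-ι y)) (*≡* refl)))
    ; ι-neg = λ x → via (toᵘ-ι (- x)) (ℚᵘₚ.≃-trans (ℚₚ.toℚᵘ-homo‿- (ιℚ x)) (ℚᵘₚ.-‿cong (toᵘ-ι x)))
    ; ι-injective = λ {x} {y} h → ι-inj (ℚᵘₚ.≃-trans (ℚᵘₚ.≃-sym (toᵘ-ι x)) (ℚᵘₚ.≃-trans (ℚₚ.toℚᵘ-cong h) (toᵘ-ι y)))
    ; inv = λ n → + 1 ℚ./ suc n
    ; inv-law = λ n → via (ℚᵘₚ.≃-trans (ℚₚ.toℚᵘ-homo-* (ιℚ (+ suc n)) (+ 1 ℚ./ suc n)) (ℚᵘₚ.≃-trans (ℚᵘₚ.*-cong (toᵘ-ι (+ suc n)) (ℚₚ.toℚᵘ-fromℚᵘ (mkℚᵘ (+ 1) n))) (*≡* (e₂ n)))) (toᵘ-ι 1ℤ)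
    }
    where
    e₁ : ∀ x y → (x * + 1 + y * + 1) * + 1 ≡ (x + y) * + 1
    e₁ = solve-∀
    e₂ : ∀ n → (+ suc n * + 1) * + 1 ≡ + 1 * (+ suc (n ℕ.+ 0))
    e₂ n = trans (ℤₚ.*-identityʳ _) (trans (ℤₚ.*-identityʳ (+ suc n)) (trans (cong (λ z → + suc z) (sym (ℕₚ.+-identityʳ n))) (sym (ℤₚ.*-identityˡ _))))
    ι-inj : ∀ {x y} → mkℚᵘ x 0 ≃ᵘ mkℚᵘ y 0 → x ≡ y
    ι-inj {x} {y} (*≡* h) = trans (sym (ℤₚ.*-identityʳ x)) (trans h (ℤₚ.*-identityʳ y))

  ∣+-+∣< : ∀ {r r' d} → r < d → r' < d → ∣ + r - + r' ∣ < d
  ∣+-+∣< {r} {r'} {d} h h' = ℕₚ.≤-<-trans (subst (λ z → ∣ z ∣ ≤ r ℕ.⊔ r') (sym (ℤₚ.m-n≡m⊖n r r')) (ℤₚ.∣m⊝n∣≤m⊔n r r')) (ℕₚ.⊔-lub h h')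

  quotient-unique : ∀ d q q' {r r'} → r < d → r' < d → + r + q * + d ≡ + r' + q' * + d → q ≡ q'
  quotient-unique d q q' {r} {r'} r<d r'<d h = ℤₚ.i-j≡0⇒i≡j q q' (ℤₚ.∣i∣≡0⇒i≡0 (small ∣ q - q' ∣ (subst (_< d)
      (trans (cong ∣_∣ (trans (e₁ (+ r) (+ r') (q * + d) (q' * + d) h) (e₂ q q' (+ d)))) (ℤₚ.abs-* (q - q') (+ d))) (∣+-+∣< r'<d r<d))))
    where
    e₁ : ∀ r r' x y → r + x ≡ r' + y → r' - r ≡ x - y
    e₁ r r' x y h = trans (e₃ r r' y) (trans (cong (λ z → z - r - y) (sym h)) (e₄ r x y))
      where
      e₃ : ∀ r r' y → r' - r ≡ (r' + y) - r - y
      e₃ = solve-∀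
      e₄ : ∀ r x y → (r + x) - r - y ≡ x - y
      e₄ = solve-∀
    e₂ : ∀ q q' d → q * d - q' * d ≡ (q - q') * d
    e₂ = solve-∀
    small : ∀ x → x ℕ.* d < d → x ≡ 0
    small zero    _ = refl
    small (suc x) h = ⊥-elim (ℕₚ.<⇒≱ h (ℕₚ.m≤m+n d (x ℕ.* d)))

  -- Is D' y z : the rational y equals z/(1 + D')
  module Fraction (D' : ℕ) where
    D : ℕ
    D = suc D'

    Is : ℚ → ℤ → Set
    Is y z = toℚᵘ y ≃ᵘ mkℚᵘ z D'

    Is-+ : ∀ {x y z w} → Is x z → Is y w → Is (x ℚ.+ y) (z + w)
    Is-+ {x} {y} {z} {w} hx hy = ℚᵘₚ.≃-trans (ℚₚ.toℚᵘ-homo-+ x y) (ℚᵘₚ.≃-trans (ℚᵘₚ.+-cong hx hy) (*≡* (trans (e z w (+ D)) (cong ((z + w) *_) (sym (ℤₚ.pos-* D D))))))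
      where
      e : ∀ z w D → (z * D + w * D) * D ≡ (z + w) * (D * D)
      e = solve-∀

    Is-neg : ∀ {x z} → Is x z → Is (ℚ.- x) (- z)
    Is-neg {x} h = ℚᵘₚ.≃-trans (ℚₚ.toℚᵘ-homo‿- x) (ℚᵘₚ.-‿cong h)

    Is-- : ∀ {x y z w} → Is x z → Is y w → Is (x ℚ.- y) (z - w)
    Is-- {x} {y} hx hy = Is-+ {x} {ℚ.- y} hx (Is-neg {y} hy)

    Is-/ : ∀ z d w → z * + D ≡ w * + suc d → Is (z ℚ./ suc d) w
    Is-/ z d w h = ℚᵘₚ.≃-trans (ℚₚ.toℚᵘ-fromℚᵘ (mkℚᵘ z d)) (*≡* h)

    Is-resp : ∀ {y z w} → z ≡ w → Is y z → Is y w
    Is-resp {y} refl h = h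

    -- The floor is computed from the reduced fraction, whereas the hypothesis is over the
    -- denominator `D`. The remainder r is therefore rescaled to the reduced denominator before
    -- uniqueness of division with remainder applies.
    floor-Is : ∀ y f r → r < D → Is y (f * + D + + r) → floor y ≡ f
    floor-Is y@(mkℚ num d-1 _) f r r<D (*≡* h) = trans (ℤₚ.*-identityˡ (num ℤ÷./ℕ d))
        (quotient-unique d (num ℤ÷./ℕ d) f (ℤ÷.n%ℕd<d num d) (proj₁ (proj₂ rem)) (trans (sym (ℤ÷.a≡a%ℕn+[a/ℕn]*n num d)) (proj₂ (proj₂ rem))))
      where
      d = suc d-1
      r' = num - f * + d
      r'D : r' * + D ≡ + (r ℕ.* d)
      r'D = trans (e₁ num f (+ d) (+ D)) (trans (cong (λ z → z - f * + d * + D) h) (trans (e₂ f (+ D) (+ r) (+ d)) (sym (ℤₚ.pos-* r d))))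
        where
        e₁ : ∀ n f d D → (n - f * d) * D ≡ n * D - f * d * D
        e₁ = solve-∀
        e₂ : ∀ f D r d → (f * D + r) * d - f * d * D ≡ r * d
        e₂ = solve-∀
      natural : ∀ z → z * + D ≡ + (r ℕ.* d) → ∃ λ x → (x < d) × (z ≡ + x)
      natural (+ x)    e = x , ℕₚ.*-cancelʳ-< D x d (subst (_< d ℕ.* D) (sym (ℤₚ.+-injective (trans (ℤₚ.pos-* x D) e))) (subst (r ℕ.* d <_) (ℕₚ.*-comm D d) (ℕₚ.*-monoˡ-< d r<D))) , refl
      natural -[1+ x ] ()
      rem : ∃ λ x → (x < d) × (num ≡ + x + f * + d)
      rem with natural r' r'D
      ... | x , x<d , e = x , x<d , trans (e₃ num (f * + d)) (cong (_+ f * + d) e)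
        where
        e₃ : ∀ n y → n ≡ (n - y) + y
        e₃ = solve-∀

    fr-Is : ∀ y f r → r < D → Is y (f * + D + + r) → Is (fr y) (+ r)
    fr-Is y f r r<D h = Is-resp {fr y} (e (f * + D) (+ r)) (Is-- {y} {floor y ℚ./ 1} h
        (Is-/ (floor y) 0 (f * + D) (trans (cong (_* + D) (floor-Is y f r r<D h)) (sym (ℤₚ.*-identityʳ (f * + D))))))
      where
      e : ∀ x r → (x + r) - x ≡ r
      e = solve-∀

    -- Holds because rationals are stored in lowest terms. For D = 3(p-1) it shows that the stored
    -- denominator is prime to p.
    den∣D : ∀ y z → Is y z → ℚ.↧ₙ y ∣ D
    den∣D (mkℚ num d-1 cop) z (*≡* h) = Coprimality.coprime-divisor (Coprimality.sym (Coprimality.recompute cop)) (divides ∣ z ∣ (trans (sym (ℤₚ.abs-* num (+ D))) (trans (cong ∣_∣ h) (ℤₚ.abs-* z (+ suc d-1)))))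

    Is-eq : ∀ y z → Is y z → ℚ.↥ y * + D ≡ z * ℚ.↧ y
    Is-eq (mkℚ num d-1 cop) z (*≡* h) = h

-- Evaluation of the terms of ₃G₃ modulo p^(k+1)

module HypergeometricSum where
  open import Defs
  open import Data.Bool using (if_then_else_)
  open import Data.Empty using (⊥-elim)
  open import Data.Nat as ℕ using (ℕ; zero; suc; _<_; _≤_; z≤n; s≤s; _∸_; _≤?_; _/_; _%_)
  import Data.Nat.Properties as ℕₚ
  open import Data.Nat.DivMod using (m≡m%n+[m/n]*n; m%n<n; m/n*n≤m)
  open import Data.Nat.Divisibility as ℕ∣ using (divides; _∣_; _∤_; _∣?_)
  open import Data.Nat.Primality using (Prime; prime⇒nonZero)
  import Data.Nat.Tactic.RingSolver as ℕS
  open import Data.Nat.ListAction using () renaming (sum to sumL)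
  open import Data.List using (map; upTo; applyUpTo)
  open import Data.List.Properties using (map-upTo)
  open import Data.Vec using ([]; _∷_)
  open import Data.Integer as ℤ using (ℤ; +_; -[1+_]; _+_; _*_; -_; _-_; _^_; 0ℤ; 1ℤ; -1ℤ; ∣_∣)
  import Data.Integer.Properties as ℤₚ
  open import Data.Integer.Tactic.RingSolver using (solve-∀)
  open import Data.Rational as ℚ using (ℚ; floor)
  open import Data.Product using (_,_; ∃; _×_; proj₁; proj₂)
  open import Data.Sum using (_⊎_; inj₁; inj₂)
  open import Function using (_∘_)
  open import Relation.Nullary using (¬_; yes; no; Dec)
  open import Relation.Nullary.Decidable using (dec-true; dec-false)
  open import Relation.Binary.PropositionalEquality as ≡ using (_≡_; refl; cong; cong₂; subst; sym; trans; module ≡-Reasoning)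
  open FiniteSums
  open ModularArithmetic
  open MoritaGamma
  open GaussMultiplication
  open Fractions

  parity : ∀ e → (∃ λ q → e ≡ q ℕ.+ q) ⊎ (∃ λ q → e ≡ suc (q ℕ.+ q))
  parity zero    = inj₁ (0 , refl)
  parity (suc e) with parity e
  ... | inj₁ (q , refl) = inj₂ (q , refl)
  ... | inj₂ (q , refl) = inj₁ (suc q , cong suc (sym (ℕₚ.+-suc q q)))

  +∸ : ∀ {x y} → y ≤ x → + (x ∸ y) ≡ + x - + y
  +∸ {x} {y} h = trans (e (+ (x ∸ y)) (+ y)) (cong (_- + y) (trans (sym (ℤₚ.pos-+ (x ∸ y) y)) (cong +_ (ℕₚ.m∸n+n≡m h))))
    where
    e : ∀ x y → x ≡ (x + y) - y
    e = solve-∀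

  ^0* : ∀ x y → x ^ 0 * y ≡ y
  ^0* x y = ℤₚ.*-identityˡ y

  ^1* : ∀ x y → x ^ 1 * y ≡ x * y
  ^1* x y = cong (_* y) (ℤₚ.*-identityʳ x)

  sumL-upTo : ∀ (f : ℕ → ℕ) m → + sumL (applyUpTo f m) ≡ sumℤ m (λ i → + f i)
  sumL-upTo f zero    = refl
  sumL-upTo f (suc m) = trans (ℤₚ.pos-+ (f 0) (sumL (applyUpTo (f ∘ suc) m))) (trans (cong (_+_ (+ f 0)) (sumL-upTo (f ∘ suc) m)) (sym (ℤΣ.sum-first m (λ i → + f i))))

  module Residues (p : ℕ) (pr : Prime p) (b : ℕ) (p≡1+2b : p ≡ suc (b ℕ.+ b)) (3<p : 3 < p) (k : ℕ) where
    open GammaP p pr b p≡1+2b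
    open Level k
    open Multiplication p pr b p≡1+2b 3<p k

    private instance
      p≢0 = prime⇒nonZero pr
      P≢0 : ℕ.NonZero P
      P≢0 = ℕ.>-nonZero (ℕₚ.m^n>0 p (suc k))

    private
      mod-% : ∀ x m .⦃ _ : ℕ.NonZero m ⦄ → x mod m ≡ x % m
      mod-% x (suc m) = refl

    mod-≈ : ∀ x → + (x mod P) ≈ + x
    mod-≈ x = ≈-trans (≡⇒≈ (cong +_ (mod-% x P))) (≈-sym (mk (+ (x / P)) (trans (cong +_ (m≡m%n+[m/n]*n x P)) (trans (ℤₚ.pos-+ (x % P) (x / P ℕ.* P)) (cong (_+_ (+ (x % P))) (ℤₚ.pos-* (x / P) P))))))

    ≈0⇒mod≡0 : ∀ x → + x ≈ 0ℤ → x mod P ≡ 0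
    ≈0⇒mod≡0 x h = trans (mod-% x P) (small (x % P) (m%n<n x P) (≈-trans (subst (λ z → + z ≈ + x) (mod-% x P) (mod-≈ x)) h))
      where
      small : ∀ y → y < P → + y ≈ 0ℤ → y ≡ 0
      small zero    _ _ = refl
      small (suc y) h (Mod.mk q e) = ⊥-elim (ℕₚ.<⇒≱ h (ℕ∣.∣⇒≤ (divides ∣ q ∣ (trans (cong ∣_∣ (trans e (ℤₚ.+-identityˡ (q * + P)))) (ℤₚ.abs-* q (+ P))))))

    private
      mod<P : ∀ x → x mod P < P
      mod<P x = subst (_< P) (sym (mod-% x P)) (m%n<n x P)

    negM-≈ : ∀ x → + negM P x ≈ - (+ x)
    negM-≈ x = ≈-trans (mod-≈ (P ∸ (x mod P))) (≈-trans (≡⇒≈ (+∸ (ℕₚ.<⇒≤ (mod<P x))))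
      (≈-trans (+-cong {+ P} {0ℤ} (mk 1ℤ (trans (sym (ℤₚ.*-identityˡ (+ P))) (sym (ℤₚ.+-identityˡ (1ℤ * + P))))) (neg-cong (mod-≈ x))) (≡⇒≈ (ℤₚ.+-identityˡ (- (+ x))))))

    zmod-≈ : ∀ z → + zmod P z ≈ z
    zmod-≈ (+ x)    = mod-≈ x
    zmod-≈ -[1+ x ] = negM-≈ (suc x)

    signM-≈ : ∀ e x → + signM P e x ≈ -1ℤ ^ e * + x
    signM-≈ e x with parity e
    ... | inj₁ (q , refl) = ≈-trans (≡⇒≈ (cong (λ d → + (if d then x mod P else negM P x)) (dec-true (2 ∣? (q ℕ.+ q)) (divides q (e₂ q)))))
        (≈-trans (mod-≈ x) (≡⇒≈ (sym (trans (cong (_* + x) (-1^2n q)) (ℤₚ.*-identityˡ (+ x))))))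
      where
      e₂ : ∀ q → q ℕ.+ q ≡ q ℕ.* 2
      e₂ = ℕS.solve-∀
    ... | inj₂ (q , refl) = ≈-trans (≡⇒≈ (cong (λ d → + (if d then x mod P else negM P x)) (dec-false (2 ∣? suc (q ℕ.+ q)) odd)))
        (≈-trans (negM-≈ x) (≡⇒≈ (sym (trans (cong (λ z → -1ℤ * z * + x) (-1^2n q)) (ℤₚ.-1*i≡-i (+ x))))))
      where
      e₂ : ∀ q → q ℕ.+ q ≡ q ℕ.* 2
      e₂ = ℕS.solve-∀
      odd : ¬ 2 ∣ suc (q ℕ.+ q)
      odd d = ℕₚ.<⇒≱ (ℕₚ.n<1+n 1) (ℕ∣.∣⇒≤ (∣m+n∣n⇒∣m 1 d (divides q (e₂ q))))

    invM-≈ : ∀ {u} → p ∤ u → + u * + invM p (suc k) u ≈ 1ℤ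
    invM-≈ {u} p∤u = ≈-trans (*-congˡ (+ u) (≈-trans (mod-≈ (u ℕ.^ (p ℕ.^ k ℕ.* (p ∸ 1) ∸ 1))) (≡⇒≈ (pos-^ u (p ℕ.^ k ℕ.* (p ∸ 1) ∸ 1))))) (euler-inv k p∤u)

    unit⇒∤ : ∀ {u} → Unit (+ u) → p ∤ u
    unit⇒∤ h d = unit⇒≉0 (unit-to-p k h) (∣⇒≈0 d)

    private
      unitProd≡ : ∀ N → -1ℤ ^ N * + unitProd p N ≡ gam N
      unitProd≡ zero    = refl
      unitProd≡ (suc N) with p ∣? N
      ... | yes _ = trans (cong (λ z → -1ℤ ^ suc N * z) (cong +_ (ℕₚ.*-identityʳ (unitProd p N)))) (trans (e (-1ℤ ^ N) (+ unitProd p N)) (cong (_* -1ℤ) (unitProd≡ N)))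
        where
        e : ∀ x y → -1ℤ * x * y ≡ x * y * -1ℤ
        e = solve-∀
      ... | no _  = trans (cong (λ z → -1ℤ ^ suc N * z) (ℤₚ.pos-* (unitProd p N) N)) (trans (e (-1ℤ ^ N) (+ unitProd p N) (+ N)) (cong (_* - (+ N)) (unitProd≡ N)))
        where
        e : ∀ x y n → -1ℤ * x * (y * n) ≡ x * y * - n
        e = solve-∀

    Γp-≈ : ∀ y → + Γp p (suc k) y ≈ gam (qmod p (suc k) y)
    Γp-≈ y = ≈-trans (signM-≈ N (unitProd p N)) (≡⇒≈ (unitProd≡ N))
      where N = qmod p (suc k) y

    Γp-unit : ∀ y → Unit (+ Γp p (suc k) y)
    Γp-unit y = Unit-resp (≈-sym (Γp-≈ y)) (gam-unit (qmod p (suc k) y))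

    invΓ-unit : ∀ y → Unit (+ invM p (suc k) (Γp p (suc k) y))
    invΓ-unit y = Unit-inv {+ Γp p (suc k) y} {+ invM p (suc k) (Γp p (suc k) y)} (invM-≈ (unit⇒∤ (Γp-unit y)))

    n : ℕ
    n = p ∸ 1

    n≡2b : n ≡ b ℕ.+ b
    n≡2b = cong ℕ.pred p≡1+2b

    private
      p≡1+n : p ≡ suc n
      p≡1+n = sym (ℕₚ.suc-pred p)
      n>0 : 0 < n
      n>0 = ℕ.s≤s⁻¹ (subst (1 <_) p≡1+n 1<p)
      instance
        3n≢0 : ℕ.NonZero (3 ℕ.* n)
        3n≢0 = ℕ.>-nonZero (ℕₚ.*-mono-≤ {1} {3} (s≤s z≤n) n>0)

    -- The common denominator 3(p-1) suits all arguments: with p - 1 = 2b the parameters 1/6, 1/2,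
    -- 5/6 become (b + in)/3n, the parameters 0, 1/3, 2/3 become in/3n, and a/(p-1) becomes 3a/3n.
    open Fraction (ℕ.pred (3 ℕ.* n)) public

    D≡3n : D ≡ 3 ℕ.* n
    D≡3n = ℕₚ.suc-pred (3 ℕ.* n)

    +D≡ : + D ≡ + 3 * + n
    +D≡ = trans (cong +_ D≡3n) (ℤₚ.pos-* 3 n)

    private
      p∤n : p ∤ n
      p∤n = 0<u<p⇒∤ n>0 (subst (n <_) (sym p≡1+n) (ℕₚ.n<1+n n))
      p∤3 : p ∤ 3
      p∤3 = 0<u<p⇒∤ (s≤s z≤n) 3<p

    3n-unit : Unit (+ 3 * + n)
    3n-unit = Unit-* (ℕ-unit k p∤3) (ℕ-unit k p∤n)

    qmod-≈ : ∀ y z → Is y z → + qmod p (suc k) y * (+ 3 * + n) ≈ z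
    qmod-≈ y z h = *-cancelˡ {+ ℚ.↧ₙ y} (ℕ-unit k p∤den) (begin
      d * (+ qmod p (suc k) y * (+ 3 * + n))                  ≈⟨ *-congˡ d (*-congʳ (+ 3 * + n) (≈-trans (mod-≈ (zm ℕ.* i)) (≡⇒≈ (ℤₚ.pos-* zm i)))) ⟩
      d * (+ zm * + i * (+ 3 * + n))                          ≡⟨ e₁ d (+ zm) (+ i) (+ 3 * + n) ⟩
      d * + i * (+ zm * (+ 3 * + n))                          ≈⟨ *-cong (invM-≈ p∤den) (*-congʳ (+ 3 * + n) (zmod-≈ (ℚ.↥ y))) ⟩
      1ℤ * (ℚ.↥ y * (+ 3 * + n))                              ≡⟨ ℤₚ.*-identityˡ (ℚ.↥ y * (+ 3 * + n)) ⟩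
      ℚ.↥ y * (+ 3 * + n)                                     ≡⟨ cong (ℚ.↥ y *_) +D≡ ⟨
      ℚ.↥ y * + D                                             ≡⟨ Is-eq y z h ⟩
      z * d                                                   ≡⟨ ℤₚ.*-comm z d ⟩
      d * z                                                   ∎)
      where
      open ≈-Reasoning
      d = + ℚ.↧ₙ y
      zm = zmod P (ℚ.↥ y)
      i = invM p (suc k) (ℚ.↧ₙ y)
      e₁ : ∀ d z i t → d * (z * i * t) ≡ d * i * (z * t)
      e₁ = solve-∀
      p∤den : p ∤ ℚ.↧ₙ y
      p∤den d = unit⇒≉0 (unit-to-p k 3n-unit) (𝔽.≈-trans (𝔽.≡⇒≈ (sym +D≡)) (∣⇒≈0 (ℕ∣.∣-trans d (den∣D y z h))))

    -- Γ_p((c + j n) / 3n)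
    γ : ℕ → ℕ → ℤ
    γ c j = gam (X (c ℕ.* rep (suc k)) j)

    -- For δ = 3f + j the numerator c + δn equals f · 3n + (c + jn), with 0 ≤ c + jn < 3n.
    evaluate : ∀ y c j δ f → c < n → j < 3 → δ ≡ f * + 3 + + j → Is y (+ c + δ * + n) →
      (floor y ≡ f) × (+ Γp p (suc k) (fr y) ≈ γ c j)
    evaluate y c j δ f c<n j<3 δ≡ h = floor-Is y f r r<D h' , ≈-trans (Γp-≈ (fr y)) (gam-cong {qmod p (suc k) (fr y)} {X (c ℕ.* rep (suc k)) j}
        (*-cancelˡ 3n-unit (≈-trans (≡⇒≈ (ℤₚ.*-comm (+ 3 * + n) (+ qmod p (suc k) (fr y)))) (≈-trans (qmod-≈ (fr y) (+ r) (fr-Is y f r r<D h'))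
           (≈-trans (≈-sym (X-spec c j)) (≡⇒≈ (ℤₚ.*-comm (+ X (c ℕ.* rep (suc k)) j) (+ 3 * + n))))))))
      where
      r = c ℕ.+ j ℕ.* n
      r<D : r < D
      r<D = subst (r <_) (sym D≡3n) (ℕₚ.<-≤-trans (ℕₚ.+-monoˡ-< (j ℕ.* n) c<n) (ℕₚ.*-monoˡ-≤ n j<3))
      e : ∀ c f j n → c + (f * + 3 + j) * n ≡ f * (+ 3 * n) + (c + j * n)
      e = solve-∀
      h' : Is y (f * + D + + r)
      h' = Is-resp {y} (trans (cong (λ z → + c + z * + n) δ≡) (trans (e (+ c) f (+ j) (+ n))
        (cong₂ (λ u v → f * u + v) (sym +D≡) (trans (cong (_+_ (+ c)) (sym (ℤₚ.pos-* j n))) (sym (ℤₚ.pos-+ c (j ℕ.* n))))))) h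

    -- The definition of the series takes floors of ⟨a_k⟩ - a/(p-1) but Γ_p at ⟨a_k - a/(p-1)⟩, and
    -- likewise for b_k. The family `y` serves the floors and `y'` the values of Γ_p.
    Three : (ℕ → ℚ) → (ℕ → ℚ) → ℤ → ℕ → Set
    Three y y' F c = (floor (y 0) + (floor (y 1) + floor (y 2)) ≡ F) ×
      (+ Γp p (suc k) (fr (y' 0)) * + Γp p (suc k) (fr (y' 1)) * + Γp p (suc k) (fr (y' 2)) ≈ Mul (c ℕ.* rep (suc k)))

    private
      0<3 : 0 < 3
      0<3 = s≤s z≤n
      1<3 : 1 < 3
      1<3 = s≤s (s≤s z≤n)
      2<3 : 2 < 3
      2<3 = s≤s (s≤s (s≤s z≤n))

      perm₁ : ∀ x y z → z * x * y ≡ x * y * z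
      perm₁ = solve-∀
      perm₂ : ∀ x y z → y * z * x ≡ x * y * z
      perm₂ = solve-∀

    -- The shifts i - q for i = 0, 1, 2 run through the classes modulo 3. So the floors add up to
    -- -q, an instance of Hermite's identity, and the three values of Γ_p are the factors of `Mul`
    -- in cyclically rotated order.
    a-side : ∀ (y y' : ℕ → ℚ) q c → q < 4 → c < n →
      (∀ i → i < 3 → Is (y i) (+ c + (+ i - + q) * + n)) → (∀ i → i < 3 → Is (y' i) (+ c + (+ i - + q) * + n)) → Three y y' (- (+ q)) c
    a-side y y' q c q<4 c<n h h' = cases q q<4 h h'
      where
      E : ∀ (w : ℕ → ℚ) q → (∀ i → i < 3 → Is (w i) (+ c + (+ i - + q) * + n)) → ∀ i → i < 3 → ∀ j f → j < 3 → + i - + q ≡ f * + 3 + + j → (floor (w i) ≡ f) × (+ Γp p (suc k) (fr (w i)) ≈ γ c j)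
      E w q h i i<3 j f j<3 e = evaluate (w i) c j (+ i - + q) f c<n j<3 e (h i i<3)
      cases : ∀ q → q < 4 → (∀ i → i < 3 → Is (y i) (+ c + (+ i - + q) * + n)) → (∀ i → i < 3 → Is (y' i) (+ c + (+ i - + q) * + n)) → Three y y' (- (+ q)) c
      cases 0 _ h h' =
        cong₂ _+_ (proj₁ (E y 0 h 0 0<3 0 (+ 0) 0<3 refl)) (cong₂ _+_ (proj₁ (E y 0 h 1 1<3 1 (+ 0) 1<3 refl)) (proj₁ (E y 0 h 2 2<3 2 (+ 0) 2<3 refl))) ,
        *-cong (*-cong (proj₂ (E y' 0 h' 0 0<3 0 (+ 0) 0<3 refl)) (proj₂ (E y' 0 h' 1 1<3 1 (+ 0) 1<3 refl))) (proj₂ (E y' 0 h' 2 2<3 2 (+ 0) 2<3 refl))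
      cases 1 _ h h' =
        cong₂ _+_ (proj₁ (E y 1 h 0 0<3 2 -1ℤ 2<3 refl)) (cong₂ _+_ (proj₁ (E y 1 h 1 1<3 0 (+ 0) 0<3 refl)) (proj₁ (E y 1 h 2 2<3 1 (+ 0) 1<3 refl))) ,
        ≈-trans (*-cong (*-cong (proj₂ (E y' 1 h' 0 0<3 2 -1ℤ 2<3 refl)) (proj₂ (E y' 1 h' 1 1<3 0 (+ 0) 0<3 refl))) (proj₂ (E y' 1 h' 2 2<3 1 (+ 0) 1<3 refl))) (≡⇒≈ (perm₁ (γ c 0) (γ c 1) (γ c 2)))
      cases 2 _ h h' =
        cong₂ _+_ (proj₁ (E y 2 h 0 0<3 1 -1ℤ 1<3 refl)) (cong₂ _+_ (proj₁ (E y 2 h 1 1<3 2 -1ℤ 2<3 refl)) (proj₁ (E y 2 h 2 2<3 0 (+ 0) 0<3 refl))) ,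
        ≈-trans (*-cong (*-cong (proj₂ (E y' 2 h' 0 0<3 1 -1ℤ 1<3 refl)) (proj₂ (E y' 2 h' 1 1<3 2 -1ℤ 2<3 refl))) (proj₂ (E y' 2 h' 2 2<3 0 (+ 0) 0<3 refl))) (≡⇒≈ (perm₂ (γ c 0) (γ c 1) (γ c 2)))
      cases 3 _ h h' =
        cong₂ _+_ (proj₁ (E y 3 h 0 0<3 0 -1ℤ 0<3 refl)) (cong₂ _+_ (proj₁ (E y 3 h 1 1<3 1 -1ℤ 1<3 refl)) (proj₁ (E y 3 h 2 2<3 2 -1ℤ 2<3 refl))) ,
        *-cong (*-cong (proj₂ (E y' 3 h' 0 0<3 0 -1ℤ 0<3 refl)) (proj₂ (E y' 3 h' 1 1<3 1 -1ℤ 1<3 refl))) (proj₂ (E y' 3 h' 2 2<3 2 -1ℤ 2<3 refl))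
      cases (suc (suc (suc (suc _)))) (s≤s (s≤s (s≤s (s≤s ())))) _ _

    -- shift of the numerator of ⟨-b_i⟩ for b = 0, 1/3, 2/3
    neg-shift : ℕ → ℤ
    neg-shift 0 = + 0
    neg-shift 1 = + 2
    neg-shift _ = + 1

    b-side : ∀ (y y' : ℕ → ℚ) q c → q < 3 → c < n →
      (∀ i → i < 3 → Is (y i) (+ c + (+ q + neg-shift i) * + n)) → (∀ i → i < 3 → Is (y' i) (+ c + (+ q - + i) * + n)) → Three y y' (+ q) c
    b-side y y' q c q<3 c<n h h' = cases q q<3 h h'
      where
      E : ∀ (w : ℕ → ℚ) (δ : ℕ → ℤ) → (∀ i → i < 3 → Is (w i) (+ c + δ i * + n)) → ∀ i → i < 3 → ∀ j f → j < 3 → δ i ≡ f * + 3 + + j → (floor (w i) ≡ f) × (+ Γp p (suc k) (fr (w i)) ≈ γ c j)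
      E w δ h i i<3 j f j<3 e = evaluate (w i) c j (δ i) f c<n j<3 e (h i i<3)
      cases : ∀ q → q < 3 → (∀ i → i < 3 → Is (y i) (+ c + (+ q + neg-shift i) * + n)) → (∀ i → i < 3 → Is (y' i) (+ c + (+ q - + i) * + n)) → Three y y' (+ q) c
      cases 0 _ h h' =
        cong₂ _+_ (proj₁ (E y (λ i → + 0 + neg-shift i) h 0 0<3 0 (+ 0) 0<3 refl)) (cong₂ _+_ (proj₁ (E y (λ i → + 0 + neg-shift i) h 1 1<3 2 (+ 0) 2<3 refl)) (proj₁ (E y (λ i → + 0 + neg-shift i) h 2 2<3 1 (+ 0) 1<3 refl))) ,
        ≈-trans (*-cong (*-cong (proj₂ (E y' (λ i → + 0 - + i) h' 0 0<3 0 (+ 0) 0<3 refl)) (proj₂ (E y' (λ i → + 0 - + i) h' 1 1<3 2 -1ℤ 2<3 refl))) (proj₂ (E y' (λ i → + 0 - + i) h' 2 2<3 1 -1ℤ 1<3 refl))) (≡⇒≈ (perm₃ (γ c 0) (γ c 1) (γ c 2)))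
        where
        perm₃ : ∀ x y z → x * z * y ≡ x * y * z
        perm₃ = solve-∀
      cases 1 _ h h' =
        cong₂ _+_ (proj₁ (E y (λ i → + 1 + neg-shift i) h 0 0<3 1 (+ 0) 1<3 refl)) (cong₂ _+_ (proj₁ (E y (λ i → + 1 + neg-shift i) h 1 1<3 0 (+ 1) 0<3 refl)) (proj₁ (E y (λ i → + 1 + neg-shift i) h 2 2<3 2 (+ 0) 2<3 refl))) ,
        ≈-trans (*-cong (*-cong (proj₂ (E y' (λ i → + 1 - + i) h' 0 0<3 1 (+ 0) 1<3 refl)) (proj₂ (E y' (λ i → + 1 - + i) h' 1 1<3 0 (+ 0) 0<3 refl))) (proj₂ (E y' (λ i → + 1 - + i) h' 2 2<3 2 -1ℤ 2<3 refl))) (≡⇒≈ (perm₃ (γ c 0) (γ c 1) (γ c 2)))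
        where
        perm₃ : ∀ x y z → y * x * z ≡ x * y * z
        perm₃ = solve-∀
      cases 2 _ h h' =
        cong₂ _+_ (proj₁ (E y (λ i → + 2 + neg-shift i) h 0 0<3 2 (+ 0) 2<3 refl)) (cong₂ _+_ (proj₁ (E y (λ i → + 2 + neg-shift i) h 1 1<3 1 (+ 1) 1<3 refl)) (proj₁ (E y (λ i → + 2 + neg-shift i) h 2 2<3 0 (+ 1) 0<3 refl))) ,
        ≈-trans (*-cong (*-cong (proj₂ (E y' (λ i → + 2 - + i) h' 0 0<3 2 (+ 0) 2<3 refl)) (proj₂ (E y' (λ i → + 2 - + i) h' 1 1<3 1 (+ 0) 1<3 refl))) (proj₂ (E y' (λ i → + 2 - + i) h' 2 2<3 0 (+ 0) 0<3 refl))) (≡⇒≈ (perm₃ (γ c 0) (γ c 1) (γ c 2)))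
        where
        perm₃ : ∀ x y z → z * y * x ≡ x * y * z
        perm₃ = solve-∀
      cases (suc (suc (suc _))) (s≤s (s≤s (s≤s ()))) _ _

    private
      +n≡ : + n ≡ + b + + b
      +n≡ = trans (cong +_ n≡2b) (ℤₚ.pos-+ b b)
      +D≡6b : + D ≡ + 3 * (+ b + + b)
      +D≡6b = trans +D≡ (cong (+ 3 *_) +n≡)
      0<b : 0 < b
      0<b = h b n≡2b
        where
        h : ∀ b → n ≡ b ℕ.+ b → 0 < b
        h zero e = ⊥-elim (ℕₚ.<-irrefl (sym e) n>0)
        h (suc b) _ = s≤s z≤n

    b<n : b < n
    b<n = subst (b <_) (sym n≡2b) (ℕₚ.m<m+n b 0<b)

    private
      x₃ : ℕ → ℚ
      x₃ a = a over n

      Is-x : ∀ a → Is (x₃ a) (+ 3 * + a)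
      Is-x a = go n refl n>0
        where
        e : ∀ a n → a * (+ 3 * n) ≡ + 3 * a * n
        e = solve-∀
        go : ∀ m → m ≡ n → 0 < m → Is (a over m) (+ 3 * + a)
        go (suc m) m≡n _ = Is-/ (+ a) m (+ 3 * + a) (trans (cong (+ a *_) +D≡) (trans (e (+ a) (+ n)) (cong (λ z → + 3 * + a * + z) (sym m≡n))))


    -- The six parameters are variables known only through their numerators, so the concrete
    -- fractions are not computed with.
    module Evaluation (a₃ b₃ : ℕ → ℚ) (Is-a : ∀ i → i < 3 → Is (a₃ i) (+ b + + i * + n)) (Is-b : ∀ i → i < 3 → Is (b₃ i) (+ i * + n)) where
      private
        Is-fra : ∀ i → i < 3 → Is (fr (a₃ i)) (+ b + + i * + n)
        Is-fra i i<3 = Is-resp {fr (a₃ i)} (trans (ℤₚ.pos-+ b (i ℕ.* n)) (cong (_+_ (+ b)) (ℤₚ.pos-* i n)))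
          (fr-Is (a₃ i) (+ 0) (b ℕ.+ i ℕ.* n) (subst (b ℕ.+ i ℕ.* n <_) (sym D≡3n) (ℕₚ.<-≤-trans (ℕₚ.+-monoˡ-< (i ℕ.* n) b<n) (ℕₚ.*-monoˡ-≤ n i<3)))
            (Is-resp {a₃ i} (trans (cong (_+_ (+ b)) (sym (ℤₚ.pos-* i n))) (trans (sym (ℤₚ.pos-+ b (i ℕ.* n))) (trans (sym (ℤₚ.+-identityˡ (+ (b ℕ.+ i ℕ.* n)))) (cong (_+ + (b ℕ.+ i ℕ.* n)) (sym (ℤₚ.*-zeroˡ (+ D))))))) (Is-a i i<3)))

        Is-frb : ∀ i → i < 3 → Is (fr (ℚ.- b₃ i)) (neg-shift i * + n)
        Is-frb i i<3 = cases i i<3 (Is-neg {b₃ i} (Is-b i i<3))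
          where
          n<D : ∀ j → j < 3 → j ℕ.* n < D
          n<D j j<3 = subst (j ℕ.* n <_) (sym D≡3n) (ℕₚ.*-monoˡ-< n ⦃ ℕ.>-nonZero n>0 ⦄ j<3)
          go : ∀ i f j → j < 3 → - (+ i) ≡ f * + 3 + + j → Is (ℚ.- b₃ i) (- (+ i * + n)) → Is (fr (ℚ.- b₃ i)) (+ j * + n)
          go i f j j<3 e h = Is-resp {fr (ℚ.- b₃ i)} (ℤₚ.pos-* j n) (fr-Is (ℚ.- b₃ i) f (j ℕ.* n) (n<D j j<3)
            (Is-resp {ℚ.- b₃ i} (trans (e₁ (+ i) (+ n)) (trans (cong (_* + n) e) (trans (e₂ f (+ j) (+ n)) (cong₂ (λ u v → f * u + v) (sym +D≡) (sym (ℤₚ.pos-* j n)))))) h))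
            where
            e₁ : ∀ i n → - (i * n) ≡ - i * n
            e₁ = solve-∀
            e₂ : ∀ f j n → (f * + 3 + j) * n ≡ f * (+ 3 * n) + j * n
            e₂ = solve-∀
          cases : ∀ i → i < 3 → Is (ℚ.- b₃ i) (- (+ i * + n)) → Is (fr (ℚ.- b₃ i)) (neg-shift i * + n)
          cases 0 _ = go 0 (+ 0) 0 0<3 refl
          cases 1 _ = go 1 -1ℤ 2 2<3 refl
          cases 2 _ = go 2 -1ℤ 1 1<3 refl
          cases (suc (suc (suc _))) (s≤s (s≤s (s≤s ())))

      private
        iA iB : ℕ → ℤ
        iA i = + invM p (suc k) (Γp p (suc k) (fr (a₃ i)))
        iB i = + invM p (suc k) (Γp p (suc k) (fr (ℚ.- b₃ i)))

        mulM-≈ : ∀ x y → + ((x ℕ.* y) mod P) ≈ + x * + y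
        mulM-≈ x y = ≈-trans (mod-≈ (x ℕ.* y)) (≡⇒≈ (ℤₚ.pos-* x y))

        constants : ℤ
        constants = (iA 0 * iB 0) * ((iA 1 * iB 1) * (iA 2 * iB 2))

        constants-unit : Unit constants
        constants-unit = Unit-* (pair 0) (Unit-* (pair 1) (pair 2))
          where
          pair : ∀ i → Unit (iA i * iB i)
          pair i = Unit-* (invΓ-unit (fr (a₃ i))) (invΓ-unit (fr (ℚ.- b₃ i)))

        ratios : ℕ → ℕ
        ratios a = (r₀ ℕ.* ((r₁ ℕ.* ((r₂ ℕ.* 1) mod P)) mod P)) mod P
          where
          r₀ = ratio p (suc k) a (a₃ 0) (b₃ 0)
          r₁ = ratio p (suc k) a (a₃ 1) (b₃ 1)
          r₂ = ratio p (suc k) a (a₃ 2) (b₃ 2)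

        ΓA ΓB : ℕ → ℕ → ℤ
        ΓA a i = + Γp p (suc k) (fr (a₃ i ℚ.- x₃ a))
        ΓB a i = + Γp p (suc k) (fr (ℚ.- b₃ i ℚ.+ x₃ a))

        ratios-≈ : ∀ a → + ratios a ≈ constants * ((ΓA a 0 * ΓA a 1 * ΓA a 2) * (ΓB a 0 * ΓB a 1 * ΓB a 2))
        ratios-≈ a = begin
          + ratios a                                  ≈⟨ ≈-trans (mulM-≈ r₀ ((r₁ ℕ.* ((r₂ ℕ.* 1) mod P)) mod P)) (*-congˡ (+ r₀) (≈-trans (mulM-≈ r₁ ((r₂ ℕ.* 1) mod P)) (*-congˡ (+ r₁) (mulM-≈ r₂ 1)))) ⟩
          + r₀ * (+ r₁ * (+ r₂ * 1ℤ))                 ≈⟨ *-cong (each 0) (*-cong (each 1) (*-congʳ 1ℤ (each 2))) ⟩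
          A 0 * iA 0 * (B 0 * iB 0) * (A 1 * iA 1 * (B 1 * iB 1) * (A 2 * iA 2 * (B 2 * iB 2) * 1ℤ))
            ≡⟨ e (A 0) (A 1) (A 2) (B 0) (B 1) (B 2) (iA 0) (iA 1) (iA 2) (iB 0) (iB 1) (iB 2) ⟩
          constants * ((A 0 * A 1 * A 2) * (B 0 * B 1 * B 2)) ∎
          where
          open ≈-Reasoning
          A = ΓA a
          B = ΓB a
          r₀ = ratio p (suc k) a (a₃ 0) (b₃ 0)
          r₁ = ratio p (suc k) a (a₃ 1) (b₃ 1)
          r₂ = ratio p (suc k) a (a₃ 2) (b₃ 2)
          e : ∀ a b c d e f g h i j k l → a * g * (d * j) * (b * h * (e * k) * (c * i * (f * l) * 1ℤ)) ≡ (g * j) * ((h * k) * (i * l)) * ((a * b * c) * (d * e * f))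
          e = solve-∀
          each : ∀ i → + ratio p (suc k) a (a₃ i) (b₃ i) ≈ A i * iA i * (B i * iB i)
          each i = ≈-trans (mulM-≈ ((u ℕ.* u') mod P) ((v ℕ.* v') mod P)) (*-cong (mulM-≈ u u') (mulM-≈ v v'))
            where
            u = Γp p (suc k) (fr (a₃ i ℚ.- x₃ a))
            u' = invM p (suc k) (Γp p (suc k) (fr (a₃ i)))
            v = Γp p (suc k) (fr (ℚ.- b₃ i ℚ.+ x₃ a))
            v' = invM p (suc k) (Γp p (suc k) (fr (ℚ.- b₃ i)))

      -- The value of the inverse Teichmüller character at t, modulo p^(k+1).
      τ : ℕ → ℤ
      τ t = ((+ t) ^ (p ℕ.^ k)) ^ (p ∸ 2)

      ωbar-≈ : ∀ t a → p ∤ t → + ωbarPow p (suc k) t a ≈ τ t ^ a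
      ωbar-≈ t a p∤t = ≈-trans (≡⇒≈ (cong (λ d → + (if d then 0 else (((t ℕ.^ (p ℕ.^ k)) ℕ.^ ((p ∸ 2) ℕ.* a)) mod P))) (dec-false (p ∣? t) p∤t)))
        (≈-trans (mod-≈ ((t ℕ.^ (p ℕ.^ k)) ℕ.^ ((p ∸ 2) ℕ.* a))) (≡⇒≈ (trans (pos-^ (t ℕ.^ (p ℕ.^ k)) ((p ∸ 2) ℕ.* a))
          (trans (cong (_^ ((p ∸ 2) ℕ.* a)) (pos-^ t (p ℕ.^ k))) (sym (ℤₚ.^-*-assoc ((+ t) ^ (p ℕ.^ k)) (p ∸ 2) a))))))

      -- The common factor of all terms, independent of `a` and `t`; that it is a unit is all that
      -- matters about it.
      κ : ℤ
      κ = constants * (Mul 0 * Mul 0 * ω₃ ^ b)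

      κ-unit : Unit κ
      κ-unit = Unit-* constants-unit (Unit-* (Unit-* (Mul-unit 0) (Mul-unit 0)) (Unit-^ b ω₃-unit))

      term₃ : ℕ → ℕ → ℕ
      term₃ t a = term p (suc k) 3 (a₃ 0 ∷ a₃ 1 ∷ a₃ 2 ∷ []) (b₃ 0 ∷ b₃ 1 ∷ b₃ 2 ∷ []) t a

      private
        signs : ∀ t a (E : ℤ) w R → E ≡ + w → p ∤ t →
          + signM P (a ℕ.* 3) ((ωbarPow p (suc k) t a ℕ.* signM P ∣ E ∣ ((p ℕ.^ ∣ + 3 + E ∣ ℕ.* R) mod P)) mod P) ≈
          -1ℤ ^ (a ℕ.* 3) * (τ t ^ a * (-1ℤ ^ w * (+ (p ℕ.^ (3 ℕ.+ w)) * + R)))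
        signs t a E w R refl p∤t = ≈-trans (signM-≈ (a ℕ.* 3) ((W ℕ.* V) mod P)) (*-congˡ (-1ℤ ^ (a ℕ.* 3)) (≈-trans (mulM-≈ W V) (*-cong (ωbar-≈ t a p∤t)
          (≈-trans (signM-≈ w U) (*-congˡ (-1ℤ ^ w) (mulM-≈ (p ℕ.^ (3 ℕ.+ w)) R))))))
          where
          W = ωbarPow p (suc k) t a
          U = (p ℕ.^ (3 ℕ.+ w) ℕ.* R) mod P
          V = signM P w U

      -- Put 3a = qn + c and b + wn = c + c'. The numerators for the a_k are c' + (i - q - w)n and
      -- those for the b_k are c plus a shift by q, so the exponent of -p is (q + w) - q = w. The
      -- powers of ω(3) combine to ω(3)^(c+c') = ω(3)^b, which does not depend on `a`. The value
      -- enters as `V` with an equation, so that one statement serves both branches of `paired`.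
      evaluate-term : ∀ t a q c c' w → p ∤ t → q < 3 → q ℕ.+ w < 4 → c < n → c' < n → a ℕ.* 3 ≡ q ℕ.* n ℕ.+ c → b ℕ.+ w ℕ.* n ≡ c ℕ.+ c' →
        ∀ V → (- (+ p)) ^ w * (Γ₁ c * Γ₁ c') ≡ V → + term₃ t a ≈ κ * (+ (p ℕ.^ 3) * (τ t ^ a * (-1ℤ ^ c * V)))
      evaluate-term t a q c c' w p∤t q<3 qw<4 c<n c'<n a3≡ bw≡ V V≡ = begin
        + term₃ t a                                                         ≈⟨ signs t a (expo₃ 0 + (expo₃ 1 + (expo₃ 2 + 0ℤ))) w (ratios a) E≡ p∤t ⟩
        -1ℤ ^ (a ℕ.* 3) * (τ t ^ a * (-1ℤ ^ w * (+ (p ℕ.^ (3 ℕ.+ w)) * + ratios a)))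
          ≈⟨ *-cong (≡⇒≈ sign≡) (*-congˡ (τ t ^ a) (*-congˡ (-1ℤ ^ w) (*-cong (≡⇒≈ p^≡) R≈))) ⟩
        -1ℤ ^ c * (τ t ^ a * (-1ℤ ^ w * (+ (p ℕ.^ 3) * (+ p) ^ w * (constants * (M * M * ω₃ ^ b * (Γ₁ c * Γ₁ c'))))))
          ≡⟨ e₀ (-1ℤ ^ c) (τ t ^ a) (-1ℤ ^ w) (+ (p ℕ.^ 3)) ((+ p) ^ w) constants (M * M * ω₃ ^ b) (Γ₁ c * Γ₁ c') ⟩
        κ * (+ (p ℕ.^ 3) * (τ t ^ a * (-1ℤ ^ c * (-1ℤ ^ w * (+ p) ^ w * (Γ₁ c * Γ₁ c')))))
          ≡⟨ cong (λ z → κ * (+ (p ℕ.^ 3) * (τ t ^ a * (-1ℤ ^ c * z)))) (trans (cong (_* (Γ₁ c * Γ₁ c')) (trans (sym (*-^-distrib -1ℤ (+ p) w)) (cong (_^ w) (ℤₚ.-1*i≡-i (+ p))))) V≡) ⟩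
        κ * (+ (p ℕ.^ 3) * (τ t ^ a * (-1ℤ ^ c * V))) ∎
        where
        open ≈-Reasoning
        M = Mul 0
        e₀ : ∀ s t u v w x y z → s * (t * (u * (v * w * (x * (y * z))))) ≡ x * y * (v * (t * (s * (u * w * z))))
        e₀ = solve-∀
        expo₃ : ℕ → ℤ
        expo₃ i = expo p (suc k) a (a₃ i) (b₃ i)
        yA yA' yB yB' : ℕ → ℚ
        yA i = fr (a₃ i) ℚ.- x₃ a
        yA' i = a₃ i ℚ.- x₃ a
        yB i = fr (ℚ.- b₃ i) ℚ.+ x₃ a
        yB' i = ℚ.- b₃ i ℚ.+ x₃ a
        3a≡ : + 3 * + a ≡ + q * + n + + c
        3a≡ = trans (ℤₚ.*-comm (+ 3) (+ a)) (trans (sym (ℤₚ.pos-* a 3)) (trans (cong +_ a3≡) (trans (ℤₚ.pos-+ (q ℕ.* n) c) (cong (_+ + c) (ℤₚ.pos-* q n)))))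
        b≡ : + b ≡ (+ c + + c') - + w * + n
        b≡ = trans (e (+ b) (+ w * + n)) (cong (_- + w * + n) (trans (cong (_+_ (+ b)) (sym (ℤₚ.pos-* w n))) (trans (sym (ℤₚ.pos-+ b (w ℕ.* n))) (trans (cong +_ bw≡) (ℤₚ.pos-+ c c')))))
          where
          e : ∀ b x → b ≡ (b + x) - x
          e = solve-∀
        numA : ∀ i → + b + + i * + n - + 3 * + a ≡ + c' + (+ i - + (q ℕ.+ w)) * + n
        numA i = trans (cong₂ (λ u v → u + + i * + n - v) b≡ 3a≡) (trans (e (+ c) (+ c') (+ w) (+ n) (+ i) (+ q)) (cong (λ z → + c' + (+ i - z) * + n) (sym (ℤₚ.pos-+ q w))))
          where
          e : ∀ c c' w n i q → ((c + c') - w * n) + i * n - (q * n + c) ≡ c' + (i - (q + w)) * n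
          e = solve-∀
        numB : ∀ i → neg-shift i * + n + + 3 * + a ≡ + c + (+ q + neg-shift i) * + n
        numB i = trans (cong (_+_ (neg-shift i * + n)) 3a≡) (e (neg-shift i) (+ n) (+ q) (+ c))
          where
          e : ∀ s n q c → s * n + (q * n + c) ≡ c + (q + s) * n
          e = solve-∀
        numB' : ∀ i → - (+ i * + n) + + 3 * + a ≡ + c + (+ q - + i) * + n
        numB' i = trans (cong (_+_ (- (+ i * + n))) 3a≡) (e (+ i) (+ n) (+ q) (+ c))
          where
          e : ∀ s n q c → - (s * n) + (q * n + c) ≡ c + (q - s) * n
          e = solve-∀
        As : Three yA yA' (- (+ (q ℕ.+ w))) c'
        As = a-side yA yA' (q ℕ.+ w) c' qw<4 c'<n
          (λ i i<3 → Is-resp {yA i} (numA i) (Is-- {fr (a₃ i)} {x₃ a} (Is-fra i i<3) (Is-x a)))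
          (λ i i<3 → Is-resp {yA' i} (numA i) (Is-- {a₃ i} {x₃ a} (Is-a i i<3) (Is-x a)))
        Bs : Three yB yB' (+ q) c
        Bs = b-side yB yB' q c q<3 c<n
          (λ i i<3 → Is-resp {yB i} (numB i) (Is-+ {fr (ℚ.- b₃ i)} {x₃ a} (Is-frb i i<3) (Is-x a)))
          (λ i i<3 → Is-resp {yB' i} (numB' i) (Is-+ {ℚ.- b₃ i} {x₃ a} (Is-neg {b₃ i} (Is-b i i<3)) (Is-x a)))
        E≡ : expo₃ 0 + (expo₃ 1 + (expo₃ 2 + 0ℤ)) ≡ + w
        E≡ = trans (e₁ (floor (yA 0)) (floor (yA 1)) (floor (yA 2)) (floor (yB 0)) (floor (yB 1)) (floor (yB 2)))
          (trans (cong₂ (λ u v → - u - v) (proj₁ As) (proj₁ Bs)) (trans (cong (λ z → - (- z) - + q) (ℤₚ.pos-+ q w)) (e₂ (+ q) (+ w))))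
          where
          e₁ : ∀ f g h x y z → (- f - x) + ((- g - y) + ((- h - z) + 0ℤ)) ≡ - (f + (g + h)) - (x + (y + z))
          e₁ = solve-∀
          e₂ : ∀ q w → - (- (q + w)) - q ≡ w
          e₂ = solve-∀
        sign≡ : -1ℤ ^ (a ℕ.* 3) ≡ -1ℤ ^ c
        sign≡ = trans (cong (-1ℤ ^_) (trans a3≡ (cong (ℕ._+ c) (trans (cong (q ℕ.*_) n≡2b) (ℕₚ.*-distribˡ-+ q b b)))))
          (trans (ℤₚ.^-distribˡ-+-* -1ℤ (q ℕ.* b ℕ.+ q ℕ.* b) c) (trans (cong (_* -1ℤ ^ c) (-1^2n (q ℕ.* b))) (ℤₚ.*-identityˡ (-1ℤ ^ c))))
        p^≡ : + (p ℕ.^ (3 ℕ.+ w)) ≡ + (p ℕ.^ 3) * (+ p) ^ w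
        p^≡ = trans (cong +_ (ℕₚ.^-distribˡ-+-* p 3 w)) (trans (ℤₚ.pos-* (p ℕ.^ 3) (p ℕ.^ w)) (cong (+ (p ℕ.^ 3) *_) (pos-^ p w)))
        n<p : n < p
        n<p = subst (n <_) (sym p≡1+n) (ℕₚ.n<1+n n)
        ω≈ : ω₃ ^ c' * ω₃ ^ c ≈ ω₃ ^ b
        ω≈ = begin
          ω₃ ^ c' * ω₃ ^ c           ≡⟨ ℤₚ.^-distribˡ-+-* ω₃ c' c ⟨
          ω₃ ^ (c' ℕ.+ c)            ≡⟨ cong (ω₃ ^_) (trans (ℕₚ.+-comm c' c) (trans (sym bw≡) (cong (b ℕ.+_) (ℕₚ.*-comm w n)))) ⟩
          ω₃ ^ (b ℕ.+ n ℕ.* w)       ≡⟨ trans (ℤₚ.^-distribˡ-+-* ω₃ b (n ℕ.* w)) (cong (ω₃ ^ b *_) (sym (ℤₚ.^-*-assoc ω₃ n w))) ⟩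
          ω₃ ^ b * (ω₃ ^ n) ^ w      ≈⟨ *-congˡ (ω₃ ^ b) (1^≈1 w ω₃^n≈1) ⟩
          ω₃ ^ b * 1ℤ                ≡⟨ ℤₚ.*-identityʳ (ω₃ ^ b) ⟩
          ω₃ ^ b                     ∎
        R≈ : + ratios a ≈ constants * (M * M * ω₃ ^ b * (Γ₁ c * Γ₁ c'))
        R≈ = begin
          + ratios a                                                            ≈⟨ ratios-≈ a ⟩
          constants * ((ΓA a 0 * ΓA a 1 * ΓA a 2) * (ΓB a 0 * ΓB a 1 * ΓB a 2)) ≈⟨ *-congˡ constants (*-cong (≈-trans (proj₂ As) (multiplication₁ c' (ℕₚ.<-trans c'<n n<p))) (≈-trans (proj₂ Bs) (multiplication₁ c (ℕₚ.<-trans c<n n<p)))) ⟩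
          constants * ((M * ω₃ ^ c' * Γ₁ c') * (M * ω₃ ^ c * Γ₁ c))             ≡⟨ cong (constants *_) (e (M) (ω₃ ^ c') (Γ₁ c') (ω₃ ^ c) (Γ₁ c)) ⟩
          constants * (M * M * (ω₃ ^ c' * ω₃ ^ c) * (Γ₁ c * Γ₁ c'))             ≈⟨ *-congˡ constants (*-congʳ (Γ₁ c * Γ₁ c') (*-congˡ (M * M) ω≈)) ⟩
          constants * (M * M * ω₃ ^ b * (Γ₁ c * Γ₁ c'))                         ∎
          where
          e : ∀ M x g y h → (M * x * g) * (M * y * h) ≡ M * M * (x * y) * (h * g)
          e = solve-∀

      -- The summand (-1)^c (-p)^w Γ_p(c/n) Γ_p(c'/n) of the ₁G₁ series, where c + c' = b + w n.
      paired : ∀ c → Dec (c ≤ b) → ℤ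
      paired c (yes _) = Γ₁ c * Γ₁ (b ∸ c)
      paired c (no _)  = - (+ p) * (Γ₁ c * Γ₁ (b ℕ.+ n ∸ c))

      H : ℕ → ℤ
      H c = -1ℤ ^ c * paired c (c ≤? b)

      private
        H≡ : ∀ c → -1ℤ ^ c * paired c (c ≤? b) ≡ H c
        H≡ c = refl

      instance
        n≢0 : ℕ.NonZero n
        n≢0 = ℕ.>-nonZero n>0

      private
        term-≤ : ∀ t a q c → c ≤ b → p ∤ t → q < 3 → c < n → a ℕ.* 3 ≡ q ℕ.* n ℕ.+ c →
          ∀ V → Γ₁ c * Γ₁ (b ∸ c) ≡ V → + term₃ t a ≈ κ * (+ (p ℕ.^ 3) * (τ t ^ a * (-1ℤ ^ c * V)))
        term-≤ t a q c c≤b p∤t q<3 c<n a3≡ V V≡ = evaluate-term t a q c (b ∸ c) 0 p∤t q<3 (subst (_< 4) (sym (ℕₚ.+-identityʳ q)) (ℕₚ.m<n⇒m<1+n q<3)) c<n (ℕₚ.≤-<-trans (ℕₚ.m∸n≤m b c) b<n) a3≡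
            (trans (ℕₚ.+-identityʳ b) (sym (ℕₚ.m+[n∸m]≡n c≤b))) V (trans (^0* (- (+ p)) (Γ₁ c * Γ₁ (b ∸ c))) V≡)

        term-> : ∀ t a q c → b < c → p ∤ t → q < 3 → c < n → a ℕ.* 3 ≡ q ℕ.* n ℕ.+ c →
          ∀ V → - (+ p) * (Γ₁ c * Γ₁ (b ℕ.+ n ∸ c)) ≡ V → + term₃ t a ≈ κ * (+ (p ℕ.^ 3) * (τ t ^ a * (-1ℤ ^ c * V)))
        term-> t a q c b<c p∤t q<3 c<n a3≡ V V≡ = evaluate-term t a q c (b ℕ.+ n ∸ c) 1 p∤t q<3 (subst (_< 4) (ℕₚ.+-comm 1 q) (s≤s q<3)) c<n c'<n a3≡
            (trans (cong (b ℕ.+_) (ℕₚ.*-identityˡ n)) (sym (ℕₚ.m+[n∸m]≡n c≤b+n))) V (trans (^1* (- (+ p)) (Γ₁ c * Γ₁ (b ℕ.+ n ∸ c))) V≡)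
          where
          c≤b+n : c ≤ b ℕ.+ n
          c≤b+n = ℕₚ.≤-trans (ℕₚ.<⇒≤ c<n) (ℕₚ.m≤n+m n b)
          c'<n : b ℕ.+ n ∸ c < n
          c'<n = ℕₚ.+-cancelʳ-< c (b ℕ.+ n ∸ c) n (subst (_< n ℕ.+ c) (sym (ℕₚ.m∸n+n≡m c≤b+n)) (subst (b ℕ.+ n <_) (ℕₚ.+-comm c n) (ℕₚ.+-monoˡ-< n b<c)))

        term-dec : ∀ t a q c (d : Dec (c ≤ b)) → p ∤ t → q < 3 → c < n → a ℕ.* 3 ≡ q ℕ.* n ℕ.+ c →
          ∀ V → paired c d ≡ V → + term₃ t a ≈ κ * (+ (p ℕ.^ 3) * (τ t ^ a * (-1ℤ ^ c * V)))
        term-dec t a q c (yes c≤b) = term-≤ t a q c c≤b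
        term-dec t a q c (no c≰b)  = term-> t a q c (ℕₚ.≰⇒> c≰b)

        term-at : ∀ t a q c → p ∤ t → q < 3 → c < n → a ℕ.* 3 ≡ q ℕ.* n ℕ.+ c →
          + term₃ t a ≈ κ * (+ (p ℕ.^ 3) * (τ t ^ a * H c))
        term-at t a q c p∤t q<3 c<n a3≡ = ≈-trans (term-dec t a q c (c ≤? b) p∤t q<3 c<n a3≡ (paired c (c ≤? b)) refl) (≡⇒≈ (cong (λ z → κ * (+ (p ℕ.^ 3) * (τ t ^ a * z))) (H≡ c)))

      term-≈ : ∀ t a → p ∤ t → a < n → + term₃ t a ≈ κ * (+ (p ℕ.^ 3) * (τ t ^ a * H (a ℕ.* 3 % n)))
      term-≈ t a p∤t a<n = term-at t a (a ℕ.* 3 / n) (a ℕ.* 3 % n) p∤t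
        (ℕₚ.*-cancelʳ-< n (a ℕ.* 3 / n) 3 (ℕₚ.≤-<-trans (m/n*n≤m (a ℕ.* 3) n) (subst (_< 3 ℕ.* n) (ℕₚ.*-comm 3 a) (ℕₚ.*-monoʳ-< 3 a<n))))
        (m%n<n (a ℕ.* 3) n) (trans (m≡m%n+[m/n]*n (a ℕ.* 3) n) (ℕₚ.+-comm (a ℕ.* 3 % n) (a ℕ.* 3 / n ℕ.* n)))

      S₃ : ℕ → ℤ
      S₃ t = sumℤ n (λ a → τ t ^ a * H (a ℕ.* 3 % n))

      G₃ : ℕ → ℕ
      G₃ t = scaledG p (suc k) 3 (a₃ 0 ∷ a₃ 1 ∷ a₃ 2 ∷ []) (b₃ 0 ∷ b₃ 1 ∷ b₃ 2 ∷ []) t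

      private
        Σterm : ∀ t → p ∤ t → + sumL (map (term₃ t) (upTo n)) ≈ κ * (+ (p ℕ.^ 3) * S₃ t)
        Σterm t p∤t = begin
          + sumL (map (term₃ t) (upTo n))                                                ≡⟨ cong (λ l → + sumL l) (map-upTo (term₃ t) n) ⟩
          + sumL (applyUpTo (term₃ t) n)                                                 ≡⟨ sumL-upTo (term₃ t) n ⟩
          sumℤ n (λ a → + term₃ t a)                                                     ≈⟨ sum-cong n (λ a a<n → term-≈ t a p∤t a<n) ⟩
          sumℤ n (λ a → κ * (+ (p ℕ.^ 3) * (τ t ^ a * H (a ℕ.* 3 % n))))                 ≡⟨ ℤΣ.sum-*ˡ n κ (λ a → + (p ℕ.^ 3) * (τ t ^ a * H (a ℕ.* 3 % n))) ⟨
          κ * sumℤ n (λ a → + (p ℕ.^ 3) * (τ t ^ a * H (a ℕ.* 3 % n)))                   ≡⟨ cong (κ *_) (ℤΣ.sum-*ˡ n (+ (p ℕ.^ 3)) (λ a → τ t ^ a * H (a ℕ.* 3 % n))) ⟨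
          κ * (+ (p ℕ.^ 3) * S₃ t)                                                       ∎
          where open ≈-Reasoning

        inv-n : ℤ
        inv-n = + invM p (suc k) n

        G₃-≈ : ∀ t → p ∤ t → + G₃ t ≈ - (inv-n * (κ * (+ (p ℕ.^ 3) * S₃ t)))
        G₃-≈ t p∤t = ≈-trans (negM-≈ _) (neg-cong (≈-trans (mulM-≈ (invM p (suc k) n) _) (*-congˡ inv-n (≈-trans (mod-≈ _) (Σterm t p∤t)))))

      -- Not a mere converse of `S₃≈0⇒`: the residue belongs to p^3 times the series, so three
      -- powers of p are lost in this direction.
      G₃≡0⇒ : ∀ t → p ∤ t → G₃ t ≡ 0 → + (p ℕ.^ 3) * S₃ t ≈ 0ℤ
      G₃≡0⇒ t p∤t h = *-cancelˡ (Unit-neg (Unit-* (Unit-inv {+ n} {inv-n} (invM-≈ p∤n)) κ-unit)) (begin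
        - (inv-n * κ) * (+ (p ℕ.^ 3) * S₃ t)     ≡⟨ e inv-n κ (+ (p ℕ.^ 3) * S₃ t) ⟩
        - (inv-n * (κ * (+ (p ℕ.^ 3) * S₃ t)))   ≈⟨ G₃-≈ t p∤t ⟨
        + G₃ t                                   ≡⟨ cong +_ h ⟩
        0ℤ                                       ≡⟨ ℤₚ.*-zeroʳ (- (inv-n * κ)) ⟨
        - (inv-n * κ) * 0ℤ                       ∎)
        where
        open ≈-Reasoning
        e : ∀ i κ x → - (i * κ) * x ≡ - (i * (κ * x))
        e = solve-∀

      S₃≈0⇒ : ∀ t → p ∤ t → S₃ t ≈ 0ℤ → G₃ t ≡ 0
      S₃≈0⇒ t p∤t h = ≈0⇒mod≡0 _ (≈-trans (≈-sym (mod-≈ _)) (begin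
        + G₃ t                                   ≈⟨ G₃-≈ t p∤t ⟩
        - (inv-n * (κ * (+ (p ℕ.^ 3) * S₃ t)))   ≈⟨ neg-cong (*-congˡ inv-n (*-congˡ κ (*-congˡ (+ (p ℕ.^ 3)) h))) ⟩
        - (inv-n * (κ * (+ (p ℕ.^ 3) * 0ℤ)))     ≡⟨ e inv-n κ (+ (p ℕ.^ 3)) ⟩
        0ℤ                                       ∎))
        where
        open ≈-Reasoning
        e : ∀ i κ x → - (i * (κ * (x * 0ℤ))) ≡ 0ℤ
        e = solve-∀


    private
      a₃ : ℕ → ℚ
      a₃ 0 = + 1 ℚ./ 6
      a₃ 1 = + 1 ℚ./ 2
      a₃ _ = + 5 ℚ./ 6
      b₃ : ℕ → ℚ
      b₃ 0 = ℚ.0ℚ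
      b₃ 1 = + 1 ℚ./ 3
      b₃ _ = + 2 ℚ./ 3
      -- only the indices 0, 1, 2 are used
      Is-a : ∀ i → i < 3 → Is (a₃ i) (+ b + + i * + n)
      Is-a 0 _ = Is-/ (+ 1) 5 (+ b + + 0 * + n) (trans (cong (+ 1 *_) +D≡6b) (trans (e (+ b)) (cong (λ z → (+ b + + 0 * z) * + 6) (sym +n≡))))
        where
        e : ∀ b → + 1 * (+ 3 * (b + b)) ≡ (b + + 0 * (b + b)) * + 6
        e = solve-∀
      Is-a 1 _ = Is-/ (+ 1) 1 (+ b + + 1 * + n) (trans (cong (+ 1 *_) +D≡6b) (trans (e (+ b)) (cong (λ z → (+ b + + 1 * z) * + 2) (sym +n≡))))
        where
        e : ∀ b → + 1 * (+ 3 * (b + b)) ≡ (b + + 1 * (b + b)) * + 2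
        e = solve-∀
      Is-a 2 _ = Is-/ (+ 5) 5 (+ b + + 2 * + n) (trans (cong (+ 5 *_) +D≡6b) (trans (e (+ b)) (cong (λ z → (+ b + + 2 * z) * + 6) (sym +n≡))))
        where
        e : ∀ b → + 5 * (+ 3 * (b + b)) ≡ (b + + 2 * (b + b)) * + 6
        e = solve-∀
      Is-a (suc (suc (suc _))) (s≤s (s≤s (s≤s ())))

      Is-b : ∀ i → i < 3 → Is (b₃ i) (+ i * + n)
      Is-b 0 _ = Is-/ (+ 0) 0 (+ 0 * + n) (trans (ℤₚ.*-zeroˡ (+ D)) (sym (cong (_* + 1) (ℤₚ.*-zeroˡ (+ n)))))
      Is-b 1 _ = Is-/ (+ 1) 2 (+ 1 * + n) (trans (cong (+ 1 *_) +D≡) (e (+ n)))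
        where
        e : ∀ n → + 1 * (+ 3 * n) ≡ + 1 * n * + 3
        e = solve-∀
      Is-b 2 _ = Is-/ (+ 2) 2 (+ 2 * + n) (trans (cong (+ 2 *_) +D≡) (e (+ n)))
        where
        e : ∀ n → + 2 * (+ 3 * n) ≡ + 2 * n * + 3
        e = solve-∀
      Is-b (suc (suc (suc _))) (s≤s (s≤s (s≤s ())))


    open Evaluation a₃ b₃ Is-a Is-b public

-- The vanishing cases, modulo every power of p

module VanishingCases where
  open import Defs
  open import Data.Empty using (⊥-elim)
  open import Data.Nat as ℕ using (ℕ; zero; suc; _<_; _≤_; s≤s; _∸_; _≤?_; _%_)
  import Data.Nat.Properties as ℕₚ
  open import Data.Nat.DivMod using (m<n⇒m%n≡m; [m+n]%n≡m%n)
  open import Data.Nat.Divisibility using (_∤_)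
  open import Data.Nat.Primality using (Prime)
  import Data.Nat.Tactic.RingSolver as ℕS
  open import Data.Integer as ℤ using (ℤ; +_; _+_; _*_; -_; _-_; _^_; 0ℤ; 1ℤ; -1ℤ)
  import Data.Integer.Properties as ℤₚ
  open import Data.Integer.Tactic.RingSolver using (solve-∀)
  open import Relation.Nullary using (yes; no)
  open import Relation.Binary.PropositionalEquality as ≡ using (_≡_; refl; cong; cong₂; subst; sym; trans; module ≡-Reasoning)
  open FiniteSums
  open ModularArithmetic
  open MoritaGamma
  open GaussMultiplication
  open DworkCongruence
  open Fractions
  open HypergeometricSum

  sum-reverse : ∀ m (f : ℕ → ℤ) → sumℤ (suc m) f ≡ sumℤ (suc m) (λ j → f (m ∸ j))
  sum-reverse zero    f = refl
  sum-reverse (suc m) f = trans (cong (_+ f (suc m)) (sum-reverse m f)) (trans (ℤₚ.+-comm (sumℤ (suc m) (λ j → f (m ∸ j))) (f (suc m))) (sym (ℤΣ.sum-first (suc m) (λ j → f (suc m ∸ j)))))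

  -- Reversing the order shows that the sum equals its own negative, and ℤ has no 2-torsion.
  antisymmetric-sum : ∀ m (f : ℕ → ℤ) → (∀ j → j < m → f (m ∸ suc j) ≡ - f j) → sumℤ m f ≡ 0ℤ
  antisymmetric-sum zero    f h = refl
  antisymmetric-sum (suc m) f h = x+x-injective (sumℤ (suc m) f) 0ℤ (trans (cong (_+_ (sumℤ (suc m) f)) (trans (sum-reverse m f)
      (trans (ℤΣ.sum-cong (suc m) h) (ℤΣ.sum-neg (suc m) f)))) (ℤₚ.+-inverseʳ (sumℤ (suc m) f)))

  -1^-+ : ∀ i j → -1ℤ ^ (i ℕ.+ j) ≡ -1ℤ ^ i * -1ℤ ^ j
  -1^-+ = ℤₚ.^-distribˡ-+-* -1ℤ

  module Vanishing (p : ℕ) (pr : Prime p) (b' : ℕ) (p≡1+2b : p ≡ suc (suc b' ℕ.+ suc b')) (4<p : 4 < p) (k : ℕ) where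
    private
      b : ℕ
      b = suc b'
    3<p : 3 < p
    3<p = ℕₚ.<-trans (ℕₚ.n<1+n 3) 4<p
    open GammaP p pr b p≡1+2b
    open Level k
    open Multiplication p pr b p≡1+2b 3<p k using (Γ₁)
    open Residues p pr b p≡1+2b 3<p k
    module D = DworkVanishing ℚ-field p pr b' p≡1+2b 4<p k

    private
      n≡ : n ≡ suc b ℕ.+ b'
      n≡ = trans n≡2b (ℕₚ.+-suc b b')

    H-≤ : ∀ c → c ≤ b → H c ≡ -1ℤ ^ c * (Γ₁ c * Γ₁ (b ∸ c))
    H-≤ c c≤b = go (c ≤? b)
      where
      go : ∀ d → -1ℤ ^ c * paired c d ≡ -1ℤ ^ c * (Γ₁ c * Γ₁ (b ∸ c))
      go (yes _)  = refl
      go (no c≰b) = ⊥-elim (c≰b c≤b)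

    H-> : ∀ c → b < c → H c ≡ -1ℤ ^ c * (- (+ p) * (Γ₁ c * Γ₁ (b ℕ.+ n ∸ c)))
    H-> c b<c = go (c ≤? b)
      where
      go : ∀ d → -1ℤ ^ c * paired c d ≡ -1ℤ ^ c * (- (+ p) * (Γ₁ c * Γ₁ (b ℕ.+ n ∸ c)))
      go (yes c≤b) = ⊥-elim (ℕₚ.<⇒≱ b<c c≤b)
      go (no _)    = refl

    ΣH≈0 : sumℤ n H ≈ 0ℤ
    ΣH≈0 = begin
      sumℤ n H                                                          ≡⟨ cong (λ m → sumℤ m H) n≡ ⟩
      sumℤ (suc b ℕ.+ b') H                                             ≡⟨ ℤΣ.sum-split (suc b) b' H ⟩
      sumℤ (suc b) H + sumℤ b' (λ i → H (suc b ℕ.+ i))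
        ≡⟨ cong₂ _+_ (ℤΣ.sum-cong (suc b) (λ i i≤b → H-≤ i (ℕ.s≤s⁻¹ i≤b))) (ℤΣ.sum-cong b' (λ i _ → trans (H-> (suc b ℕ.+ i) (s≤s (ℕₚ.m≤m+n b i))) (cong (λ z → -1ℤ ^ (suc b ℕ.+ i) * (- (+ p) * (Γ₁ (suc b ℕ.+ i) * Γ₁ z))) (idx i)))) ⟩
      _                                                                 ≈⟨ D.vanishing ⟩
      0ℤ                                                                ∎
      where
      open ≈-Reasoning
      idx : ∀ i → b ℕ.+ n ∸ (suc b ℕ.+ i) ≡ n ∸ suc i
      idx i = trans (cong (b ℕ.+ n ∸_) (sym (ℕₚ.+-suc b i))) (ℕₚ.[m+n]∸[m+o]≡n∸o b n (suc i))

    τ^n≈1 : ∀ {t} → p ∤ t → τ t ^ n ≈ 1ℤ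
    τ^n≈1 {t} p∤t = ≈-trans (≡⇒≈ e) (1^≈1 (p ∸ 2) (≈-trans (≡⇒≈ (ℤₚ.^-*-assoc (+ t) (p ℕ.^ k) n)) (euler k p∤t)))
      where
      x = (+ t) ^ (p ℕ.^ k)
      e : (x ^ (p ∸ 2)) ^ n ≡ (x ^ n) ^ (p ∸ 2)
      e = trans (ℤₚ.^-*-assoc x (p ∸ 2) n) (trans (cong (x ^_) (ℕₚ.*-comm (p ∸ 2) n)) (sym (ℤₚ.^-*-assoc x n (p ∸ 2))))

    private
      τ1^ : ∀ a → τ 1 ^ a ≡ 1ℤ
      τ1^ a = trans (cong (λ z → (z ^ (p ∸ 2)) ^ a) (ℤₚ.^-zeroˡ (p ℕ.^ k))) (trans (cong (_^ a) (ℤₚ.^-zeroˡ (p ∸ 2))) (ℤₚ.^-zeroˡ a))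

      S₃-1 : S₃ 1 ≡ sumℤ n (λ a → H (a ℕ.* 3 % n))
      S₃-1 = ℤΣ.sum-cong n (λ a _ → trans (cong (_* H (a ℕ.* 3 % n)) (τ1^ a)) (ℤₚ.*-identityˡ (H (a ℕ.* 3 % n))))

    -- Here 3 is prime to p - 1, so the residue of 3a runs through every index once and the sum
    -- becomes the one treated by Dwork's method.
    S₃-one-2mod3 : ∀ l → n ≡ suc (l ℕ.* 3) → S₃ 1 ≈ 0ℤ
    S₃-one-2mod3 l n≡l = begin
      S₃ 1                                             ≡⟨ S₃-1 ⟩
      sumℤ n (λ a → H (a ℕ.* 3 % n))                   ≡⟨ cong (λ m → sumℤ m (λ a → H (a ℕ.* 3 % n))) n≡l ⟩
      sumℤ (suc (l ℕ.* 3)) (λ a → H (a ℕ.* 3 % n))     ≡⟨ ℤΣ.sum-triple-perm l (λ i → H (i % n)) (λ i → cong H (trans (cong (λ m → (i ℕ.+ m) % n) (sym n≡l)) ([m+n]%n≡m%n i n))) ⟩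
      sumℤ (suc (l ℕ.* 3)) (λ i → H (i % n))           ≡⟨ cong (λ m → sumℤ m (λ i → H (i % n))) n≡l ⟨
      sumℤ n (λ i → H (i % n))                         ≡⟨ ℤΣ.sum-cong n (λ i i<n → cong H (m<n⇒m%n≡m i<n)) ⟩
      sumℤ n H                                         ≈⟨ ΣH≈0 ⟩
      0ℤ                                               ∎
      where open ≈-Reasoning

    module _ (l : ℕ) (n≡3l : n ≡ l ℕ.* 3) where
      private
        index : ∀ j → (l ℕ.+ j) ℕ.* 3 % n ≡ j ℕ.* 3 % n
        index j = trans (cong (λ z → z % n) (trans (ℕₚ.*-distribʳ-+ 3 l j) (trans (cong (ℕ._+ j ℕ.* 3) (sym n≡3l)) (ℕₚ.+-comm n (j ℕ.* 3))))) ([m+n]%n≡m%n (j ℕ.* 3) n)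

        base : ℕ → ℤ
        base t = sumℤ l (λ j → τ t ^ j * H (j ℕ.* 3 % n))

      -- When n = 3l the residue of 3a modulo n has period l in a, so the three thirds of the sum
      -- differ only by powers of τ^l.
      S₃-thirds : ∀ t → S₃ t ≡ (1ℤ + τ t ^ l + τ t ^ l * τ t ^ l) * base t
      S₃-thirds t = begin
        S₃ t                                                        ≡⟨ cong (λ m → sumℤ m f) n≡3l ⟩
        sumℤ (l ℕ.* 3) f                                            ≡⟨ ℤΣ.sum-thirds l f ⟩
        base t + sumℤ l (λ j → f (l ℕ.+ j)) + sumℤ l (λ j → f (l ℕ.+ l ℕ.+ j))
          ≡⟨ cong₂ (λ x y → base t + x + y)
               (trans (ℤΣ.sum-cong l (λ j _ → step j)) (sym (ℤΣ.sum-*ˡ l ρ f)))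
               (trans (ℤΣ.sum-cong l (λ j _ → trans (cong f (ℕₚ.+-assoc l l j)) (trans (step (l ℕ.+ j)) (trans (cong (ρ *_) (step j)) (sym (ℤₚ.*-assoc ρ ρ (f j))))))) (sym (ℤΣ.sum-*ˡ l (ρ * ρ) f))) ⟩
        base t + ρ * base t + ρ * ρ * base t                        ≡⟨ e (base t) ρ ⟩
        (1ℤ + ρ + ρ * ρ) * base t                                   ∎
        where
        open ≡-Reasoning
        ρ = τ t ^ l
        f : ℕ → ℤ
        f a = τ t ^ a * H (a ℕ.* 3 % n)
        e : ∀ b r → b + r * b + r * r * b ≡ (1ℤ + r + r * r) * b
        e = solve-∀
        step : ∀ j → f (l ℕ.+ j) ≡ ρ * f j
        step j = trans (cong₂ (λ u v → u * H v) (ℤₚ.^-distribˡ-+-* (τ t) l j) (index j)) (ℤₚ.*-assoc ρ (τ t ^ j) (H (j ℕ.* 3 % n)))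

      -- ρ = τ^l satisfies (ρ - 1)(1 + ρ + ρ²) = ρ³ - 1 ≈ 0. Modulo a prime power the first factor
      -- can be cancelled only if it is a unit, hence the form of the hypothesis.
      S₃-noncube : ∀ {t} → p ∤ t → Unit (τ t ^ l - 1ℤ) → S₃ t ≈ 0ℤ
      S₃-noncube {t} p∤t u = begin
        S₃ t                              ≡⟨ S₃-thirds t ⟩
        (1ℤ + ρ + ρ * ρ) * base t         ≈⟨ *-congʳ (base t) 1+ρ+ρ²≈0 ⟩
        0ℤ * base t                       ≡⟨ ℤₚ.*-zeroˡ (base t) ⟩
        0ℤ                                ∎
        where
        open ≈-Reasoning
        ρ = τ t ^ l
        e₁ : ∀ r → (r - 1ℤ) * (1ℤ + r + r * r) ≡ r * (r * (r * 1ℤ)) - 1ℤ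
        e₁ = solve-∀
        ρ³≈1 : ρ ^ 3 ≈ 1ℤ
        ρ³≈1 = ≈-trans (≡⇒≈ (trans (ℤₚ.^-*-assoc (τ t) l 3) (cong (τ t ^_) (sym n≡3l)))) (τ^n≈1 p∤t)
        1+ρ+ρ²≈0 : 1ℤ + ρ + ρ * ρ ≈ 0ℤ
        1+ρ+ρ²≈0 = *-cancelˡ u (≈-trans (≡⇒≈ (e₁ ρ)) (≈-trans (≈⇒∸≈0 ρ³≈1) (≡⇒≈ (sym (ℤₚ.*-zeroʳ (ρ - 1ℤ))))))

      -- c ↦ b - c preserves the Γ_p-product and changes the sign (-1)^c when b is odd.
      module _ (m : ℕ) (b≡3m : b ≡ m ℕ.* 3) (odd : -1ℤ ^ b ≡ -1ℤ) where
        private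
          flip : ∀ c c' → c ℕ.+ c' ≡ b → -1ℤ ^ c' ≡ - (-1ℤ ^ c)
          flip c c' e = trans (sym (ℤₚ.*-identityˡ (-1ℤ ^ c'))) (trans (cong (_* -1ℤ ^ c') (sym (trans (sym (-1^-+ c c)) (-1^2n c))))
            (trans (ℤₚ.*-assoc (-1ℤ ^ c) (-1ℤ ^ c) (-1ℤ ^ c')) (trans (cong (-1ℤ ^ c *_) (trans (sym (-1^-+ c c')) (trans (cong (-1ℤ ^_) e) odd))) (trans (ℤₚ.*-comm (-1ℤ ^ c) -1ℤ) (ℤₚ.-1*i≡-i (-1ℤ ^ c))))))

          comm : ∀ x y z → - x * (y * z) ≡ - (x * (z * y))
          comm = solve-∀
          comm' : ∀ x q y z → - x * (q * (y * z)) ≡ - (x * (q * (z * y)))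
          comm' = solve-∀

          H-flip-≤ : ∀ c c' → c ℕ.+ c' ≡ b → H c' ≡ - H c
          H-flip-≤ c c' e = begin
            H c'                                      ≡⟨ H-≤ c' (subst (c' ≤_) e (ℕₚ.m≤n+m c' c)) ⟩
            -1ℤ ^ c' * (Γ₁ c' * Γ₁ (b ∸ c'))          ≡⟨ cong₂ (λ x y → x * (Γ₁ c' * Γ₁ y)) (flip c c' e) (trans (cong (_∸ c') (sym e)) (ℕₚ.m+n∸n≡m c c')) ⟩
            - (-1ℤ ^ c) * (Γ₁ c' * Γ₁ c)              ≡⟨ comm (-1ℤ ^ c) (Γ₁ c') (Γ₁ c) ⟩
            - (-1ℤ ^ c * (Γ₁ c * Γ₁ c'))              ≡⟨ cong (λ y → - (-1ℤ ^ c * (Γ₁ c * Γ₁ y))) (trans (sym (ℕₚ.m+n∸m≡n c c')) (cong (_∸ c) e)) ⟩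
            - (-1ℤ ^ c * (Γ₁ c * Γ₁ (b ∸ c)))         ≡⟨ cong -_ (H-≤ c (subst (c ≤_) e (ℕₚ.m≤m+n c c'))) ⟨
            - H c                                     ∎
            where open ≡-Reasoning

          H-flip-> : ∀ c c' → b < c → b < c' → c ℕ.+ c' ≡ b ℕ.+ n → H c' ≡ - H c
          H-flip-> c c' b<c b<c' e = begin
            H c'                                                  ≡⟨ H-> c' b<c' ⟩
            -1ℤ ^ c' * (- (+ p) * (Γ₁ c' * Γ₁ (b ℕ.+ n ∸ c')))    ≡⟨ cong₂ (λ x y → x * (- (+ p) * (Γ₁ c' * Γ₁ y))) sgn (trans (cong (_∸ c') (sym e)) (ℕₚ.m+n∸n≡m c c')) ⟩
            - (-1ℤ ^ c) * (- (+ p) * (Γ₁ c' * Γ₁ c))              ≡⟨ comm' (-1ℤ ^ c) (- (+ p)) (Γ₁ c') (Γ₁ c) ⟩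
            - (-1ℤ ^ c * (- (+ p) * (Γ₁ c * Γ₁ c')))              ≡⟨ cong (λ y → - (-1ℤ ^ c * (- (+ p) * (Γ₁ c * Γ₁ y)))) (trans (sym (ℕₚ.m+n∸m≡n c c')) (cong (_∸ c) e)) ⟩
            - (-1ℤ ^ c * (- (+ p) * (Γ₁ c * Γ₁ (b ℕ.+ n ∸ c))))   ≡⟨ cong -_ (H-> c b<c) ⟨
            - H c                                                 ∎
            where
            open ≡-Reasoning
            odd' : -1ℤ ^ (b ℕ.+ n) ≡ -1ℤ
            odd' = trans (-1^-+ b n) (trans (cong₂ _*_ odd (trans (cong (-1ℤ ^_) n≡2b) (-1^2n b))) refl)
            sgn : -1ℤ ^ c' ≡ - (-1ℤ ^ c)
            sgn = trans (sym (ℤₚ.*-identityˡ (-1ℤ ^ c'))) (trans (cong (_* -1ℤ ^ c') (sym (trans (sym (-1^-+ c c)) (-1^2n c))))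
              (trans (ℤₚ.*-assoc (-1ℤ ^ c) (-1ℤ ^ c) (-1ℤ ^ c')) (trans (cong (-1ℤ ^ c *_) (trans (sym (-1^-+ c c')) (trans (cong (-1ℤ ^_) e) odd'))) (trans (ℤₚ.*-comm (-1ℤ ^ c) -1ℤ) (ℤₚ.-1*i≡-i (-1ℤ ^ c))))))

          l≡2m : l ≡ m ℕ.+ m
          l≡2m = ℕₚ.*-cancelʳ-≡ l (m ℕ.+ m) 3 (trans (sym n≡3l) (trans n≡2b (trans (cong₂ ℕ._+_ b≡3m b≡3m) (sym (ℕₚ.*-distribʳ-+ 3 m m)))))

          h : ℕ → ℤ
          h j = H (j ℕ.* 3)

          first : sumℤ (suc m) h ≡ 0ℤ
          first = antisymmetric-sum (suc m) h (λ j j≤m → H-flip-≤ (j ℕ.* 3) ((m ∸ j) ℕ.* 3)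
             (trans (sym (ℕₚ.*-distribʳ-+ 3 j (m ∸ j))) (trans (cong (ℕ._* 3) (ℕₚ.m+[n∸m]≡n (ℕ.s≤s⁻¹ j≤m))) (sym b≡3m))))

          -- The multiples of 3 above b = 3m and below n = 6m are 3(m+1), ..., 3(2m-1). There are m
          -- - 1 of them, and c ↦ b + n - c = 9m - c reverses their order.
          second : ∀ m' → m ≡ suc m' → sumℤ m' (λ j → h (suc m ℕ.+ j)) ≡ 0ℤ
          second m' m≡ = antisymmetric-sum m' (λ j → h (suc m ℕ.+ j)) (λ j j<m' → H-flip-> ((suc m ℕ.+ j) ℕ.* 3) ((suc m ℕ.+ (m' ∸ suc j)) ℕ.* 3)
              (big j) (big (m' ∸ suc j)) (trans (e₁ m j (m' ∸ suc j)) (trans (cong (λ z → (suc m ℕ.+ m ℕ.+ z) ℕ.* 3) (ℕₚ.m+[n∸m]≡n j<m')) (total m≡))))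
            where
            big : ∀ j → b < (suc m ℕ.+ j) ℕ.* 3
            big j = subst (_< (suc m ℕ.+ j) ℕ.* 3) (sym b≡3m) (ℕₚ.*-monoˡ-< 3 (s≤s (ℕₚ.m≤m+n m j)))
            e₁ : ∀ m j d → (suc m ℕ.+ j) ℕ.* 3 ℕ.+ (suc m ℕ.+ d) ℕ.* 3 ≡ (suc m ℕ.+ m ℕ.+ (suc j ℕ.+ d)) ℕ.* 3
            e₁ = ℕS.solve-∀
            e₂ : ∀ m' → (suc (suc m') ℕ.+ suc m' ℕ.+ m') ℕ.* 3 ≡ suc m' ℕ.* 3 ℕ.+ (suc m' ℕ.* 3 ℕ.+ suc m' ℕ.* 3)
            e₂ = ℕS.solve-∀
            total : m ≡ suc m' → (suc m ℕ.+ m ℕ.+ m') ℕ.* 3 ≡ b ℕ.+ n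
            total refl = trans (e₂ m') (cong₂ ℕ._+_ (sym b≡3m) (trans (cong₂ ℕ._+_ (sym b≡3m) (sym b≡3m)) (sym n≡2b)))

          halves : ∀ m' → m ≡ suc m' → sumℤ l h ≡ 0ℤ
          halves m' m≡ = trans (cong (λ z → sumℤ z h) (trans l≡2m (trans (cong (m ℕ.+_) m≡) (ℕₚ.+-suc m m')))) (trans (ℤΣ.sum-split (suc m) m' h) (cong₂ _+_ first (second m' m≡)))

        S₃-one-odd : S₃ 1 ≈ 0ℤ
        S₃-one-odd = ≡⇒≈ (trans (S₃-thirds 1) (trans (cong ((1ℤ + τ 1 ^ l + τ 1 ^ l * τ 1 ^ l) *_) (trans base≡ (h-sum m b≡3m refl))) (ℤₚ.*-zeroʳ (1ℤ + τ 1 ^ l + τ 1 ^ l * τ 1 ^ l))))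
          where
          base≡ : base 1 ≡ sumℤ l h
          base≡ = ℤΣ.sum-cong l (λ j j<l → trans (cong (_* H (j ℕ.* 3 % n)) (τ1^ j)) (trans (ℤₚ.*-identityˡ (H (j ℕ.* 3 % n))) (cong H (m<n⇒m%n≡m (subst (j ℕ.* 3 <_) (sym n≡3l) (ℕₚ.*-monoˡ-< 3 j<l))))))
          h-sum : ∀ m₀ → b ≡ m₀ ℕ.* 3 → m₀ ≡ m → sumℤ l h ≡ 0ℤ
          h-sum zero ()
          h-sum (suc m') _ e = halves m' (sym e)

-- Nonvanishing modulo p, and powers of a primitive root

module NonvanishingCases where
  open import Defs
  open import Data.Empty using (⊥; ⊥-elim)
  open import Data.Nat as ℕ using (ℕ; zero; suc; _<_; _≤_; z≤n; s≤s; _∸_; _≤?_; _/_; _%_; _!)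
  import Data.Nat.Properties as ℕₚ
  open import Data.Nat.DivMod using (m≡m%n+[m/n]*n; m%n<n; m/n*n≡m; m<n⇒m%n≡m; [m+n]%n≡m%n)
  open import Data.Nat.Divisibility as ℕ∣ using (divides; _∣_; _∤_; _∣?_)
  open import Data.Nat.Primality using (Prime; prime⇒nonZero; prime?)
  open import Data.Nat.Combinatorics using (_C_; nCk≡n!/k![n-k]!; k![n∸k]!∣n!; k>n⇒nCk≡0)
  import Data.Nat.Tactic.RingSolver as ℕS
  open import Data.Integer as ℤ using (ℤ; +_; -[1+_]; _+_; _*_; -_; _-_; _^_; 0ℤ; 1ℤ; -1ℤ; ∣_∣)
  import Data.Integer.Properties as ℤₚ
  open import Data.Integer.Tactic.RingSolver using (solve-∀)
  open import Data.Product using (_,_; ∃; _×_; proj₁; proj₂)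
  open import Data.Sum using (_⊎_; inj₁; inj₂)
  open import Function using (_∘_)
  open import Relation.Nullary using (¬_; yes; no; Dec)
  open import Relation.Binary.PropositionalEquality as ≡ using (_≡_; _≢_; refl; cong; cong₂; subst; sym; trans; module ≡-Reasoning)
  open import Data.Fin as Fin using (Fin; fromℕ<; toℕ)
  import Data.Fin.Properties as Finₚ
  open import Data.Nat.GCD using (gcd; gcd-greatest)
  open import Relation.Nullary.Decidable using (toWitness)
  open FiniteSums
  open ModularArithmetic
  open MoritaGamma
  open GaussMultiplication
  open Fractions
  open HypergeometricSum
  open VanishingCases

  n!≡nCk*k!*[n∸k]! : ∀ {b c} → c ≤ b → b ! ≡ (b C c) ℕ.* (c ! ℕ.* (b ∸ c) !)
  n!≡nCk*k!*[n∸k]! {b} {c} c≤b = sym (trans (cong (ℕ._* (c ! ℕ.* (b ∸ c) !)) (nCk≡n!/k![n-k]! c≤b)) (m/n*n≡m ⦃ ℕₚ._!*_!≢0 c (b ∸ c) ⦄ (k![n∸k]!∣n! c≤b)))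

  -- The modulus is p^0 = 1. The other statements work at level k + 1, so this level has to be
  -- supplied separately.
  scaledG-mod-1 : ∀ p {m} as bs t → scaledG p 0 m as bs t ≡ 0
  scaledG-mod-1 p as bs t = refl

  3-prime : Prime 3
  3-prime = toWitness {a? = prime? 3} _

  module Modulo (p : ℕ) (pr : Prime p) (b' : ℕ) (p≡1+2b : p ≡ suc (suc b' ℕ.+ suc b')) (4<p : 4 < p) where
    private
      b : ℕ
      b = suc b'
      n : ℕ
      n = p ∸ 1
      n≡2b : n ≡ b ℕ.+ b
      n≡2b = cong ℕ.pred p≡1+2b
      3<p : 3 < p
      3<p = ℕₚ.<-trans (ℕₚ.n<1+n 3) 4<p
    open GammaP p pr b p≡1+2b
    private instance
      p≢0 = prime⇒nonZero pr
    open 𝔽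

    private
      p≡1+n : p ≡ suc n
      p≡1+n = sym (ℕₚ.suc-pred p)
      p≡2+ : p ≡ suc (suc (p ∸ 2))
      p≡2+ = sym (ℕₚ.m+[n∸m]≡n {2} {p} (ℕₚ.≤-trans (s≤s (s≤s z≤n)) 3<p))
      mod-% : ∀ x m .⦃ _ : ℕ.NonZero m ⦄ → x mod m ≡ x % m
      mod-% x (suc m) = refl

    mod-p≈ : ∀ x → + (x mod p) ≈ + x
    mod-p≈ x = ≈-trans (≡⇒≈ (cong +_ (mod-% x p))) (≈-sym (mk (+ (x / p)) (trans (cong +_ (m≡m%n+[m/n]*n x p)) (trans (ℤₚ.pos-+ (x % p) (x / p ℕ.* p)) (cong (_+_ (+ (x % p))) (ℤₚ.pos-* (x / p) p))))))

    mod-p< : ∀ x → x mod p < p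
    mod-p< x = subst (_< p) (sym (mod-% x p)) (m%n<n x p)

    ≈⇒≡ : ∀ {x y} → x < p → y < p → + x ≈ + y → x ≡ y
    ≈⇒≡ {x} {y} x<p y<p h = ℤₚ.+-injective (ℤₚ.i-j≡0⇒i≡j (+ x) (+ y) (ℤₚ.∣i∣≡0⇒i≡0 (small ∣ + x - + y ∣ (∣+-+∣< x<p y<p) (≈0⇒∣ (≈⇒∸≈0 h)))))
      where
      small : ∀ d → d < p → p ∣ d → d ≡ 0
      small zero    _ _ = refl
      small (suc d) h d∣ = ⊥-elim (ℕₚ.<⇒≱ h (ℕ∣.∣⇒≤ d∣))

    mod≡1⇒≈1 : ∀ x → x mod p ≡ 1 → + x ≈ 1ℤ
    mod≡1⇒≈1 x h = ≈-trans (≈-sym (mod-p≈ x)) (≡⇒≈ (cong +_ h))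

    ≈1⇒mod≡1 : ∀ x → + x ≈ 1ℤ → x mod p ≡ 1
    ≈1⇒mod≡1 x h = ≈⇒≡ (mod-p< x) 1<p (≈-trans (mod-p≈ x) h)

    ^≈0⇒ : ∀ x m → x ^ m ≈ 0ℤ → x ≈ 0ℤ
    ^≈0⇒ x zero    h = ⊥-elim (1≉0 h)
    ^≈0⇒ x (suc m) h = decide (p ∣? ∣ x ∣)
      where
      decide : Dec (p ∣ ∣ x ∣) → x ≈ 0ℤ
      decide (yes d) = ∣⇒≈0 d
      decide (no nd) = ^≈0⇒ x m (zero-product x (x ^ m) h (nd ∘ ≈0⇒∣))

    fermat-ℤ : ∀ x → ¬ x ≈ 0ℤ → x ^ n ≈ 1ℤ
    fermat-ℤ (+ u)    h = fermat-unit (h ∘ ∣⇒≈0)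
    fermat-ℤ -[1+ u ] h = ≈-trans (≡⇒≈ (trans (cong (_^ n) (sym (ℤₚ.-1*i≡-i (+ suc u)))) (trans (*-^-distrib -1ℤ (+ suc u) n)
      (trans (cong (_* (+ suc u) ^ n) (trans (cong (-1ℤ ^_) n≡2b) (-1^2n b))) (ℤₚ.*-identityˡ ((+ suc u) ^ n)))))) (fermat-unit {suc u} (h ∘ ∣⇒≈0))

    -- The square of x^b is x^(p-1) ≈ 1, and 1 has only two square roots modulo a prime.
    sign^b : ∀ x → ¬ x ≈ 0ℤ → (x ^ b ≈ 1ℤ) ⊎ (x ^ b ≈ -1ℤ)
    sign^b x x≉0 = decide (p ∣? ∣ x ^ b - 1ℤ ∣)
      where
      e : ∀ y → (y - 1ℤ) * (y - -1ℤ) ≡ y * y - 1ℤ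
      e = solve-∀
      prod≈0 : (x ^ b - 1ℤ) * (x ^ b - -1ℤ) ≈ 0ℤ
      prod≈0 = ≈-trans (≡⇒≈ (e (x ^ b))) (≈⇒∸≈0 (≈-trans (≡⇒≈ (trans (sym (ℤₚ.^-distribˡ-+-* x b b)) (cong (x ^_) (sym n≡2b)))) (fermat-ℤ x x≉0)))
      decide : Dec (p ∣ ∣ x ^ b - 1ℤ ∣) → (x ^ b ≈ 1ℤ) ⊎ (x ^ b ≈ -1ℤ)
      decide (yes d) = inj₁ (∸≈0⇒≈ (∣⇒≈0 d))
      decide (no nd) = inj₂ (∸≈0⇒≈ (zero-product (x ^ b - 1ℤ) (x ^ b - -1ℤ) prod≈0 (nd ∘ ≈0⇒∣)))

    -- A sum of three signs is ±1 or ±3, and p > 3.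
    three-signs : ∀ {x y z} → (x ≈ 1ℤ) ⊎ (x ≈ -1ℤ) → (y ≈ 1ℤ) ⊎ (y ≈ -1ℤ) → (z ≈ 1ℤ) ⊎ (z ≈ -1ℤ) → ¬ x + y + z ≈ 0ℤ
    three-signs hx hy hz h = go hx hy hz
      where
      p∤1 : p ∤ 1
      p∤1 = 0<u<p⇒∤ (s≤s z≤n) 1<p
      p∤3 : p ∤ 3
      p∤3 = 0<u<p⇒∤ (s≤s z≤n) 3<p
      via : ∀ {x y z a b c : ℤ} → x ≈ a → y ≈ b → z ≈ c → x + y + z ≈ 0ℤ → p ∣ ∣ a + b + c ∣
      via hx hy hz h = ≈0⇒∣ (≈-trans (≈-sym (+-cong (+-cong hx hy) hz)) h)
      go : _ → _ → _ → ⊥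
      go (inj₁ a) (inj₁ b) (inj₁ c) = p∤3 (via a b c h)
      go (inj₁ a) (inj₁ b) (inj₂ c) = p∤1 (via a b c h)
      go (inj₁ a) (inj₂ b) (inj₁ c) = p∤1 (via a b c h)
      go (inj₁ a) (inj₂ b) (inj₂ c) = p∤1 (via a b c h)
      go (inj₂ a) (inj₁ b) (inj₁ c) = p∤1 (via a b c h)
      go (inj₂ a) (inj₁ b) (inj₂ c) = p∤1 (via a b c h)
      go (inj₂ a) (inj₂ b) (inj₁ c) = p∤1 (via a b c h)
      go (inj₂ a) (inj₂ b) (inj₂ c) = p∤3 (via a b c h)

    t^p^k≈t : ∀ t k → (+ t) ^ (p ℕ.^ k) ≈ + t
    t^p^k≈t t zero    = ≡⇒≈ (ℤₚ.*-identityʳ (+ t))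
    t^p^k≈t t (suc k) = ≈-trans (≡⇒≈ (trans (cong ((+ t) ^_) (ℕₚ.*-comm p (p ℕ.^ k))) (sym (ℤₚ.^-*-assoc (+ t) (p ℕ.^ k) p)))) (≈-trans (^-cong p (t^p^k≈t t k)) (fermat t))

    inverse : ∀ {t} → p ∤ t → + t * (+ t) ^ (p ∸ 2) ≈ 1ℤ
    inverse {t} p∤t = subst (λ e → (+ t) ^ e ≈ 1ℤ) (cong ℕ.pred p≡2+) (fermat-unit p∤t)

    inverse≈1⇒ : ∀ {t} → p ∤ t → (+ t) ^ (p ∸ 2) ≈ 1ℤ → + t ≈ 1ℤ
    inverse≈1⇒ {t} p∤t h = ≈-trans (≡⇒≈ (sym (ℤₚ.*-identityʳ (+ t)))) (≈-trans (*-congˡ (+ t) (≈-sym h)) (inverse p∤t))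

    module _ (k : ℕ) where
      open Residues p pr b p≡1+2b 3<p k using (τ)

      τ≈ : ∀ t → τ t ≈ (+ t) ^ (p ∸ 2)
      τ≈ t = ^-cong (p ∸ 2) (t^p^k≈t t k)

      t*τ≈1 : ∀ {t} → p ∤ t → + t * τ t ≈ 1ℤ
      t*τ≈1 {t} p∤t = ≈-trans (*-congˡ (+ t) (τ≈ t)) (inverse p∤t)

      τ≈1⇒t≈1 : ∀ {t} → p ∤ t → τ t ≈ 1ℤ → + t ≈ 1ℤ
      τ≈1⇒t≈1 {t} p∤t h = inverse≈1⇒ p∤t (≈-trans (≈-sym (τ≈ t)) h)

      τ^n≈1 : ∀ {t} → p ∤ t → τ t ^ n ≈ 1ℤ
      τ^n≈1 {t} p∤t = to-p k (Vanishing.τ^n≈1 p pr b' p≡1+2b 4<p k p∤t)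

    ℤ-unit : ∀ k z → ¬ z ≈ 0ℤ → ℤ/.Unit (suc k) z
    ℤ-unit k (+ u)    h = ℕ-unit k (h ∘ ∣⇒≈0)
    ℤ-unit k -[1+ u ] h = ℤ/.Unit-neg (suc k) (ℕ-unit k {suc u} (h ∘ ∣⇒≈0))

    -- At k = 3 the modulus is p^4, and dividing by p^3 leaves `S₃` modulo p. The level is a
    -- variable equal to 3, so that powers p^(k+1) stay symbolic.
    module Nonvanishing (k : ℕ) (k≡3 : k ≡ 3) where
      open Multiplication p pr b p≡1+2b 3<p k using (Γ₁)
      open Residues p pr b p≡1+2b 3<p k using (τ; H; S₃; G₃≡0⇒; n≢0)
      private
        module V = Vanishing p pr b' p≡1+2b 4<p k
        module L = Level k
        module L₀ = Level 0

      S₃≈0 : ∀ t → p ∤ t → G3Vanishes p t → S₃ t ≈ 0ℤ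
      S₃≈0 t p∤t h = divide (S₃ t) (G₃≡0⇒ t p∤t (h (suc k)))
        where
        e' : ∀ q x p → 0ℤ + q * (x * p) ≡ x * (0ℤ + q * p)
        e' = solve-∀
        p^4≡ : + (p ℕ.^ suc k) ≡ + (p ℕ.^ 3) * + p
        p^4≡ = trans (cong (λ m → + (p ℕ.^ suc m)) k≡3) (trans (cong +_ (ℕₚ.*-comm p (p ℕ.^ 3))) (ℤₚ.pos-* (p ℕ.^ 3) p))
        divide : ∀ S → L._≈_ (+ (p ℕ.^ 3) * S) 0ℤ → S ≈ 0ℤ
        divide S (Mod.mk q e) = mk q (ℤₚ.*-cancelˡ-≡ (+ (p ℕ.^ 3)) S (0ℤ + q * + p) ⦃ ℕ.>-nonZero (ℕₚ.m^n>0 p 3) ⦄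
          (trans e (trans (cong (λ z → 0ℤ + q * z) p^4≡) (e' q (+ (p ℕ.^ 3)) (+ p)))))

      private
        refl-prod-! : ∀ c → c < p → refl-prod c ≡ + (c !)
        refl-prod-! zero    _ = refl
        refl-prod-! (suc c) h = trans (cong₂ _*_ (refl-prod-! c (ℕₚ.<-trans (ℕₚ.n<1+n c) h)) (s-∤ (0<u<p⇒∤ (s≤s z≤n) h))) (trans (ℤₚ.*-comm (+ (c !)) (+ suc c)) (sym (ℤₚ.pos-* (suc c) (c !))))

        rep≈1 : + rep (suc k) ≈ 1ℤ
        rep≈1 = mk (+ rep k) (trans (ℤₚ.pos-+ 1 (rep k ℕ.* p)) (cong (_+_ 1ℤ) (ℤₚ.pos-* (rep k) p)))

        -- Modulo p the argument c/(p-1) is -c, and the reflection product up to c < p is the plain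
        -- factorial.
        Γ₁*! : ∀ c → c < p → Γ₁ c * + (c !) ≈ 1ℤ
        Γ₁*! c c<p = ≈-trans (*-cong (to-p 0 (L₀.gam-cong {c ℕ.* rep (suc k) ℕ.* L.Q} {c ℕ.* L₀.Q} (from-p idx))) (≡⇒≈ (sym (refl-prod-! c c<p)))) (to-p 0 (L₀.reflection c))
          where
          idx : + (c ℕ.* rep (suc k) ℕ.* L.Q) ≈ + (c ℕ.* L₀.Q)
          idx = ≈-trans (to-p k (L.i*Q≈-i (c ℕ.* rep (suc k)))) (≈-trans (neg-cong (≈-trans (≡⇒≈ (ℤₚ.pos-* c (rep (suc k)))) (≈-trans (*-congˡ (+ c) rep≈1) (≡⇒≈ (ℤₚ.*-identityʳ (+ c)))))) (≈-sym (to-p 0 (L₀.i*Q≈-i c))))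

        b<p : b < p
        b<p = subst (b <_) (sym p≡1+2b) (s≤s (ℕₚ.m≤m+n b b))

      -- For c ≤ b the two values of Γ_p are 1/c! and 1/(b-c)!. For c > b the left side has the
      -- factor p and the binomial coefficient is 0.
      H-binomial : ∀ c → + (b !) * H c ≈ -1ℤ ^ c * + (b C c)
      H-binomial c = decide (c ≤? b)
        where
        open ≈-Reasoning
        decide : Dec (c ≤ b) → + (b !) * H c ≈ -1ℤ ^ c * + (b C c)
        decide (yes c≤b) = begin
          + (b !) * H c                                                             ≡⟨ cong₂ (λ x y → x * y) b!' (V.H-≤ c c≤b) ⟩
          + (b C c) * (+ (c !) * + ((b ∸ c) !)) * (-1ℤ ^ c * (Γ₁ c * Γ₁ (b ∸ c)))   ≡⟨ e (+ (b C c)) (+ (c !)) (+ ((b ∸ c) !)) (-1ℤ ^ c) (Γ₁ c) (Γ₁ (b ∸ c)) ⟩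
          -1ℤ ^ c * + (b C c) * (Γ₁ c * + (c !) * (Γ₁ (b ∸ c) * + ((b ∸ c) !)))     ≈⟨ *-congˡ (-1ℤ ^ c * + (b C c)) (*-cong (Γ₁*! c (ℕₚ.≤-<-trans c≤b b<p)) (Γ₁*! (b ∸ c) (ℕₚ.≤-<-trans (ℕₚ.m∸n≤m b c) b<p))) ⟩
          -1ℤ ^ c * + (b C c) * (1ℤ * 1ℤ)                                           ≡⟨ ℤₚ.*-identityʳ (-1ℤ ^ c * + (b C c)) ⟩
          -1ℤ ^ c * + (b C c)                                                       ∎
          where
          b!' : + (b !) ≡ + (b C c) * (+ (c !) * + ((b ∸ c) !))
          b!' = trans (cong +_ (n!≡nCk*k!*[n∸k]! c≤b)) (trans (ℤₚ.pos-* (b C c) (c ! ℕ.* (b ∸ c) !)) (cong (+ (b C c) *_) (ℤₚ.pos-* (c !) ((b ∸ c) !))))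
          e : ∀ C x y s g h → C * (x * y) * (s * (g * h)) ≡ s * C * (g * x * (h * y))
          e = solve-∀
        decide (no c≰b) = begin
          + (b !) * H c                                                   ≡⟨ cong (+ (b !) *_) (V.H-> c (ℕₚ.≰⇒> c≰b)) ⟩
          + (b !) * (-1ℤ ^ c * (- (+ p) * G))                             ≡⟨ e (+ (b !)) (-1ℤ ^ c) (+ p) G ⟩
          - (+ (b !) * -1ℤ ^ c * G) * + p                                 ≈⟨ multiple≈0 (- (+ (b !) * -1ℤ ^ c * G)) ⟩
          0ℤ                                                              ≡⟨ trans (cong (λ z → -1ℤ ^ c * + z) (k>n⇒nCk≡0 (ℕₚ.≰⇒> c≰b))) (ℤₚ.*-zeroʳ (-1ℤ ^ c)) ⟨
          -1ℤ ^ c * + (b C c)                                             ∎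
          where
          G = Γ₁ c * Γ₁ (b ℕ.+ n ∸ c)
          e : ∀ f s p g → f * (s * (- p * g)) ≡ - (f * s * g) * p
          e = solve-∀

      Φ : ℤ → ℤ
      Φ y = sumℤ n (λ i → y ^ i * H i)

      Φ-binomial : ∀ y → + (b !) * Φ y ≈ (1ℤ - y) ^ b
      Φ-binomial y = begin
        + (b !) * Φ y                                              ≡⟨ ℤΣ.sum-*ˡ n (+ (b !)) (λ i → y ^ i * H i) ⟩
        sumℤ n (λ i → + (b !) * (y ^ i * H i))                     ≈⟨ sum-cong n (λ i _ → summand i) ⟩
        sumℤ n f                                                   ≡⟨ cong (λ m → sumℤ m f) (trans n≡2b (ℕₚ.+-suc b b')) ⟩
        sumℤ (suc b ℕ.+ b') f                                      ≡⟨ ℤΣ.sum-split (suc b) b' f ⟩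
        sumℤ (suc b) f + sumℤ b' (λ i → f (suc b ℕ.+ i))           ≡⟨ cong (_+_ (sumℤ (suc b) f)) (ℤΣ.sum-zero b' (λ i _ → trans (cong (λ z → + z * (- y) ^ (suc b ℕ.+ i)) (k>n⇒nCk≡0 (s≤s (ℕₚ.m≤m+n b i)))) (ℤₚ.*-zeroˡ ((- y) ^ (suc b ℕ.+ i))))) ⟩
        sumℤ (suc b) f + 0ℤ                                        ≡⟨ ℤₚ.+-identityʳ (sumℤ (suc b) f) ⟩
        sumℤ (suc b) f                                             ≡⟨ binomial-theorem (- y) b ⟨
        (1ℤ - y) ^ b                                               ∎
        where
        open ≈-Reasoning
        f : ℕ → ℤ
        f i = + (b C i) * (- y) ^ i
        e₁ : ∀ f y h → f * (y * h) ≡ y * (f * h)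
        e₁ = solve-∀
        e₂ : ∀ y s c → y * (s * c) ≡ c * (s * y)
        e₂ = solve-∀
        summand : ∀ i → + (b !) * (y ^ i * H i) ≈ f i
        summand i = ≈-trans (≡⇒≈ (e₁ (+ (b !)) (y ^ i) (H i))) (≈-trans (*-congˡ (y ^ i) (H-binomial i)) (≡⇒≈ (trans (e₂ (y ^ i) (-1ℤ ^ i) (+ (b C i)))
          (cong (+ (b C i) *_) (trans (sym (*-^-distrib -1ℤ y i)) (cong (_^ i) (ℤₚ.-1*i≡-i y)))))))

      module _ (t : ℕ) (z : ℤ) (z³≈τ : z ^ 3 ≈ τ t) (z^n≈1 : z ^ n ≈ 1ℤ) where
        private
          f : ℕ → ℤ
          f i = z ^ i * H (i % n)

          f-period : ∀ i → f (i ℕ.+ n) ≈ f i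
          f-period i = *-cong (≈-trans (≡⇒≈ (ℤₚ.^-distribˡ-+-* z i n)) (≈-trans (*-congˡ (z ^ i) z^n≈1) (≡⇒≈ (ℤₚ.*-identityʳ (z ^ i))))) (≡⇒≈ (cong H ([m+n]%n≡m%n i n)))

          S₃≈f : S₃ t ≈ sumℤ n (λ a → f (a ℕ.* 3))
          S₃≈f = sum-cong n (λ a _ → *-congʳ (H (a ℕ.* 3 % n)) (≈-trans (^-cong a (≈-sym z³≈τ)) (≡⇒≈ (trans (ℤₚ.^-*-assoc z 3 a) (cong (z ^_) (ℕₚ.*-comm 3 a))))))

          Σf≡Φ : ∀ u → sumℤ n (λ i → u ^ i * f i) ≡ Φ (u * z)
          Σf≡Φ u = ℤΣ.sum-cong n (λ i i<n → trans (sym (ℤₚ.*-assoc (u ^ i) (z ^ i) (H (i % n)))) (cong₂ _*_ (sym (*-^-distrib u z i)) (cong H (m<n⇒m%n≡m i<n))))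

        -- With τ replaced by z³ the summand depends on 3a alone, and it is periodic with period n
        -- because z^n ≈ 1; multiplication by 3 then only permutes the terms.
        S₃≈Φ : ∀ l → n ≡ suc (l ℕ.* 3) → S₃ t ≈ Φ z
        S₃≈Φ l n≡ = begin
          S₃ t                                             ≈⟨ S₃≈f ⟩
          sumℤ n (λ a → f (a ℕ.* 3))                       ≡⟨ cong (λ m → sumℤ m (λ a → f (a ℕ.* 3))) n≡ ⟩
          sumℤ (suc (l ℕ.* 3)) (λ a → f (a ℕ.* 3))         ≈⟨ sum-triple-perm l f (λ i → subst (λ m → f (i ℕ.+ m) ≈ f i) n≡ (f-period i)) ⟩
          sumℤ (suc (l ℕ.* 3)) f                           ≡⟨ cong (λ m → sumℤ m f) n≡ ⟨
          sumℤ n f                                         ≡⟨ ℤΣ.sum-cong n (λ i i<n → cong (λ j → z ^ i * H j) (m<n⇒m%n≡m i<n)) ⟩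
          Φ z                                              ∎
          where open ≈-Reasoning

        -- 1 + ζ^i + ζ^{2i} is 3 or 0 according as 3 divides i or not.
        S₃≈ΣΦ : ∀ l → n ≡ l ℕ.* 3 → ∀ ζ → ζ ^ 3 ≈ 1ℤ → 1ℤ + ζ + ζ * ζ ≈ 0ℤ → S₃ t ≈ Φ (1ℤ * z) + Φ (ζ * z) + Φ (ζ * ζ * z)
        S₃≈ΣΦ l n≡ ζ ζ³ 1+ζ+ζ² = begin
          S₃ t                                                          ≈⟨ S₃≈f ⟩
          sumℤ n (λ a → f (a ℕ.* 3))                                    ≡⟨ cong (λ m → sumℤ m (λ a → f (a ℕ.* 3))) n≡ ⟩
          sumℤ (l ℕ.* 3) (λ a → f (a ℕ.* 3))                            ≡⟨ ℤΣ.sum-thirds l (λ a → f (a ℕ.* 3)) ⟩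
          Σ₀ + sumℤ l (λ j → f ((l ℕ.+ j) ℕ.* 3)) + sumℤ l (λ j → f ((l ℕ.+ l ℕ.+ j) ℕ.* 3))
            ≈⟨ +-cong (+-congˡ Σ₀ (sum-cong l (λ j _ → shift j))) (sum-cong l (λ j _ → ≈-trans (≡⇒≈ (cong (λ i → f (i ℕ.* 3)) (ℕₚ.+-assoc l l j))) (≈-trans (shift (l ℕ.+ j)) (shift j)))) ⟩
          Σ₀ + Σ₀ + Σ₀                                                     ≡⟨ e Σ₀ ⟩
          + 3 * Σ₀ + 0ℤ + 0ℤ                                             ≈⟨ +-cong (+-cong (≈-sym part₀) (≈-sym (part 2 part₂))) (≈-sym (part 1 part₁)) ⟩
          sumℤ l (λ j → w (j ℕ.* 3) * f (j ℕ.* 3)) + sumℤ l (λ j → w (2 ℕ.+ j ℕ.* 3) * f (2 ℕ.+ j ℕ.* 3)) + sumℤ l (λ j → w (1 ℕ.+ j ℕ.* 3) * f (1 ℕ.+ j ℕ.* 3))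
            ≡⟨ ℤΣ.sum-residues l (λ i → w i * f i) ⟨
          sumℤ (l ℕ.* 3) (λ i → w i * f i)                              ≡⟨ cong (λ m → sumℤ m (λ i → w i * f i)) n≡ ⟨
          sumℤ n (λ i → w i * f i)                                      ≡⟨ trans (ℤΣ.sum-cong n (λ i _ → e₃ (1ℤ ^ i) (ζ ^ i) ((ζ * ζ) ^ i) (f i))) (trans (ℤΣ.sum-+ n (λ i → 1ℤ ^ i * f i + ζ ^ i * f i) (λ i → (ζ * ζ) ^ i * f i)) (cong (_+ sumℤ n (λ i → (ζ * ζ) ^ i * f i)) (ℤΣ.sum-+ n (λ i → 1ℤ ^ i * f i) (λ i → ζ ^ i * f i)))) ⟩
          sumℤ n (λ i → 1ℤ ^ i * f i) + sumℤ n (λ i → ζ ^ i * f i) + sumℤ n (λ i → (ζ * ζ) ^ i * f i)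
            ≡⟨ cong₂ _+_ (cong₂ _+_ (Σf≡Φ 1ℤ) (Σf≡Φ ζ)) (Σf≡Φ (ζ * ζ)) ⟩
          Φ (1ℤ * z) + Φ (ζ * z) + Φ (ζ * ζ * z)                        ∎
          where
          open ≈-Reasoning
          Σ₀ = sumℤ l (λ j → f (j ℕ.* 3))
          w : ℕ → ℤ
          w i = 1ℤ ^ i + ζ ^ i + (ζ * ζ) ^ i
          e : ∀ x → x + x + x ≡ + 3 * x + 0ℤ + 0ℤ
          e = solve-∀
          e₃ : ∀ a b c f → (a + b + c) * f ≡ a * f + b * f + c * f
          e₃ = solve-∀
          shift : ∀ j → f ((l ℕ.+ j) ℕ.* 3) ≈ f (j ℕ.* 3)
          shift j = ≈-trans (≡⇒≈ (cong f (trans (ℕₚ.*-distribʳ-+ 3 l j) (trans (cong (ℕ._+ j ℕ.* 3) (sym n≡)) (ℕₚ.+-comm n (j ℕ.* 3)))))) (f-period (j ℕ.* 3))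
          ζ^3j : ∀ j → ζ ^ (j ℕ.* 3) ≈ 1ℤ
          ζ^3j j = ≈-trans (≡⇒≈ (trans (cong (ζ ^_) (ℕₚ.*-comm j 3)) (sym (ℤₚ.^-*-assoc ζ 3 j)))) (1^≈1 j ζ³)
          w-3j : ∀ r j → w (r ℕ.+ j ℕ.* 3) ≈ 1ℤ + ζ ^ r + ζ ^ r * ζ ^ r
          w-3j r j = +-cong (+-cong (≡⇒≈ (ℤₚ.^-zeroˡ (r ℕ.+ j ℕ.* 3))) ζ≈) (≈-trans (≡⇒≈ (*-^-distrib ζ ζ (r ℕ.+ j ℕ.* 3))) (*-cong ζ≈ ζ≈))
            where
            ζ≈ : ζ ^ (r ℕ.+ j ℕ.* 3) ≈ ζ ^ r
            ζ≈ = ≈-trans (≡⇒≈ (ℤₚ.^-distribˡ-+-* ζ r (j ℕ.* 3))) (≈-trans (*-congˡ (ζ ^ r) (ζ^3j j)) (≡⇒≈ (ℤₚ.*-identityʳ (ζ ^ r))))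
          part₁ : 1ℤ + ζ ^ 1 + ζ ^ 1 * ζ ^ 1 ≈ 0ℤ
          part₁ = ≈-trans (≡⇒≈ (cong (λ y → 1ℤ + y + y * y) (ℤₚ.*-identityʳ ζ))) 1+ζ+ζ²
          part₂ : 1ℤ + ζ ^ 2 + ζ ^ 2 * ζ ^ 2 ≈ 0ℤ
          part₂ = ≈-trans (≡⇒≈ (e₄ ζ)) (≈-trans (+-congˡ (1ℤ + ζ * ζ) (*-congˡ ζ ζ³)) (≈-trans (≡⇒≈ (e₅ ζ)) 1+ζ+ζ²))
            where
            e₄ : ∀ y → 1ℤ + y * (y * 1ℤ) + y * (y * 1ℤ) * (y * (y * 1ℤ)) ≡ 1ℤ + y * y + y * (y * (y * (y * 1ℤ)))
            e₄ = solve-∀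
            e₅ : ∀ y → 1ℤ + y * y + y * 1ℤ ≡ 1ℤ + y + y * y
            e₅ = solve-∀
          part : ∀ r → 1ℤ + ζ ^ r + ζ ^ r * ζ ^ r ≈ 0ℤ → sumℤ l (λ j → w (r ℕ.+ j ℕ.* 3) * f (r ℕ.+ j ℕ.* 3)) ≈ 0ℤ
          part r h = sum-zero l (λ j _ → ≈-trans (*-congʳ (f (r ℕ.+ j ℕ.* 3)) (≈-trans (w-3j r j) h)) (≡⇒≈ (ℤₚ.*-zeroˡ (f (r ℕ.+ j ℕ.* 3)))))
          part₀ : sumℤ l (λ j → w (j ℕ.* 3) * f (j ℕ.* 3)) ≈ + 3 * Σ₀
          part₀ = ≈-trans (sum-cong l (λ j _ → *-congʳ (f (j ℕ.* 3)) (w-3j 0 j))) (≡⇒≈ (sym (ℤΣ.sum-*ˡ l (+ 3) (λ j → f (j ℕ.* 3)))))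

      -- Cubing is a bijection when p ≡ 2 modulo 3, so a single cube root z of τ is involved and b!
      -- S₃ ≈ (1 - z)^b. This vanishes only for z ≈ 1, whence τ ≈ 1.
      vanish⇒t≡1 : ∀ l → n ≡ suc (l ℕ.* 3) → ∀ t → 0 < t → t < p → G3Vanishes p t → t ≡ 1
      vanish⇒t≡1 l n≡ t 0<t t<p h = ≈⇒≡ t<p 1<p (τ≈1⇒t≈1 k p∤t (≈-trans (≈-sym z³≈τ) (1^≈1 {z} 3 (≈-sym (∸≈0⇒≈ {1ℤ} {z} 1-z≈0)))))
        where
        p∤t : p ∤ t
        p∤t = 0<u<p⇒∤ 0<t t<p
        -- 3 (2l + 1) = 1 + 2n, so z is a cube root of τ
        z : ℤ
        z = τ t ^ suc (l ℕ.+ l)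
        e : ∀ l → suc (l ℕ.+ l) ℕ.* 3 ≡ 1 ℕ.+ suc (l ℕ.* 3) ℕ.* 2
        e = ℕS.solve-∀
        z³≈τ : z ^ 3 ≈ τ t
        z³≈τ = ≈-trans (≡⇒≈ (trans (ℤₚ.^-*-assoc (τ t) (suc (l ℕ.+ l)) 3) (trans (cong (τ t ^_) (trans (e l) (cong (λ m → 1 ℕ.+ m ℕ.* 2) (sym n≡)))) (cong (τ t *_) (sym (ℤₚ.^-*-assoc (τ t) n 2))))))
          (≈-trans (*-congˡ (τ t) (1^≈1 2 (τ^n≈1 k p∤t))) (≡⇒≈ (ℤₚ.*-identityʳ (τ t))))
        z^n≈1 : z ^ n ≈ 1ℤ
        z^n≈1 = ≈-trans (≡⇒≈ (trans (ℤₚ.^-*-assoc (τ t) (suc (l ℕ.+ l)) n) (trans (cong (τ t ^_) (ℕₚ.*-comm (suc (l ℕ.+ l)) n)) (sym (ℤₚ.^-*-assoc (τ t) n (suc (l ℕ.+ l))))))) (1^≈1 (suc (l ℕ.+ l)) (τ^n≈1 k p∤t))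
        1-z≈0 : 1ℤ - z ≈ 0ℤ
        1-z≈0 = ^≈0⇒ (1ℤ - z) b (≈-trans (≈-sym (Φ-binomial z)) (≈-trans (*-congˡ (+ (b !)) (≈-trans (≈-sym (S₃≈Φ t z z³≈τ z^n≈1 l n≡)) (S₃≈0 t p∤t h))) (≡⇒≈ (ℤₚ.*-zeroʳ (+ (b !))))))

      -- b! S₃ is the sum of (1 - y)^b over the three cube roots y of τ.
      vanish⇒powers : ∀ l → n ≡ l ℕ.* 3 → ∀ ζ → ζ ^ 3 ≈ 1ℤ → 1ℤ + ζ + ζ * ζ ≈ 0ℤ → ∀ t z → p ∤ t → z ^ 3 ≈ (+ t) ^ (p ∸ 2) → z ^ n ≈ 1ℤ → G3Vanishes p t →
        (1ℤ - 1ℤ * z) ^ b + (1ℤ - ζ * z) ^ b + (1ℤ - ζ * ζ * z) ^ b ≈ 0ℤ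
      vanish⇒powers l n≡ ζ ζ³ 1+ζ+ζ² t z p∤t z³≈ z^n≈1 h = begin
        (1ℤ - 1ℤ * z) ^ b + (1ℤ - ζ * z) ^ b + (1ℤ - ζ * ζ * z) ^ b         ≈⟨ +-cong (+-cong (Φ-binomial (1ℤ * z)) (Φ-binomial (ζ * z))) (Φ-binomial (ζ * ζ * z)) ⟨
        B * Φ (1ℤ * z) + B * Φ (ζ * z) + B * Φ (ζ * ζ * z)                  ≡⟨ e B (Φ (1ℤ * z)) (Φ (ζ * z)) (Φ (ζ * ζ * z)) ⟩
        B * (Φ (1ℤ * z) + Φ (ζ * z) + Φ (ζ * ζ * z))                        ≈⟨ *-congˡ B (≈-trans (≈-sym (S₃≈ΣΦ t z (≈-trans z³≈ (≈-sym (τ≈ k t))) z^n≈1 l n≡ ζ ζ³ 1+ζ+ζ²)) (S₃≈0 t p∤t h)) ⟩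
        B * 0ℤ                                                              ≡⟨ ℤₚ.*-zeroʳ B ⟩
        0ℤ                                                                  ∎
        where
        open ≈-Reasoning
        B = + (b !)
        e : ∀ B x y z → B * x + B * y + B * z ≡ B * (x + y + z)
        e = solve-∀

    module Generator (g : ℕ) (root : PrimitiveRoot p g) where
      private
        n>0 : 0 < n
        n>0 = subst (0 <_) (sym n≡2b) (s≤s z≤n)
        instance
          n≢0' : ℕ.NonZero n
          n≢0' = ℕ.>-nonZero n>0

      g^n≈1 : (+ g) ^ n ≈ 1ℤ
      g^n≈1 = ≈-trans (≡⇒≈ (sym (pos-^ g n))) (mod≡1⇒≈1 (g ℕ.^ n) (proj₁ root))

      g≉0 : ¬ + g ≈ 0ℤ
      g≉0 h = 1≉0 (≈-trans (≈-sym g^n≈1) (≈-trans (^-cong n h) (≡⇒≈ (trans (cong (0ℤ ^_) n≡2b) (ℤₚ.*-zeroˡ (0ℤ ^ (b' ℕ.+ b)))))))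

      order : ∀ e → (+ g) ^ e ≈ 1ℤ → n ∣ e
      order e h = go (e % n) refl
        where
        g^r≈1 : (+ g) ^ (e % n) ≈ 1ℤ
        g^r≈1 = ≈-trans (≡⇒≈ (sym (ℤₚ.*-identityʳ ((+ g) ^ (e % n))))) (≈-trans (*-congˡ ((+ g) ^ (e % n)) (≈-sym (1^≈1 (e / n) g^n≈1)))
          (≈-trans (≡⇒≈ (trans (cong ((+ g) ^ (e % n) *_) (trans (ℤₚ.^-*-assoc (+ g) n (e / n)) (cong ((+ g) ^_) (ℕₚ.*-comm n (e / n)))))
            (trans (sym (ℤₚ.^-distribˡ-+-* (+ g) (e % n) (e / n ℕ.* n))) (cong ((+ g) ^_) (sym (m≡m%n+[m/n]*n e n)))))) h))
        go : ∀ r → r ≡ e % n → n ∣ e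
        go zero    r≡ = divides (e / n) (trans (m≡m%n+[m/n]*n e n) (cong (ℕ._+ e / n ℕ.* n) (sym r≡)))
        go (suc r) r≡ = ⊥-elim (proj₂ root (suc r) (s≤s z≤n) (subst (_< n) (sym r≡) (m%n<n e n)) (≈1⇒mod≡1 (g ℕ.^ suc r) (≈-trans (≡⇒≈ (pos-^ g (suc r))) (subst (λ i → (+ g) ^ i ≈ 1ℤ) (sym r≡) g^r≈1))))

      g-unit : Unit (+ g)
      g-unit = unit-to-p 0 (ℕ-unit 0 (g≉0 ∘ ∣⇒≈0))

      private
        code : ∀ x → x < p → ¬ + x ≈ 0ℤ → Fin n
        code zero    _   x≉0 = ⊥-elim (x≉0 (≈-refl {0ℤ}))
        code (suc x) x<p _   = fromℕ< {x} (ℕ.s≤s⁻¹ (subst (suc x <_) p≡1+n x<p))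

        code-injective : ∀ x y x<p y<p x≉0 y≉0 → code x x<p x≉0 ≡ code y y<p y≉0 → x ≡ y
        code-injective zero    _       _ _ x≉0 _ _ = ⊥-elim (x≉0 (≈-refl {0ℤ}))
        code-injective (suc _) zero    _ _ _ y≉0 _ = ⊥-elim (y≉0 (≈-refl {0ℤ}))
        code-injective (suc x) (suc y) _ _ _ _ e = cong suc (Finₚ.fromℕ<-injective x y _ _ e)

        pow : ℕ → ℕ
        pow i = (g ℕ.^ i) mod p
        pow≈ : ∀ i → + pow i ≈ (+ g) ^ i
        pow≈ i = ≈-trans (mod-p≈ (g ℕ.^ i)) (≡⇒≈ (pos-^ g i))
        pow≉0 : ∀ i → ¬ + pow i ≈ 0ℤ
        pow≉0 i h = unit⇒≉0 (Unit-^ i g-unit) (≈-trans (≈-sym (pow≈ i)) h)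

      -- Pigeonhole: t and the powers g^0, ..., g^(n-1) are n + 1 nonzero residues, of which there
      -- are only n. Two powers never coincide, so the coincidence involves t.
      discrete-log : ∀ t → t < p → ¬ + t ≈ 0ℤ → ∃ λ i → t ≡ (g ℕ.^ i) mod p
      discrete-log t t<p t≉0 = go (Finₚ.pigeonhole (ℕₚ.n<1+n n) f)
        where
        f : Fin (suc n) → Fin n
        f Fin.zero    = code t t<p t≉0
        f (Fin.suc i) = code (pow (toℕ i)) (mod-p< (g ℕ.^ toℕ i)) (pow≉0 (toℕ i))
        distinct : ∀ i j → i < j → j < n → ¬ + pow i ≈ + pow j
        distinct i j i<j j<n h = proj₂ root (j ∸ i) (ℕₚ.m<n⇒0<n∸m i<j) (ℕₚ.≤-<-trans (ℕₚ.m∸n≤m j i) j<n)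
          (≈1⇒mod≡1 (g ℕ.^ (j ∸ i)) (≈-trans (≡⇒≈ (pos-^ g (j ∸ i))) (≈-sym (*-cancelˡ (Unit-^ i g-unit) (≈-trans (≡⇒≈ (ℤₚ.*-identityʳ ((+ g) ^ i))) (≈-trans (≈-sym (pow≈ i)) (≈-trans h (≈-trans (pow≈ j)
            (≡⇒≈ (trans (cong ((+ g) ^_) (sym (ℕₚ.m+[n∸m]≡n (ℕₚ.<⇒≤ i<j)))) (ℤₚ.^-distribˡ-+-* (+ g) i (j ∸ i)))))))))))) 
        go : (∃ λ i → ∃ λ j → (i Fin.< j) × (f i ≡ f j)) → ∃ λ i → t ≡ (g ℕ.^ i) mod p
        go (Fin.zero , Fin.suc j , _ , e) = toℕ j , code-injective _ _ _ _ _ _ e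
        go (Fin.suc i , Fin.suc j , s≤s i<j , e) = ⊥-elim (distinct (toℕ i) (toℕ j) i<j (Finₚ.toℕ<n j) (≡⇒≈ (cong +_ (code-injective _ _ _ _ _ _ e))))

      module _ (l : ℕ) (n≡3l : n ≡ l ℕ.* 3) where
        ζ : ℤ
        ζ = (+ g) ^ l

        ζ³≈1 : ζ ^ 3 ≈ 1ℤ
        ζ³≈1 = ≈-trans (≡⇒≈ (trans (ℤₚ.^-*-assoc (+ g) l 3) (cong ((+ g) ^_) (sym n≡3l)))) g^n≈1

        private
          0<l : 0 < l
          0<l = go l n≡3l
            where
            go : ∀ l → n ≡ l ℕ.* 3 → 0 < l
            go zero e = ⊥-elim (ℕₚ.<-irrefl (sym e) n>0)
            go (suc l) _ = s≤s z≤n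
          l<n : l < n
          l<n = subst (l <_) (sym (trans n≡3l (ℕₚ.*-comm l 3))) (ℕₚ.m<m+n l (ℕₚ.<-≤-trans 0<l (ℕₚ.m≤m+n l (l ℕ.+ 0))))

        ζ≉1 : ¬ ζ - 1ℤ ≈ 0ℤ
        ζ≉1 h = proj₂ root l 0<l l<n (≈1⇒mod≡1 (g ℕ.^ l) (≈-trans (≡⇒≈ (pos-^ g l)) (∸≈0⇒≈ {ζ} {1ℤ} h)))

        1+ζ+ζ²≈0 : 1ℤ + ζ + ζ * ζ ≈ 0ℤ
        1+ζ+ζ²≈0 = zero-product (ζ - 1ℤ) (1ℤ + ζ + ζ * ζ) (≈-trans (≡⇒≈ (e ζ)) (≈⇒∸≈0 ζ³≈1)) ζ≉1
          where
          e : ∀ r → (r - 1ℤ) * (1ℤ + r + r * r) ≡ r * (r * (r * 1ℤ)) - 1ℤ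
          e = solve-∀

        -- If τ^l were ≈ 1 modulo p, then t^l ≈ 1 and g^(il) ≈ 1, so n = 3l would divide il and 3
        -- would divide i. Hence τ^l - 1 is a unit modulo every power of p.
        noncube-vanishes : ∀ t i → 0 < t → t < p → gcd i 3 ≡ 1 → t ≡ (g ℕ.^ i) mod p → G3Vanishes p t
        noncube-vanishes t i 0<t t<p gcd≡1 t≡ zero    = scaledG-mod-1 p as₃ bs₃ t
        noncube-vanishes t i 0<t t<p gcd≡1 t≡ (suc k) = Residues.S₃≈0⇒ p pr b p≡1+2b 3<p k t p∤t (Vanishing.S₃-noncube p pr b' p≡1+2b 4<p k l n≡3l p∤t (ℤ-unit k (τ t ^ l - 1ℤ) (λ h → contra (∸≈0⇒≈ {τ t ^ l} {1ℤ} h))))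
          where
          open Residues p pr b p≡1+2b 3<p k using (τ)
          p∤t : p ∤ t
          p∤t = 0<u<p⇒∤ 0<t t<p
          contra : ¬ τ t ^ l ≈ 1ℤ
          contra h = 3∤i (ℕ∣.*-cancelʳ-∣ l ⦃ ℕ.>-nonZero 0<l ⦄ (subst (_∣ i ℕ.* l) (trans n≡3l (ℕₚ.*-comm l 3)) (order (i ℕ.* l) g^il≈1)))
            where
            3∤i : 3 ∤ i
            3∤i d = ℕₚ.<⇒≱ {1} {3} (s≤s (s≤s z≤n)) (subst (3 ≤_) gcd≡1 (ℕ∣.∣⇒≤ ⦃ ℕ.≢-nonZero (λ e → ℕₚ.1+n≢0 (trans (sym gcd≡1) e)) ⦄ (gcd-greatest d ℕ∣.∣-refl)))
            t^l≈1 : (+ t) ^ l ≈ 1ℤ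
            t^l≈1 = ≈-trans (≡⇒≈ (sym (ℤₚ.*-identityʳ ((+ t) ^ l)))) (≈-trans (*-congˡ ((+ t) ^ l) (≈-sym h)) (≈-trans (≡⇒≈ (sym (*-^-distrib (+ t) (τ t) l))) (1^≈1 l (t*τ≈1 k p∤t))))
            g^il≈1 : (+ g) ^ (i ℕ.* l) ≈ 1ℤ
            g^il≈1 = ≈-trans (≡⇒≈ (sym (ℤₚ.^-*-assoc (+ g) i l))) (≈-trans (^-cong l (≈-trans (≈-sym (pow≈ i)) (≡⇒≈ (cong +_ (sym t≡))))) t^l≈1)

        open Nonvanishing 3 refl using (vanish⇒powers)

        -- With i = 3m the element z = g^(-m) is a cube root of 1/t. As t ≠ 1, no cube root y of 1/t
        -- is 1, so each (1 - y)^b is a sign.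
        cube-nonvanishing : ∀ t i → 0 < t → t < p → t ≢ 1 → 3 ∣ i → t ≡ (g ℕ.^ i) mod p → ¬ G3Vanishes p t
        cube-nonvanishing t i 0<t t<p t≢1 (divides m i≡) t≡ h = three-signs (sign^b _ (nz 1ℤ (ℤₚ.^-zeroˡ 3))) (sign^b _ (nz' ζ ζ³≈1)) (sign^b _ (nz' (ζ * ζ) ζζ³≈1))
            (vanish⇒powers l n≡3l ζ ζ³≈1 1+ζ+ζ²≈0 t z p∤t z³≈ z^n≈1 h)
          where
          p∤t : p ∤ t
          p∤t = 0<u<p⇒∤ 0<t t<p
          z : ℤ
          z = ((+ g) ^ m) ^ (p ∸ 2)
          z³≈ : z ^ 3 ≈ (+ t) ^ (p ∸ 2)
          z³≈ = ≈-trans (≡⇒≈ (swap ((+ g) ^ m) (p ∸ 2) 3)) (^-cong (p ∸ 2) (≈-trans (≡⇒≈ (trans (ℤₚ.^-*-assoc (+ g) m 3) (cong ((+ g) ^_) (sym i≡)))) (≈-trans (≈-sym (pow≈ i)) (≡⇒≈ (cong +_ (sym t≡))))))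
            where
            swap : ∀ x a c → (x ^ a) ^ c ≡ (x ^ c) ^ a
            swap x a c = trans (ℤₚ.^-*-assoc x a c) (trans (cong (x ^_) (ℕₚ.*-comm a c)) (sym (ℤₚ.^-*-assoc x c a)))
          z^n≈1 : z ^ n ≈ 1ℤ
          z^n≈1 = ≈-trans (≡⇒≈ (trans (cong (_^ n) (ℤₚ.^-*-assoc (+ g) m (p ∸ 2))) (trans (ℤₚ.^-*-assoc (+ g) (m ℕ.* (p ∸ 2)) n) (trans (cong ((+ g) ^_) (ℕₚ.*-comm (m ℕ.* (p ∸ 2)) n)) (sym (ℤₚ.^-*-assoc (+ g) n (m ℕ.* (p ∸ 2)))))))) (1^≈1 (m ℕ.* (p ∸ 2)) g^n≈1)
          ζζ³≈1 : (ζ * ζ) ^ 3 ≈ 1ℤ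
          ζζ³≈1 = ≈-trans (≡⇒≈ (*-^-distrib ζ ζ 3)) (*-cong ζ³≈1 ζ³≈1)
          nz' : ∀ u → u ^ 3 ≈ 1ℤ → ¬ 1ℤ - u * z ≈ 0ℤ
          nz' u u³≈1 e = t≢1 (≈⇒≡ t<p 1<p (inverse≈1⇒ p∤t (≈-trans (≈-sym z³≈) (≈-trans (≡⇒≈ (sym (ℤₚ.*-identityˡ (z ^ 3)))) (≈-trans (*-congʳ (z ^ 3) (≈-sym u³≈1)) (≈-trans (≡⇒≈ (sym (*-^-distrib u z 3))) (1^≈1 {u * z} 3 (≈-sym (∸≈0⇒≈ {1ℤ} {u * z} e)))))))))
          nz : ∀ u → u ^ 3 ≡ 1ℤ → ¬ 1ℤ - u * z ≈ 0ℤ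
          nz u e = nz' u (≡⇒≈ e)

        -- (1 - ζ²) = -ζ² (1 - ζ) has the same b-th power as 1 - ζ when b is even.
        one-nonvanishing : -1ℤ ^ b ≡ 1ℤ → ¬ G3Vanishes p 1
        one-nonvanishing even h = 0<u<p⇒∤ {2} (s≤s z≤n) (ℕₚ.<-trans (s≤s (s≤s (s≤s z≤n))) 3<p) (≈0⇒∣ (zero-product y (+ 2) y*2≈0 y≉0))
          where
          p∤1 : p ∤ 1
          p∤1 = 0<u<p⇒∤ (s≤s z≤n) 1<p
          y : ℤ
          y = (1ℤ - ζ) ^ b
          sum≈0 = vanish⇒powers l n≡3l ζ ζ³≈1 1+ζ+ζ²≈0 1 1ℤ p∤1 (≡⇒≈ (sym (ℤₚ.^-zeroˡ (p ∸ 2)))) (≡⇒≈ (ℤₚ.^-zeroˡ n)) h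
          y≉0 : ¬ y ≈ 0ℤ
          y≉0 e = ζ≉1 (≈-trans (≡⇒≈ (e₁ ζ)) (neg-cong (^≈0⇒ (1ℤ - ζ) b e)))
            where
            e₁ : ∀ x → x - 1ℤ ≡ - (1ℤ - x)
            e₁ = solve-∀
          ζ²ᵇ≈1 : (ζ * ζ) ^ b ≈ 1ℤ
          ζ²ᵇ≈1 = ≈-trans (≡⇒≈ (trans (*-^-distrib ζ ζ b) (trans (sym (ℤₚ.^-distribˡ-+-* ζ b b)) (trans (cong (ζ ^_) (sym n≡2b)) (trans (ℤₚ.^-*-assoc (+ g) l n) (trans (cong ((+ g) ^_) (ℕₚ.*-comm l n)) (sym (ℤₚ.^-*-assoc (+ g) n l)))))))) (1^≈1 l g^n≈1)
          third : (1ℤ - ζ * ζ * 1ℤ) ^ b ≈ y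
          third = begin
            (1ℤ - ζ * ζ * 1ℤ) ^ b                        ≈⟨ ^-cong b (≈-trans (+-congʳ (- (ζ * ζ * 1ℤ)) (≈-sym ζ³≈1)) (≡⇒≈ (e₁ ζ))) ⟩
            (-1ℤ * (ζ * ζ) * (1ℤ - ζ)) ^ b               ≡⟨ trans (*-^-distrib (-1ℤ * (ζ * ζ)) (1ℤ - ζ) b) (cong (_* y) (*-^-distrib -1ℤ (ζ * ζ) b)) ⟩
            -1ℤ ^ b * (ζ * ζ) ^ b * y                    ≈⟨ *-congʳ y (*-cong (≡⇒≈ even) ζ²ᵇ≈1) ⟩
            1ℤ * 1ℤ * y                                  ≡⟨ ℤₚ.*-identityˡ y ⟩
            y                                            ∎
            where
            open ≈-Reasoning
            e₁ : ∀ x → x * (x * (x * 1ℤ)) - x * x * 1ℤ ≡ -1ℤ * (x * x) * (1ℤ - x)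
            e₁ = solve-∀
          y*2≈0 : y * + 2 ≈ 0ℤ
          y*2≈0 = begin
            y * + 2                                      ≡⟨ e₁ y ⟩
            -- The first summand is (1 - 1)^b unfolded once, with b = suc b'; it vanishes because b
            -- is positive.
            0ℤ * 0ℤ ^ b' + y + y                         ≈⟨ +-cong (+-congˡ (0ℤ * 0ℤ ^ b') (≡⇒≈ (cong (λ x → (1ℤ - x) ^ b) (sym (ℤₚ.*-identityʳ ζ))))) (≈-sym third) ⟩
            (1ℤ - 1ℤ * 1ℤ) ^ b + (1ℤ - ζ * 1ℤ) ^ b + (1ℤ - ζ * ζ * 1ℤ) ^ b ≈⟨ sum≈0 ⟩
            0ℤ                                           ∎
            where
            open ≈-Reasoning
            e₁ : ∀ y → y * + 2 ≡ 0ℤ * 0ℤ ^ b' + y + y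
            e₁ y = trans (e₂ y) (cong (λ z → z + y + y) (sym (ℤₚ.*-zeroˡ (0ℤ ^ b'))))
              where
              e₂ : ∀ y → y * + 2 ≡ 0ℤ + y + y
              e₂ = solve-∀

-- Assembly according to p modulo 3 and modulo 12

open import Defs
open import Data.Empty using (⊥-elim)
open import Data.Nat using (ℕ; zero; suc; _<_; _≤_; _^_; _%_; _/_; _+_; _*_; s≤s; z≤n; _∸_)
import Data.Nat.Properties as ℕₚ
open import Data.Nat.DivMod using (m≡m%n+[m/n]*n; m%n<n; [m+kn]%n≡m%n)
open import Data.Nat.Divisibility using (divides; _∣_; _∤_; ∣⇒≤)
open import Data.Nat.GCD using (gcd; gcd[m,n]∣m; gcd[m,n]∣n)
open import Data.Nat.Primality using (Prime; prime⇒irreducible; euclidsLemma)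
import Data.Nat.Tactic.RingSolver as ℕS
import Data.Integer as ℤ
open import Data.Integer using (1ℤ; -1ℤ)
open import Data.Product using (_,_; _×_; ∃)
open import Data.Sum using (inj₁; inj₂)
open import Function.Bundles using (_⇔_; mk⇔)
open import Relation.Binary.PropositionalEquality using (_≡_; _≢_; refl; sym; trans; cong; cong₂; subst)
open ModularArithmetic
open MoritaGamma
open HypergeometricSum
open VanishingCases
open NonvanishingCases

gcd[i,3]≡1 : ∀ i → 3 ∤ i → gcd i 3 ≡ 1
gcd[i,3]≡1 i 3∤i with prime⇒irreducible 3-prime (gcd[m,n]∣n i 3)
... | inj₁ e = e
... | inj₂ e = ⊥-elim (3∤i (subst (_∣ i) e (gcd[m,n]∣m i 3)))

prime-∣ : ∀ {p q} → Prime p → 1 < q → q < p → q ∤ p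
prime-∣ pr 1<q q<p d with prime⇒irreducible pr d
... | inj₁ refl = ℕₚ.<-irrefl refl 1<q
... | inj₂ refl = ℕₚ.<-irrefl refl q<p

module Main (p : ℕ) (pr : Prime p) (b' : ℕ) (p≡1+2b : p ≡ suc (suc b' + suc b')) (4<p : 4 < p) where
  private
    b = suc b'
    l = p / 3
    3<p : 3 < p
    3<p = ℕₚ.<-trans (ℕₚ.n<1+n 3) 4<p
    p≡ : p ≡ p % 3 + l * 3
    p≡ = m≡m%n+[m/n]*n p 3
  open GammaP p pr b p≡1+2b using (0<u<p⇒∤; 1<p; ∤⇒≉0)
  open Modulo p pr b' p≡1+2b 4<p

  private
    p∤1 : p ∤ 1
    p∤1 = 0<u<p⇒∤ (s≤s z≤n) 1<p

    one-vanishes : (∀ k → Mod._≈_ (ℤ.+ (p ^ suc k)) (Residues.S₃ p pr b p≡1+2b 3<p k 1) ℤ.0ℤ) → G3Vanishes p 1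
    one-vanishes h zero    = scaledG-mod-1 p as₃ bs₃ 1
    one-vanishes h (suc k) = Residues.S₃≈0⇒ p pr b p≡1+2b 3<p k 1 p∤1 (h k)

  2mod3 : p % 3 ≢ 1 → ∀ t → 0 < t → t < p → G3Vanishes p t ⇔ t ≡ 1
  2mod3 p%3≢1 t 0<t t<p = mk⇔ (Nonvanishing.vanish⇒t≡1 3 refl l n≡ t 0<t t<p)
      (λ t≡1 → subst (G3Vanishes p) (sym t≡1) (one-vanishes (λ k → Vanishing.S₃-one-2mod3 p pr b' p≡1+2b 4<p k l n≡)))
    where
    residue : ∀ r → r ≡ p % 3 → p ∸ 1 ≡ suc (l * 3)
    residue 0 e = ⊥-elim (prime-∣ pr (s≤s (s≤s z≤n)) 3<p (divides l (trans p≡ (cong (_+ l * 3) (sym e)))))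
    residue 1 e = ⊥-elim (p%3≢1 (sym e))
    residue 2 e = cong (_∸ 1) (trans p≡ (cong (_+ l * 3) (sym e)))
    residue (suc (suc (suc r))) e = ⊥-elim (ℕₚ.<⇒≱ (m%n<n p 3) (subst (3 ≤_) e (s≤s (s≤s (s≤s z≤n)))))
    n≡ : p ∸ 1 ≡ suc (l * 3)
    n≡ = residue (p % 3) refl

  module _ (p%3≡1 : p % 3 ≡ 1) (g : ℕ) (root : PrimitiveRoot p g) where
    open Generator g root
    private
      n≡3l : p ∸ 1 ≡ l * 3
      n≡3l = cong (_∸ 1) (trans p≡ (cong (_+ l * 3) p%3≡1))

      3∣b : 3 ∣ b
      3∣b with euclidsLemma b 2 3-prime (divides l (trans (e b) (trans (sym (cong (_∸ 1) p≡1+2b)) n≡3l)))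
        where
        e : ∀ b → b * 2 ≡ b + b
        e = ℕS.solve-∀
      ... | inj₁ d = d
      ... | inj₂ d = ⊥-elim (ℕₚ.<⇒≱ (ℕₚ.n<1+n 2) (∣⇒≤ d))

    not-one : ∀ t → 0 < t → t < p → t ≢ 1 → G3Vanishes p t ⇔ ∃ λ i → gcd i 3 ≡ 1 × t ≡ (g ^ i) mod p
    not-one t 0<t t<p t≢1 = mk⇔ forward (λ (i , gcd≡1 , t≡) → noncube-vanishes l n≡3l t i 0<t t<p gcd≡1 t≡)
      where
      forward : G3Vanishes p t → ∃ λ i → gcd i 3 ≡ 1 × t ≡ (g ^ i) mod p
      forward h with discrete-log t t<p (∤⇒≉0 (0<u<p⇒∤ 0<t t<p))
      ... | i , t≡ = i , gcd[i,3]≡1 i (λ 3∣i → cube-nonvanishing l n≡3l t i 0<t t<p t≢1 3∣i t≡ h) , t≡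

    -- As 3 divides p - 1 = 2b, one has b = 3m and p = 6m + 1. The parity of m is that of b and
    -- decides between p ≡ 1 and p ≡ 7 modulo 12.
    one : G3Vanishes p 1 ⇔ p % 12 ≡ 7
    one with 3∣b
    ... | divides m b≡3m with parity m
    ...   | inj₁ (u , refl) = mk⇔ (λ h → ⊥-elim (one-nonvanishing l n≡3l even h)) (λ e → ⊥-elim (1≢7 (trans (sym p%12≡1) e)))
      where
      1≢7 : 1 ≢ 7
      1≢7 ()
      even : -1ℤ ℤ.^ b ≡ 1ℤ
      even = trans (cong (-1ℤ ℤ.^_) (trans b≡3m (ℕₚ.*-distribʳ-+ 3 u u))) (-1^2n (u * 3))
      e : ∀ u → suc ((u + u) * 3 + (u + u) * 3) ≡ 1 + u * 12
      e = ℕS.solve-∀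
      p%12≡1 : p % 12 ≡ 1
      p%12≡1 = trans (cong (_% 12) (trans p≡1+2b (trans (cong₂ (λ x y → suc (x + y)) b≡3m b≡3m) (e u)))) ([m+kn]%n≡m%n 1 u 12)
    ...   | inj₂ (u , refl) = mk⇔ (λ _ → p%12≡7) (λ _ → one-vanishes (λ k → Vanishing.S₃-one-odd p pr b' p≡1+2b 4<p k l n≡3l (suc (u + u)) b≡3m odd))
      where
      e₁ : ∀ u → suc (u + u) * 3 ≡ suc ((1 + u * 3) + (1 + u * 3))
      e₁ = ℕS.solve-∀
      odd : -1ℤ ℤ.^ b ≡ -1ℤ
      odd = trans (cong (-1ℤ ℤ.^_) (trans b≡3m (e₁ u))) (cong (-1ℤ ℤ.*_) (-1^2n (1 + u * 3)))
      e : ∀ u → suc (suc (u + u) * 3 + suc (u + u) * 3) ≡ 7 + u * 12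
      e = ℕS.solve-∀
      p%12≡7 : p % 12 ≡ 7
      p%12≡7 = trans (cong (_% 12) (trans p≡1+2b (trans (cong₂ (λ x y → suc (x + y)) b≡3m b≡3m) (e u)))) ([m+kn]%n≡m%n 7 u 12)

odd-prime : ∀ {p} → Prime p → 3 < p → ∃ λ b' → p ≡ suc (suc b' + suc b') × 4 < p
odd-prime {p} pr 3<p with parity p
... | inj₁ (q , e) = ⊥-elim (prime-∣ pr (s≤s (s≤s z≤n)) (ℕₚ.<-trans (ℕₚ.n<1+n 2) 3<p) (divides q (trans e (e₂ q))))
  where
  e₂ : ∀ q → q + q ≡ q * 2
  e₂ = ℕS.solve-∀
... | inj₂ (zero , refl) = ⊥-elim (ℕₚ.<⇒≱ 3<p (s≤s z≤n))
... | inj₂ (suc zero , refl) = ⊥-elim (ℕₚ.<-irrefl refl 3<p)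
... | inj₂ (suc (suc c) , refl) = suc c , refl , s≤s (s≤s (s≤s (subst (2 ≤_) (sym (ℕₚ.+-suc c (suc c))) (s≤s (subst (1 ≤_) (sym (ℕₚ.+-suc c c)) (s≤s z≤n))))))

theorem2p2 : (p : ℕ) → Prime p → 3 < p → (t : ℕ) → 0 < t → t < p →
    ((p % 3 ≡ 1) → (g : ℕ) → PrimitiveRoot p g →
    ((t ≢ 1 → (G3Vanishes p t ⇔ ∃ λ i → gcd i 3 ≡ 1 × t ≡ (g ^ i) mod p))
    × (t ≡ 1 → (G3Vanishes p 1 ⇔ p % 12 ≡ 7))))
    × ((p % 3 ≢ 1) → (G3Vanishes p t ⇔ t ≡ 1))
theorem2p2 p pr 3<p t 0<t t<p with odd-prime pr 3<p
... | b' , p≡ , 4<p = (λ p%3≡1 g root → not-one p%3≡1 g root t 0<t t<p , λ _ → one p%3≡1 g root) , λ p%3≢1 → 2mod3 p%3≢1 t 0<t t<p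
  where open Main p pr b' p≡ 4<p
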